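{- Let $k \geq 2$. Every $k$-rose graph other than $R(3,4)$ and $R(3,5)$ is determined by its Laplacian spectrum. Each of $R(3,4)$ and $R(3,5)$ has exactly one Laplacian cospectral mate (up to isomorphism).
   Context: All graphs are finite, simple and undirected. For $k \geq 2$, a $k$-rose graph is a graph consisting of $k$ cycles that all meet in exactly one common vertex (the central vertex); equivalently, a connected graph with one vertex of degree $2k$ and all other vertices of degree $2$. A rose graph is a $k$-rose graph for some $k\ge 2$. For $\ell \geq 3$, $R(3,\ell)$ denotes the $2$-rose graph whose two cycles are a triangle and a cycle of length $\ell$. The Laplacian matrix of a graph is $L=D-A$, where $A$ is the adjacency matrix and $D$ the diagonal matrix of vertex degrees; the Laplacian spectrum is the multiset of eigenvalues of $L$. A graph is determined by its Laplacian spectrum if every graph with the same Laplacian spectrum is isomorphic to it. A Laplacian cospectral mate of a graph $G$ is a graph not isomorphic to $G$ having the same Laplacian spectrum as $G$. -}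

module Defs where

open import Data.Bool using (Bool; true; false; if_then_else_; _∧_; _∨_; not)
open import Data.Nat using (ℕ; zero; suc; _≡ᵇ_; _≤ᵇ_) renaming (_+_ to _+ℕ_)
open import Data.Nat.Properties using (≡⇒≡ᵇ)
open import Data.Integer using (ℤ; +_; -_) renaming (_+_ to _+ℤ_; _*_ to _*ℤ_)
open import Data.List using (List; []; _∷_; map)
open import Data.Fin using (Fin; zero; suc; toℕ; punchIn; _≟_)
open import Data.Product using (Σ; _×_; _,_)
open import Data.Bool.Properties using (∨-comm)
open import Function.Bundles using (_↔_; Inverse)
open import Relation.Nullary using (¬_)
open import Relation.Nullary.Decidable using (⌊_⌋)
open import Relation.Binary.PropositionalEquality using (_≡_; refl; cong; cong₂)

-- Polynomials with integer coefficients (coefficient lists, lowest degree first)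

Poly : Set
Poly = List ℤ

infixl 6 _+P_
infixl 7 _*P_

_+P_ : Poly → Poly → Poly
[] +P q = q
(a ∷ p) +P [] = a ∷ p
(a ∷ p) +P (b ∷ q) = (a +ℤ b) ∷ (p +P q)

scaleP : ℤ → Poly → Poly
scaleP c p = map (c *ℤ_) p

_*P_ : Poly → Poly → Poly
[] *P q = []
(a ∷ p) *P q = scaleP a q +P (+ 0 ∷ (p *P q))

coeff : Poly → ℕ → ℤ
coeff [] _ = + 0
coeff (a ∷ p) zero = a
coeff (a ∷ p) (suc i) = coeff p i

sumFinP : ∀ {n} → (Fin n → Poly) → Poly
sumFinP {zero} f = []
sumFinP {suc n} f = f zero +P sumFinP (λ j → f (suc j))

sign : ℕ → ℤ
sign zero = + 1
sign (suc k) = - sign k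

det : ∀ n → (Fin n → Fin n → Poly) → Poly
det zero M = + 1 ∷ []
det (suc n) M =
  sumFinP (λ j → scaleP (sign (toℕ j))
                   (M zero j *P det n (λ a b → M (suc a) (punchIn j b))))

record Graph : Set where
  field
    size   : ℕ
    adj    : Fin size → Fin size → Bool
    adj-sym    : ∀ i j → adj i j ≡ adj j i
    adj-irrefl : ∀ i → adj i i ≡ false
open Graph public

countFin : ∀ {n} → (Fin n → Bool) → ℕ
countFin {zero} f = 0
countFin {suc n} f = (if f zero then 1 else 0) +ℕ countFin (λ j → f (suc j))

degree : (G : Graph) → Fin (size G) → ℕ
degree G i = countFin (adj G i)

laplacian : (G : Graph) → Fin (size G) → Fin (size G) → ℤ
laplacian G i j =
  if ⌊ i ≟ j ⌋ then + degree G i else (if adj G i j then - (+ 1) else + 0)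

xI-L : (G : Graph) → Fin (size G) → Fin (size G) → Poly
xI-L G i j = if ⌊ i ≟ j ⌋ then (- laplacian G i j) ∷ + 1 ∷ [] else (- laplacian G i j) ∷ []

lapCharPoly : Graph → Poly
lapCharPoly G = det (size G) (xI-L G)

-- same Laplacian spectrum  (= same Laplacian characteristic polynomial)
LapCospectral : Graph → Graph → Set
LapCospectral G H = ∀ i → coeff (lapCharPoly G) i ≡ coeff (lapCharPoly H) i

Iso : Graph → Graph → Set
Iso G H = Σ (Fin (size G) ↔ Fin (size H)) λ f →
  ∀ i j → adj H (Inverse.to f i) (Inverse.to f j) ≡ adj G i j

DeterminedByLapSpectrum : Graph → Set
DeterminedByLapSpectrum G = ∀ H → LapCospectral G H → Iso G H

data Reach (G : Graph) : Fin (size G) → Fin (size G) → Set where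
  here : ∀ {u} → Reach G u u
  step : ∀ {u w v} → adj G u w ≡ true → Reach G w v → Reach G u v

Connected : Graph → Set
Connected G = ∀ u v → Reach G u v

IsRose : ℕ → Graph → Set
IsRose k G = Connected G × Σ (Fin (size G)) λ c →
  degree G c ≡ 2 Data.Nat.* k × (∀ v → ¬ (v ≡ c) → degree G v ≡ 2)

-- R(3,ℓ) on vertices 0..ℓ+1: centre 0, triangle 0-1-2, cycle 0-3-4-...-(ℓ+1)-0

edgeR : ℕ → ℕ → ℕ → Bool
edgeR ℓ a b =
     ((a ≡ᵇ 0) ∧ (b ≡ᵇ 1))
  ∨ ((a ≡ᵇ 1) ∧ (b ≡ᵇ 2))
  ∨ ((a ≡ᵇ 0) ∧ (b ≡ᵇ 2))
  ∨ ((a ≡ᵇ 0) ∧ (b ≡ᵇ 3))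
  ∨ ((a ≡ᵇ 0) ∧ (b ≡ᵇ suc ℓ))
  ∨ ((3 ≤ᵇ a) ∧ (b ≡ᵇ suc a) ∧ (b ≤ᵇ suc ℓ))

adjR : ℕ → ℕ → ℕ → Bool
adjR ℓ a b = not (a ≡ᵇ b) ∧ (edgeR ℓ a b ∨ edgeR ℓ b a)

private
  ≡ᵇ-sym : ∀ a b → (a ≡ᵇ b) ≡ (b ≡ᵇ a)
  ≡ᵇ-sym zero zero = refl
  ≡ᵇ-sym zero (suc b) = refl
  ≡ᵇ-sym (suc a) zero = refl
  ≡ᵇ-sym (suc a) (suc b) = ≡ᵇ-sym a b

  ≡ᵇ-refl : ∀ a → (a ≡ᵇ a) ≡ true
  ≡ᵇ-refl zero = refl
  ≡ᵇ-refl (suc a) = ≡ᵇ-refl a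

  adjR-sym : ∀ ℓ a b → adjR ℓ a b ≡ adjR ℓ b a
  adjR-sym ℓ a b = cong₂ _∧_ (cong not (≡ᵇ-sym a b)) (∨-comm (edgeR ℓ a b) (edgeR ℓ b a))

  adjR-irrefl : ∀ ℓ a → adjR ℓ a a ≡ false
  adjR-irrefl ℓ a rewrite ≡ᵇ-refl a = refl

R3 : ℕ → Graph
R3 ℓ = record
  { size = suc (suc ℓ)
  ; adj = λ i j → adjR ℓ (toℕ i) (toℕ j)
  ; adj-sym = λ i j → adjR-sym ℓ (toℕ i) (toℕ j)
  ; adj-irrefl = λ i → adjR-irrefl ℓ (toℕ i)
  }

{-# OPTIONS --safe #-}

-- The spectrum of a graph G on n vertices determines D(a,b) = det(aI + b(L − 2I)) for all integers a and b.
-- For a rose, removing the petals one by one evaluates D; at a = 1 + q², b = q the determinant of a path is a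
-- geometric sum in q, and up to a factor D is an expression in the powers q^ℓ, ℓ running over the cycle lengths,
-- from which the lengths are recovered q-adically. Two roses with the same spectrum are therefore isomorphic.
--
-- Let H be cospectral with a rose. H is connected, because the coefficient of h in det(hI + L) counts the spanning
-- trees. Modulo powers of q, D gives the traces of the powers of L − 2I. With x the degree minus 2, the first three
-- give ∑ x, ∑ x² and ∑ x³ up to the number of triangles, and these leave only the degrees of a rose or, for two
-- petals, the degrees 3, 3, 3, 1, 2, …, 2. In the second case the rose has a triangle and H has none unless H has
-- five vertices, which is impossible; the fourth and fifth traces count the 4-cycles of H and their position
-- relative to the vertices of degree 3 and 1, and force H to be one of the two mates.
module Submission where

open import Defs hiding (here; step)
open import Algebra.Bundles using (CommutativeRing)
import Algebra.Properties.Semiring.Sum as SemiringSum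
open import Algebra.Structures using (IsCommutativeRing)
open import Data.Bool as Bool using (Bool; _∧_; _∨_; false; if_then_else_; true)
open import Data.Bool.Properties using (∨-comm)
open import Data.Empty using (⊥; ⊥-elim)
open import Data.Fin as Fin using (Fin; _≟_; inject₁; punchIn; punchOut; suc; toℕ; zero)
open import Data.Fin.Patterns using (0F; 1F; 2F; 3F; 4F; 5F; 6F)
open import Data.Fin.Permutation using (↔⇒≡)
open import Data.Fin.Properties using (any?; punchIn-injective; punchIn-punchOut; punchInᵢ≢i; toℕ-fromℕ<; toℕ-injective; toℕ-inject₁; toℕ<n)
open import Data.Integer as ℤ using (+_; ℤ)
import Data.Integer.Properties as ℤ
open import Data.List using (List; []; _++_; _∷_; allFin; concat; length; lookup; map)
import Data.List.Membership.DecPropositional as DecMembership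
open import Data.List.Membership.Propositional using (_∈_; _∉_; find; lose)
open import Data.List.Membership.Propositional.Properties using (∈-++⁺ʳ; ∈-++⁺ˡ; ∈-++⁻; ∈-allFin; ∈-concat⁺′; ∈-concat⁻′; ∈-lookup; ∈-map⁺; ∈-∃++)
open import Data.List.Properties using (++-assoc; concat-map; length-++; length-map; length-tabulate; map-cong-local; map-injective; ∷-injectiveʳ; ∷-injectiveˡ)
open import Data.List.Relation.Binary.Permutation.Propositional as Perm using (_↭_; prep; swap; ↭-refl; ↭-reflexive; ↭-sym; ↭-trans; ↭⇒↭ₛ)
open import Data.List.Relation.Binary.Permutation.Propositional.Properties using (++-comm; ++⁺ʳ; ++⁺ˡ; All-resp-↭; shift; ↭-length; ↭-map-inv; ∈-resp-↭)
import Data.List.Relation.Binary.Permutation.Setoid.Properties as Permₛ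
open import Data.List.Relation.Unary.All as All using (All; []; _∷_)
open import Data.List.Relation.Unary.AllPairs as AllPairs using ([]; _∷_)
open import Data.List.Relation.Unary.Any as Any using (here; there)
open import Data.List.Relation.Unary.Unique.Propositional using (Unique)
open import Data.List.Relation.Unary.Unique.Propositional.Properties using (++⁺; Unique[x∷xs]⇒x∉xs; allFin⁺)
open import Data.Maybe using (Maybe; just; nothing)
open import Data.Nat as ℕ using (_∸_; suc; zero; ℕ)
open import Data.Nat.ListAction using () renaming (sum to ℕ-sum)
import Data.Nat.Properties as ℕ
open import Data.Product using (_,_; _×_; proj₁; proj₂; Σ; ∃)
open import Data.Sum using (_⊎_; inj₁; inj₂)
open import Data.Unit using (tt; ⊤)
open import Function using (_∋_; _∘_; id)
open import Function.Bundles using (Inverse; mk↔ₛ′)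
open import Relation.Binary.Definitions using (tri<; tri>; tri≈)
open import Relation.Binary.PropositionalEquality
open import Relation.Nullary using (Dec; _×-dec_; _⊎-dec_; contradiction; no; yes; ¬?; ¬_)
open import Relation.Nullary.Decidable using (decidable-stable; from-no; ⌊_⌋)
open import Tactic.RingSolver using (solve-∀)
open import Tactic.RingSolver.Core.AlmostCommutativeRing using (AlmostCommutativeRing; fromCommutativeRing)

-- `D` is available only as an integer at each pair of integers, so the proof works with neither
-- polynomials in q nor inverse matrices. Cramer's rule with explicit integral vectors replaces
-- inverses; a coefficient is a digit modulo a power of q, known for every q >= 2; and the
-- derivative in Jacobi's formula becomes a difference with step q⁵, computed modulo q^10, which is
-- just enough for five traces. The obstacle is small k. With b = 2k - 2, if no excess reaches b,
-- the moments force b² <= 6k. This fails for k >= 4, needs a closer count for k = 3, and for k = 2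
-- leaves the degrees 3, 3, 3, 1. There the fourth trace gives the number of 4-cycles up to the
-- edges among the exceptional vertices, and always at least two. The fifth trace serves to exclude
-- that two of them are disjoint; two that meet share an edge, and then the saturated degrees leave
-- no freedom.

-- Integer ring, congruences, finite sums and inequalities.

module Integers where
  open import Data.Integer using (_≤_)

  infixl 6 _+_ _-_
  infixl 7 _*_
  infix 8 -_

  -- Opaque, so that ring expressions are compared as they stand instead of being unfolded to integer arithmetic.
  opaque
    _+_ _*_ : ℤ → ℤ → ℤ
    a + b = a ℤ.+ b
    a * b = a ℤ.* b
    -_ : ℤ → ℤ
    - a = ℤ.- a

  _-_ : ℤ → ℤ → ℤ
  a - b = a + - b

  opaque
    unfolding _+_
    isCommutativeRing : IsCommutativeRing _≡_ _+_ _*_ -_ (+ 0) (+ 1)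
    isCommutativeRing = ℤ.+-*-isCommutativeRing

    0≟ : (x : ℤ) → Maybe (+ 0 ≡ x)
    0≟ (+ 0) = just refl
    0≟ _ = nothing

  ℤ-ring : CommutativeRing _ _
  ℤ-ring = record { isCommutativeRing = isCommutativeRing }

  open CommutativeRing ℤ-ring public using
    (+-comm; +-assoc; *-comm; *-assoc; +-identityˡ; +-identityʳ; *-identityˡ; *-identityʳ; zeroˡ; zeroʳ; -‿inverseʳ; distribˡ; distribʳ; semiring)

  ring : AlmostCommutativeRing _ _
  ring = fromCommutativeRing ℤ-ring 0≟

  zero-+ : ∀ {a b} → a ≡ + 0 → a + b ≡ b
  zero-+ {b = b} refl = +-identityˡ b

  +-zero : ∀ {a b} → b ≡ + 0 → a + b ≡ a
  +-zero {a} refl = +-identityʳ a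

  zero-- : ∀ {a b} → b ≡ + 0 → a - b ≡ a
  zero-- {a} refl = lem a
    where
    opaque
      unfolding _+_ 0≟
      lem : ∀ a → a - + 0 ≡ a
      lem = solve-∀ ring

  infix 4 _≈_mod_
  -- The quotient is stored, so that a ring identity a = b + k d is a congruence as it stands, with
  -- k left to unification.
  record _≈_mod_ (a b d : ℤ) : Set where
    constructor mod
    field
      quotient : ℤ
      equation : a ≡ b + quotient * d

  mod-refl : ∀ {d a b} → a ≡ b → a ≈ b mod d
  mod-refl {d} {a} refl = mod (+ 0) (sym (trans (cong (_+_ a) (zeroˡ d)) (+-identityʳ a)))

  mod-sym : ∀ {d a b} → a ≈ b mod d → b ≈ a mod d
  mod-sym {d} {a} {b} (mod k e) = mod (- k) (trans (lem b k d) (cong (λ z → z + (- k) * d) (sym e)))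
    where
    opaque
      unfolding _+_ 0≟
      lem : ∀ b k d → b ≡ (b + k * d) + (- k) * d
      lem = solve-∀ ring

  mod-trans : ∀ {d a b c} → a ≈ b mod d → b ≈ c mod d → a ≈ c mod d
  mod-trans {d} {a} {b} {c} (mod k e) (mod l e′) = mod (l + k) (trans e (trans (cong (λ z → z + k * d) e′) (lem c l k d)))
    where
    opaque
      unfolding _+_ 0≟
      lem : ∀ c l k d → (c + l * d) + k * d ≡ c + (l + k) * d
      lem = solve-∀ ring

  mod-+ : ∀ {d a b a′ b′} → a ≈ b mod d → a′ ≈ b′ mod d → a + a′ ≈ b + b′ mod d
  mod-+ {d} {a} {b} {a′} {b′} (mod k e) (mod l e′) = mod (k + l) (trans (cong₂ _+_ e e′) (lem b b′ k l d))
    where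
    opaque
      unfolding _+_ 0≟
      lem : ∀ b c k l d → (b + k * d) + (c + l * d) ≡ (b + c) + (k + l) * d
      lem = solve-∀ ring

  mod-- : ∀ {d a b a′ b′} → a ≈ b mod d → a′ ≈ b′ mod d → a - a′ ≈ b - b′ mod d
  mod-- {d} {a} {b} {a′} {b′} (mod k e) (mod l e′) = mod (k - l) (trans (cong₂ _-_ e e′) (lem b b′ k l d))
    where
    opaque
      unfolding _+_ 0≟
      lem : ∀ b c k l d → (b + k * d) - (c + l * d) ≡ (b - c) + (k - l) * d
      lem = solve-∀ ring

  mod-* : ∀ {d a b a′ b′} → a ≈ b mod d → a′ ≈ b′ mod d → a * a′ ≈ b * b′ mod d
  mod-* {d} {a} {b} {a′} {b′} (mod k e) (mod l e′) = mod (b * l + k * b′ + k * l * d) (trans (cong₂ _*_ e e′) (lem b b′ k l d))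
    where
    opaque
      unfolding _+_ 0≟
      lem : ∀ b c k l d → (b + k * d) * (c + l * d) ≡ b * c + (b * l + k * c + k * l * d) * d
      lem = solve-∀ ring

  mod-scale : ∀ {d a b} h → a ≈ b mod d → h * a ≈ h * b mod (h * d)
  mod-scale {d} {a} {b} h (mod k e) = mod k (trans (cong (h *_) e) (lem h b k d))
    where
    opaque
      unfolding _+_ 0≟
      lem : ∀ h b k d → h * (b + k * d) ≡ h * b + k * (h * d)
      lem = solve-∀ ring

  private module S = SemiringSum semiring

  opaque
    sum : ∀ {n} → (Fin n → ℤ) → ℤ
    sum = S.sum

  opaque
    unfolding sum
    sum-[] : (f : Fin 0 → ℤ) → sum f ≡ + 0
    sum-[] f = refl

    sum-suc : ∀ {n} (f : Fin (suc n) → ℤ) → sum f ≡ f zero + sum (f ∘ suc)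
    sum-suc f = refl

    sum-cong : ∀ {n} {f g : Fin n → ℤ} → (∀ i → f i ≡ g i) → sum f ≡ sum g
    sum-cong h = S.sum-cong-≗ h

    sum-+ : ∀ {n} (f g : Fin n → ℤ) → sum (λ i → f i + g i) ≡ sum f + sum g
    sum-+ = S.∑-distrib-+

    sum-comm : ∀ {m n} (f : Fin m → Fin n → ℤ) → sum (λ i → sum (f i)) ≡ sum (λ j → sum (λ i → f i j))
    sum-comm = S.∑-comm

    sum-*ˡ : ∀ {n} x (f : Fin n → ℤ) → sum (λ i → x * f i) ≡ x * sum f
    sum-*ˡ x f = sym (S.*-distribˡ-sum x f)

    sum-*ʳ : ∀ {n} x (f : Fin n → ℤ) → sum (λ i → f i * x) ≡ sum f * x
    sum-*ʳ x f = sym (S.*-distribʳ-sum x f)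

  mod-sum : ∀ {n d} {f g : Fin n → ℤ} → (∀ i → f i ≈ g i mod d) → sum f ≈ sum g mod d
  mod-sum {zero} {f = f} {g} h = mod-refl (trans (sum-[] f) (sym (sum-[] g)))
  mod-sum {suc n} {d} {f} {g} h = subst₂ (_≈_mod d) (sym (sum-suc f)) (sym (sum-suc g)) (mod-+ (h zero) (mod-sum (h ∘ suc)))

  sum-zero : ∀ {n} {f : Fin n → ℤ} → (∀ i → f i ≡ + 0) → sum f ≡ + 0
  sum-zero {zero} {f} h = sum-[] f
  sum-zero {suc n} {f} h = trans (sum-suc f) (trans (cong₂ _+_ (h zero) (sum-zero (h ∘ suc))) (+-identityˡ _))

  sum-single : ∀ {n} (f : Fin n → ℤ) v → (∀ j → j ≢ v → f j ≡ + 0) → sum f ≡ f v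
  sum-single f zero h = trans (sum-suc f) (trans (cong (_+_ (f zero)) (sum-zero (λ i → h (suc i) λ ()))) (+-identityʳ _))
  sum-single f (suc v) h = trans (sum-suc f) (trans (cong₂ _+_ (h zero λ ()) (sum-single (f ∘ suc) v λ j n → h (suc j) λ { refl → n refl })) (+-identityˡ _))

  sum-linear : ∀ {n} x y (f g : Fin n → ℤ) → sum (λ i → x * f i + y * g i) ≡ x * sum f + y * sum g
  sum-linear x y f g = trans (sum-+ _ _) (cong₂ _+_ (sum-*ˡ x f) (sum-*ˡ y g))

  opaque
    unfolding _+_
    ≤-from-difference : ∀ {a b} k → + 0 ≤ k → b ≡ a + k → a ≤ b
    ≤-from-difference {a} k p refl = subst (ℤ._≤ a ℤ.+ k) (ℤ.+-identityʳ a) (ℤ.+-monoʳ-≤ a p)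

    difference-nonneg : ∀ {a b} → a ≤ b → + 0 ≤ b - a
    difference-nonneg = ℤ.i≤j⇒0≤j-i

    +-nonneg : ∀ {a b} → + 0 ≤ a → + 0 ≤ b → + 0 ≤ a + b
    +-nonneg = ℤ.+-mono-≤

    +-mono-≤ : ∀ {a b c d} → a ≤ b → c ≤ d → a + c ≤ b + d
    +-mono-≤ = ℤ.+-mono-≤

    *-nonneg : ∀ {a b} → + 0 ≤ a → + 0 ≤ b → + 0 ≤ a * b
    *-nonneg {+ a} {+ b} _ _ = subst (+ 0 ℤ.≤_) (ℤ.pos-* a b) (ℤ.+≤+ ℕ.z≤n)

    square-nonneg : ∀ a → + 0 ≤ a * a
    square-nonneg (+ a) = subst (+ 0 ℤ.≤_) (ℤ.pos-* a a) (ℤ.+≤+ ℕ.z≤n)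
    square-nonneg ℤ.-[1+ a ] = ℤ.+≤+ ℕ.z≤n

    *-cancelˡ : ∀ {a b} c → c ≢ + 0 → c * a ≡ c * b → a ≡ b
    *-cancelˡ {a} {b} c p e = ℤ.*-cancelˡ-≡ c a b ⦃ ℤ.≢-nonZero p ⦄ e

    pos-+ : ∀ m n → + (m ℕ.+ n) ≡ + m + + n
    pos-+ = ℤ.pos-+

    pos-* : ∀ m n → + (m ℕ.* n) ≡ + m * + n
    pos-* = ℤ.pos-*

  sum-nonneg : ∀ {n} {f : Fin n → ℤ} → (∀ i → + 0 ≤ f i) → + 0 ≤ sum f
  sum-nonneg {zero} {f} h = ℤ.≤-reflexive (sym (sum-[] f))
  sum-nonneg {suc n} {f} h = subst (+ 0 ≤_) (sym (sum-suc f)) (+-nonneg (h zero) (sum-nonneg (h ∘ suc)))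

  sum-mono : ∀ {n} {f g : Fin n → ℤ} → (∀ i → f i ≤ g i) → sum f ≤ sum g
  sum-mono {zero} {f} {g} h = ℤ.≤-reflexive (trans (sum-[] f) (sym (sum-[] g)))
  sum-mono {suc n} {f} {g} h = subst₂ _≤_ (sym (sum-suc f)) (sym (sum-suc g)) (+-mono-≤ (h zero) (sum-mono (h ∘ suc)))

  private
    nonneg-summand : ∀ {a b} → + 0 ≤ a → + 0 ≤ b → a + b ≡ + 0 → a ≡ + 0
    nonneg-summand {a} {b} p q e = ℤ.≤-antisym (≤-from-difference b q (sym e)) p

  sum-nonneg-zero : ∀ {n} {f : Fin n → ℤ} → (∀ i → + 0 ≤ f i) → sum f ≡ + 0 → ∀ i → f i ≡ + 0
  sum-nonneg-zero {suc n} {f} h e zero = nonneg-summand (h zero) (sum-nonneg (h ∘ suc)) (trans (sym (sum-suc f)) e)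
  sum-nonneg-zero {suc n} {f} h e (suc i) = sum-nonneg-zero (h ∘ suc)
    (nonneg-summand (sum-nonneg (h ∘ suc)) (h zero) (trans (+-comm _ _) (trans (sym (sum-suc f)) e))) i

  sum-neg : ∀ {n} (f : Fin n → ℤ) → sum (λ i → - f i) ≡ - sum f
  sum-neg f = trans (sum-cong λ i → neg (f i)) (trans (sum-*ˡ (- (+ 1)) f) (sym (neg (sum f))))
    where
    opaque
      unfolding _+_ 0≟
      neg : ∀ a → - a ≡ (- (+ 1)) * a
      neg = solve-∀ ring

  sum-- : ∀ {n} (f g : Fin n → ℤ) → sum (λ i → f i - g i) ≡ sum f - sum g
  sum-- f g = trans (sum-+ f (λ i → - g i)) (cong (_+_ (sum f)) (sum-neg g))

  sum-one : ∀ n → sum {n} (λ _ → + 1) ≡ + n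
  sum-one zero = sum-[] _
  sum-one (suc n) = trans (sum-suc _) (trans (cong (_+_ (+ 1)) (sum-one n)) (sym (pos-+ 1 n)))

  sum-const : ∀ n c → sum {n} (λ _ → c) ≡ + n * c
  sum-const n c = trans (sum-cong λ _ → sym (*-identityˡ c)) (trans (sum-*ʳ c (λ _ → + 1)) (cong (_* c) (sum-one n)))

  opaque
    unfolding _+_
    -- The step from digits to numbers: once the modulus is chosen beyond both sides, a congruence
    -- is an equality.
    mod-small : ∀ {x y n} → + x ≈ + y mod (+ n) → x ℕ.< n → y ℕ.< n → x ≡ y
    mod-small {x} {y} {n} (mod (+ zero) e) _ _ = ℤ.+-injective (trans e (ℤ.+-identityʳ (+ y)))
    mod-small {x} {y} {n} (mod (+ suc k) e) lt _ = contradiction (ℕ.≤-trans (ℕ.m≤m+n n (k ℕ.* n)) (ℕ.m≤n+m _ y))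
      (ℕ.<⇒≱ (subst (ℕ._< n) (ℤ.+-injective (trans e (cong (ℤ._+_ (+ y)) (sym (ℤ.pos-* (suc k) n))))) lt))
    mod-small {x} {y} {n} (mod ℤ.-[1+ k ] e) _ lt = contradiction (ℕ.≤-trans (ℕ.m≤m+n n (k ℕ.* n)) (ℕ.m≤n+m _ x))
      (ℕ.<⇒≱ (subst (ℕ._< n) (ℤ.+-injective (trans (lem (+ y) (ℤ.-[1+ k ] ℤ.* + n)) (trans (cong₂ ℤ._-_ (sym e) (sym (neg k))) (cong (ℤ._+_ (+ x)) (ℤ.neg-involutive (+ (suc k ℕ.* n))))))) lt))
      where
      lem : ∀ a b → a ≡ (a ℤ.+ b) ℤ.- b
      lem a b = sym (trans (ℤ.+-assoc a b (ℤ.- b)) (trans (cong (ℤ._+_ a) (ℤ.+-inverseʳ b)) (ℤ.+-identityʳ a)))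
      neg : ∀ k → ℤ.- (+ (suc k ℕ.* n)) ≡ ℤ.-[1+ k ] ℤ.* + n
      neg k = trans (cong ℤ.-_ (ℤ.pos-* (suc k) n)) (ℤ.neg-distribˡ-* (+ suc k) (+ n))

  mod-cancelˡ : ∀ {a b d} c → c ≢ + 0 → c * a ≈ c * b mod (c * d) → a ≈ b mod d
  mod-cancelˡ {a} {b} {d} c c≢0 (mod k e) = mod k (*-cancelˡ c c≢0 (trans e (lem c b k d)))
    where
    opaque
      unfolding _+_ 0≟
      lem : ∀ c b k d → c * b + k * (c * d) ≡ c * (b + k * d)
      lem = solve-∀ ring

  mod-weaken : ∀ {a b d} e → a ≈ b mod (d * e) → a ≈ b mod d
  mod-weaken {a} {b} {d} e (mod k h) = mod (k * e) (trans h (cong (_+_ b) (lem k d e)))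
    where
    opaque
      unfolding _+_ 0≟
      lem : ∀ k d e → k * (d * e) ≡ k * e * d
      lem = solve-∀ ring

  opaque
    unfolding _+_
    ≰⇒difference : ∀ {a b} → ¬ b ≤ a → + 0 ≤ b - + 1 - a
    ≰⇒difference {a} {b} n = subst (+ 0 ℤ.≤_) (trans (cong (λ z → b ℤ.+ z) (trans (ℤ.neg-distrib-+ (+ 1) a) refl)) (sym (ℤ.+-assoc b (ℤ.- (+ 1)) (ℤ.- a))))
      (ℤ.i≤j⇒0≤j-i (ℤ.i<j⇒suc[i]≤j (ℤ.≰⇒> n)))

    zero-product : ∀ a b → a * b ≡ + 0 → a ≡ + 0 ⊎ b ≡ + 0
    zero-product a b = ℤ.i*j≡0⇒i≡0∨j≡0 a

  -- The common form of the numerical contradictions below: a sum of nonnegative quantities that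
  -- ring arithmetic evaluates to a negative literal.
  negative-absurd : ∀ {ℓ} {X : Set ℓ} {z n} → + 0 ≤ z → z ≡ ℤ.-[1+ n ] → X
  negative-absurd p refl = contradiction p λ ()

  nonneg : ∀ n → + 0 ≤ + n
  nonneg n = ℤ.+≤+ ℕ.z≤n

-- Determinants over the integers: multilinearity, alternation, Cramer's rule.

module Determinants where
  open Integers

  sum-adjacent : ∀ {n} (f : Fin (suc n) → ℤ) (a : Fin n) → f (inject₁ a) + f (suc a) ≡ + 0 →
    (∀ j → j ≢ inject₁ a → j ≢ suc a → f j ≡ + 0) → sum f ≡ + 0
  sum-adjacent {suc n} f zero e h = trans (sum-suc f) (trans (cong (_+_ (f zero)) (sum-suc (f ∘ suc))) (trans (sym (+-assoc _ _ _)) (trans (cong₂ _+_ e (sum-zero λ i → h (suc (suc i)) (λ ()) λ ())) (+-identityˡ _))))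
  sum-adjacent {suc n} f (suc a) e h = trans (sum-suc f) (trans (cong₂ _+_ (h zero (λ ()) λ ())
    (sum-adjacent (f ∘ suc) a e λ j p q → h (suc j) (λ { refl → p refl }) λ { refl → q refl })) (+-identityˡ _))

  sgn : ℕ → ℤ
  sgn zero = + 1
  sgn (suc k) = - sgn k

  Mat : ℕ → Set
  Mat n = Fin n → Fin n → ℤ

  minor : ∀ {n} → Mat (suc n) → Fin (suc n) → Mat n
  minor M j a b = M (suc a) (punchIn j b)

  detℤ : ∀ {n} → Mat n → ℤ
  detℤ {zero} M = + 1
  detℤ {suc n} M = sum λ j → sgn (toℕ j) * (M zero j * detℤ (minor M j))

  detℤ-cong : ∀ {n} {M M′ : Mat n} → (∀ i j → M i j ≡ M′ i j) → detℤ M ≡ detℤ M′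
  detℤ-cong {zero} h = refl
  detℤ-cong {suc n} h = sum-cong λ j → cong (sgn (toℕ j) *_) (cong₂ _*_ (h zero j) (detℤ-cong λ a b → h (suc a) (punchIn j b)))

  detℤ-mod : ∀ {n d} {M M′ : Mat n} → (∀ i j → M i j ≈ M′ i j mod d) → detℤ M ≈ detℤ M′ mod d
  detℤ-mod {zero} h = mod-refl refl
  detℤ-mod {suc n} h = mod-sum λ j → mod-* (mod-refl {a = sgn (toℕ j)} refl) (mod-* (h zero j) (detℤ-mod λ a b → h (suc a) (punchIn j b)))

  -- In the expansion along row 0 the term j = v is linear through its entry, since its minor omits
  -- column v; every other term is linear through its minor, where column v has moved to `punchOut`.
  -- Relating three matrices entrywise lets the induction pass to minors.
  detℤ-col-linear : ∀ {n} (v : Fin n) (M A B : Mat n) x y →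
    (∀ i j → j ≢ v → A i j ≡ M i j) → (∀ i j → j ≢ v → B i j ≡ M i j) →
    (∀ i → M i v ≡ x * A i v + y * B i v) → detℤ M ≡ x * detℤ A + y * detℤ B
  detℤ-col-linear {suc n} v M A B x y hA hB hM =
    trans (sum-cong term) (sum-linear x y _ _)
    where
    opaque
      unfolding _+_ 0≟
      lem₁ : ∀ s x y a b m → s * ((x * a + y * b) * m) ≡ x * (s * (a * m)) + y * (s * (b * m))
      lem₁ = solve-∀ ring
    opaque
      unfolding _+_ 0≟
      lem₂ : ∀ s x y e a b → s * (e * (x * a + y * b)) ≡ x * (s * (e * a)) + y * (s * (e * b))
      lem₂ = solve-∀ ring
    D : Mat (suc n) → Fin (suc n) → ℤ
    D M j = detℤ (minor M j)
    term : ∀ j → sgn (toℕ j) * (M zero j * D M j) ≡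
      x * (sgn (toℕ j) * (A zero j * D A j)) + y * (sgn (toℕ j) * (B zero j * D B j))
    term j with j ≟ v
    ... | yes refl = begin
        sgn (toℕ j) * (M zero j * D M j) ≡⟨ cong (λ z → sgn (toℕ j) * (z * D M j)) (hM zero) ⟩
        sgn (toℕ j) * ((x * A zero j + y * B zero j) * D M j) ≡⟨ lem₁ (sgn (toℕ j)) x y (A zero j) (B zero j) (D M j) ⟩
        x * (sgn (toℕ j) * (A zero j * D M j)) + y * (sgn (toℕ j) * (B zero j * D M j))
          ≡⟨ cong₂ (λ p q → x * (sgn (toℕ j) * (A zero j * p)) + y * (sgn (toℕ j) * (B zero j * q)))
               (detℤ-cong λ a b → sym (hA (suc a) _ (punchInᵢ≢i j b)))
               (detℤ-cong λ a b → sym (hB (suc a) _ (punchInᵢ≢i j b))) ⟩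
        _ ∎
      where open ≡-Reasoning
    ... | no j≢v = begin
        sgn (toℕ j) * (M zero j * D M j) ≡⟨ cong (λ z → sgn (toℕ j) * (M zero j * z)) rec ⟩
        sgn (toℕ j) * (M zero j * (x * D A j + y * D B j)) ≡⟨ lem₂ (sgn (toℕ j)) x y (M zero j) (D A j) (D B j) ⟩
        x * (sgn (toℕ j) * (M zero j * D A j)) + y * (sgn (toℕ j) * (M zero j * D B j))
          ≡⟨ sym (cong₂ (λ p q → x * (sgn (toℕ j) * (p * D A j)) + y * (sgn (toℕ j) * (q * D B j))) (hA zero j j≢v) (hB zero j j≢v)) ⟩
        _ ∎
      where
      open ≡-Reasoning
      v′ = punchOut j≢v
      e : punchIn j v′ ≡ v
      e = punchIn-punchOut j≢v
      off : ∀ b → b ≢ v′ → punchIn j b ≢ v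
      off b ne q = ne (punchIn-injective j b v′ (trans q (sym e)))
      rec : D M j ≡ x * D A j + y * D B j
      rec = detℤ-col-linear v′ (minor M j) (minor A j) (minor B j) x y
        (λ a b ne → hA (suc a) _ (off b ne)) (λ a b ne → hB (suc a) _ (off b ne))
        (λ a → subst (λ w → M (suc a) w ≡ x * A (suc a) w + y * B (suc a) w) (sym e) (hM (suc a)))

  detℤ-row-linear : ∀ {n} (r : Fin n) (M A B : Mat n) x y →
    (∀ i j → i ≢ r → A i j ≡ M i j) → (∀ i j → i ≢ r → B i j ≡ M i j) →
    (∀ j → M r j ≡ x * A r j + y * B r j) → detℤ M ≡ x * detℤ A + y * detℤ B
  detℤ-row-linear {suc n} zero M A B x y hA hB hM = trans (sum-cong term) (sum-linear x y _ _)
    where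
    open ≡-Reasoning
    opaque
      unfolding _+_ 0≟
      lem₁ : ∀ s x y a b m → s * ((x * a + y * b) * m) ≡ x * (s * (a * m)) + y * (s * (b * m))
      lem₁ = solve-∀ ring
    term : ∀ j → sgn (toℕ j) * (M zero j * detℤ (minor M j)) ≡
      x * (sgn (toℕ j) * (A zero j * detℤ (minor A j))) + y * (sgn (toℕ j) * (B zero j * detℤ (minor B j)))
    term j = begin
        sgn (toℕ j) * (M zero j * detℤ (minor M j)) ≡⟨ cong (λ z → sgn (toℕ j) * (z * detℤ (minor M j))) (hM j) ⟩
        sgn (toℕ j) * ((x * A zero j + y * B zero j) * detℤ (minor M j)) ≡⟨ lem₁ (sgn (toℕ j)) x y (A zero j) (B zero j) (detℤ (minor M j)) ⟩
        x * (sgn (toℕ j) * (A zero j * detℤ (minor M j))) + y * (sgn (toℕ j) * (B zero j * detℤ (minor M j)))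
          ≡⟨ cong₂ (λ p q → x * (sgn (toℕ j) * (A zero j * p)) + y * (sgn (toℕ j) * (B zero j * q)))
               (detℤ-cong λ a b → sym (hA (suc a) _ λ ()))
               (detℤ-cong λ a b → sym (hB (suc a) _ λ ())) ⟩
        _ ∎
  detℤ-row-linear {suc n} (suc r) M A B x y hA hB hM = trans (sum-cong term) (sum-linear x y _ _)
    where
    open ≡-Reasoning
    opaque
      unfolding _+_ 0≟
      lem₂ : ∀ s x y e a b → s * (e * (x * a + y * b)) ≡ x * (s * (e * a)) + y * (s * (e * b))
      lem₂ = solve-∀ ring
    D : Mat (suc n) → Fin (suc n) → ℤ
    D M j = detℤ (minor M j)
    term : ∀ j → sgn (toℕ j) * (M zero j * D M j) ≡
      x * (sgn (toℕ j) * (A zero j * D A j)) + y * (sgn (toℕ j) * (B zero j * D B j))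
    term j = begin
        sgn (toℕ j) * (M zero j * D M j) ≡⟨ cong (λ z → sgn (toℕ j) * (M zero j * z))
          (detℤ-row-linear r (minor M j) (minor A j) (minor B j) x y
            (λ a b ne → hA (suc a) _ λ { refl → ne refl }) (λ a b ne → hB (suc a) _ λ { refl → ne refl })
            (λ b → hM (punchIn j b))) ⟩
        sgn (toℕ j) * (M zero j * (x * D A j + y * D B j)) ≡⟨ lem₂ (sgn (toℕ j)) x y (M zero j) (D A j) (D B j) ⟩
        x * (sgn (toℕ j) * (M zero j * D A j)) + y * (sgn (toℕ j) * (M zero j * D B j))
          ≡⟨ sym (cong₂ (λ p q → x * (sgn (toℕ j) * (p * D A j)) + y * (sgn (toℕ j) * (q * D B j))) (hA zero j λ ()) (hB zero j λ ())) ⟩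
        _ ∎

  +0* : ∀ a b → a + + 0 * b ≡ a
  +0* a b = trans (cong (_+_ a) (zeroˡ b)) (+-identityʳ a)

  0*+0* : ∀ a b → + 0 * a + + 0 * b ≡ + 0
  0*+0* a b = trans (cong₂ _+_ (zeroˡ a) (zeroˡ b)) (+-identityˡ _)

  detℤ-zero-col : ∀ {n} (v : Fin n) (M : Mat n) → (∀ i → M i v ≡ + 0) → detℤ M ≡ + 0
  detℤ-zero-col v M h = trans (detℤ-col-linear v M M M (+ 0) (+ 0) (λ _ _ _ → refl) (λ _ _ _ → refl) λ i → trans (h i) (sym (0*+0* _ _))) (0*+0* _ _)

  punchIn-adjacent : ∀ {n} (a b : Fin n) →
    punchIn (inject₁ a) b ≡ punchIn (suc a) b ⊎ (punchIn (inject₁ a) b ≡ suc a × punchIn (suc a) b ≡ inject₁ a)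
  punchIn-adjacent zero zero = inj₂ (refl , refl)
  punchIn-adjacent zero (suc b) = inj₁ refl
  punchIn-adjacent (suc a) zero = inj₁ refl
  punchIn-adjacent (suc a) (suc b) with punchIn-adjacent a b
  ... | inj₁ e = inj₁ (cong suc e)
  ... | inj₂ (e , e′) = inj₂ (cong suc e , cong suc e′)

  punchIn-away : ∀ {n} (j : Fin (suc (suc n))) (a : Fin (suc n)) → j ≢ inject₁ a → j ≢ suc a →
    Σ (Fin n) λ a′ → punchIn j (inject₁ a′) ≡ inject₁ a × punchIn j (suc a′) ≡ suc a
  punchIn-away zero zero p q = contradiction refl p
  punchIn-away zero (suc a) p q = a , refl , refl
  punchIn-away (suc zero) zero p q = contradiction refl q
  punchIn-away {suc n} (suc (suc j)) zero p q = zero , refl , refl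
  punchIn-away {suc n} (suc j) (suc a) p q
    with punchIn-away j a (λ { refl → p refl }) (λ { refl → q refl })
  ... | a′ , e , e′ = suc a′ , cong suc e , cong suc e′

  -- The terms of the two equal columns have the same minor and opposite signs; the minor of any
  -- other term still contains two equal adjacent columns.
  detℤ-alt-adjacent : ∀ {n} (M : Mat (suc n)) (a : Fin n) → (∀ i → M i (inject₁ a) ≡ M i (suc a)) → detℤ M ≡ + 0
  detℤ-alt-adjacent {suc n} M a h = sum-adjacent _ a cancel other
    where
    open ≡-Reasoning
    same : ∀ i b → minor M (inject₁ a) i b ≡ minor M (suc a) i b
    same i b with punchIn-adjacent a b
    ... | inj₁ e = cong (M (suc i)) e
    ... | inj₂ (e , e′) = trans (cong (M (suc i)) e) (trans (sym (h (suc i))) (sym (cong (M (suc i)) e′)))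
    opaque
      unfolding _+_ 0≟
      lem : ∀ s x → s * x + (- s) * x ≡ + 0
      lem = solve-∀ ring
    cancel : sgn (toℕ (inject₁ a)) * (M zero (inject₁ a) * detℤ (minor M (inject₁ a))) +
             sgn (suc (toℕ a)) * (M zero (suc a) * detℤ (minor M (suc a))) ≡ + 0
    cancel = trans (cong (λ z → z + sgn (suc (toℕ a)) * (M zero (suc a) * detℤ (minor M (suc a))))
                     (cong₂ _*_ (cong sgn (toℕ-inject₁ a)) (cong₂ _*_ (h zero) (detℤ-cong same))))
                   (lem (sgn (toℕ a)) _)
    other : ∀ j → j ≢ inject₁ a → j ≢ suc a → sgn (toℕ j) * (M zero j * detℤ (minor M j)) ≡ + 0
    other j p q with punchIn-away j a p q
    ... | a′ , e , e′ = begin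
      sgn (toℕ j) * (M zero j * detℤ (minor M j)) ≡⟨ cong (λ z → sgn (toℕ j) * (M zero j * z))
         (detℤ-alt-adjacent (minor M j) a′ λ i → trans (cong (M (suc i)) e) (trans (h (suc i)) (sym (cong (M (suc i)) e′)))) ⟩
      sgn (toℕ j) * (M zero j * + 0) ≡⟨ cong (sgn (toℕ j) *_) (zeroʳ (M zero j)) ⟩
      sgn (toℕ j) * + 0 ≡⟨ zeroʳ (sgn (toℕ j)) ⟩
      + 0 ∎

  setCol : ∀ {n} → Fin n → (Fin n → ℤ) → Mat n → Mat n
  setCol v w M i j = if ⌊ j ≟ v ⌋ then w i else M i j

  setCol-at : ∀ {n} v (w : Fin n → ℤ) M i → setCol v w M i v ≡ w i
  setCol-at v w M i with v ≟ v
  ... | yes _ = refl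
  ... | no n = contradiction refl n

  setCol-off : ∀ {n} v (w : Fin n → ℤ) M i j → j ≢ v → setCol v w M i j ≡ M i j
  setCol-off v w M i j ne with j ≟ v
  ... | yes e = contradiction e ne
  ... | no _ = refl

  detℤ-col-+ : ∀ {n} v (w w′ : Fin n → ℤ) M → detℤ (setCol v (λ i → w i + w′ i) M) ≡ detℤ (setCol v w M) + detℤ (setCol v w′ M)
  detℤ-col-+ v w w′ M = trans (detℤ-col-linear v (setCol v w₊ M) (setCol v w M) (setCol v w′ M) (+ 1) (+ 1)
      (λ i j ne → trans (setCol-off v w M i j ne) (sym (setCol-off v w₊ M i j ne)))
      (λ i j ne → trans (setCol-off v w′ M i j ne) (sym (setCol-off v w₊ M i j ne)))
      (λ i → trans (setCol-at v w₊ M i) (sym (cong₂ _+_ (trans (*-identityˡ _) (setCol-at v w M i)) (trans (*-identityˡ _) (setCol-at v w′ M i))))))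
    (cong₂ _+_ (*-identityˡ _) (*-identityˡ _))
    where
    w₊ : Fin _ → ℤ
    w₊ i = w i + w′ i

  detℤ-col-* : ∀ {n} v x (w : Fin n → ℤ) M → detℤ (setCol v (λ i → x * w i) M) ≡ x * detℤ (setCol v w M)
  detℤ-col-* v x w M = trans (detℤ-col-linear v (setCol v w* M) (setCol v w M) (setCol v w M) x (+ 0)
      (λ i j ne → trans (setCol-off v w M i j ne) (sym (setCol-off v w* M i j ne)))
      (λ i j ne → trans (setCol-off v w M i j ne) (sym (setCol-off v w* M i j ne)))
      (λ i → trans (setCol-at v w* M i) (trans (cong (x *_) (sym (setCol-at v w M i))) (sym (+0* _ _)))))
    (+0* _ _)
    where
    w* : Fin _ → ℤ
    w* i = x * w i

  -- Polarisation: the determinant with x + y in both columns vanishes, and so do those with x twice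
  -- and with y twice.
  detℤ-swap-adjacent : ∀ {n} (M M′ : Mat (suc n)) (a : Fin n) →
    (∀ i → M′ i (inject₁ a) ≡ M i (suc a)) → (∀ i → M′ i (suc a) ≡ M i (inject₁ a)) →
    (∀ i j → j ≢ inject₁ a → j ≢ suc a → M′ i j ≡ M i j) → detℤ M ≡ - detℤ M′
  detℤ-swap-adjacent {n} M M′ a h₁ h₂ h₃ =
    trans (detℤ-cong eqM) (trans (lem _ _ total) (cong -_ (detℤ-cong eqM′)))
    where
    open ≡-Reasoning
    u v : Fin (suc n)
    u = inject₁ a
    v = suc a
    u≢v : ∀ {n} {a : Fin n} → inject₁ a ≢ suc a
    u≢v {a = zero} ()
    u≢v {a = suc a} e = u≢v {a = a} (cong pr e)
      where
      pr : ∀ {m} → Fin (suc (suc m)) → Fin (suc m)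
      pr zero = zero
      pr (suc i) = i
    x y : Fin (suc n) → ℤ
    x i = M i u
    y i = M i v
    S : (Fin (suc n) → ℤ) → (Fin (suc n) → ℤ) → Mat (suc n)
    S p q = setCol u p (setCol v q M)
    swapSet : ∀ p q → detℤ (S p q) ≡ detℤ (setCol v q (setCol u p M))
    swapSet p q = detℤ-cong g
      where
      g : ∀ i j → S p q i j ≡ setCol v q (setCol u p M) i j
      g i j with j ≟ u | j ≟ v
      ... | yes e | yes e′ = contradiction (trans (sym e) e′) (u≢v {a = a})
      ... | yes _ | no _ = refl
      ... | no _ | yes _ = refl
      ... | no _ | no _ = refl
    add₂ : ∀ p q q′ → detℤ (S p (λ i → q i + q′ i)) ≡ detℤ (S p q) + detℤ (S p q′)
    add₂ p q q′ = trans (swapSet p (λ i → q i + q′ i)) (trans (detℤ-col-+ v q q′ (setCol u p M)) (sym (cong₂ _+_ (swapSet p q) (swapSet p q′))))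
    diag : ∀ p → detℤ (S p p) ≡ + 0
    diag p = detℤ-alt-adjacent (S p p) a λ i → trans (setCol-at u p (setCol v p M) i)
      (sym (trans (setCol-off u p (setCol v p M) i v (≢-sym (u≢v {a = a}))) (setCol-at v p M i)))
    s : Fin (suc n) → ℤ
    s i = x i + y i
    total : detℤ (S x y) + detℤ (S y x) ≡ + 0
    total = begin
      detℤ (S x y) + detℤ (S y x) ≡⟨ lem′ _ _ ⟩
      (+ 0 + detℤ (S x y)) + (detℤ (S y x) + + 0) ≡⟨ sym (cong₂ (λ p q → (p + detℤ (S x y)) + (detℤ (S y x) + q)) (diag x) (diag y)) ⟩
      (detℤ (S x x) + detℤ (S x y)) + (detℤ (S y x) + detℤ (S y y)) ≡⟨ sym (cong₂ _+_ (add₂ x x y) (add₂ y x y)) ⟩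
      detℤ (S x s) + detℤ (S y s) ≡⟨ sym (detℤ-col-+ u x y (setCol v s M)) ⟩
      detℤ (S s s) ≡⟨ diag s ⟩
      + 0 ∎
      where
      opaque
        unfolding _+_ 0≟
        lem′ : ∀ a b → a + b ≡ (+ 0 + a) + (b + + 0)
        lem′ = solve-∀ ring
    lem : ∀ a b → a + b ≡ + 0 → a ≡ - b
    lem a b e = trans (l a b) (trans (cong (_- b) e) (+-identityˡ _))
      where
      opaque
        unfolding _+_ 0≟
        l : ∀ a b → a ≡ (a + b) - b
        l = solve-∀ ring
    eqM : ∀ i j → M i j ≡ S x y i j
    eqM i j with j ≟ u | j ≟ v
    ... | yes refl | _ = refl
    ... | no _ | yes refl = refl
    ... | no _ | no _ = refl
    eqM′ : ∀ i j → S y x i j ≡ M′ i j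
    eqM′ i j with j ≟ u | j ≟ v
    ... | yes refl | _ = sym (h₁ i)
    ... | no _ | yes refl = sym (h₂ i)
    ... | no p | no q = sym (h₃ i j p q)

  private
    opaque
      unfolding _+_
      neg-zero : - (+ 0) ≡ + 0
      neg-zero = refl

    -- Column v travels left by adjacent swaps until it stands next to u; the induction is on its
    -- position.
    alt-< : ∀ {n} m (M : Mat (suc n)) (u v : Fin (suc n)) → toℕ v ≡ m → toℕ u ℕ.< toℕ v →
      (∀ i → M i u ≡ M i v) → detℤ M ≡ + 0
    alt-< (suc m) M u (suc v) e lt h with u ≟ inject₁ v
    ... | yes refl = detℤ-alt-adjacent M v h
    ... | no u≢ = trans (detℤ-swap-adjacent M M′ v at₁ at₂ off)
        (trans (cong -_ (alt-< m M′ u (inject₁ v) (trans (toℕ-inject₁ v) (ℕ.suc-injective e)) lt′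
          λ i → trans (off i u u≢ u≢sv) (trans (h i) (sym (at₁ i))))) neg-zero)
      where
      u≢sv : u ≢ suc v
      u≢sv q = ℕ.<⇒≢ lt (cong toℕ q)
      lt′ : toℕ u ℕ.< toℕ (inject₁ v)
      lt′ = ℕ.≤∧≢⇒< (subst (toℕ u ℕ.≤_) (sym (toℕ-inject₁ v)) (ℕ.s≤s⁻¹ lt)) λ q → u≢ (toℕ-injective q)
      M′ : Mat _
      M′ i j = if ⌊ j ≟ inject₁ v ⌋ then M i (suc v) else (if ⌊ j ≟ suc v ⌋ then M i (inject₁ v) else M i j)
      at₁ : ∀ i → M′ i (inject₁ v) ≡ M i (suc v)
      at₁ i with inject₁ v ≟ inject₁ v
      ... | yes _ = refl
      ... | no q = contradiction refl q
      at₂ : ∀ i → M′ i (suc v) ≡ M i (inject₁ v)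
      at₂ i with suc v ≟ inject₁ v
      ... | yes q = contradiction (cong toℕ q) (λ w → ℕ.<⇒≢ (ℕ.n<1+n (toℕ v)) (sym (trans w (toℕ-inject₁ v))))
      ... | no _ with suc v ≟ suc v
      ...   | yes _ = refl
      ...   | no q = contradiction refl q
      off : ∀ i j → j ≢ inject₁ v → j ≢ suc v → M′ i j ≡ M i j
      off i j p q with j ≟ inject₁ v
      ... | yes w = contradiction w p
      ... | no _ with j ≟ suc v
      ...   | yes w = contradiction w q
      ...   | no _ = refl

  detℤ-alternating : ∀ {n} (M : Mat n) u v → u ≢ v → (∀ i → M i u ≡ M i v) → detℤ M ≡ + 0
  detℤ-alternating {suc n} M u v u≢v h with ℕ.<-cmp (toℕ u) (toℕ v)
  ... | tri< lt _ _ = alt-< _ M u v refl lt h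
  ... | tri≈ _ e _ = contradiction (toℕ-injective e) u≢v
  ... | tri> _ _ gt = alt-< _ M v u refl gt (sym ∘ h)

  infixr 7 _·_
  _·_ : ∀ {n} → Mat n → (Fin n → ℤ) → Fin n → ℤ
  (M · f) i = sum λ k → M i k * f k

  private
    detℤ-col-sum : ∀ {n m} v (g : Fin m → Fin n → ℤ) (f : Fin m → ℤ) M →
      detℤ (setCol v (λ i → sum λ k → g k i * f k) M) ≡ sum λ k → detℤ (setCol v (g k) M) * f k
    detℤ-col-sum {m = zero} v g f M = trans (detℤ-zero-col v _ λ i → trans (setCol-at v (λ i → sum λ k → g k i * f k) M i) (sum-[] _)) (sym (sum-[] _))
    detℤ-col-sum {n} {m = suc m} v g f M = begin
      detℤ (setCol v (λ i → sum λ k → g k i * f k) M)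
        ≡⟨ detℤ-cong {n} (λ i j → cong (λ w → if ⌊ j ≟ v ⌋ then w else M i j) (trans (sum-suc _) (cong (λ z → z + rest i) (*-comm _ _)))) ⟩
      detℤ (setCol v (λ i → f zero * g zero i + rest i) M)
        ≡⟨ detℤ-col-+ v (λ i → f zero * g zero i) rest M ⟩
      detℤ (setCol v (λ i → f zero * g zero i) M) + detℤ (setCol v rest M)
        ≡⟨ cong₂ _+_ (trans (detℤ-col-* v (f zero) (g zero) M) (*-comm _ _)) (detℤ-col-sum v (g ∘ suc) (f ∘ suc) M) ⟩
      detℤ (setCol v (g zero) M) * f zero + sum (λ k → detℤ (setCol v (g (suc k)) M) * f (suc k))
        ≡⟨ sym (sum-suc _) ⟩
      sum (λ k → detℤ (setCol v (g k) M) * f k) ∎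
      where
      open ≡-Reasoning
      rest : Fin n → ℤ
      rest i = sum λ k → g (suc k) i * f (suc k)

  -- The new column is a combination of the columns of `M` with coefficients `f`, and by alternation
  -- only its v-th summand survives. Being free of division, this stands in for inverse matrices
  -- throughout.
  cramer : ∀ {n} (M : Mat n) f v → detℤ (setCol v (M · f) M) ≡ detℤ M * f v
  cramer M f v = trans (detℤ-col-sum v (λ k i → M i k) f M)
    (trans (sum-single _ v λ k k≢v → trans (cong (_* f k) (detℤ-alternating _ v k (≢-sym k≢v)
        λ i → trans (setCol-at v (λ i → M i k) M i) (sym (setCol-off v (λ i → M i k) M i k k≢v)))) (zeroˡ (f k)))
      (cong (_* f v) (detℤ-cong same)))
    where
    same : ∀ i j → setCol v (λ i → M i v) M i j ≡ M i j
    same i j with j ≟ v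
    ... | yes refl = refl
    ... | no _ = refl

  δ : ∀ {n} → Fin n → Fin n → ℤ
  δ i j = if ⌊ i ≟ j ⌋ then + 1 else + 0

  δ-refl : ∀ {n} (i : Fin n) → δ i i ≡ + 1
  δ-refl i with i ≟ i
  ... | yes _ = refl
  ... | no q = contradiction refl q

  δ-≢ : ∀ {n} {i j : Fin n} → i ≢ j → δ i j ≡ + 0
  δ-≢ {i = i} {j} p with i ≟ j
  ... | yes e = contradiction e p
  ... | no _ = refl

  δ-suc : ∀ {n} (i j : Fin n) → δ (suc i) (suc j) ≡ δ i j
  δ-suc i j with i ≟ j
  ... | yes _ = refl
  ... | no _ = refl

  sum-δ : ∀ {n} (i : Fin n) (f : Fin n → ℤ) → sum (λ j → δ i j * f j) ≡ f i
  sum-δ i f = trans (sum-single (λ j → δ i j * f j) i λ j ne → trans (cong (_* f j) (δ-≢ (≢-sym ne))) (zeroˡ (f j)))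
    (trans (cong (_* f i) (δ-refl i)) (*-identityˡ (f i)))

  detℤ-δ : ∀ n → detℤ (δ {n}) ≡ + 1
  detℤ-δ zero = refl
  detℤ-δ (suc n) = trans (sum-single _ zero λ { zero ne → contradiction refl ne
                                             ; (suc j) _ → trans (cong (sgn (suc (toℕ j)) *_) (zeroˡ (detℤ (minor δ (suc j))))) (zeroʳ (sgn (suc (toℕ j)))) })
    (trans (*-identityˡ _) (trans (*-identityˡ _) (trans (detℤ-cong {n} (λ a b → δ-suc a b)) (detℤ-δ n))))

  -- Once a column is a basis vector, the row through its non-zero entry is irrelevant.
  detℤ-unit-row : ∀ {n} (v : Fin n) (M M′ : Mat n) → (∀ i → M i v ≡ δ i v) →
    (∀ i j → i ≢ v → M i j ≡ M′ i j) → (∀ j → M′ v j ≡ δ v j) → detℤ M ≡ detℤ M′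
  detℤ-unit-row v M M′ hc hs hr = trans (detℤ-row-linear v M M′ B (+ 1) (+ 1) (λ i j ne → sym (hs i j ne)) offB rowB)
    (trans (cong₂ (λ p q → p + q) (*-identityˡ _) (trans (*-identityˡ _) (detℤ-zero-col v B colB))) (+-identityʳ _))
    where
    B : Mat _
    B i j = if ⌊ i ≟ v ⌋ then M v j - δ v j else M i j
    offB : ∀ i j → i ≢ v → B i j ≡ M i j
    offB i j ne with i ≟ v
    ... | yes e = contradiction e ne
    ... | no _ = refl
    atB : ∀ j → B v j ≡ M v j - δ v j
    atB j with v ≟ v
    ... | yes e = refl
    ... | no q = contradiction refl q
    opaque
      unfolding _+_ 0≟
      l : ∀ a b → a ≡ + 1 * b + + 1 * (a - b)
      l = solve-∀ ring
    rowB : ∀ j → M v j ≡ + 1 * M′ v j + + 1 * B v j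
    rowB j = trans (l (M v j) (δ v j)) (sym (cong₂ (λ p q → + 1 * p + + 1 * q) (hr j) (atB j)))
    colB : ∀ i → B i v ≡ + 0
    colB i with i ≟ v
    ... | yes refl = trans (cong (_- δ i i) (hc i)) (-‿inverseʳ (δ i i))
    ... | no ne = trans (hc i) (δ-≢ ne)

  -- The columns are perturbed one at a time.
  detℤ-perturb : ∀ {n} h (M Y : Mat n) →
    detℤ (λ i j → M i j + h * Y i j) ≈ detℤ M + h * sum (λ v → detℤ (setCol v (λ i → Y i v) M)) mod (h * h)
  detℤ-perturb {n} h M Y = mod-trans (mod-refl (detℤ-cong full)) (mod-trans (steps n ℕ.≤-refl) (mod-refl (cong (λ z → detℤ M + h * z) (upto-all n dM ℕ.≤-refl))))
    where
    dM : Fin n → ℤ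
    dM v = detℤ (setCol v (λ i → Y i v) M)
    upto : ∀ {m} → ℕ → (Fin m → ℤ) → ℤ
    upto {zero} _ f = + 0
    upto {suc m} zero f = + 0
    upto {suc m} (suc k) f = f zero + upto k (f ∘ suc)
    upto-zero : ∀ {m} (f : Fin m → ℤ) → upto 0 f ≡ + 0
    upto-zero {zero} f = refl
    upto-zero {suc m} f = refl
    upto-all : ∀ {m} k (f : Fin m → ℤ) → m ℕ.≤ k → upto k f ≡ sum f
    upto-all {zero} k f le = sym (sum-[] f)
    upto-all {suc m} (suc k) f (ℕ.s≤s le) = trans (cong (_+_ (f zero)) (upto-all k (f ∘ suc) le)) (sym (sum-suc f))
    upto-suc : ∀ {m} (f : Fin m → ℤ) (v : Fin m) → upto (suc (toℕ v)) f ≡ upto (toℕ v) f + f v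
    upto-suc f zero = trans (cong (_+_ (f zero)) (upto-zero (f ∘ suc))) (+-comm (f zero) (+ 0))
    upto-suc f (suc v) = trans (cong (_+_ (f zero)) (upto-suc (f ∘ suc) v)) (sym (+-assoc (f zero) _ _))
    P : ℕ → Mat n
    P k i j = if toℕ j ℕ.<ᵇ k then M i j + h * Y i j else M i j
    full : ∀ i j → M i j + h * Y i j ≡ P n i j
    full i j with toℕ j ℕ.<ᵇ n | ℕ.<⇒<ᵇ (toℕ<n j)
    ... | true | _ = refl
    empty : detℤ (P 0) ≡ detℤ M
    empty = detℤ-cong {n} λ i j → refl
    near : ∀ k i j → P k i j ≈ M i j mod h
    near k i j with toℕ j ℕ.<ᵇ k
    ... | true = mod (Y i j) (cong (_+_ (M i j)) (*-comm h (Y i j)))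
    ... | false = mod-refl refl
    <ᵇ-irr : ∀ k → (k ℕ.<ᵇ k) ≡ false
    <ᵇ-irr zero = refl
    <ᵇ-irr (suc k) = <ᵇ-irr k
    <ᵇ-suc : ∀ k → (k ℕ.<ᵇ suc k) ≡ true
    <ᵇ-suc zero = refl
    <ᵇ-suc (suc k) = <ᵇ-suc k
    <ᵇ-ne : ∀ a k → a ≢ k → (a ℕ.<ᵇ suc k) ≡ (a ℕ.<ᵇ k)
    <ᵇ-ne zero zero ne = contradiction refl ne
    <ᵇ-ne zero (suc k) ne = refl
    <ᵇ-ne (suc a) zero ne = refl
    <ᵇ-ne (suc a) (suc k) ne = <ᵇ-ne a k (ne ∘ cong suc)
    one : ∀ v → detℤ (P (suc (toℕ v))) ≈ detℤ (P (toℕ v)) + h * dM v mod (h * h)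
    one v = mod-trans (mod-refl (trans (detℤ-col-linear v _ (P (toℕ v)) (setCol v (λ i → Y i v) (P (toℕ v))) (+ 1) h
        (λ i j ne → cong (λ b → if b then M i j + h * Y i j else M i j) (sym (<ᵇ-ne _ _ (ne ∘ toℕ-injective))))
        (λ i j ne → trans (setCol-off v (λ i → Y i v) (P (toℕ v)) i j ne) (cong (λ b → if b then M i j + h * Y i j else M i j) (sym (<ᵇ-ne _ _ (ne ∘ toℕ-injective)))))
        atv) (cong (λ z → z + h * detℤ (setCol v (λ i → Y i v) (P (toℕ v)))) (*-identityˡ _))))
      (mod-+ {a = detℤ (P (toℕ v))} (mod-refl refl) (mod-scale h (detℤ-mod nearSet)))
      where
      nearSet : ∀ i j → setCol v (λ i → Y i v) (P (toℕ v)) i j ≈ setCol v (λ i → Y i v) M i j mod h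
      nearSet i j with j ≟ v
      ... | yes _ = mod-refl refl
      ... | no _ = near (toℕ v) i j
      atv : ∀ i → P (suc (toℕ v)) i v ≡ + 1 * P (toℕ v) i v + h * setCol v (λ i → Y i v) (P (toℕ v)) i v
      atv i = trans (cong (λ b → if b then M i v + h * Y i v else M i v) (<ᵇ-suc (toℕ v)))
        (sym (cong₂ (λ p q → p + h * q)
          (trans (*-identityˡ (P (toℕ v) i v)) (cong (λ b → if b then M i v + h * Y i v else M i v) (<ᵇ-irr (toℕ v))))
          (setCol-at v (λ i → Y i v) (P (toℕ v)) i)))
    steps : ∀ k → k ℕ.≤ n → detℤ (P k) ≈ detℤ M + h * upto k dM mod (h * h)
    steps zero le = mod-refl (trans empty (trans (sym (+-identityʳ _)) (cong (_+_ (detℤ M)) (sym (trans (cong (h *_) (upto-zero dM)) (zeroʳ h))))))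
    steps (suc k) le = subst (λ k → detℤ (P (suc k)) ≈ detℤ M + h * upto (suc k) dM mod (h * h)) (toℕ-fromℕ< le) step
      where
      v : Fin n
      v = Fin.fromℕ< le
      opaque
        unfolding _+_ 0≟
        l : ∀ a h x y → (a + h * x) + h * y ≡ a + h * (x + y)
        l = solve-∀ ring
      step : detℤ (P (suc (toℕ v))) ≈ detℤ M + h * upto (suc (toℕ v)) dM mod (h * h)
      step = mod-trans (one v) (mod-trans (mod-+ {a′ = h * dM v} (subst (λ k → detℤ (P k) ≈ detℤ M + h * upto k dM mod (h * h)) (sym (toℕ-fromℕ< le)) (steps k (ℕ.≤-trans (ℕ.n≤1+n k) le))) (mod-refl refl))
        (mod-refl (trans (l (detℤ M) h (upto (toℕ v) dM) (dM v)) (cong (λ z → detℤ M + h * z) (sym (upto-suc dM v))))))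

-- From the characteristic polynomial to the values of `D`.

module Pencils where
  open Integers
  open Determinants

  pow : ℤ → ℕ → ℤ
  pow x zero = + 1
  pow x (suc n) = x * pow x n

  -- ∑_{i ≤ n} c i · α^i · β^(n-i)
  homogenise : ℤ → ℤ → ℕ → (ℕ → ℤ) → ℤ
  homogenise α β zero c = c zero
  homogenise α β (suc n) c = pow β (suc n) * c zero + α * homogenise α β n (c ∘ suc)

  homogenise-cong : ∀ α β n {c c′ : ℕ → ℤ} → (∀ i → c i ≡ c′ i) → homogenise α β n c ≡ homogenise α β n c′
  homogenise-cong α β zero h = h zero
  homogenise-cong α β (suc n) h = cong₂ (λ p q → pow β (suc n) * p + α * q) (h zero) (homogenise-cong α β n (h ∘ suc))

  homogenise-linear : ∀ α β n u v (c c′ : ℕ → ℤ) →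
    homogenise α β n (λ i → u * c i + v * c′ i) ≡ u * homogenise α β n c + v * homogenise α β n c′
  homogenise-linear α β zero u v c c′ = refl
  homogenise-linear α β (suc n) u v c c′ =
    trans (cong (λ z → pow β (suc n) * (u * c 0 + v * c′ 0) + α * z) (homogenise-linear α β n u v (c ∘ suc) (c′ ∘ suc)))
      (lem (pow β (suc n)) α u v _ _ _ _)
    where
    opaque
      unfolding _+_ 0≟
      lem : ∀ b a u v c c′ h h′ → b * (u * c + v * c′) + a * (u * h + v * h′) ≡ u * (b * c + a * h) + v * (b * c′ + a * h′)
      lem = solve-∀ ring

  homogenise-raise : ∀ α β n (c : ℕ → ℤ) → c (suc n) ≡ + 0 → homogenise α β (suc n) c ≡ β * homogenise α β n c
  homogenise-raise α β zero c h = trans (cong (λ z → β * + 1 * c 0 + α * z) h) (lem α β (c 0))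
    where
    opaque
      unfolding _+_ 0≟
      lem : ∀ a b c → b * + 1 * c + a * + 0 ≡ b * c
      lem = solve-∀ ring
  homogenise-raise α β (suc n) c h =
    trans (cong (λ z → pow β (suc (suc n)) * c 0 + α * z) (homogenise-raise α β n (c ∘ suc) h)) (lem α β (pow β (suc n)) (c 0) _)
    where
    opaque
      unfolding _+_ 0≟
      lem : ∀ a b p c h → b * p * c + a * (b * h) ≡ b * (p * c + a * h)
      lem = solve-∀ ring

  homogenise-top : ∀ n c → homogenise (+ 1) (+ 0) n c ≡ c n
  homogenise-top zero c = refl
  homogenise-top (suc n) c = trans (cong (λ z → + 0 * pow (+ 0) n * c 0 + + 1 * z) (homogenise-top n (c ∘ suc))) (lem (pow (+ 0) n) (c 0) (c (suc n)))
    where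
    opaque
      unfolding _+_ 0≟
      lem : ∀ p c d → + 0 * p * c + + 1 * d ≡ d
      lem = solve-∀ ring

  -- Coefficients of the polynomial multiplied by its variable.
  delay : (ℕ → ℤ) → ℕ → ℤ
  delay c zero = + 0
  delay c (suc i) = c i

  homogenise-delay : ∀ α β n (c : ℕ → ℤ) → homogenise α β (suc n) (delay c) ≡ α * homogenise α β n c
  homogenise-delay α β n c = trans (cong (λ z → z + α * homogenise α β n c) (zeroʳ (pow β (suc n)))) (+-identityˡ _)

  AtMostLinear : Poly → Set
  AtMostLinear e = (Σ ℤ λ u → e ≡ u ∷ []) ⊎ (Σ ℤ λ u → Σ ℤ λ v → e ≡ u ∷ v ∷ [])

  opaque
    unfolding _+_
    coeff-+P : ∀ p q i → coeff (p +P q) i ≡ coeff p i + coeff q i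
    coeff-+P [] q i = sym (ℤ.+-identityˡ _)
    coeff-+P (a ∷ p) [] i = sym (ℤ.+-identityʳ _)
    coeff-+P (a ∷ p) (b ∷ q) zero = refl
    coeff-+P (a ∷ p) (b ∷ q) (suc i) = coeff-+P p q i

    coeff-scaleP : ∀ c p i → coeff (scaleP c p) i ≡ c * coeff p i
    coeff-scaleP c [] i = sym (ℤ.*-zeroʳ c)
    coeff-scaleP c (a ∷ p) zero = refl
    coeff-scaleP c (a ∷ p) (suc i) = coeff-scaleP c p i

    sign≡sgn : ∀ k → sign k ≡ sgn k
    sign≡sgn zero = refl
    sign≡sgn (suc k) = cong ℤ.-_ (sign≡sgn k)

  coeff-sumFinP : ∀ {n} (f : Fin n → Poly) i → coeff (sumFinP f) i ≡ sum (λ j → coeff (f j) i)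
  coeff-sumFinP {zero} f i = sym (sum-[] _)
  coeff-sumFinP {suc n} f i = trans (coeff-+P (f zero) _ i) (trans (cong (_+_ _) (coeff-sumFinP (f ∘ suc) i)) (sym (sum-suc _)))

  coeff-*P : ∀ e r i → AtMostLinear e → coeff (e *P r) i ≡ coeff e 0 * coeff r i + coeff e 1 * delay (coeff r) i
  coeff-*P .(u ∷ []) r i (inj₁ (u , refl)) = trans (coeff-+P (scaleP u r) (+ 0 ∷ []) i)
    (cong₂ _+_ (coeff-scaleP u r i) (trans (zeros i) (sym (zeroˡ _))))
    where
    zeros : ∀ i → coeff (+ 0 ∷ []) i ≡ + 0
    zeros zero = refl
    zeros (suc i) = refl
  coeff-*P .(u ∷ v ∷ []) r i (inj₂ (u , v , refl)) = trans (coeff-+P (scaleP u r) (+ 0 ∷ (v ∷ []) *P r) i)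
    (cong₂ _+_ (coeff-scaleP u r i) (tl i))
    where
    tl : ∀ i → coeff (+ 0 ∷ (v ∷ []) *P r) i ≡ v * delay (coeff r) i
    tl zero = sym (zeroʳ v)
    tl (suc i) = trans (coeff-*P (v ∷ []) r i (inj₁ (v , refl))) (trans (cong (_+_ _) (zeroˡ _)) (+-identityʳ _))

  module _ (α β : ℤ) where
    DetSpec : ∀ n → (Fin n → Fin n → Poly) → Set
    DetSpec n M = (∀ i → n ℕ.< i → coeff (det n M) i ≡ + 0) ×
      homogenise α β n (coeff (det n M)) ≡ detℤ (λ i j → β * coeff (M i j) 0 + α * coeff (M i j) 1)

    -- The degree bound and the evaluation are proved together: a minor of degree at most n, read as
    -- one of degree n + 1, gains exactly one factor β, and this needs its coefficient n + 1 to
    -- vanish.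
    homogenise-det : ∀ n (M : Fin n → Fin n → Poly) → (∀ i j → AtMostLinear (M i j)) → DetSpec n M
    homogenise-det zero M lin = high , refl
      where
      high : ∀ i → 0 ℕ.< i → coeff (+ 1 ∷ []) i ≡ + 0
      high (suc i) _ = refl
    homogenise-det (suc n) M lin = high , trans (homogenise-cong α β (suc n) expand)
        (trans (hom-sum (λ j i → sgn (toℕ j) * term j i)) (sum-cong λ j → trans (hom-scale (sgn (toℕ j)) (term j)) (cong (sgn (toℕ j) *_) (evalTerm j))))
      where
      D : Fin (suc n) → Poly
      D j = det n (λ a b → M (suc a) (punchIn j b))
      rec : ∀ j → DetSpec n (λ a b → M (suc a) (punchIn j b))
      rec j = homogenise-det n _ (λ a b → lin (suc a) (punchIn j b))
      term : Fin (suc n) → ℕ → ℤ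
      term j i = coeff (M zero j) 0 * coeff (D j) i + coeff (M zero j) 1 * delay (coeff (D j)) i
      expand : ∀ i → coeff (det (suc n) M) i ≡ sum λ j → sgn (toℕ j) * term j i
      expand i = trans (coeff-sumFinP (λ j → scaleP (sign (toℕ j)) (M zero j *P D j)) i) (sum-cong λ j → trans (coeff-scaleP (sign (toℕ j)) (M zero j *P D j) i)
        (cong₂ _*_ (sign≡sgn (toℕ j)) (coeff-*P (M zero j) (D j) i (lin zero j))))
      high : ∀ i → suc n ℕ.< i → coeff (det (suc n) M) i ≡ + 0
      high (suc i) lt = trans (expand (suc i)) (sum-zero λ j → trans (cong (sgn (toℕ j) *_)
        (trans (cong₂ _+_ (trans (cong (_*_ _) (proj₁ (rec j) (suc i) (ℕ.<-trans (ℕ.n<1+n n) lt))) (zeroʳ _)) (trans (cong (_*_ _) (proj₁ (rec j) i (ℕ.s≤s⁻¹ lt))) (zeroʳ _))) (+-identityˡ _))) (zeroʳ _))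
      hom-scale : ∀ x (c : ℕ → ℤ) → homogenise α β (suc n) (λ i → x * c i) ≡ x * homogenise α β (suc n) c
      hom-scale x c = trans (homogenise-cong α β (suc n) λ i → sym (+0* (x * c i) (c i))) (trans (homogenise-linear α β (suc n) x (+ 0) c c) (+0* _ _))
      hom-sum : ∀ {m} (c : Fin m → ℕ → ℤ) → homogenise α β (suc n) (λ i → sum λ j → c j i) ≡ sum λ j → homogenise α β (suc n) (c j)
      hom-sum {zero} c = trans (homogenise-cong α β (suc n) {c′ = λ i → + 0 * + 0} (λ i → trans (sum-[] (λ j → c j i)) (sym (zeroˡ _)))) (trans (hom-scale (+ 0) (λ _ → + 0)) (trans (zeroˡ _) (sym (sum-[] _))))
      hom-sum {suc m} c = trans (homogenise-cong α β (suc n) λ i → trans (sum-suc (λ j → c j i)) (cong₂ _+_ (sym (*-identityˡ (c zero i))) (sym (*-identityˡ (sum λ j → c (suc j) i)))))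
        (trans (homogenise-linear α β (suc n) (+ 1) (+ 1) (c zero) (λ i → sum λ j → c (suc j) i))
          (trans (cong₂ _+_ (*-identityˡ _) (trans (*-identityˡ _) (hom-sum (c ∘ suc)))) (sym (sum-suc _))))
      opaque
        unfolding _+_ 0≟
        lem : ∀ a b u v h → u * (b * h) + v * (a * h) ≡ (b * u + a * v) * h
        lem = solve-∀ ring
      evalTerm : ∀ j → homogenise α β (suc n) (term j) ≡ (β * coeff (M zero j) 0 + α * coeff (M zero j) 1) * detℤ (minor (λ i j → β * coeff (M i j) 0 + α * coeff (M i j) 1) j)
      evalTerm j = trans (homogenise-linear α β (suc n) u v (coeff (D j)) (delay (coeff (D j))))
        (trans (cong₂ (λ p q → u * p + v * q) (homogenise-raise α β n (coeff (D j)) (proj₁ (rec j) (suc n) (ℕ.n<1+n n))) (homogenise-delay α β n (coeff (D j))))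
          (trans (lem α β u v (homogenise α β n (coeff (D j)))) (cong ((β * u + α * v) *_) (proj₂ (rec j)))))
        where
        u = coeff (M zero j) 0
        v = coeff (M zero j) 1

  A : (G : Graph) → Fin (size G) → Fin (size G) → ℤ
  A G i j = if adj G i j then + 1 else + 0

  -- The degree excess d − 2; the matrix X − A with X = diag(excess) is L − 2I.
  excess : (G : Graph) → Fin (size G) → ℤ
  excess G i = + degree G i - + 2

  pencil : (a b : ℤ) (G : Graph) → Mat (size G)
  pencil a b G i j = δ i j * (a + b * excess G i) - b * A G i j

  D : ℤ → ℤ → Graph → ℤ
  D a b G = detℤ (pencil a b G)

  xI-L-linear : ∀ G i j → AtMostLinear (xI-L G i j)
  xI-L-linear G i j with i ≟ j
  ... | yes _ = inj₂ (_ , _ , refl)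
  ... | no _ = inj₁ (_ , refl)

  A-irrefl : ∀ G i → A G i i ≡ + 0
  A-irrefl G i = cong (λ z → if z then + 1 else + 0) (adj-irrefl G i)

  A-sym : ∀ G i j → A G i j ≡ A G j i
  A-sym G i j = cong (λ z → if z then + 1 else + 0) (adj-sym G i j)

  opaque
    unfolding _+_
    neg≡ : ∀ z → ℤ.- z ≡ - z
    neg≡ z = refl
    neg-neg-1 : - (ℤ.- (+ 1)) ≡ + 1
    neg-neg-1 = refl
    neg-0 : ℤ.- (+ 0) ≡ + 0
    neg-0 = refl

  -- Homogeneous evaluation of xI - L at α = a - 2b, β = -b yields (a - 2b)I + bL, that is aI + b(L
  -- - 2I).
  pencil-entry : ∀ G a b i j → (- b) * coeff (xI-L G i j) 0 + (a - + 2 * b) * coeff (xI-L G i j) 1 ≡ pencil a b G i j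
  pencil-entry G a b i j with i ≟ j
  ... | yes refl rewrite A-irrefl G i = trans (cong (λ z → (- b) * z + (a - + 2 * b) * + 1) (neg≡ (+ degree G i))) (lem a b (+ degree G i))
    where
    opaque
      unfolding _+_ 0≟
      lem : ∀ a b d → (- b) * (- d) + (a - + 2 * b) * + 1 ≡ + 1 * (a + b * (d - + 2)) - b * + 0
      lem = solve-∀ ring
  ... | no _ with adj G i j
  ...   | true = trans (cong (λ z → (- b) * z + (a - + 2 * b) * + 0) (trans (neg≡ _) neg-neg-1)) (lem a b (+ degree G i))
    where
    opaque
      unfolding _+_ 0≟
      lem : ∀ a b d → (- b) * + 1 + (a - + 2 * b) * + 0 ≡ + 0 * (a + b * (d - + 2)) - b * + 1
      lem = solve-∀ ring
  ...   | false = trans (cong (λ z → (- b) * z + (a - + 2 * b) * + 0) neg-0) (lem a b (+ degree G i))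
    where
    opaque
      unfolding _+_ 0≟
      lem : ∀ a b d → (- b) * + 0 + (a - + 2 * b) * + 0 ≡ + 0 * (a + b * (d - + 2)) - b * + 0
      lem = solve-∀ ring

  homogenise-charPoly : ∀ G a b → homogenise (a - + 2 * b) (- b) (size G) (coeff (lapCharPoly G)) ≡ D a b G
  homogenise-charPoly G a b = trans (proj₂ (homogenise-det (a - + 2 * b) (- b) (size G) (xI-L G) (xI-L-linear G)))
    (detℤ-cong {size G} (pencil-entry G a b))

  charPoly-high : ∀ G i → size G ℕ.< i → coeff (lapCharPoly G) i ≡ + 0
  charPoly-high G = proj₁ (homogenise-det (+ 0) (+ 0) (size G) (xI-L G) (xI-L-linear G))

  -- Evaluation at α = 1, β = 0 picks out the top coefficient and turns the matrix into the
  -- identity.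
  charPoly-monic : ∀ G → coeff (lapCharPoly G) (size G) ≡ + 1
  charPoly-monic G = trans (sym (homogenise-top (size G) _))
    (trans (proj₂ (homogenise-det (+ 1) (+ 0) (size G) (xI-L G) (xI-L-linear G)))
      (trans (detℤ-cong {size G} entry) (detℤ-δ (size G))))
    where
    entry : ∀ i j → + 0 * coeff (xI-L G i j) 0 + + 1 * coeff (xI-L G i j) 1 ≡ δ i j
    entry i j with i ≟ j
    ... | yes _ = trans (cong₂ _+_ (zeroˡ _) (*-identityˡ _)) (+-identityˡ _)
    ... | no _ = trans (cong₂ _+_ (zeroˡ _) (*-identityˡ _)) (+-identityˡ _)

  cospectral-size : ∀ {G H} → LapCospectral G H → size G ≡ size H
  cospectral-size {G} {H} c with ℕ.<-cmp (size G) (size H)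
  ... | tri≈ _ e _ = e
  ... | tri< lt _ _ = contradiction (trans (sym (charPoly-high G _ lt)) (trans (c (size H)) (charPoly-monic H))) λ ()
  ... | tri> _ _ gt = contradiction (trans (sym (charPoly-high H _ gt)) (trans (sym (c (size G))) (charPoly-monic G))) λ ()

  cospectral-D : ∀ {G H} → LapCospectral G H → ∀ a b → D a b G ≡ D a b H
  cospectral-D {G} {H} c a b = trans (sym (homogenise-charPoly G a b))
    (trans (trans (cong (λ n → homogenise (a - + 2 * b) (- b) n (coeff (lapCharPoly G))) (cospectral-size {G} {H} c))
                  (homogenise-cong (a - + 2 * b) (- b) (size H) c))
      (homogenise-charPoly H a b))

-- Neighbourhoods as lists.

module Neighbours where
  open import Data.Integer using (_≤_)
  open Integers
  open Determinants
  open Pencils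

  module _ {n : ℕ} where
    open DecMembership (_≟_ {n}) public using (_∈?_)

  mult : ∀ {n} → List (Fin n) → Fin n → ℤ
  mult [] i = + 0
  mult (x ∷ xs) i = δ x i + mult xs i

  listSum : ∀ {n} → (Fin n → ℤ) → List (Fin n) → ℤ
  listSum F [] = + 0
  listSum F (x ∷ xs) = F x + listSum F xs

  sum-mult : ∀ {n} (xs : List (Fin n)) F → sum (λ i → mult xs i * F i) ≡ listSum F xs
  sum-mult [] F = sum-zero λ i → zeroˡ (F i)
  sum-mult (x ∷ xs) F = trans (sum-cong λ i → distribʳ (F i) (δ x i) (mult xs i))
    (trans (sum-+ _ _) (cong₂ _+_ (sum-δ x F) (sum-mult xs F)))

  mult-∉ : ∀ {n} {xs : List (Fin n)} {i} → i ∉ xs → mult xs i ≡ + 0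
  mult-∉ {xs = []} _ = refl
  mult-∉ {xs = x ∷ xs} i∉ = trans (cong₂ _+_ (δ-≢ λ { refl → i∉ (here refl) }) (mult-∉ (i∉ ∘ there))) (+-identityˡ _)

  mult-∈ : ∀ {n} {xs : List (Fin n)} {i} → Unique xs → i ∈ xs → mult xs i ≡ + 1
  mult-∈ u@(_ ∷ _) (here refl) = trans (cong₂ _+_ (δ-refl _) (mult-∉ (Unique[x∷xs]⇒x∉xs u))) (+-identityʳ _)
  mult-∈ {xs = x ∷ xs} u@(_ ∷ us) (there p) = trans (cong₂ _+_ (δ-≢ λ { refl → Unique[x∷xs]⇒x∉xs u p }) (mult-∈ us p)) (+-identityˡ _)

  listSum-one : ∀ {n} (xs : List (Fin n)) → listSum (λ _ → + 1) xs ≡ + length xs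
  listSum-one [] = refl
  listSum-one (x ∷ xs) = trans (cong (_+_ (+ 1)) (listSum-one xs)) (sym (pos-+ 1 (length xs)))

  sum-mult-one : ∀ {n} (xs : List (Fin n)) → sum (mult xs) ≡ + length xs
  sum-mult-one xs = trans (sum-cong λ i → sym (*-identityʳ _)) (trans (sum-mult xs (λ _ → + 1)) (listSum-one xs))

  ι : Bool → ℤ
  ι b = if b then + 1 else + 0

  ι-nonneg : ∀ b → + 0 ≤ ι b
  ι-nonneg true = ℤ.+≤+ ℕ.z≤n
  ι-nonneg false = ℤ.≤-refl

  count-sum : ∀ {n} (f : Fin n → Bool) → + countFin f ≡ sum (ι ∘ f)
  count-sum {zero} f = sym (sum-[] _)
  count-sum {suc n} f = trans (pos-+ (if f zero then 1 else 0) _) (trans (cong₂ _+_ (lem (f zero)) (count-sum (f ∘ suc))) (sym (sum-suc _)))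
    where
    lem : ∀ b → + (if b then 1 else 0) ≡ ι b
    lem true = refl
    lem false = refl

  degree-sum : ∀ G i → + degree G i ≡ sum (A G i)
  degree-sum G i = count-sum (adj G i)

  A-nonneg : ∀ G i j → + 0 ≤ A G i j
  A-nonneg G i j = ι-nonneg (adj G i j)

  A-true : ∀ G {i j} → adj G i j ≡ true → A G i j ≡ + 1
  A-true G e = cong ι e

  A-false : ∀ G {i j} → adj G i j ≢ true → A G i j ≡ + 0
  A-false G {i} {j} e with adj G i j
  ... | true = contradiction refl e
  ... | false = refl

  -- The entire adjacency row is prescribed, so that one hypothesis both lists the neighbours and
  -- evaluates every sum over them.
  Nbrs : (G : Graph) → Fin (size G) → List (Fin (size G)) → Set
  Nbrs G x ys = ∀ j → A G x j ≡ mult ys j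

  nbrs-sum : ∀ {G x ys} → Nbrs G x ys → ∀ F → sum (λ j → A G x j * F j) ≡ listSum F ys
  nbrs-sum {ys = ys} h F = trans (sum-cong λ j → cong (_* F j) (h j)) (sum-mult ys F)

  nbrs-elim : ∀ {G x ys} → Nbrs G x ys → ∀ {v} → adj G x v ≡ true → v ∈ ys
  nbrs-elim {G} {x} {ys} h {v} e = decidable-stable (v ∈? ys) λ v∉ →
    contradiction (trans (sym (A-true G e)) (trans (h v) (mult-∉ v∉))) λ ()

  module _ {n} (f : Fin n → Bool) where

    opaque
      -- The indicator of `f` minus that of the list is nonnegative, because the list is
      -- duplicate-free and `f` holds on it, and it sums to 0.
      count-exact : ∀ ys → Unique ys → All (λ y → f y ≡ true) ys → sum (ι ∘ f) ≡ + length ys → ∀ j → ι (f j) ≡ mult ys j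
      count-exact ys u as e j = trans (lem (ι (f j)) (mult ys j)) (zero-+ (sum-nonneg-zero {f = g} g≥0 sum-g j))
        where
        opaque
          unfolding _+_ 0≟
          lem : ∀ a b → a ≡ (a - b) + b
          lem = solve-∀ ring
        g : Fin n → ℤ
        g j = ι (f j) - mult ys j
        g≥0 : ∀ j → + 0 ≤ g j
        g≥0 j with j ∈? ys
        ... | yes p = ℤ.≤-reflexive (sym (trans (cong₂ _-_ (cong ι (All.lookup as p)) (mult-∈ u p)) (-‿inverseʳ _)))
        ... | no p = subst (+ 0 ≤_) (sym (zero-- (mult-∉ p))) (ι-nonneg (f j))
        sum-g : sum g ≡ + 0
        sum-g = trans (sum-- _ _) (trans (cong₂ _-_ e (sum-mult-one ys)) (-‿inverseʳ _))

      count-extra : ∀ ys → Unique ys → All (λ y → f y ≡ true) ys → sum (ι ∘ f) ≢ + length ys → Σ (Fin n) λ w → w ∉ ys × f w ≡ true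
      count-extra ys u as ne with any? (λ w → ¬? (w ∈? ys) ×-dec (f w Bool.≟ true))
      ... | yes p = p
      ... | no none = contradiction (trans (sum-cong same) (sum-mult-one ys)) ne
        where
        same : ∀ j → ι (f j) ≡ mult ys j
        same j with j ∈? ys
        ... | yes p = trans (cong ι (All.lookup as p)) (sym (mult-∈ u p))
        ... | no p with f j in e
        ...   | true = contradiction (j , p , e) none
        ...   | false = sym (mult-∉ p)

  nbrs-intro : ∀ G x ys → Unique ys → All (λ y → adj G x y ≡ true) ys → degree G x ≡ length ys → Nbrs G x ys
  nbrs-intro G x ys u as e = count-exact (adj G x) ys u as (trans (sym (degree-sum G x)) (cong +_ e))

  extra-nbr : ∀ G x ys → Unique ys → All (λ y → adj G x y ≡ true) ys → length ys ℕ.< degree G x →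
    Σ (Fin (size G)) λ w → w ∉ ys × adj G x w ≡ true
  extra-nbr G x ys u as lt = count-extra (adj G x) ys u as λ e → ℕ.<⇒≢ lt (sym (ℤ.+-injective (trans (degree-sum G x) e)))

  Nbrs-degree : ∀ {G x ys} → Nbrs G x ys → degree G x ≡ length ys
  Nbrs-degree {G} {x} {ys} h = ℤ.+-injective (trans (degree-sum G x) (trans (sum-cong h) (sum-mult-one ys)))

  adj-≢ : ∀ G {u v} → adj G u v ≡ true → u ≢ v
  adj-≢ G e refl = contradiction (trans (sym e) (adj-irrefl G _)) λ ()

  adj-flip : ∀ G {u v} → adj G u v ≡ true → adj G v u ≡ true
  adj-flip G {u} {v} e = trans (adj-sym G v u) e

-- Cutting a rose into its petals.

module PetalDecomposition where
  open Neighbours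

  next : ∀ {a} {V : Set a} → List V → V → V
  next [] e = e
  next (y ∷ p) e = y

  -- The list p runs from u to e, and each vertex on it has only its two neighbours on u ∷ p ++ [ e ].
  Path : (G : Graph) → Fin (size G) → List (Fin (size G)) → Fin (size G) → Set
  Path G u [] e = ⊤
  Path G u (x ∷ p) e = Nbrs G x (u ∷ next p e ∷ []) × Path G x p e

  -- A petal lists its vertices without the centre: a list of length r is a cycle of length r + 1.
  record Petals (G : Graph) (k : ℕ) : Set where
    field
      centre : Fin (size G)
      petals : List (List (Fin (size G)))
      paths  : All (λ p → Path G centre p centre) petals
      long   : All (λ p → 2 ℕ.≤ length p) petals
      cover  : centre ∷ concat petals ↭ allFin (size G)
      degree-centre : degree G centre ≡ 2 ℕ.* k

  Unique-resp-↭ : ∀ {n} {xs ys : List (Fin n)} → xs ↭ ys → Unique xs → Unique ys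
  Unique-resp-↭ p u = Permₛ.Unique-resp-↭ (setoid _) (↭⇒↭ₛ p) u

  ∉-unique : ∀ {n} {x : Fin n} {xs} → Unique (x ∷ xs) → x ∉ xs
  ∉-unique = Unique[x∷xs]⇒x∉xs

  module Extract (G : Graph) (c : Fin (size G)) (deg2 : ∀ v → ¬ v ≡ c → degree G v ≡ 2) where
    V = Fin (size G)

    Closed : List V → Set
    Closed rem = ∀ {y v} → y ∈ rem → adj G y v ≡ true → v ≡ c ⊎ v ∈ rem

    record Walked (u x : V) (rem : List V) : Set where
      field
        path rest : List V
        split : rem ↭ path ++ rest
        isPath : Path G u (x ∷ path) c
        proper : u ≡ c → path ≢ []
        closed : Closed rest

    extract : ∀ {w : V} {rem} → w ∈ rem → Σ (List V) λ rem′ → rem ↭ w ∷ rem′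
    extract w∈ with ∈-∃++ w∈
    ... | as , bs , refl = as ++ bs , shift _ as bs

    -- The vertex `x`, entered from `u`, has one more neighbour, which is the centre or a vertex not
    -- yet visited, since the visited ones have used up both their edges. The closure hypotheses
    -- express that no edge leads from the remaining vertices back to the removed ones; `m` bounds
    -- the vertices left.
    walk : ∀ m u x rem → length rem ℕ.≤ m → Unique (x ∷ rem) → c ∉ rem → ¬ x ≡ c → u ∉ rem → adj G x u ≡ true →
      (∀ {v} → adj G x v ≡ true → v ≡ u ⊎ v ≡ c ⊎ v ∈ rem) →
      (∀ {y v} → y ∈ rem → adj G y v ≡ true → v ≡ c ⊎ v ≡ x ⊎ v ∈ rem) → Walked u x rem
    walk m u x rem le uq c∉ x≢c u∉ xu clx clr
      with extra-nbr G x (u ∷ []) ([] ∷ []) (xu ∷ []) (subst (1 ℕ.<_) (sym (deg2 x x≢c)) (ℕ.s≤s (ℕ.s≤s ℕ.z≤n)))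
    ... | w , w∉ , xw = go (clx xw)
      where
      w≢u : ¬ w ≡ u
      w≢u e = w∉ (here e)
      nb : Nbrs G x (u ∷ w ∷ [])
      nb = nbrs-intro G x (u ∷ w ∷ []) (((λ e → w≢u (sym e)) ∷ []) ∷ [] ∷ []) (xu ∷ xw ∷ []) (deg2 x x≢c)
      go : w ≡ u ⊎ w ≡ c ⊎ w ∈ rem → Walked u x rem
      go (inj₁ e) = contradiction e w≢u
      go (inj₂ (inj₁ w≡c)) = record { path = [] ; rest = rem ; split = ↭-refl
        ; isPath = subst (λ z → Nbrs G x (u ∷ z ∷ [])) w≡c nb , tt
        -- The two neighbours of `x` differ, so a walk that has just left the centre cannot return
        -- to it at once: a petal has at least two vertices.
        ; proper = λ u≡c _ → w≢u (trans w≡c (sym u≡c)) ; closed = cl }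
        where
        cl : Closed rem
        cl {y} y∈ yv with clr y∈ yv
        ... | inj₁ e = inj₁ e
        ... | inj₂ (inj₂ p) = inj₂ p
        ... | inj₂ (inj₁ refl) with nbrs-elim {G} {ys = u ∷ w ∷ []} nb (adj-flip G yv)
        ...   | here refl = contradiction y∈ u∉
        ...   | there (here refl) = contradiction (subst (_∈ rem) w≡c y∈) c∉
      go (inj₂ (inj₂ w∈)) with extract w∈
      ... | rem₁ , perm = finish m le
        where
        uq₁ : Unique (w ∷ rem₁)
        uq₁ = Unique-resp-↭ perm (AllPairs.tail uq)
        back : ∀ {v} → v ∈ w ∷ rem₁ → v ∈ rem
        back = ∈-resp-↭ (↭-sym perm)
        forth : ∀ {v} → v ∈ rem → v ∈ w ∷ rem₁
        forth = ∈-resp-↭ perm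
        x∉rem : x ∉ rem
        x∉rem = ∉-unique uq
        clx₁ : ∀ {v} → adj G w v ≡ true → v ≡ x ⊎ v ≡ c ⊎ v ∈ rem₁
        clx₁ wv with clr w∈ wv
        ... | inj₁ e = inj₂ (inj₁ e)
        ... | inj₂ (inj₁ e) = inj₁ e
        ... | inj₂ (inj₂ v∈) with forth v∈
        ...   | here refl = contradiction refl (adj-≢ G wv)
        ...   | there p = inj₂ (inj₂ p)
        clr₁ : ∀ {y v} → y ∈ rem₁ → adj G y v ≡ true → v ≡ c ⊎ v ≡ w ⊎ v ∈ rem₁
        clr₁ y∈ yv with clr (back (there y∈)) yv
        ... | inj₁ e = inj₁ e
        ... | inj₂ (inj₂ v∈) with forth v∈
        ...   | here e = inj₂ (inj₁ e)
        ...   | there p = inj₂ (inj₂ p)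
        clr₁ y∈ yv | inj₂ (inj₁ refl) with nbrs-elim {G} {ys = u ∷ w ∷ []} nb (adj-flip G yv)
        ...   | here refl = contradiction (back (there y∈)) u∉
        ...   | there (here refl) = contradiction y∈ (∉-unique uq₁)
        finish : ∀ m → length rem ℕ.≤ m → Walked u x rem
        finish m le with subst (ℕ._≤ m) (↭-length perm) le
        finish (suc m) le | ℕ.s≤s le₁ = record { path = w ∷ W.path ; rest = W.rest ; split = ↭-trans perm (prep w W.split)
            ; isPath = nb , W.isPath ; proper = λ _ () ; closed = W.closed }
          where
          module W = Walked (walk m x w rem₁ le₁ uq₁ (c∉ ∘ back ∘ there) (λ e → c∉ (subst (_∈ rem) e w∈))
            (x∉rem ∘ back ∘ there) (adj-flip G xw) clx₁ clr₁)

    record Petalled (rem : List V) : Set where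
      field
        petals : List (List V)
        split : rem ↭ concat petals
        paths : All (λ p → Path G c p c) petals
        long : All (λ p → 2 ℕ.≤ length p) petals

    module _ (conn : Connected G) where
      -- A walk from a remaining vertex to the centre stays among the remaining vertices until the
      -- step into the centre, and that step would reveal a remaining neighbour of the centre.
      stuck : ∀ {rem} → Closed rem → c ∉ rem → (∀ {x} → x ∈ rem → ¬ adj G c x ≡ true) → rem ≡ []
      stuck {[]} cl c∉ no-nbr = refl
      stuck {y ∷ rem} cl c∉ no-nbr = ⊥-elim (go (here refl) (conn y c))
        where
        go : ∀ {v} → v ∈ y ∷ rem → Reach G v c → ⊥
        go v∈ Reach.here = c∉ v∈
        go v∈ (Reach.step e r) with cl v∈ e
        ... | inj₁ refl = no-nbr v∈ (adj-flip G e)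
        ... | inj₂ w∈ = go w∈ r

      decompose : ∀ m rem → length rem ℕ.≤ m → Unique rem → c ∉ rem → Closed rem → Petalled rem
      decompose m rem le uq c∉ cl with Any.any? (λ x → adj G c x Bool.≟ true) rem
      ... | no none = subst Petalled (sym (stuck cl c∉ λ x∈ e → none (lose x∈ e)))
              record { petals = [] ; split = ↭-refl ; paths = [] ; long = [] }
      ... | yes some with find some
      ...   | x , x∈ , cx with extract x∈
      ...     | rem₁ , perm = finish m le
        where
        uq₁ : Unique (x ∷ rem₁)
        uq₁ = Unique-resp-↭ perm uq
        back : ∀ {v} → v ∈ x ∷ rem₁ → v ∈ rem
        back = ∈-resp-↭ (↭-sym perm)
        split-x : ∀ {v} → v ∈ rem → v ≡ x ⊎ v ∈ rem₁
        split-x v∈ with ∈-resp-↭ perm v∈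
        ... | here e = inj₁ e
        ... | there p = inj₂ p
        clx : ∀ {v} → adj G x v ≡ true → v ≡ c ⊎ v ≡ c ⊎ v ∈ rem₁
        clx xv with cl x∈ xv
        ... | inj₁ e = inj₁ e
        ... | inj₂ v∈ with split-x v∈
        ...   | inj₁ refl = contradiction refl (adj-≢ G xv)
        ...   | inj₂ p = inj₂ (inj₂ p)
        clr : ∀ {y v} → y ∈ rem₁ → adj G y v ≡ true → v ≡ c ⊎ v ≡ x ⊎ v ∈ rem₁
        clr y∈ yv with cl (back (there y∈)) yv
        ... | inj₁ e = inj₁ e
        ... | inj₂ v∈ = inj₂ (split-x v∈)
        module W = Walked (walk m c x rem₁ (ℕ.≤-trans (ℕ.n≤1+n _) (subst (ℕ._≤ m) (↭-length perm) le)) uq₁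
          (c∉ ∘ back ∘ there) (λ e → c∉ (subst (_∈ rem) e x∈)) (c∉ ∘ back ∘ there) (adj-flip G cx) clx clr)
        perm₂ : rem ↭ (x ∷ W.path) ++ W.rest
        perm₂ = ↭-trans perm (prep x W.split)
        long-path : 2 ℕ.≤ length (x ∷ W.path)
        long-path with W.path | W.proper refl
        ... | [] | p = contradiction refl p
        ... | _ ∷ _ | _ = ℕ.s≤s (ℕ.s≤s ℕ.z≤n)
        in-rest : ∀ {v} → v ∈ W.rest → v ∈ rem
        in-rest v∈ = ∈-resp-↭ (↭-sym perm₂) (∈-++⁺ʳ (x ∷ W.path) v∈)
        unique-rest : ∀ (as : List V) {bs} → Unique (as ++ bs) → Unique bs
        unique-rest [] u = u
        unique-rest (_ ∷ as) (_ ∷ u) = unique-rest as u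
        finish : ∀ m → length rem ℕ.≤ m → Petalled rem
        finish m le with subst (ℕ._≤ m) (trans (↭-length perm₂) (cong suc (length-++ W.path))) le
        finish (suc m) le | ℕ.s≤s le₁ = record
            { petals = (x ∷ W.path) ∷ P.petals ; split = ↭-trans perm₂ (++⁺ˡ (x ∷ W.path) P.split)
            ; paths = W.isPath ∷ P.paths ; long = long-path ∷ P.long }
          where
          module P = Petalled (decompose m W.rest (ℕ.≤-trans (ℕ.m≤n+m _ (length W.path)) le₁)
            (unique-rest (x ∷ W.path) (Unique-resp-↭ perm₂ uq)) (c∉ ∘ in-rest) W.closed)

  opaque
    rose-petals : ∀ k G → IsRose k G → Petals G k
    rose-petals k G (conn , c , degc , deg2) with ∈-∃++ (∈-allFin c)
    ... | as , bs , e = record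
        { centre = c ; petals = P.petals ; paths = P.paths ; long = P.long
        ; cover = ↭-trans (prep c (↭-sym P.split)) (↭-sym perm) ; degree-centre = degc }
      where
      open Extract G c deg2
      perm : allFin (size G) ↭ c ∷ (as ++ bs)
      perm = subst (_↭ c ∷ (as ++ bs)) (sym e) (shift c as bs)
      uq : Unique (c ∷ (as ++ bs))
      uq = Unique-resp-↭ perm (allFin⁺ (size G))
      cl : Closed (as ++ bs)
      cl {v = v} _ _ with ∈-resp-↭ perm (∈-allFin v)
      ... | here e = inj₁ e
      ... | there p = inj₂ p
      module P = Petalled (decompose conn (length (as ++ bs)) (as ++ bs) ℕ.≤-refl (AllPairs.tail uq) (∉-unique uq) cl)

-- The determinant of a rose by elimination of vertices.

module RoseDeterminant where
  open Integers
  open Determinants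
  open Pencils
  open Neighbours
  open PetalDecomposition

  opaque
    -- A principal submatrix padded with the identity: its determinant is the principal minor, while
    -- the size stays fixed as vertices are removed.
    restrict : ∀ {n} → Mat n → List (Fin n) → Mat n
    restrict M vs i j with i ∈? vs | j ∈? vs
    ... | yes _ | yes _ = M i j
    ... | _ | _ = δ i j

  opaque
    unfolding restrict
    restrict-in : ∀ {n} (M : Mat n) {vs i j} → i ∈ vs → j ∈ vs → restrict M vs i j ≡ M i j
    restrict-in M {vs} {i} {j} p q with i ∈? vs | j ∈? vs
    ... | yes _ | yes _ = refl
    ... | no n | _ = contradiction p n
    ... | yes _ | no n = contradiction q n

    restrict-outˡ : ∀ {n} (M : Mat n) {vs i j} → i ∉ vs → restrict M vs i j ≡ δ i j
    restrict-outˡ M {vs} {i} {j} p with i ∈? vs | j ∈? vs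
    ... | yes y | _ = contradiction y p
    ... | no _ | yes _ = refl
    ... | no _ | no _ = refl

    restrict-outʳ : ∀ {n} (M : Mat n) {vs i j} → j ∉ vs → restrict M vs i j ≡ δ i j
    restrict-outʳ M {vs} {i} {j} p with i ∈? vs | j ∈? vs
    ... | _ | yes y = contradiction y p
    ... | yes _ | no _ = refl
    ... | no _ | no _ = refl

  -- If M f vanishes on vs, Cramer's rule removes the vertex v from the principal minor at v ∷ vs.
  eliminate : ∀ {n} (M : Mat n) v vs (f : Fin n → ℤ) → v ∉ vs → (∀ u → u ∉ v ∷ vs → f u ≡ + 0) →
    (∀ u → u ∈ vs → (M · f) u ≡ + 0) → detℤ (restrict M (v ∷ vs)) * f v ≡ (M · f) v * detℤ (restrict M vs)
  eliminate {n} M v vs f v∉ supp harm = trans (sym (cramer M′ f v))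
    (trans (detℤ-cong {n} (λ i j → cong (λ w → if ⌊ j ≟ v ⌋ then w else M′ i j) (image i)))
      (trans (detℤ-col-* v g (λ i → δ i v) M′) (cong (g *_) (detℤ-unit-row v _ (restrict M vs) (setCol-at v e M′) same λ j → restrict-outˡ M v∉))))
    where
    M′ = restrict M (v ∷ vs)
    g = (M · f) v
    e : Fin n → ℤ
    e i = δ i v
    image : ∀ i → (M′ · f) i ≡ g * δ i v
    image i with i ∈? (v ∷ vs)
    ... | no i∉ = trans (sum-cong λ j → cong (_* f j) (restrict-outˡ M {v ∷ vs} {i} {j} i∉))
          (trans (sum-δ i f) (trans (supp i i∉) (sym (trans (cong (g *_) (δ-≢ λ { refl → i∉ (here refl) })) (zeroʳ g)))))
    ... | yes i∈ = trans (sum-cong term) (row i∈)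
      where
      term : ∀ j → M′ i j * f j ≡ M i j * f j
      term j with j ∈? (v ∷ vs)
      ... | yes j∈ = cong (_* f j) (restrict-in M i∈ j∈)
      ... | no j∉ = trans (cong (M′ i j *_) (supp j j∉)) (trans (zeroʳ _) (sym (trans (cong (M i j *_) (supp j j∉)) (zeroʳ _))))
      row : i ∈ v ∷ vs → (M · f) i ≡ g * δ i v
      row (here refl) = sym (trans (cong (g *_) (δ-refl v)) (*-identityʳ g))
      row (there i∈vs) = trans (harm i i∈vs) (sym (trans (cong (g *_) (δ-≢ λ { refl → v∉ i∈vs })) (zeroʳ g)))
    mem : ∀ {i} → i ≢ v → i ∉ vs → i ∉ v ∷ vs
    mem ne n (here e) = ne e
    mem ne n (there p) = n p
    same : ∀ i j → i ≢ v → setCol v e M′ i j ≡ restrict M vs i j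
    same i j i≢v = by (j ≟ v)
      where
      by : Dec (j ≡ v) → setCol v e M′ i j ≡ restrict M vs i j
      by (yes refl) = trans (setCol-at v e M′ i) (sym (restrict-outʳ M v∉))
      by (no j≢v) = trans (setCol-off v e M′ i j j≢v) (inner (i ∈? vs) (j ∈? vs))
        where
        inner : Dec (i ∈ vs) → Dec (j ∈ vs) → M′ i j ≡ restrict M vs i j
        inner (yes p) (yes q) = trans (restrict-in M {v ∷ vs} {i} {j} (there p) (there q)) (sym (restrict-in M p q))
        inner (no p) _ = trans (restrict-outˡ M {v ∷ vs} {i} {j} (mem i≢v p)) (sym (restrict-outˡ M p))
        inner (yes _) (no q) = trans (restrict-outʳ M {v ∷ vs} {i} {j} (mem j≢v q)) (sym (restrict-outʳ M q))

  assign : ∀ {n} → (ℕ → ℤ) → List (Fin n) → Fin n → ℤ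
  assign g [] v = + 0
  assign g (x ∷ p) v = g 0 * δ x v + assign (g ∘ suc) p v

  assign-∉ : ∀ {n} g {p : List (Fin n)} {v} → v ∉ p → assign g p v ≡ + 0
  assign-∉ g {[]} _ = refl
  assign-∉ g {x ∷ p} v∉ = trans (cong₂ _+_ (trans (cong (g 0 *_) (δ-≢ λ { refl → v∉ (here refl) })) (zeroʳ _)) (assign-∉ (g ∘ suc) (v∉ ∘ there))) (+-identityˡ _)

  assign-head : ∀ {n} g {x : Fin n} {p} → x ∉ p → assign g (x ∷ p) x ≡ g 0
  assign-head g {x} {p} x∉ = trans (cong₂ _+_ (trans (cong (g 0 *_) (δ-refl x)) (*-identityʳ _)) (assign-∉ (g ∘ suc) {p} x∉)) (+-identityʳ _)

  assign-tail : ∀ {n} g {x v : Fin n} {p} → v ≢ x → assign g (x ∷ p) v ≡ assign (g ∘ suc) p v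
  assign-tail g {x} ne = trans (cong (λ z → z + _) (trans (cong (g 0 *_) (δ-≢ (ne ∘ sym))) (zeroʳ _))) (+-identityˡ _)

  weighted : ∀ {n} → (ℕ → ℤ) → (Fin n → ℤ) → List (Fin n) → ℤ
  weighted g F [] = + 0
  weighted g F (x ∷ p) = g 0 * F x + weighted (g ∘ suc) F p

  sum-assign : ∀ {n} (F : Fin n → ℤ) g p → sum (λ j → F j * assign g p j) ≡ weighted g F p
  sum-assign F g [] = sum-zero λ j → zeroʳ (F j)
  sum-assign F g (x ∷ p) = trans (sum-cong λ j → lem (F j) (g 0) (δ x j) (assign (g ∘ suc) p j))
    (trans (sum-+ _ _) (cong₂ _+_ (trans (sum-δ x _) refl) (sum-assign F (g ∘ suc) p)))
    where
    opaque
      unfolding _+_ 0≟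
      lem : ∀ f g d a → f * (g * d + a) ≡ d * (g * f) + f * a
      lem = solve-∀ ring

  -- F takes the values g 0, g 1, … along the list u ∷ p ++ [ e ].
  Along : ∀ {n} → (Fin n → ℤ) → (ℕ → ℤ) → Fin n → List (Fin n) → Fin n → Set
  Along F g u [] e = F u ≡ g 0 × F e ≡ g 1
  Along F g u (x ∷ p) e = F u ≡ g 0 × Along F (g ∘ suc) x p e

  along-cong : ∀ {n} {F F′ : Fin n → ℤ} {g g′ : ℕ → ℤ} {u p e} (h : ℤ → ℤ) → (∀ i → g′ i ≡ h (g i)) →
    F′ u ≡ h (F u) → (∀ {x} → x ∈ p → F′ x ≡ h (F x)) → F′ e ≡ h (F e) → Along F g u p e → Along F′ g′ u p e
  along-cong {p = []} h hg hu hp he (a , b) = trans hu (trans (cong h a) (sym (hg 0))) , trans he (trans (cong h b) (sym (hg 1)))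
  along-cong {p = x ∷ p} h hg hu hp he (a , b) = trans hu (trans (cong h a) (sym (hg 0))) , along-cong h (hg ∘ suc) (hp (here refl)) (hp ∘ there) he b

  along-next : ∀ {n} {F : Fin n → ℤ} {g u p e} → Along F g u p e → F (next p e) ≡ g 1
  along-next {p = []} (_ , b) = b
  along-next {p = x ∷ []} (_ , b , _) = b
  along-next {p = x ∷ y ∷ p} (_ , b , _) = b

  module Pencil (G : Graph) (a b : ℤ) where
    M = pencil a b G

    pencil-row : ∀ F u → (M · F) u ≡ (a + b * excess G u) * F u - b * sum (λ j → A G u j * F j)
    pencil-row F u = trans (sum-cong λ j → lem (δ u j) (a + b * excess G u) b (A G u j) (F j))
      (trans (sum-- _ _) (cong₂ _-_ (sum-δ u _) (sum-*ˡ b _)))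
      where
      opaque
        unfolding _+_ 0≟
        lem : ∀ d y b a f → (d * y - b * a) * f ≡ d * (y * f) - b * (a * f)
        lem = solve-∀ ring

    path-row : ∀ F {x y z} → Nbrs G x (y ∷ z ∷ []) → (M · F) x ≡ a * F x - b * (F y + F z)
    path-row F {x} {y} {z} nb = trans (pencil-row F x)
      (trans (cong₂ (λ d t → (a + b * (+ d - + 2)) * F x - b * t) (Nbrs-degree {G} {x} {y ∷ z ∷ []} nb) (nbrs-sum {G} {x} {y ∷ z ∷ []} nb F)) (lem a b (F x) (F y) (F z)))
      where
      opaque
        unfolding _+_ 0≟
        lem : ∀ a b x y z → (a + b * (+ 2 - + 2)) * x - b * (y + (z + + 0)) ≡ a * x - b * (y + z)
        lem = solve-∀ ring

    -- At a vertex of degree 2 the row of the pencil is a three-term expression, so a sequence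
    -- obeying the recurrence is annihilated along the whole path.
    harmonic : ∀ F g u p e → Path G u p e → Along F g u p e → (∀ i → i ℕ.< length p → a * g (1 ℕ.+ i) ≡ b * (g i + g (2 ℕ.+ i))) →
      ∀ y → y ∈ p → (M · F) y ≡ + 0
    harmonic F g u (x ∷ p) e (nb , path) (Fu , al) rec y (here refl) = trans (path-row F nb)
      (trans (cong₂ (λ s t → a * s - b * t) (along-head al) (cong₂ _+_ Fu (along-next al)))
        (trans (cong (λ z → z - b * (g 0 + g 2)) (rec 0 (ℕ.s≤s ℕ.z≤n))) (-‿inverseʳ _)))
      where
      along-head : ∀ {n} {F : Fin n → ℤ} {g u p e} → Along F g u p e → F u ≡ g 0
      along-head {p = []} = proj₁
      along-head {p = x ∷ p} = proj₁
    harmonic F g u (x ∷ p) e (nb , path) (Fu , al) rec y (there y∈) =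
      harmonic F (g ∘ suc) x p e path al (λ i lt → rec (suc i) (ℕ.s≤s lt)) y y∈

    -- determinants of path segments: a on the diagonal, −b next to it
    s : ℕ → ℤ
    s 0 = + 0
    s 1 = + 1
    s (suc (suc l)) = a * s (suc l) - b * b * s l

    -- The values s_r, b s_(r-1), b² s_(r-2), ... along a path of r vertices: the first column of
    -- the adjugate of its matrix. With this vector `eliminate` removes the first vertex. Note that
    -- `s (suc l)` belongs to l vertices.
    pathVec : List (Fin (size G)) → Fin (size G) → ℤ
    pathVec [] v = + 0
    pathVec (x ∷ p) v = s (suc (length p)) * δ x v + b * pathVec p v

    pathVec-∉ : ∀ {p v} → v ∉ p → pathVec p v ≡ + 0
    pathVec-∉ {[]} _ = refl
    pathVec-∉ {x ∷ p} v∉ = trans (cong₂ _+_ (trans (cong (s (suc (length p)) *_) (δ-≢ λ { refl → v∉ (here refl) })) (zeroʳ _))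
      (trans (cong (b *_) (pathVec-∉ (v∉ ∘ there))) (zeroʳ b))) (+-identityˡ _)

    pathVec-head : ∀ {x p} → x ∉ p → pathVec (x ∷ p) x ≡ s (suc (length p))
    pathVec-head {x} {p} x∉ = trans (cong₂ _+_ (trans (cong (s (suc (length p)) *_) (δ-refl x)) (*-identityʳ _))
      (trans (cong (b *_) (pathVec-∉ x∉)) (zeroʳ b))) (+-identityʳ _)

    pathVec-tail : ∀ {x v p} → v ≢ x → pathVec (x ∷ p) v ≡ b * pathVec p v
    pathVec-tail {x} {v} {p} ne = trans (cong (λ z → z + b * pathVec p v) (trans (cong (s (suc (length p)) *_) (δ-≢ (ne ∘ sym))) (zeroʳ _))) (+-identityˡ _)

    pathVec-next : ∀ {p e} → Unique p → e ∉ p → pathVec p (next p e) ≡ s (length p)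
    pathVec-next {[]} _ _ = refl
    pathVec-next {x ∷ p} u _ = pathVec-head (∉-unique u)

    next∈ : ∀ {V : Set} (p : List V) e → next p e ≡ e ⊎ next p e ∈ p
    next∈ [] e = inj₁ refl
    next∈ (y ∷ p) e = inj₂ (here refl)

    -- The scalar κ collects the factors b that appear on passing from a path to its tail.
    pathVec-harmonic : ∀ F κ u p e → Path G u p e → Unique (u ∷ p) → e ∉ u ∷ p →
      F u ≡ κ * s (suc (length p)) → F e ≡ + 0 → (∀ {x} → x ∈ p → F x ≡ κ * (b * pathVec p x)) →
      ∀ y → y ∈ p → (M · F) y ≡ + 0
    pathVec-harmonic F κ u (x ∷ p) e (nb , path) (_ ∷ uq) e∉ Fu Fe Fp y (here refl) =
      trans (path-row F nb) (trans (cong₂ (λ z t → a * z - b * t) Fx (cong₂ _+_ Fu Fn)) (lem a b κ _ _))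
      where
      Fx : F x ≡ κ * (b * s (suc (length p)))
      Fx = trans (Fp (here refl)) (cong (λ z → κ * (b * z)) (pathVec-head (∉-unique uq)))
      Fn : F (next p e) ≡ κ * (b * (b * s (length p)))
      Fn with next∈ p e
      ... | inj₂ n∈ = trans (Fp (there n∈)) (cong (λ z → κ * (b * z)) (trans (pathVec-tail {p = p} (λ q → ∉-unique uq (subst (_∈ p) q n∈))) (cong (b *_) (pathVec-next (AllPairs.tail uq) (e∉ ∘ there ∘ there)))))
      Fn | inj₁ q = trans (cong F q) (trans Fe (sym (trans (cong (λ z → κ * (b * (b * z))) (short p q (e∉ ∘ there ∘ there))) (lem′ κ b))))
        where
        short : ∀ p → next p e ≡ e → e ∉ p → s (length p) ≡ + 0
        short [] _ _ = refl
        short (z ∷ p) refl n = contradiction (here refl) n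
        opaque
          unfolding _+_ 0≟
          lem′ : ∀ k b → k * (b * (b * + 0)) ≡ + 0
          lem′ = solve-∀ ring
      opaque
        unfolding _+_ 0≟
        lem : ∀ a b k s₁ s₀ → a * (k * (b * s₁)) - b * (k * (a * s₁ - b * b * s₀) + k * (b * (b * s₀))) ≡ + 0
        lem = solve-∀ ring
    pathVec-harmonic F κ u (x ∷ p) e (nb , path) (_ ∷ uq) e∉ Fu Fe Fp y (there y∈) =
      pathVec-harmonic F (κ * b) x p e path uq (e∉ ∘ there)
        (trans (Fp (here refl)) (trans (cong (λ z → κ * (b * z)) (pathVec-head (∉-unique uq))) (sym (*-assoc κ b _)))) Fe
        (λ {z} z∈ → trans (Fp (there z∈)) (trans (cong (λ t → κ * (b * t)) (pathVec-tail {p = p} (λ q → ∉-unique uq (subst (_∈ p) q z∈)))) (sym (*-assoc κ b _)))) y y∈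

    -- A combination of the two fundamental solutions of the recurrence on the positions 0, ..., r +
    -- 1 of a closed petal. It is symmetric and equals s_(r+1) at both ends, where the centre sits.
    cycleSeq : ℕ → ℕ → ℤ
    cycleSeq r j = pow b j * s (suc r ∸ j) + pow b (suc r ∸ j) * s j

    cycleSeq-rec : ∀ r i → i ℕ.< r → a * cycleSeq r (1 ℕ.+ i) ≡ b * (cycleSeq r i + cycleSeq r (2 ℕ.+ i))
    cycleSeq-rec r i lt with ℕ.m≤n⇒∃[o]m+o≡n lt
    ... | t , refl rewrite trans (cong (_∸ i) (trans (cong suc (sym (ℕ.+-suc i t))) (sym (ℕ.+-suc i (suc t))))) (ℕ.m+n∸m≡n i (suc (suc t)))
        | trans (cong (_∸ i) (sym (ℕ.+-suc i t))) (ℕ.m+n∸m≡n i (suc t)) | ℕ.m+n∸m≡n i t =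
      lem a b (pow b i) (pow b t) (s (suc t)) (s t) (s (suc i)) (s i)
      where
      opaque
        unfolding _+_ 0≟
        lem : ∀ a b p q t₁ t₀ i₁ i₀ → a * (b * p * t₁ + b * q * i₁) ≡
          b * ((p * (a * t₁ - b * b * t₀) + b * (b * q) * i₀) + (b * (b * p) * t₀ + q * (a * i₁ - b * b * i₀)))
        lem = solve-∀ ring

    -- `Πs` will be the determinant of the rose without its centre, and `Ws` the sum of `centreVec`
    -- over the neighbours of the centre.
    Πs Ws : List ℕ → ℤ
    Πs [] = + 1
    Πs (r ∷ rs) = s (suc r) * Πs rs
    Ws [] = + 0
    Ws (r ∷ rs) = s (suc r) * Ws rs + Πs rs * (+ 2 * (b * s r + pow b r))

    along-assign : ∀ (F : Fin (size G) → ℤ) κ g u p e → F u ≡ κ * g 0 → F e ≡ κ * g (suc (length p)) →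
      (∀ {x} → x ∈ p → F x ≡ κ * assign (g ∘ suc) p x) → Unique p → Along F (λ i → κ * g i) u p e
    along-assign F κ g u [] e Fu Fe Fp uq = Fu , Fe
    along-assign F κ g u (x ∷ p) e Fu Fe Fp uq@(_ ∷ uq′) = Fu , along-assign F κ (g ∘ suc) x p e
      (trans (Fp (here refl)) (cong (κ *_) (assign-head (g ∘ suc) {p = p} (∉-unique uq)))) Fe
      (λ {y} y∈ → trans (Fp (there y∈)) (cong (κ *_) (assign-tail (g ∘ suc) {p = p} λ { refl → ∉-unique uq y∈ }))) uq′

    module Centre (c : Fin (size G)) where

      -- Inner vertices of the path have both their neighbours on it, so only the two ends can see
      -- the centre: the last one always, the first one when `u` is the centre.
      weighted-nbrs : ∀ g u x p → Path G u (x ∷ p) c → c ∉ x ∷ p → weighted g (A G c) (x ∷ p) ≡ g 0 * δ u c + g (length p)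
      weighted-nbrs g u x [] (nb , _) c∉ = trans (cong (λ z → g 0 * z + + 0) (trans (A-sym G c x) (trans (nb c) (cong (λ z → δ u c + (z + + 0)) (δ-refl c))))) (lem (g 0) (δ u c))
        where
        opaque
          unfolding _+_ 0≟
          lem : ∀ g d → g * (d + (+ 1 + + 0)) + + 0 ≡ g * d + g
          lem = solve-∀ ring
      weighted-nbrs g u x (y ∷ p) (nb , path) c∉ = trans
        (cong₂ (λ z t → g 0 * z + t)
          (trans (A-sym G c x) (trans (nb c) (cong (λ z → δ u c + (z + + 0)) (δ-≢ λ { refl → c∉ (there (here refl)) }))))
          (trans (weighted-nbrs (g ∘ suc) x y p path (c∉ ∘ there)) (cong (λ z → g 1 * z + g (suc (length p))) (δ-≢ λ { refl → c∉ (here refl) }))))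
        (lem (g 0) (δ u c) (g 1) _)
        where
        opaque
          unfolding _+_ 0≟
          lem : ∀ g d h l → g * (d + (+ 0 + + 0)) + (h * + 0 + l) ≡ g * d + l
          lem = solve-∀ ring

      Petal : List (Fin (size G)) → Set
      Petal p = Path G c p c × 2 ℕ.≤ length p

      petal-weight : ∀ g p → Petal p → c ∉ p → weighted g (A G c) p ≡ g 0 + g (length p ∸ 1)
      petal-weight g (x ∷ p) (path , _) c∉ = trans (weighted-nbrs g c x p path c∉) (cong (λ z → z + g (length p)) (trans (cong (g 0 *_) (δ-refl c)) (*-identityʳ _)))

      -- A vector annihilated by the pencil at every vertex of the petals, with value `Πs` at the
      -- centre; this scaling keeps it integral.
      centreVec : List (List (Fin (size G))) → Fin (size G) → ℤ
      centreVec [] v = δ c v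
      centreVec (p ∷ ps) v = s (suc (length p)) * centreVec ps v + Πs (map length ps) * assign (cycleSeq (length p) ∘ suc) p v

      unique-++ : ∀ (p : List (Fin (size G))) {q} → Unique (p ++ q) → Unique p × Unique q × (∀ {v} → v ∈ p → v ∈ q → ⊥)
      unique-++ [] u = [] , u , λ ()
      unique-++ (x ∷ p) {q} u@(a ∷ u′) with unique-++ p u′
      ... | up , uq , d = (All.tabulate λ y∈ → All.lookup a (∈-++⁺ˡ y∈)) ∷ up , uq ,
        λ { (here refl) w → ∉-unique u (∈-++⁺ʳ p w) ; (there v) w → d v w }

      centreVec-∉ : ∀ ps {v} → v ≢ c → v ∉ concat ps → centreVec ps v ≡ + 0
      centreVec-∉ [] ne _ = δ-≢ (ne ∘ sym)
      centreVec-∉ (p ∷ ps) ne v∉ = trans (cong₂ (λ y z → s (suc (length p)) * y + Πs (map length ps) * z)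
        (centreVec-∉ ps ne (v∉ ∘ ∈-++⁺ʳ p)) (assign-∉ _ {p} (v∉ ∘ ∈-++⁺ˡ))) (lem _ _)
        where
        opaque
          unfolding _+_ 0≟
          lem : ∀ a b → a * + 0 + b * + 0 ≡ + 0
          lem = solve-∀ ring

      centreVec-off : ∀ p ps {v} → v ∉ p → centreVec (p ∷ ps) v ≡ s (suc (length p)) * centreVec ps v
      centreVec-off p ps {v} v∉ = trans (cong (λ z → s (suc (length p)) * centreVec ps v + Πs (map length ps) * z) (assign-∉ _ {p} v∉))
        (trans (cong (_+_ _) (zeroʳ _)) (+-identityʳ _))

      centreVec-centre : ∀ ps → c ∉ concat ps → centreVec ps c ≡ Πs (map length ps)
      centreVec-centre [] _ = δ-refl c
      centreVec-centre (p ∷ ps) c∉ = trans (centreVec-off p ps (c∉ ∘ ∈-++⁺ˡ)) (cong (s (suc (length p)) *_) (centreVec-centre ps (c∉ ∘ ∈-++⁺ʳ p)))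

      cycleSeq-ends : ∀ r → cycleSeq r 0 ≡ s (suc r) × cycleSeq r (suc r) ≡ s (suc r)
      cycleSeq-ends r = lem₁ _ _ , trans (cong (λ z → pow b (suc r) * s z + pow b z * s (suc r)) (ℕ.n∸n≡0 (suc r))) (lem₂ _ _)
        where
        opaque
          unfolding _+_ 0≟
          lem₁ : ∀ x y → + 1 * x + y * + 0 ≡ x
          lem₁ = solve-∀ ring
          lem₂ : ∀ x y → y * + 0 + + 1 * x ≡ x
          lem₂ = solve-∀ ring

      centreVec-along : ∀ ps → Unique (c ∷ concat ps) →
        All (λ p → Σ ℤ λ κ → Along (centreVec ps) (λ i → κ * cycleSeq (length p) i) c p c) ps
      centreVec-along [] _ = []
      centreVec-along (p ∷ ps) uq@(cs ∷ u) with unique-++ p u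
      ... | up , uc , disj = (Π , along-assign F Π (cycleSeq (length p)) c p c
            (trans Fc (cong (Π *_) (sym (proj₁ (cycleSeq-ends (length p)))))) (trans Fc (cong (Π *_) (sym (proj₂ (cycleSeq-ends (length p))))))
            (λ {x} x∈ → trans (cong (λ z → s (suc (length p)) * z + Π * assign (cycleSeq (length p) ∘ suc) p x)
               (centreVec-∉ ps (λ { refl → c∉ (∈-++⁺ˡ x∈) }) (disj x∈))) (zero-+ (zeroʳ _))) up)
          ∷ All.tabulate λ {p′} p′∈ → let κ , al = All.lookup (centreVec-along ps (unique-rest uq)) p′∈ in
              s (suc (length p)) * κ , along-cong (s (suc (length p)) *_) (λ i → *-assoc _ κ _) (centreVec-off p ps (c∉ ∘ ∈-++⁺ˡ))
                (λ x∈ → centreVec-off p ps λ x∈p → disj x∈p (∈-concat⁺′ x∈ p′∈)) (centreVec-off p ps (c∉ ∘ ∈-++⁺ˡ)) al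
        where
        Π = Πs (map length ps)
        F = centreVec (p ∷ ps)
        c∉ = ∉-unique uq
        Fc : F c ≡ Π * s (suc (length p))
        Fc = trans (centreVec-off p ps (c∉ ∘ ∈-++⁺ˡ)) (trans (cong (s (suc (length p)) *_) (centreVec-centre ps (c∉ ∘ ∈-++⁺ʳ p))) (*-comm _ _))
        unique-rest : Unique (c ∷ (p ++ concat ps)) → Unique (c ∷ concat ps)
        unique-rest (cs ∷ _) = (All.tabulate λ y∈ → All.lookup cs (∈-++⁺ʳ p y∈)) ∷ uc

      centreVec-weight : ∀ ps → All Petal ps → c ∉ concat ps → sum (λ j → A G c j * centreVec ps j) ≡ Ws (map length ps)
      centreVec-weight [] [] _ = trans (sum-cong λ j → *-comm _ _) (trans (sum-δ c (A G c)) (A-irrefl G c))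
      centreVec-weight (p ∷ ps) (pt ∷ pts) c∉ = trans (sum-cong λ j → lem (A G c j) _ (centreVec ps j) Π (assign g p j))
        (trans (sum-linear _ Π _ _) (cong₂ (λ y z → s (suc (length p)) * y + Π * z) (centreVec-weight ps pts (c∉ ∘ ∈-++⁺ʳ p))
          (trans (sum-assign (A G c) g p) (trans (petal-weight g p pt (c∉ ∘ ∈-++⁺ˡ)) (ends (length p) (ℕ.≤-trans (ℕ.s≤s ℕ.z≤n) (proj₂ pt)))))))
        where
        Π = Πs (map length ps)
        g = cycleSeq (length p) ∘ suc
        opaque
          unfolding _+_ 0≟
          lem : ∀ a s v p y → a * (s * v + p * y) ≡ s * (a * v) + p * (a * y)
          lem = solve-∀ ring
          lem₂ : ∀ b s q → (b * + 1 * s + q * + 1) + (q * + 1 + b * + 1 * s) ≡ + 2 * (b * s + q)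
          lem₂ = solve-∀ ring
        ends : ∀ r → 1 ℕ.≤ r → cycleSeq r 1 + cycleSeq r (suc (r ∸ 1)) ≡ + 2 * (b * s r + pow b r)
        ends (suc r) _ = trans (cong (λ z → cycleSeq (suc r) 1 + (pow b (suc r) * s z + pow b z * s (suc r))) (trans (cong (_∸ r) (ℕ.+-comm 1 r)) (ℕ.m+n∸m≡n r 1)))
          (lem₂ b (s (suc r)) (pow b (suc r)))

      concat-closed : ∀ ps → All Petal ps → ∀ {y v} → y ∈ concat ps → adj G y v ≡ true → v ≡ c ⊎ v ∈ concat ps
      concat-closed (p ∷ ps) ((path , _) ∷ pts) {y} {v} y∈ e with ∈-++⁻ p y∈
      ... | inj₂ y∈ps = case (concat-closed ps pts y∈ps e)
        where
        case : v ≡ c ⊎ v ∈ concat ps → v ≡ c ⊎ v ∈ p ++ concat ps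
        case (inj₁ q) = inj₁ q
        case (inj₂ q) = inj₂ (∈-++⁺ʳ p q)
      ... | inj₁ y∈p = case (go c p path y∈p)
        where
        go : ∀ u p → Path G u p c → y ∈ p → v ≡ u ⊎ v ≡ c ⊎ v ∈ p
        go u (x ∷ p) (nb , path) (here refl) with nbrs-elim {G} {ys = u ∷ next p c ∷ []} nb e
        ... | here q = inj₁ q
        ... | there (here q) with next∈ p c
        ...   | inj₁ w = inj₂ (inj₁ (trans q w))
        ...   | inj₂ w = inj₂ (inj₂ (there (subst (_∈ p) (sym q) w)))
        go u (x ∷ p) (nb , path) (there y∈) with go x p path y∈
        ... | inj₁ q = inj₂ (inj₂ (here q))
        ... | inj₂ (inj₁ q) = inj₂ (inj₁ q)
        ... | inj₂ (inj₂ q) = inj₂ (inj₂ (there q))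
        case : v ≡ c ⊎ v ≡ c ⊎ v ∈ p → v ≡ c ⊎ v ∈ p ++ concat ps
        case (inj₁ q) = inj₁ q
        case (inj₂ (inj₁ q)) = inj₁ q
        case (inj₂ (inj₂ q)) = inj₂ (∈-++⁺ˡ q)

      petals-degree : ∀ ps → All Petal ps → c ∉ concat ps → listSum (A G c) (concat ps) ≡ + (2 ℕ.* length ps)
      petals-degree [] [] _ = refl
      petals-degree (p ∷ ps) (pt ∷ pts) c∉ = trans (listSum-++ p (concat ps)) (trans (cong₂ _+_
          (trans (listSum-weighted p) (trans (petal-weight (λ _ → + 1) p pt (c∉ ∘ ∈-++⁺ˡ)) (sym (pos-+ 1 1)))) (petals-degree ps pts (c∉ ∘ ∈-++⁺ʳ p)))
        (trans (sym (pos-+ 2 (2 ℕ.* length ps))) (cong +_ (sym (ℕ.*-suc 2 (length ps))))))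
        where
        listSum-++ : ∀ xs ys → listSum (A G c) (xs ++ ys) ≡ listSum (A G c) xs + listSum (A G c) ys
        listSum-++ [] ys = sym (+-identityˡ _)
        listSum-++ (x ∷ xs) ys = trans (cong (_+_ _) (listSum-++ xs ys)) (sym (+-assoc _ _ _))
        listSum-weighted : ∀ xs → listSum (A G c) xs ≡ weighted (λ _ → + 1) (A G c) xs
        listSum-weighted [] = refl
        listSum-weighted (x ∷ xs) = cong₂ _+_ (sym (*-identityˡ _)) (listSum-weighted xs)

    module _ (s≢0 : ∀ l → s (suc l) ≢ + 0) where

      -- Vertices are eliminated from the front by means of `pathVec`. Each step cancels the
      -- determinant of the shorter path, whence the assumption that these do not vanish. By `sep`
      -- the remaining vertices do not meet the path, so the vector is harmonic there trivially.
      path-det : ∀ u p c rest → Path G u p c → Unique (u ∷ p) → Unique (p ++ rest) → c ∉ p → u ∉ rest → c ∉ rest →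
        (∀ {y v} → y ∈ rest → adj G y v ≡ true → v ∉ p) →
        detℤ (restrict M (p ++ rest)) ≡ s (suc (length p)) * detℤ (restrict M rest)
      path-det u [] c rest _ _ _ _ _ _ _ = sym (*-identityˡ _)
      path-det u (x ∷ p) c rest (nb , path) uq@(_ ∷ uq′) uqr@(_ ∷ uqr′) c∉ u∉r c∉r sep =
        *-cancelˡ (s (suc (length p))) (s≢0 (length p)) (begin
          s (suc (length p)) * detℤ (restrict M (x ∷ p ++ rest)) ≡⟨ *-comm _ _ ⟩
          detℤ (restrict M (x ∷ p ++ rest)) * s (suc (length p)) ≡⟨ cong (detℤ (restrict M (x ∷ p ++ rest)) *_) (sym Fx) ⟩
          detℤ (restrict M (x ∷ p ++ rest)) * F x ≡⟨ eliminate M x (p ++ rest) F (∉-unique uqr) supp harm ⟩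
          (M · F) x * detℤ (restrict M (p ++ rest)) ≡⟨ cong₂ _*_ row (path-det x p c rest path uq′ uqr′ (c∉ ∘ there) (∉-unique uqr ∘ ∈-++⁺ʳ p) c∉r (λ y∈ e → sep y∈ e ∘ there)) ⟩
          s (suc (suc (length p))) * (s (suc (length p)) * detℤ (restrict M rest)) ≡⟨ lem (s (suc (suc (length p)))) _ _ ⟩
          s (suc (length p)) * (s (suc (suc (length p))) * detℤ (restrict M rest)) ∎)
        where
        open ≡-Reasoning
        F = pathVec (x ∷ p)
        opaque
          unfolding _+_ 0≟
          lem : ∀ a b c → a * (b * c) ≡ b * (a * c)
          lem = solve-∀ ring
          lem₂ : ∀ a b s₁ s₀ → a * s₁ - b * (+ 0 + b * s₀) ≡ a * s₁ - b * b * s₀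
          lem₂ = solve-∀ ring
        Fx : F x ≡ s (suc (length p))
        Fx = pathVec-head (∉-unique uq′)
        supp : ∀ v → v ∉ x ∷ p ++ rest → F v ≡ + 0
        supp v v∉ = pathVec-∉ {x ∷ p} λ { (here e) → v∉ (here e) ; (there q) → v∉ (there (∈-++⁺ˡ q)) }
        Fn : F (next p c) ≡ b * s (length p)
        Fn = trans (pathVec-tail {p = p} (λ q → next≢ (next∈ p c) q)) (cong (b *_) (pathVec-next (AllPairs.tail uq′) (c∉ ∘ there)))
          where
          next≢ : next p c ≡ c ⊎ next p c ∈ p → next p c ≢ x
          next≢ (inj₁ e) q = c∉ (here (trans (sym e) q))
          next≢ (inj₂ n∈) q = ∉-unique uq′ (subst (_∈ p) q n∈)
        row : (M · F) x ≡ s (suc (suc (length p)))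
        row = trans (path-row F nb) (trans (cong₂ (λ z t → a * z - b * t) Fx (cong₂ _+_ (pathVec-∉ (∉-unique uq)) Fn)) (lem₂ a b _ _))
        harm : ∀ y → y ∈ p ++ rest → (M · F) y ≡ + 0
        harm y y∈ with ∈-++⁻ p y∈
        ... | inj₁ y∈p = pathVec-harmonic F (+ 1) x p c path uq′ c∉ (trans Fx (sym (*-identityˡ _))) (pathVec-∉ c∉)
                (λ z∈ → trans (pathVec-tail {p = p} (λ q → ∉-unique uq′ (subst (_∈ p) q z∈))) (sym (*-identityˡ _))) y y∈p
        ... | inj₂ y∈r = trans (pencil-row F y) (trans (cong₂ (λ z t → (a + b * excess G y) * z - b * t) F-y
                (sum-zero term)) (lem₃ _ b))
          where
          opaque
            unfolding _+_ 0≟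
            lem₃ : ∀ z b → z * + 0 - b * + 0 ≡ + 0
            lem₃ = solve-∀ ring
          y∉ : y ∉ x ∷ p
          y∉ (here refl) = ∉-unique uqr (∈-++⁺ʳ p y∈r)
          y∉ (there q) = disjoint p uqr′ q y∈r
            where
            disjoint : ∀ p → Unique (p ++ rest) → ∀ {v} → v ∈ p → v ∈ rest → ⊥
            disjoint (_ ∷ p) u (here refl) w = ∉-unique u (∈-++⁺ʳ p w)
            disjoint (_ ∷ p) (_ ∷ u) (there q) w = disjoint p u q w
          F-y : F y ≡ + 0
          F-y = pathVec-∉ y∉
          term : ∀ j → A G y j * F j ≡ + 0
          term j with adj G y j in e
          ... | true = trans (*-identityˡ _) (pathVec-∉ (sep y∈r e))
          ... | false = zeroˡ _

      module _ {k} (P : Petals G k) where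
        open Petals P
        open Centre centre

        private
          lens = map length petals
          pts : All Petal petals
          pts = All.zip (paths , long)
          uq : Unique (centre ∷ concat petals)
          uq = Unique-resp-↭ (↭-sym cover) (allFin⁺ (size G))
          all∈ : ∀ v → v ∈ centre ∷ concat petals
          all∈ v = ∈-resp-↭ (↭-sym cover) (∈-allFin v)

        petals-det : ∀ ps → All Petal ps → Unique (centre ∷ concat ps) → detℤ (restrict M (concat ps)) ≡ Πs (map length ps)
        petals-det [] _ _ = trans (detℤ-cong {size G} (λ i j → restrict-outˡ M λ ())) (detℤ-δ (size G))
        petals-det (p ∷ ps) (pt ∷ pts) u@(cs ∷ u′) with unique-++ p u′
        ... | up , uc , disj = trans
          (path-det centre p centre (concat ps) (proj₁ pt) ((All.tabulate λ y∈ → All.lookup cs (∈-++⁺ˡ y∈)) ∷ up) u′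
            (∉-unique u ∘ ∈-++⁺ˡ) (∉-unique u ∘ ∈-++⁺ʳ p) (∉-unique u ∘ ∈-++⁺ʳ p) sep)
          (cong (s (suc (length p)) *_) (petals-det ps pts ((All.tabulate λ y∈ → All.lookup cs (∈-++⁺ʳ p y∈)) ∷ uc)))
          where
          sep : ∀ {y v} → y ∈ concat ps → adj G y v ≡ true → v ∉ p
          sep y∈ e v∈ with concat-closed ps pts y∈ e
          ... | inj₁ refl = ∉-unique u (∈-++⁺ˡ v∈)
          ... | inj₂ w = disj v∈ w

        Πs≢0 : ∀ rs → Πs rs ≢ + 0
        Πs≢0 [] ()
        Πs≢0 (r ∷ rs) e = Πs≢0 rs (*-cancelˡ (s (suc r)) (s≢0 r) (trans e (sym (zeroʳ _))))

        -- Both sides count the edges at the centre, two for each petal.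
        number-of-petals : length petals ≡ k
        number-of-petals = ℕ.*-cancelˡ-≡ (length petals) k 2 (ℤ.+-injective (begin
          + (2 ℕ.* length petals) ≡⟨ sym (petals-degree petals pts (∉-unique uq)) ⟩
          listSum (A G centre) (concat petals) ≡⟨ sym (zero-+ (A-irrefl G centre)) ⟩
          listSum (A G centre) (centre ∷ concat petals) ≡⟨ sym (sum-mult (centre ∷ concat petals) (A G centre)) ⟩
          sum (λ i → mult (centre ∷ concat petals) i * A G centre i) ≡⟨ sum-cong (λ i → trans (cong (_* A G centre i) (mult-∈ uq (all∈ i))) (*-identityˡ _)) ⟩
          sum (A G centre) ≡⟨ sym (degree-sum G centre) ⟩
          + degree G centre ≡⟨ cong +_ degree-centre ⟩
          + (2 ℕ.* k) ∎))
          where open ≡-Reasoning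

        -- Eliminating the centre with `centreVec` leaves the determinant of the petals, which
        -- equals the value of that vector at the centre, and so cancels.
        rose-det : D a b G ≡ (a + b * (+ (2 ℕ.* k) - + 2)) * Πs lens - b * Ws lens
        rose-det = *-cancelˡ (Πs lens) (Πs≢0 lens) (begin
          Πs lens * D a b G ≡⟨ *-comm _ _ ⟩
          D a b G * Πs lens ≡⟨ cong₂ _*_ (detℤ-cong {size G} λ i j → sym (restrict-in M (all∈ i) (all∈ j))) (sym F-centre) ⟩
          detℤ (restrict M (centre ∷ concat petals)) * F centre ≡⟨ eliminate M centre (concat petals) F (∉-unique uq) (λ u u∉ → contradiction (all∈ u) u∉) harm ⟩
          (M · F) centre * detℤ (restrict M (concat petals)) ≡⟨ cong₂ _*_ row (petals-det petals pts uq) ⟩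
          ((a + b * (+ (2 ℕ.* k) - + 2)) * Πs lens - b * Ws lens) * Πs lens ≡⟨ *-comm _ _ ⟩
          Πs lens * ((a + b * (+ (2 ℕ.* k) - + 2)) * Πs lens - b * Ws lens) ∎)
          where
          open ≡-Reasoning
          F = centreVec petals
          F-centre : F centre ≡ Πs lens
          F-centre = centreVec-centre petals (∉-unique uq)
          row : (M · F) centre ≡ (a + b * (+ (2 ℕ.* k) - + 2)) * Πs lens - b * Ws lens
          row = trans (pencil-row F centre) (cong₂ (λ y z → y - b * z)
            (cong₂ (λ d f → (a + b * (+ d - + 2)) * f) degree-centre F-centre) (centreVec-weight petals pts (∉-unique uq)))
          harm : ∀ y → y ∈ concat petals → (M · F) y ≡ + 0
          harm y y∈ with ∈-concat⁻′ petals y∈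
          ... | p , y∈p , p∈ with All.lookup (centreVec-along petals uq) p∈
          ...   | κ , al = harmonic F (λ i → κ * cycleSeq (length p) i) centre p centre (All.lookup paths p∈) al
                    (λ i lt → trans (lem a κ _) (trans (cong (κ *_) (cycleSeq-rec (length p) i lt)) (lem₂ b κ _ _))) y y∈p
            where
            opaque
              unfolding _+_ 0≟
              lem : ∀ a k g → a * (k * g) ≡ k * (a * g)
              lem = solve-∀ ring
              lem₂ : ∀ b k g h → k * (b * (g + h)) ≡ b * (k * g + k * h)
              lem₂ = solve-∀ ring

-- Recovering the cycle lengths from the determinant.

module CycleLengths where
  open Integers
  open Determinants
  open Pencils
  open PetalDecomposition
  open RoseDeterminant

  open ≡-Reasoning using (begin_; step-≡-⟩; _∎)

  cnt : ℕ → List ℕ → ℕ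
  cnt m [] = 0
  cnt m (l ∷ ls) with l ℕ.≟ m
  ... | yes _ = suc (cnt m ls)
  ... | no _ = cnt m ls

  cnt-∈ : ∀ {m ls} → m ∈ ls → cnt m ls ≢ 0
  cnt-∈ {m} {l ∷ ls} p with l ℕ.≟ m
  cnt-∈ {m} {l ∷ ls} p | yes _ = λ ()
  cnt-∈ {m} {l ∷ ls} (here refl) | no n = contradiction refl n
  cnt-∈ {m} {l ∷ ls} (there p) | no _ = cnt-∈ p

  ∈-cnt : ∀ {m} ls → cnt m ls ≢ 0 → m ∈ ls
  ∈-cnt [] p = contradiction refl p
  ∈-cnt {m} (l ∷ ls) p with l ℕ.≟ m
  ... | yes e = here (sym e)
  ... | no _ = there (∈-cnt ls p)

  module Ψ (q : ℤ) where
    Q : ℕ → ℤ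
    Q = pow q

    -- What `Πs` and `Ws` become at a = 1 + q², b = q once powers of 1 - q² are cleared; the exact
    -- relations are `Πs-closed` and `Ws-closed`.
    Πa Σa : List ℕ → ℤ
    Πa [] = + 1
    Πa (l ∷ ls) = (+ 1 - Q l * Q l) * Πa ls
    Σa [] = + 0
    Σa (l ∷ ls) = (+ 1 - Q l * Q l) * Σa ls + Q l * (+ 1 - Q l) * Πa ls

    Ψ : ℤ → ℤ → List ℕ → ℤ
    Ψ α γ ls = α * Πa ls - γ * Σa ls

    Πa-↭ : ∀ {ls ls′} → ls ↭ ls′ → Πa ls ≡ Πa ls′
    Πa-↭ Perm.refl = refl
    Πa-↭ (prep x p) = cong (_*_ _) (Πa-↭ p)
    Πa-↭ (swap x y p) = trans (cong (λ z → _ * (_ * z)) (Πa-↭ p)) (lem _ _ _)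
      where
      opaque
        unfolding _+_ 0≟
        lem : ∀ a b c → a * (b * c) ≡ b * (a * c)
        lem = solve-∀ ring
    Πa-↭ (Perm.trans p p′) = trans (Πa-↭ p) (Πa-↭ p′)

    Σa-↭ : ∀ {ls ls′} → ls ↭ ls′ → Σa ls ≡ Σa ls′
    Σa-↭ Perm.refl = refl
    Σa-↭ (prep x p) = cong₂ (λ y z → (+ 1 - Q x * Q x) * y + Q x * (+ 1 - Q x) * z) (Σa-↭ p) (Πa-↭ p)
    Σa-↭ (swap x y p) = trans (lem (+ 1 - Q x * Q x) (+ 1 - Q y * Q y) (Q x * (+ 1 - Q x)) (Q y * (+ 1 - Q y)) _ _)
      (cong₂ (λ v w → (+ 1 - Q y * Q y) * ((+ 1 - Q x * Q x) * v + Q x * (+ 1 - Q x) * w) + Q y * (+ 1 - Q y) * ((+ 1 - Q x * Q x) * w)) (Σa-↭ p) (Πa-↭ p))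
      where
      opaque
        unfolding _+_ 0≟
        lem : ∀ x y x′ y′ s p → x * (y * s + y′ * p) + x′ * (y * p) ≡ y * (x * s + x′ * p) + y′ * (x * p)
        lem = solve-∀ ring
    Σa-↭ (Perm.trans p p′) = trans (Σa-↭ p) (Σa-↭ p′)

    Ψ-↭ : ∀ α γ {ls ls′} → ls ↭ ls′ → Ψ α γ ls ≡ Ψ α γ ls′
    Ψ-↭ α γ p = cong₂ (λ x y → α * x - γ * y) (Πa-↭ p) (Σa-↭ p)

    -- Taking out one length preserves the shape of `Ψ` and changes only its two coefficients. This
    -- is why α and γ are free, and may vary with q, in the induction below.
    Ψ-remove : ∀ α γ l ls → Ψ α γ (l ∷ ls) ≡ (+ 1 - Q l) * Ψ (α * (+ 1 + Q l) - γ * Q l) (γ * (+ 1 + Q l)) ls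
    Ψ-remove α γ l ls = lem α γ (Q l) (Πa ls) (Σa ls)
      where
      opaque
        unfolding _+_ 0≟
        lem : ∀ α γ Q p s → α * ((+ 1 - Q * Q) * p) - γ * ((+ 1 - Q * Q) * s + Q * (+ 1 - Q) * p) ≡
          (+ 1 - Q) * ((α * (+ 1 + Q) - γ * Q) * p - γ * (+ 1 + Q) * s)
        lem = solve-∀ ring

    pow-+ : ∀ m n → Q (m ℕ.+ n) ≡ Q m * Q n
    pow-+ zero n = sym (*-identityˡ _)
    pow-+ (suc m) n = trans (cong (q *_) (pow-+ m n)) (sym (*-assoc q _ _))

    Q-high : ∀ {m l} → m ℕ.≤ l → Q l ≈ + 0 mod (Q m)
    Q-high {m} m≤l with ℕ.m≤n⇒∃[o]m+o≡n m≤l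
    ... | o , refl = mod (Q o) (trans (pow-+ m o) (trans (*-comm _ _) (sym (+-identityˡ _))))

    square-high : ∀ m {l} → suc m ℕ.≤ l → Q l * Q l ≈ + 0 mod (Q (suc (suc m)))
    square-high m {l} le = mod-trans (mod-refl (sym (pow-+ l l)))
      (Q-high (ℕ.≤-trans (ℕ.s≤s (ℕ.m≤n+m (suc m) m)) (ℕ.+-mono-≤ le le)))

    Πa-low : ∀ m ls → All (suc m ℕ.≤_) ls → Πa ls ≈ + 1 mod (Q (suc (suc m)))
    Πa-low m [] [] = mod-refl refl
    Πa-low m (l ∷ ls) (p ∷ ps) = mod-trans (mod-* (mod-- (mod-refl refl) (square-high m p)) (Πa-low m ls ps)) (mod-refl lem)
      where
      opaque
        unfolding _+_
        lem : (+ 1 - + 0) * + 1 ≡ + 1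
        lem = refl

    Σa-low : ∀ m ls → All (suc m ℕ.≤_) ls → Σa ls ≈ + cnt (suc m) ls * Q (suc m) mod (Q (suc (suc m)))
    Σa-low m [] [] = mod-refl (sym (zeroˡ _))
    Σa-low m (l ∷ ls) (p ∷ ps) = mod-trans (mod-+ (mod-* (mod-- (mod-refl {a = + 1} refl) (square-high m p)) (Σa-low m ls ps))
        (mod-* (mod-trans (mod-refl (lem₀ (Q l))) (mod-- (mod-refl {a = Q l} refl) (square-high m p))) (Πa-low m ls ps)))
      (top (l ℕ.≟ suc m))
      where
      opaque
        unfolding _+_ 0≟
        lem₀ : ∀ Q → Q * (+ 1 - Q) ≡ Q - Q * Q
        lem₀ = solve-∀ ring
        lem₁ : ∀ c Q → (+ 1 - + 0) * (c * Q) + (Q - + 0) * + 1 ≡ (+ 1 + c) * Q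
        lem₁ = solve-∀ ring
        lem₂ : ∀ c Q → (+ 1 - + 0) * (c * Q) + (+ 0 - + 0) * + 1 ≡ c * Q
        lem₂ = solve-∀ ring
      cnt-yes : cnt (suc m) (suc m ∷ ls) ≡ suc (cnt (suc m) ls)
      cnt-yes with suc m ℕ.≟ suc m
      ... | yes _ = refl
      ... | no n = contradiction refl n
      cnt-no : l ≢ suc m → cnt (suc m) (l ∷ ls) ≡ cnt (suc m) ls
      cnt-no n with l ℕ.≟ suc m
      ... | yes e = contradiction e n
      ... | no _ = refl
      top : Dec (l ≡ suc m) → (+ 1 - + 0) * (+ cnt (suc m) ls * Q (suc m)) + (Q l - + 0) * + 1 ≈ + cnt (suc m) (l ∷ ls) * Q (suc m) mod (Q (suc (suc m)))
      top (yes refl) = mod-refl (trans (lem₁ (+ cnt (suc m) ls) (Q (suc m))) (cong (_* Q (suc m)) (trans (sym (pos-+ 1 (cnt (suc m) ls))) (cong +_ (sym cnt-yes)))))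
      top (no n) = mod-trans (mod-+ (mod-refl {a = (+ 1 - + 0) * (+ cnt (suc m) ls * Q (suc m))} refl) (mod-* (mod-- (Q-high (ℕ.≤∧≢⇒< p (n ∘ sym))) (mod-refl {a = + 0} refl)) (mod-refl {a = + 1} refl)))
        (mod-refl (trans (lem₂ (+ cnt (suc m) ls) (Q (suc m))) (cong (λ c → + c * Q (suc m)) (sym (cnt-no n)))))

    -- Squares q^(2l) with l >= m + 1 vanish modulo q^(m+2), and so do the powers q^l with l > m +
    -- 1; only lengths equal to m + 1 leave a trace.
    Ψ-low : ∀ α γ m ls → All (suc m ℕ.≤_) ls → Ψ α γ ls ≈ α - γ * (+ cnt (suc m) ls * Q (suc m)) mod (Q (suc (suc m)))
    Ψ-low α γ m ls ps = mod-trans (mod-- (mod-* (mod-refl {a = α} refl) (Πa-low m ls ps)) (mod-* (mod-refl {a = γ} refl) (Σa-low m ls ps)))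
      (mod-refl (cong (λ z → z - γ * (+ cnt (suc m) ls * Q (suc m))) (*-identityʳ α)))

  base : ℕ → ℤ
  base t = + suc (suc t)

  base-1 : ∀ t {z} → z ≈ + 1 mod (base t) → z ≢ + 0
  base-1 t p refl = contradiction (mod-small p (ℕ.s≤s ℕ.z≤n) (ℕ.s≤s (ℕ.s≤s ℕ.z≤n))) λ ()

  pow≢0 : ∀ t l → pow (base t) l ≢ + 0
  pow≢0 t zero ()
  pow≢0 t (suc l) e = pow≢0 t l (*-cancelˡ (base t) (λ ()) (trans e (sym (zeroʳ _))))

  minimum : ∀ (l : ℕ) ls → Σ ℕ λ m → m ∈ l ∷ ls × All (m ℕ.≤_) (l ∷ ls)
  minimum l [] = l , here refl , ℕ.≤-refl ∷ []
  minimum l (l′ ∷ ls) with minimum l′ ls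
  ... | m , m∈ , ps with ℕ.≤-total l m
  ...   | inj₁ l≤m = l , here refl , ℕ.≤-refl ∷ All.map (ℕ.≤-trans l≤m) ps
  ...   | inj₂ m≤l = m , there m∈ , m≤l ∷ ps

  open Ψ using (Ψ)

  -- The multiplicity of the least length is read off from the first q-adic digit in which Ψ departs from α.
  same-cnt : ∀ (α γ : ℕ → ℤ) m ls ls′ → (∀ t → γ t ≈ + 2 mod (base t)) →
    All (suc m ℕ.≤_) ls → All (suc m ℕ.≤_) ls′ → (∀ t → Ψ (base t) (α t) (γ t) ls ≡ Ψ (base t) (α t) (γ t) ls′) →
    cnt (suc m) ls ≡ cnt (suc m) ls′
  same-cnt α γ m ls ls′ γ≈ ps ps′ eq = ℕ.*-cancelˡ-≡ c c′ 2 (mod-small small (bound (ℕ.m≤m+n c c′)) (bound (ℕ.m≤n+m c′ c)))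
    where
    c = cnt (suc m) ls
    c′ = cnt (suc m) ls′
    -- With this choice q = t + 2 exceeds both 2c and 2c′. As γ is 2 modulo q, the two digits are 2c
    -- and 2c′ themselves.
    t = 2 ℕ.* (c ℕ.+ c′)
    q = base t
    open Ψ q using (Q; Ψ-low)
    d d′ : ℤ
    d = + cnt (suc m) ls
    d′ = + cnt (suc m) ls′
    opaque
      unfolding _+_ 0≟
      lem : ∀ α γ d Q → Q * (γ * d) ≡ α - (α - γ * (d * Q))
      lem = solve-∀ ring
    digits : Q (suc m) * (γ t * d) ≈ Q (suc m) * (γ t * d′) mod (Q (suc m) * q)
    digits = subst (λ z → Q (suc m) * (γ t * d) ≈ Q (suc m) * (γ t * d′) mod z) (*-comm q _)
      (mod-trans (mod-refl (lem (α t) (γ t) d (Q (suc m)))) (mod-trans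
        (mod-- (mod-refl {a = α t} refl) (mod-trans (mod-sym (Ψ-low (α t) (γ t) m ls ps)) (mod-trans (mod-refl (eq t)) (Ψ-low (α t) (γ t) m ls′ ps′))))
        (mod-refl (sym (lem (α t) (γ t) d′ (Q (suc m)))))))
    small : + (2 ℕ.* c) ≈ + (2 ℕ.* c′) mod q
    small = mod-trans (mod-refl (pos-* 2 c)) (mod-trans (mod-* (mod-sym (γ≈ t)) (mod-refl {a = d} refl))
      (mod-trans (mod-cancelˡ (Q (suc m)) (pow≢0 t (suc m)) digits) (mod-trans (mod-* (γ≈ t) (mod-refl {a = d′} refl)) (mod-refl (sym (pos-* 2 c′))))))
    bound : ∀ {x} → x ℕ.≤ c ℕ.+ c′ → 2 ℕ.* x ℕ.< suc (suc t)
    bound le = ℕ.s≤s (ℕ.≤-trans (ℕ.*-monoʳ-≤ 2 le) (ℕ.n≤1+n _))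

  -- The least length found in either list occurs in both. It is removed from both and the factor 1
  -- - q^m is cancelled; since m >= 1, the new γ is still 2 modulo q, while nothing is ever asked of
  -- α.
  Ψ-determines : ∀ n ls ls′ → length ls ℕ.≤ n → All (1 ℕ.≤_) ls → All (1 ℕ.≤_) ls′ → (α γ : ℕ → ℤ) → (∀ t → γ t ≈ + 2 mod (base t)) →
    (∀ t → Ψ (base t) (α t) (γ t) ls ≡ Ψ (base t) (α t) (γ t) ls′) → ls ↭ ls′
  Ψ-determines n [] [] _ _ _ α γ γ≈ eq = ↭-refl
  Ψ-determines n (l ∷ ls) ls′ le ps ps′ α γ γ≈ eq = common (minimum l (ls ++ ls′))
    where
    common : (Σ ℕ λ m → m ∈ l ∷ ls ++ ls′ × All (m ℕ.≤_) (l ∷ ls ++ ls′)) → (l ∷ ls) ↭ ls′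
    common (m , m∈ , low) = peel m n (both 1≤m lowˡ lowʳ (∈-++⁻ (l ∷ ls) m∈)) le
      where
      lowˡ : All (m ℕ.≤_) (l ∷ ls)
      lowˡ = All.tabulate λ x∈ → All.lookup low (∈-++⁺ˡ x∈)
      lowʳ : All (m ℕ.≤_) ls′
      lowʳ = All.tabulate λ x∈ → All.lookup low (∈-++⁺ʳ (l ∷ ls) x∈)
      1≤m : 1 ℕ.≤ m
      1≤m with ∈-++⁻ (l ∷ ls) m∈
      ... | inj₁ p = All.lookup ps p
      ... | inj₂ p = All.lookup ps′ p
      both : ∀ {m} → 1 ℕ.≤ m → All (m ℕ.≤_) (l ∷ ls) → All (m ℕ.≤_) ls′ → m ∈ l ∷ ls ⊎ m ∈ ls′ → m ∈ l ∷ ls × m ∈ ls′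
      both {suc m} _ lo lo′ (inj₁ p) = p , ∈-cnt ls′ (subst (_≢ 0) (same-cnt α γ m (l ∷ ls) ls′ γ≈ lo lo′ eq) (cnt-∈ p))
      both {suc m} _ lo lo′ (inj₂ p) = ∈-cnt (l ∷ ls) (subst (_≢ 0) (sym (same-cnt α γ m (l ∷ ls) ls′ γ≈ lo lo′ eq)) (cnt-∈ p)) , p
      peel : ∀ m n → m ∈ l ∷ ls × m ∈ ls′ → length (l ∷ ls) ℕ.≤ n → (l ∷ ls) ↭ ls′
      peel m (suc n) (m∈ , m∈′) (ℕ.s≤s le) with ∈-∃++ m∈ | ∈-∃++ m∈′
      ... | as , bs , e | as′ , bs′ , e′ = ↭-trans perm (↭-trans (prep m rec) (↭-sym perm′))
        where
        perm : (l ∷ ls) ↭ m ∷ (as ++ bs)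
        perm = subst (_↭ m ∷ (as ++ bs)) (sym e) (shift m as bs)
        perm′ : ls′ ↭ m ∷ (as′ ++ bs′)
        perm′ = subst (_↭ m ∷ (as′ ++ bs′)) (sym e′) (shift m as′ bs′)
        αs γs : ℕ → ℤ
        αs t = α t * (+ 1 + pow (base t) m) - γ t * pow (base t) m
        γs t = γ t * (+ 1 + pow (base t) m)
        pow≈0 : ∀ t m → 1 ℕ.≤ m → pow (base t) m ≈ + 0 mod (base t)
        pow≈0 t (suc m) _ = mod (pow (base t) m) (trans (*-comm _ _) (sym (+-identityˡ _)))
        opaque
          unfolding _+_
          c₁ : + 2 * (+ 1 + + 0) ≡ + 2
          c₁ = refl
          c₂ : + 1 - + 0 ≡ + 1
          c₂ = refl
        γs≈ : ∀ t → γs t ≈ + 2 mod (base t)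
        γs≈ t = mod-trans (mod-* (γ≈ t) (mod-+ (mod-refl {a = + 1} refl) (pow≈0 t m (All.lookup ps m∈)))) (mod-refl c₁)
        eqs : ∀ t → Ψ (base t) (αs t) (γs t) (as ++ bs) ≡ Ψ (base t) (αs t) (γs t) (as′ ++ bs′)
        eqs t = *-cancelˡ (+ 1 - pow (base t) m) (base-1 t (mod-trans (mod-- (mod-refl {a = + 1} refl) (pow≈0 t m (All.lookup ps m∈))) (mod-refl c₂)))
          (trans (sym (Ψ.Ψ-remove (base t) (α t) (γ t) m (as ++ bs))) (trans (sym (Ψ.Ψ-↭ (base t) (α t) (γ t) perm)) (trans (eq t)
            (trans (Ψ.Ψ-↭ (base t) (α t) (γ t) perm′) (Ψ.Ψ-remove (base t) (α t) (γ t) m (as′ ++ bs′))))))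
        rec : (as ++ bs) ↭ (as′ ++ bs′)
        rec = Ψ-determines n (as ++ bs) (as′ ++ bs′) (subst (ℕ._≤ n) (ℕ.suc-injective (↭-length perm)) le)
          (All.tail (All-resp-↭ perm ps)) (All.tail (All-resp-↭ perm′ ps′)) αs γs γs≈ eqs
  Ψ-determines n [] (l ∷ ls′) le ps ps′ α γ γ≈ eq with minimum l ls′
  ... | zero , m∈ , low = contradiction (All.lookup ps′ m∈) λ ()
  ... | suc m , m∈ , low = contradiction (sym (same-cnt α γ m [] (l ∷ ls′) γ≈ [] low eq)) (cnt-∈ m∈)

  module RoseΨ (t : ℕ) where
    q = base t
    a = + 1 + q * q
    θ = + 1 - q * q
    open Ψ q public using (Q; Πa; Σa)

    module _ (G : Graph) where
      open Pencil G a q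

      -- For a = 1 + q² and b = q the recurrence has the characteristic roots 1 and q².
      s-closed : ∀ l → θ * s l ≡ + 1 - Q l * Q l
      s-closed 0 = lem θ
        where
        opaque
          unfolding _+_ 0≟
          lem : ∀ θ → θ * + 0 ≡ + 1 - + 1 * + 1
          lem = solve-∀ ring
      s-closed 1 = lem q
        where
        opaque
          unfolding _+_ 0≟
          lem : ∀ q → (+ 1 - q * q) * + 1 ≡ + 1 - (q * + 1) * (q * + 1)
          lem = solve-∀ ring
      s-closed (suc (suc l)) = begin
        θ * (a * s (suc l) - q * q * s l) ≡⟨ lem₁ θ a (q * q) _ _ ⟩
        a * (θ * s (suc l)) - q * q * (θ * s l) ≡⟨ cong₂ (λ x y → a * x - q * q * y) (s-closed (suc l)) (s-closed l) ⟩
        a * (+ 1 - Q (suc l) * Q (suc l)) - q * q * (+ 1 - Q l * Q l) ≡⟨ lem₂ q (Q l) ⟩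
        + 1 - Q (suc (suc l)) * Q (suc (suc l)) ∎
        where
        opaque
          unfolding _+_ 0≟
          lem₁ : ∀ θ a b x y → θ * (a * x - b * y) ≡ a * (θ * x) - b * (θ * y)
          lem₁ = solve-∀ ring
          lem₂ : ∀ q Q → (+ 1 + q * q) * (+ 1 - (q * Q) * (q * Q)) - q * q * (+ 1 - Q * Q) ≡ + 1 - (q * (q * Q)) * (q * (q * Q))
          lem₂ = solve-∀ ring

      -- As q >= 2, this keeps the path determinants away from 0, as elimination demands.
      s≈1 : ∀ l → s (suc l) ≈ + 1 mod q
      s≈1 zero = mod-refl refl
      s≈1 (suc l) = mod-trans (mod (q * s (suc l) - q * s l) (lem q (s (suc l)) (s l))) (s≈1 l)
        where
        opaque
          unfolding _+_ 0≟
          lem : ∀ q x y → (+ 1 + q * q) * x - q * q * y ≡ x + (q * x - q * y) * q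
          lem = solve-∀ ring

      s≢0 : ∀ l → s (suc l) ≢ + 0
      s≢0 l = base-1 t (s≈1 l)

      Πs-closed : ∀ rs → pow θ (length rs) * Πs rs ≡ Πa (map ℕ.suc rs)
      Πs-closed [] = *-identityˡ _
      Πs-closed (r ∷ rs) = trans (lem θ (pow θ (length rs)) _ _) (cong₂ _*_ (s-closed (suc r)) (Πs-closed rs))
        where
        opaque
          unfolding _+_ 0≟
          lem : ∀ θ p s x → θ * p * (s * x) ≡ (θ * s) * (p * x)
          lem = solve-∀ ring

      Ws-closed : ∀ rs → pow θ (length rs) * (q * Ws rs) ≡ + 2 * q * q * + length rs * Πa (map ℕ.suc rs) + + 2 * θ * Σa (map ℕ.suc rs)
      Ws-closed [] = lem θ q
        where
        opaque
          unfolding _+_ 0≟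
          lem : ∀ θ q → + 1 * (q * + 0) ≡ + 2 * q * q * + 0 * + 1 + + 2 * θ * + 0
          lem = solve-∀ ring
      Ws-closed (r ∷ rs) = begin
        θ * p * (q * (s (suc r) * Ws rs + Πs rs * (+ 2 * (q * s r + Q r)))) ≡⟨ lem₁ θ p q (s (suc r)) (Ws rs) (Πs rs) (s r) (Q r) ⟩
        (θ * s (suc r)) * (p * (q * Ws rs)) + (p * Πs rs) * (+ 2 * q * (q * (θ * s r) + θ * Q r))
          ≡⟨ cong₂ (λ x y → x + y) (cong₂ _*_ (s-closed (suc r)) (Ws-closed rs)) (cong₂ (λ x y → x * (+ 2 * q * (q * y + θ * Q r))) (Πs-closed rs) (s-closed r)) ⟩
        (+ 1 - Q (suc r) * Q (suc r)) * (+ 2 * q * q * + length rs * Πa ls + + 2 * θ * Σa ls) + Πa ls * (+ 2 * q * (q * (+ 1 - Q r * Q r) + θ * Q r))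
          ≡⟨ lem₂ q (Q r) (+ length rs) (Πa ls) (Σa ls) ⟩
        + 2 * q * q * (+ 1 + + length rs) * Πa (suc r ∷ ls) + + 2 * θ * Σa (suc r ∷ ls)
          ≡⟨ cong (λ z → + 2 * q * q * z * Πa (suc r ∷ ls) + + 2 * θ * Σa (suc r ∷ ls)) (sym (pos-+ 1 (length rs))) ⟩
        + 2 * q * q * + length (r ∷ rs) * Πa (suc r ∷ ls) + + 2 * θ * Σa (suc r ∷ ls) ∎
        where
        p = pow θ (length rs)
        ls = map ℕ.suc rs
        opaque
          unfolding _+_ 0≟
          lem₁ : ∀ θ p q s₁ w x s Q → θ * p * (q * (s₁ * w + x * (+ 2 * (q * s + Q)))) ≡
            (θ * s₁) * (p * (q * w)) + (p * x) * (+ 2 * q * (q * (θ * s) + θ * Q))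
          lem₁ = solve-∀ ring
          lem₂ : ∀ q Q n P S → (+ 1 - (q * Q) * (q * Q)) * (+ 2 * q * q * n * P + + 2 * (+ 1 - q * q) * S) + P * (+ 2 * q * (q * (+ 1 - Q * Q) + (+ 1 - q * q) * Q)) ≡
            + 2 * q * q * (+ 1 + n) * ((+ 1 - (q * Q) * (q * Q)) * P) + + 2 * (+ 1 - q * q) * ((+ 1 - (q * Q) * (q * Q)) * S + (q * Q) * (+ 1 - (q * Q)) * P)
          lem₂ = solve-∀ ring

      cycleLengths : ∀ {k} → Petals G k → List ℕ
      cycleLengths P = map ℕ.suc (map length (Petals.petals P))

      -- Multiplication by θ^k clears the denominators of the geometric sums. The factor 1 - q
      -- appears because the pencil at q = 1 is the singular matrix L.
      rose-Ψ : ∀ {k} (P : Petals G k) → pow θ k * D a q G ≡ (+ 1 - q) * Ψ q (+ 1 + (+ 2 * + k - + 1) * q) (+ 2 * (+ 1 + q)) (cycleLengths P)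
      rose-Ψ {k} P = begin
        pow θ k * D a q G ≡⟨ cong (pow θ k *_) (rose-det s≢0 P) ⟩
        pow θ k * ((a + q * (+ (2 ℕ.* k) - + 2)) * Πs rs - q * Ws rs) ≡⟨ lem₁ (pow θ k) (a + q * (+ (2 ℕ.* k) - + 2)) (Πs rs) (q * Ws rs) ⟩
        (a + q * (+ (2 ℕ.* k) - + 2)) * (pow θ k * Πs rs) - pow θ k * (q * Ws rs)
          ≡⟨ cong₂ (λ x y → (a + q * (x - + 2)) * (pow θ k * Πs rs) - y) (pos-* 2 k) (cong (λ z → pow θ z * (q * Ws rs)) (sym len)) ⟩
        (a + q * (+ 2 * + k - + 2)) * (pow θ k * Πs rs) - pow θ (length rs) * (q * Ws rs)
          ≡⟨ cong₂ (λ x y → (a + q * (+ 2 * + k - + 2)) * x - y) (trans (cong (λ z → pow θ z * Πs rs) (sym len)) (Πs-closed rs)) (Ws-closed rs) ⟩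
        (a + q * (+ 2 * + k - + 2)) * Πa ls - (+ 2 * q * q * + length rs * Πa ls + + 2 * θ * Σa ls)
          ≡⟨ cong (λ z → (a + q * (+ 2 * + k - + 2)) * Πa ls - (+ 2 * q * q * + z * Πa ls + + 2 * θ * Σa ls)) len ⟩
        (a + q * (+ 2 * + k - + 2)) * Πa ls - (+ 2 * q * q * + k * Πa ls + + 2 * θ * Σa ls) ≡⟨ lem₂ q (+ k) (Πa ls) (Σa ls) ⟩
        (+ 1 - q) * Ψ q (+ 1 + (+ 2 * + k - + 1) * q) (+ 2 * (+ 1 + q)) ls ∎
        where
        rs = map length (Petals.petals P)
        ls = map ℕ.suc rs
        len : length rs ≡ k
        len = trans (length-map length (Petals.petals P)) (number-of-petals s≢0 P)
        opaque
          unfolding _+_ 0≟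
          lem₁ : ∀ p x s w → p * (x * s - w) ≡ x * (p * s) - p * w
          lem₁ = solve-∀ ring
          lem₂ : ∀ q k P S → (+ 1 + q * q + q * (+ 2 * k - + 2)) * P - (+ 2 * q * q * k * P + + 2 * (+ 1 - q * q) * S) ≡
            (+ 1 - q) * ((+ 1 + (+ 2 * k - + 1) * q) * P - + 2 * (+ 1 + q) * S)
          lem₂ = solve-∀ ring

  opaque
    roses-same-lengths : ∀ {k} G H (P : Petals G k) (P′ : Petals H k) → (∀ a b → D a b G ≡ D a b H) →
      map length (Petals.petals P) ↭ map length (Petals.petals P′)
    roses-same-lengths {k} G H P P′ eq = unsuc (Ψ-determines (length ls) ls ls′ ℕ.≤-refl (pos _) (pos _)
        (λ t → + 1 + (+ 2 * + k - + 1) * base t) (λ t → + 2 * (+ 1 + base t))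
        (λ t → mod (+ 2) (lem (base t)))
        (λ t → *-cancelˡ (+ 1 - base t) (base-2 t) (trans (sym (RoseΨ.rose-Ψ t G P)) (trans (cong (_*_ _) (eq _ _)) (RoseΨ.rose-Ψ t H P′)))))
      where
      rs rs′ ls ls′ : List ℕ
      rs = map length (Petals.petals P)
      rs′ = map length (Petals.petals P′)
      ls = map ℕ.suc rs
      ls′ = map ℕ.suc rs′
      pos : ∀ rs → All (1 ℕ.≤_) (map ℕ.suc rs)
      pos [] = []
      pos (r ∷ rs) = ℕ.s≤s ℕ.z≤n ∷ pos rs
      opaque
        unfolding _+_ 0≟
        lem : ∀ q → + 2 * (+ 1 + q) ≡ + 2 + + 2 * q
        lem = solve-∀ ring
        lem′ : ∀ q → + 1 - q ≡ + 1 + (- (+ 1)) * q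
        lem′ = solve-∀ ring
      base-2 : ∀ t → + 1 - base t ≢ + 0
      base-2 t = base-1 t (mod (- (+ 1)) (lem′ (base t)))
      unsuc : map ℕ.suc rs ↭ map ℕ.suc rs′ → rs ↭ rs′
      unsuc p with ↭-map-inv suc p
      ... | zs , e , p′ = subst (rs ↭_) (map-injective ℕ.suc-injective (sym e)) p′

-- Isomorphisms from degree-preserving embeddings.

module Embeddings where
  open import Data.Integer using (_≤_)
  open Integers
  open Determinants
  open Pencils
  open Neighbours
  open PetalDecomposition

  module _ (K H : Graph) (f : Fin (size K) → Fin (size H)) (inj : ∀ {i j} → f i ≡ f j → i ≡ j)
           (edge : ∀ {i j} → adj K i j ≡ true → adj H (f i) (f j) ≡ true)
           (deg : ∀ i → degree K i ≡ degree H (f i)) where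

    private
      push : Fin (size K) → Fin (size H) → ℤ
      push i u = sum λ j → A K i j * δ (f j) u

      push-f : ∀ i j → push i (f j) ≡ A K i j
      push-f i j = trans (sum-single _ j λ j′ ne → trans (cong (A K i j′ *_) (δ-≢ (ne ∘ inj))) (zeroʳ _))
        (trans (cong (A K i j *_) (δ-refl (f j))) (*-identityʳ _))

      push-outside : ∀ i u → ¬ (∃ λ j → f j ≡ u) → push i u ≡ + 0
      push-outside i u n = sum-zero λ j → trans (cong (A K i j *_) (δ-≢ λ e → n (j , e))) (zeroʳ _)

      A-mono : ∀ i j → + 0 ≤ A H (f i) (f j) - A K i j
      A-mono i j with adj K i j in e
      ... | true = ℤ.≤-reflexive (sym (trans (cong (λ z → z - + 1) (A-true H (edge e))) (-‿inverseʳ _)))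
      ... | false = subst (+ 0 ≤_) (lem _) (A-nonneg H (f i) (f j))
        where
        opaque
          unfolding _+_ 0≟
          lem : ∀ a → a ≡ a - + 0
          lem = solve-∀ ring

      gap : ∀ i u → + 0 ≤ A H (f i) u - push i u
      gap i u with any? (λ j → f j ≟ u)
      ... | yes (j , refl) = subst (λ z → + 0 ≤ A H (f i) (f j) - z) (sym (push-f i j)) (A-mono i j)
      ... | no n = subst (λ z → + 0 ≤ A H (f i) u - z) (sym (push-outside i u n)) (subst (+ 0 ≤_) (lem _) (A-nonneg H (f i) u))
        where
        opaque
          unfolding _+_ 0≟
          lem : ∀ a → a ≡ a - + 0
          lem = solve-∀ ring

      total : ∀ i → sum (λ u → A H (f i) u - push i u) ≡ + 0
      total i = trans (sum-- _ _) (trans (cong₂ _-_ (trans (sym (degree-sum H (f i))) (cong +_ (sym (deg i)))) sum-push) (-‿inverseʳ _))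
        where
        sum-push : sum (push i) ≡ + degree K i
        sum-push = trans (sum-comm (λ u j → A K i j * δ (f j) u)) (trans (sum-cong λ j → trans (sum-*ˡ (A K i j) (δ (f j)))
          (trans (cong (A K i j *_) (trans (sum-cong λ u → sym (*-identityʳ _)) (sum-δ (f j) (λ _ → + 1)))) (*-identityʳ _))) (sym (degree-sum K i)))

      exact : ∀ i u → A H (f i) u ≡ push i u
      exact i u = trans (lem _ _) (zero-+ (sum-nonneg-zero (gap i) (total i) u))
        where
        opaque
          unfolding _+_ 0≟
          lem : ∀ a b → a ≡ (a - b) + b
          lem = solve-∀ ring

      ι-injective : ∀ {b b′} → ι b ≡ ι b′ → b ≡ b′
      ι-injective {true} {true} _ = refl
      ι-injective {false} {false} _ = refl

      reach : ∀ {i u} → Reach H (f i) u → ∃ λ j → f j ≡ u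
      reach {i} Reach.here = i , refl
      reach {i} {u} (Reach.step {w = w} e r) with any? (λ j → f j ≟ w)
      ... | yes (j , refl) = reach r
      ... | no n = contradiction (trans (sym (A-true H e)) (trans (exact i w) (push-outside i w n))) λ ()

    -- Equal degrees leave no room for further edges at a vertex of the image. So the image is
    -- closed under adjacency, hence all of `H` by connectivity, and adjacency is reflected as well
    -- as preserved. The vertex `i₀` is where the walks start.
    embedding-iso : Connected H → Fin (size K) → Iso K H
    embedding-iso conn i₀ = mk↔ₛ′ f g f∘g (λ i → inj (f∘g (f i))) , λ i j → ι-injective (trans (exact i (f j)) (push-f i j))
      where
      g : Fin (size H) → Fin (size K)
      g u = proj₁ (reach (conn (f i₀) u))
      f∘g : ∀ u → f (g u) ≡ u
      f∘g u = proj₂ (reach (conn (f i₀) u))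

  mult-nonneg : ∀ {n} (xs : List (Fin n)) i → + 0 ≤ mult xs i
  mult-nonneg [] i = ℤ.≤-refl
  mult-nonneg (x ∷ xs) i = +-nonneg (δ-nonneg x i) (mult-nonneg xs i)
    where
    δ-nonneg : ∀ {n} (x i : Fin n) → + 0 ≤ δ x i
    δ-nonneg x i with x ≟ i
    ... | yes _ = ℤ.+≤+ ℕ.z≤n
    ... | no _ = ℤ.≤-refl

  nbrs-adj : ∀ {G x ys y} → Nbrs G x ys → y ∈ ys → adj G x y ≡ true
  nbrs-adj {G} {x} {ys} {y} nb y∈ with adj G x y in e
  ... | true = refl
  ... | false = ⊥-elim (zero-mult y∈ (trans (sym (nb y)) (cong ι e)))
    where
    impossible : ∀ {k} → + 0 ≤ k → + 1 + k ≢ + 0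
    impossible {+ k} _ e = contradiction (trans (pos-+ 1 k) e) λ ()
    zero-mult : ∀ {xs} → y ∈ xs → mult xs y ≡ + 0 → ⊥
    zero-mult {x ∷ xs} (here refl) e = impossible (mult-nonneg xs y) (trans (cong (λ z → z + mult xs y) (sym (δ-refl y))) e)
    zero-mult {x ∷ xs} (there p) e with x ≟ y
    ... | yes refl = impossible (mult-nonneg xs y) e
    ... | no _ = zero-mult p (trans (sym (+-identityˡ _)) e)

  matching : ∀ {n} {B : Set} → List (Fin n) → List B → B → Fin n → B
  matching (x ∷ xs) (y ∷ ys) d v with v ≟ x
  ... | yes _ = y
  ... | no _ = matching xs ys d v
  matching _ _ d v = d

  map-matching : ∀ {n} {B : Set} (xs : List (Fin n)) (ys : List B) d → Unique xs → length xs ≡ length ys → map (matching xs ys d) xs ≡ ys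
  map-matching [] [] d _ _ = refl
  map-matching (x ∷ xs) (y ∷ ys) d u@(_ ∷ u′) e = cong₂ _∷_ at (trans (map-cong-local (All.tabulate λ v∈ → off λ { refl → ∉-unique u v∈ }))
      (map-matching xs ys d u′ (ℕ.suc-injective e)))
    where
    at : matching (x ∷ xs) (y ∷ ys) d x ≡ y
    at with x ≟ x
    ... | yes _ = refl
    ... | no n = contradiction refl n
    off : ∀ {v} → v ≢ x → matching (x ∷ xs) (y ∷ ys) d v ≡ matching xs ys d v
    off {v} ne with v ≟ x
    ... | yes e = contradiction e ne
    ... | no _ = refl

  unique-map⁻ : ∀ {A B : Set} (f : A → B) {xs v w} → Unique (map f xs) → v ∈ xs → w ∈ xs → f v ≡ f w → v ≡ w
  unique-map⁻ f (a ∷ u) (here refl) (here refl) e = refl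
  unique-map⁻ f (a ∷ u) (here refl) (there w) e = contradiction e (All.lookup a (∈-map⁺ f w))
  unique-map⁻ f (a ∷ u) (there v) (here refl) e = contradiction (sym e) (All.lookup a (∈-map⁺ f v))
  unique-map⁻ f (a ∷ u) (there v) (there w) e = unique-map⁻ f u v w e

  ++-injective : ∀ {A : Set} (xs ys : List A) {us vs} → length xs ≡ length ys → xs ++ us ≡ ys ++ vs → xs ≡ ys × us ≡ vs
  ++-injective [] [] _ e = refl , e
  ++-injective (x ∷ xs) (y ∷ ys) l e with ++-injective xs ys (ℕ.suc-injective l) (∷-injectiveʳ e)
  ... | p , q = cong₂ _∷_ (∷-injectiveˡ e) p , q

  concat-injective : ∀ {A : Set} (xss yss : List (List A)) → map length xss ≡ map length yss → concat xss ≡ concat yss → xss ≡ yss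
  concat-injective [] [] _ _ = refl
  concat-injective (xs ∷ xss) (ys ∷ yss) l e with ++-injective xs ys (∷-injectiveˡ l) e
  ... | p , q = cong₂ _∷_ p (concat-injective xss yss (∷-injectiveʳ l) q)

  length-concat : ∀ {A : Set} {B : Set} (xss : List (List A)) (yss : List (List B)) → map length xss ≡ map length yss → length (concat xss) ≡ length (concat yss)
  length-concat [] [] _ = refl
  length-concat (xs ∷ xss) (ys ∷ yss) e = trans (length-++ xs) (trans (cong₂ ℕ._+_ (∷-injectiveˡ e) (length-concat xss yss (∷-injectiveʳ e))) (sym (length-++ ys)))

  -- The flattened lists of vertices are matched position by position. Every edge has an end on some
  -- petal, so the neighbourhoods along the petals determine all edges.
  petals-iso : ∀ {k G H} (P : Petals G k) (P′ : Petals H k) → Connected H → map length (Petals.petals P) ≡ map length (Petals.petals P′) → Iso G H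
  petals-iso {k} {G} {H} P P′ conn same = embedding-iso G H f (λ {i} {j} → inj i j) edge deg conn P.centre
    where
    module P = Petals P
    module P′ = Petals P′
    flat = P.centre ∷ concat P.petals
    flat′ = P′.centre ∷ concat P′.petals
    uq : Unique flat
    uq = Unique-resp-↭ (↭-sym P.cover) (allFin⁺ (size G))
    uq′ : Unique flat′
    uq′ = Unique-resp-↭ (↭-sym P′.cover) (allFin⁺ (size H))
    all∈ : ∀ v → v ∈ flat
    all∈ v = ∈-resp-↭ (↭-sym P.cover) (∈-allFin v)
    f = matching flat flat′ P′.centre
    map-f : map f flat ≡ flat′
    map-f = map-matching flat flat′ P′.centre uq (cong suc (length-concat P.petals P′.petals same))
    f-centre : f P.centre ≡ P′.centre
    f-centre = ∷-injectiveˡ map-f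
    f-petals : map (map f) P.petals ≡ P′.petals
    f-petals = concat-injective _ _ (trans (lens P.petals) same) (trans (concat-map P.petals) (∷-injectiveʳ map-f))
      where
      lens : ∀ xss → map length (map (map f) xss) ≡ map length xss
      lens [] = refl
      lens (xs ∷ xss) = cong₂ _∷_ (length-map f xs) (lens xss)
    inj : ∀ i j → f i ≡ f j → i ≡ j
    inj i j = unique-map⁻ f (subst Unique (sym map-f) uq′) (all∈ i) (all∈ j)
    path′ : ∀ {p} → p ∈ P.petals → Path H (f P.centre) (map f p) (f P.centre)
    path′ {p} p∈ = subst (λ c → Path H c (map f p) c) (sym f-centre) (All.lookup P′.paths (subst (map f p ∈_) f-petals (∈-map⁺ (map f) p∈)))
    next-map : ∀ p e → next (map f p) (f e) ≡ f (next p e)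
    next-map [] e = refl
    next-map (x ∷ p) e = refl
    local : ∀ u p e {x} → x ∈ p → Path G u p e → Path H (f u) (map f p) (f e) →
      (∀ {v} → adj G x v ≡ true → adj H (f x) (f v) ≡ true) × degree G x ≡ degree H (f x)
    local u (x ∷ p) e (here refl) (nb , _) (nb′ , _) = nbr , trans (Nbrs-degree {G} {x} {u ∷ next p e ∷ []} nb) (sym (Nbrs-degree {H} {f x} {f u ∷ next (map f p) (f e) ∷ []} nb′))
      where
      nbr : ∀ {v} → adj G x v ≡ true → adj H (f x) (f v) ≡ true
      nbr xv with nbrs-elim {G} {x} {u ∷ next p e ∷ []} nb xv
      ... | here refl = nbrs-adj {H} {f x} {f u ∷ next (map f p) (f e) ∷ []} nb′ (here refl)
      ... | there (here refl) = nbrs-adj {H} {f x} {f u ∷ next (map f p) (f e) ∷ []} nb′ (there (here (sym (next-map p e))))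
    local u (x ∷ p) e (there x∈) (_ , path) (_ , pth′) = local x p e x∈ path pth′
    inPetal : ∀ {x} → x ∈ concat P.petals → (∀ {v} → adj G x v ≡ true → adj H (f x) (f v) ≡ true) × degree G x ≡ degree H (f x)
    inPetal x∈ with ∈-concat⁻′ P.petals x∈
    ... | p , x∈p , p∈ = local P.centre p P.centre x∈p (All.lookup P.paths p∈) (path′ p∈)
    edge : ∀ {i j} → adj G i j ≡ true → adj H (f i) (f j) ≡ true
    edge {i} {j} e with all∈ i | all∈ j
    ... | there i∈ | _ = proj₁ (inPetal i∈) e
    ... | here refl | there j∈ = adj-flip H (proj₁ (inPetal j∈) (adj-flip G e))
    ... | here refl | here refl = contradiction refl (adj-≢ G e)
    deg : ∀ i → degree G i ≡ degree H (f i)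
    deg i with all∈ i
    ... | there i∈ = proj₂ (inPetal i∈)
    ... | here refl = trans P.degree-centre (trans (sym P′.degree-centre) (cong (degree H) (sym f-centre)))

  opaque
    permute-petals : ∀ {k G} (P : Petals G k) {rs} → map length (Petals.petals P) ↭ rs → Σ (Petals G k) λ P′ → map length (Petals.petals P′) ≡ rs
    permute-petals P p with ↭-map-inv length p
    ... | ps , e , perm = record { centre = P.centre ; petals = ps ; paths = All-resp-↭ perm P.paths ; long = All-resp-↭ perm P.long
        ; cover = ↭-trans (prep P.centre (concat-↭ (↭-sym perm))) P.cover ; degree-centre = P.degree-centre } , sym e
      where
      module P = Petals P
      concat-↭ : ∀ {A : Set} {xss yss : List (List A)} → xss ↭ yss → concat xss ↭ concat yss
      concat-↭ Perm.refl = ↭-refl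
      concat-↭ (prep x p) = ++⁺ˡ x (concat-↭ p)
      concat-↭ {xss = x ∷ y ∷ xss} {_ ∷ _ ∷ yss} (swap x y p) = ↭-trans (++⁺ˡ x (++⁺ˡ y (concat-↭ p)))
        (↭-trans (↭-reflexive (sym (++-assoc x y (concat yss)))) (↭-trans (++⁺ʳ (concat yss) (++-comm x y)) (↭-reflexive (++-assoc y x (concat yss)))))
      concat-↭ (Perm.trans p p′) = ↭-trans (concat-↭ p) (concat-↭ p′)

-- Connectivity of graphs cospectral with a rose.

module Connectivity where
  open import Data.Integer using (_≤_)
  open Integers
  open Determinants
  open Pencils
  open Neighbours
  open PetalDecomposition
  open RoseDeterminant

  unique-length : ∀ {n} {xs : List (Fin n)} → Unique xs → length xs ℕ.≤ n
  unique-length {n} {xs} u = ℤ.drop‿+≤+ (subst₂ _≤_ (sum-mult-one xs) (sum-one n) (sum-mono bound))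
    where
    bound : ∀ i → mult xs i ≤ + 1
    bound i with i ∈? xs
    ... | yes p = ℤ.≤-reflexive (mult-∈ u p)
    ... | no p = ℤ.≤-trans (ℤ.≤-reflexive (mult-∉ p)) (ℤ.+≤+ ℕ.z≤n)

  reach-trans : ∀ {G u v w} → Reach G u v → Reach G v w → Reach G u w
  reach-trans Reach.here r = r
  reach-trans (Reach.step e r) r′ = Reach.step e (reach-trans r r′)

  record Component (G : Graph) (v₀ : Fin (size G)) : Set where
    field
      members   : List (Fin (size G))
      unique    : Unique members
      root      : v₀ ∈ members
      reachable : ∀ {v} → v ∈ members → Reach G v₀ v
      closed    : ∀ {u v} → u ∈ members → adj G u v ≡ true → v ∈ members

  component : ∀ G v₀ → Component G v₀
  component G v₀ = grow (size G) (v₀ ∷ []) ([] ∷ []) (here refl) (λ { (here refl) → Reach.here }) (ℕ.m≤m+n _ _)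
    where
    grow : ∀ m vs → Unique vs → v₀ ∈ vs → (∀ {v} → v ∈ vs → Reach G v₀ v) → size G ℕ.≤ m ℕ.+ length vs → Component G v₀
    grow m vs u r reach le with any? (λ x → any? (λ y → (x ∈? vs) ×-dec (¬? (y ∈? vs) ×-dec (adj G x y Bool.≟ true))))
    ... | no none = record { members = vs ; unique = u ; root = r ; reachable = reach
          ; closed = λ {x} {y} x∈ e → decidable-stable (y ∈? vs) λ y∉ → none (x , y , x∈ , y∉ , e) }
    ... | yes (x , y , x∈ , y∉ , e) = more m le
      where
      u′ : Unique (y ∷ vs)
      u′ = (All.tabulate λ { v∈ refl → y∉ v∈ }) ∷ u
      more : ∀ m → size G ℕ.≤ m ℕ.+ length vs → Component G v₀
      more zero le = contradiction (unique-length u′) (ℕ.<⇒≱ (ℕ.s≤s le))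
      more (suc m) le = grow m (y ∷ vs) u′ (there r)
        (λ { (here refl) → reach-trans (reach x∈) (Reach.step e Reach.here) ; (there v∈) → reach v∈ }) (subst (size G ℕ.≤_) (sym (ℕ.+-suc m _)) le)

  Separated : Graph → Set
  Separated G = Σ (List (Fin (size G))) λ S → Unique S × (∀ {u v} → u ∈ S → adj G u v ≡ true → v ∈ S) × (∃ λ v → v ∈ S) × (∃ λ w → w ∉ S)

  connected-or-separated : ∀ G → Connected G ⊎ Separated G
  connected-or-separated G with any? {n = size G} (λ v → any? {n = size G} (λ w → ¬? (w ∈? Component.members (component G v))))
  ... | yes (v , w , w∉) = inj₂ (C.members , C.unique , C.closed , (v , C.root) , (w , w∉))
    where module C = Component (component G v)
  ... | no none = inj₁ λ u v → Component.reachable (component G u)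
          (decidable-stable (v ∈? _) λ v∉ → none (u , v , v∉))

  module _ (G : Graph) (h : ℤ) where
    private
      M = pencil (+ 2 + h) (+ 1) G

    -- Functions constant on components are eigenvectors of hI + L.
    invariant-eigenvector : ∀ F → (∀ u j → A G u j * F j ≡ A G u j * F u) → ∀ u → (M · F) u ≡ h * F u
    invariant-eigenvector F inv u = trans (Pencil.pencil-row G (+ 2 + h) (+ 1) F u)
      (trans (cong (λ z → (+ 2 + h + + 1 * excess G u) * F u - + 1 * z) (trans (sum-cong (inv u)) (trans (sum-*ʳ (F u) (A G u)) (cong (_* F u) (sym (degree-sum G u))))))
        (lem h (+ degree G u) (F u)))
      where
      opaque
        unfolding _+_ 0≟
        lem : ∀ h d f → (+ 2 + h + + 1 * (d - + 2)) * f - + 1 * (d * f) ≡ h * f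
        lem = solve-∀ ring

    -- The indicators of `S` and of its complement are independent eigenvectors for the eigenvalue
    -- h. Cramer's rule draws one factor h out of column v and another out of column w; the second
    -- vector vanishes at v, so the first replacement does not affect its image.
    separated-D : Separated G → D (+ 2 + h) (+ 1) G ≈ + 0 mod (h * h)
    separated-D (S , uq , closed , (v , v∈) , (w , w∉)) = mod X (trans D≡ (lem h X))
      where
      F F′ : Fin (size G) → ℤ
      F = mult S
      F′ i = + 1 - F i
      inv : ∀ u j → A G u j * F j ≡ A G u j * F u
      inv u j with adj G u j in e
      ... | false = trans (zeroˡ _) (sym (zeroˡ _))
      ... | true with u ∈? S | j ∈? S
      ...   | yes p | yes q = cong (+ 1 *_) (trans (mult-∈ uq q) (sym (mult-∈ uq p)))
      ...   | no p | no q = cong (+ 1 *_) (trans (mult-∉ q) (sym (mult-∉ p)))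
      ...   | yes p | no q = contradiction (closed p e) q
      ...   | no p | yes q = contradiction (closed q (adj-flip G e)) p
      opaque
        unfolding _+_ 0≟
        lem₁ : ∀ a f → a * (+ 1 - f) ≡ a - a * f
        lem₁ = solve-∀ ring
        lem : ∀ h x → h * (h * x) ≡ + 0 + x * (h * h)
        lem = solve-∀ ring
        one : + 1 - + 0 ≡ + 1
        one = refl
      inv′ : ∀ u j → A G u j * F′ j ≡ A G u j * F′ u
      inv′ u j = trans (lem₁ _ _) (trans (cong (λ z → A G u j - z) (inv u j)) (sym (lem₁ _ _)))
      N = setCol v F M
      X = detℤ (setCol w F′ N)
      F′v : F′ v ≡ + 0
      F′v = trans (cong (λ z → + 1 - z) (mult-∈ uq v∈)) (-‿inverseʳ _)
      F′w : F′ w ≡ + 1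
      F′w = trans (cong (λ z → + 1 - z) (mult-∉ w∉)) one
      first : D (+ 2 + h) (+ 1) G ≡ h * detℤ N
      first = trans (sym (trans (cong (detℤ M *_) (mult-∈ uq v∈)) (*-identityʳ _))) (trans (sym (cramer M F v))
        (trans (detℤ-cong {size G} (λ i j → cong (λ z → if ⌊ j ≟ v ⌋ then z else M i j) (invariant-eigenvector F inv i))) (detℤ-col-* v h F M)))
      N·F′ : ∀ i → (N · F′) i ≡ h * F′ i
      N·F′ i = trans (sum-cong same) (invariant-eigenvector F′ inv′ i)
        where
        same : ∀ j → N i j * F′ j ≡ M i j * F′ j
        same j with j ≟ v
        ... | yes refl = trans (cong (_*_ _) F′v) (trans (zeroʳ _) (sym (trans (cong (_*_ _) F′v) (zeroʳ _))))
        ... | no _ = refl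
      second : detℤ N ≡ h * X
      second = trans (sym (trans (cong (detℤ N *_) F′w) (*-identityʳ _))) (trans (sym (cramer N F′ w))
        (trans (detℤ-cong {size G} (λ i j → cong (λ z → if ⌊ j ≟ w ⌋ then z else N i j) (N·F′ i))) (detℤ-col-* w h F′ N)))
      D≡ : D (+ 2 + h) (+ 1) G ≡ h * (h * X)
      D≡ = trans first (cong (h *_) second)

  module _ (h : ℕ) where
    -- The path determinants at a = 2 + h, b = 1. Summing the recurrence once, with `tₙ` as the
    -- partial sums of `sₙ`, removes all subtraction, so that the values are natural numbers.
    sₙ tₙ : ℕ → ℕ
    sₙ zero = 0
    sₙ (suc l) = suc (sₙ l ℕ.+ h ℕ.* tₙ l)
    tₙ zero = 0
    tₙ (suc l) = tₙ l ℕ.+ sₙ (suc l)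

    -- `Kₙ` measures how far `Ws` stays below 2k times `Πs`: the difference is h times `Kₙ`, as
    -- `Ws≡Kₙ` shows. This exhibits the factor h of the determinant with a positive cofactor.
    Πₙ Kₙ : List ℕ → ℕ
    Πₙ [] = 1
    Πₙ (r ∷ rs) = sₙ (suc r) ℕ.* Πₙ rs
    Kₙ [] = 0
    Kₙ (r ∷ rs) = sₙ (suc r) ℕ.* Kₙ rs ℕ.+ Πₙ rs ℕ.* (2 ℕ.* tₙ r)

  module _ (G : Graph) (h : ℕ) where
    open Pencil G (+ 2 + + h) (+ 1)

    private
      +sₙ : ∀ l → + sₙ h (suc l) ≡ + 1 + + sₙ h l + + h * + tₙ h l
      +sₙ l = trans (pos-+ 1 _) (trans (cong (_+_ (+ 1)) (trans (pos-+ (sₙ h l) _) (cong (_+_ _) (pos-* h _)))) (sym (+-assoc _ _ _)))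

      pow-one : ∀ n → pow (+ 1) n ≡ + 1
      pow-one zero = refl
      pow-one (suc n) = trans (*-identityˡ _) (pow-one n)

    s≡sₙ : ∀ l → s l ≡ + sₙ h l
    s≡sₙ 0 = refl
    s≡sₙ 1 = sym (trans (+sₙ 0) (lem (+ h)))
      where
      opaque
        unfolding _+_ 0≟
        lem : ∀ h → + 1 + + 0 + h * + 0 ≡ + 1
        lem = solve-∀ ring
    s≡sₙ (suc (suc l)) = begin
      (+ 2 + + h) * s (suc l) - + 1 * + 1 * s l ≡⟨ cong₂ (λ x y → (+ 2 + + h) * x - + 1 * + 1 * y) (s≡sₙ (suc l)) (s≡sₙ l) ⟩
      (+ 2 + + h) * + sₙ h (suc l) - + 1 * + 1 * + sₙ h l ≡⟨ lem (+ h) (+ sₙ h (suc l)) (+ sₙ h l) (+ tₙ h l) (+sₙ l) ⟩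
      + 1 + + sₙ h (suc l) + + h * (+ tₙ h l + + sₙ h (suc l)) ≡⟨ cong (λ z → + 1 + + sₙ h (suc l) + + h * z) (sym (pos-+ (tₙ h l) (sₙ h (suc l)))) ⟩
      + 1 + + sₙ h (suc l) + + h * + tₙ h (suc l) ≡⟨ sym (+sₙ (suc l)) ⟩
      + sₙ h (suc (suc l)) ∎
      where
      open ≡-Reasoning
      opaque
        unfolding _+_ 0≟
        lem′ : ∀ h s₀ t → (+ 2 + h) * (+ 1 + s₀ + h * t) - + 1 * + 1 * s₀ ≡ + 1 + (+ 1 + s₀ + h * t) + h * (t + (+ 1 + s₀ + h * t))
        lem′ = solve-∀ ring
      lem : ∀ h s₁ s₀ t → s₁ ≡ + 1 + s₀ + h * t → (+ 2 + h) * s₁ - + 1 * + 1 * s₀ ≡ + 1 + s₁ + h * (t + s₁)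
      lem h s₁ s₀ t refl = lem′ h s₀ t

    s≢0 : ∀ l → s (suc l) ≢ + 0
    s≢0 l e = contradiction (trans (sym (s≡sₙ (suc l))) e) λ ()

    Πs≡Πₙ : ∀ rs → Πs rs ≡ + Πₙ h rs
    Πs≡Πₙ [] = refl
    Πs≡Πₙ (r ∷ rs) = trans (cong₂ _*_ (s≡sₙ (suc r)) (Πs≡Πₙ rs)) (sym (pos-* _ _))

    Ws≡Kₙ : ∀ rs → Ws rs ≡ + 2 * + length rs * Πs rs - + h * + Kₙ h rs
    Ws≡Kₙ [] = sym (lem (+ h))
      where
      opaque
        unfolding _+_ 0≟
        lem : ∀ h → + 2 * + 0 * + 1 - h * + 0 ≡ + 0
        lem = solve-∀ ring
    Ws≡Kₙ (r ∷ rs) = begin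
      s (suc r) * Ws rs + Πs rs * (+ 2 * (+ 1 * s r + pow (+ 1) r))
        ≡⟨ cong₂ (λ x y → s (suc r) * x + Πs rs * y) (Ws≡Kₙ rs) (cong₂ (λ x y → + 2 * (+ 1 * x + y)) (s≡sₙ r) (pow-one r)) ⟩
      s (suc r) * (+ 2 * + length rs * Πs rs - + h * + Kₙ h rs) + Πs rs * (+ 2 * (+ 1 * + sₙ h r + + 1))
        ≡⟨ lem (s (suc r)) (+ length rs) (Πs rs) (+ h) (+ Kₙ h rs) (+ sₙ h r) (+ tₙ h r) (trans (s≡sₙ (suc r)) (+sₙ r)) ⟩
      + 2 * (+ 1 + + length rs) * (s (suc r) * Πs rs) - + h * (s (suc r) * + Kₙ h rs + Πs rs * (+ 2 * + tₙ h r))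
        ≡⟨ cong₂ (λ x y → + 2 * x * (s (suc r) * Πs rs) - + h * y) (sym (pos-+ 1 (length rs))) (sym K-step) ⟩
      + 2 * + length (r ∷ rs) * Πs (r ∷ rs) - + h * + Kₙ h (r ∷ rs) ∎
      where
      open ≡-Reasoning
      K-step : + Kₙ h (r ∷ rs) ≡ s (suc r) * + Kₙ h rs + Πs rs * (+ 2 * + tₙ h r)
      K-step = trans (pos-+ (sₙ h (suc r) ℕ.* Kₙ h rs) _) (cong₂ _+_ (trans (pos-* _ _) (cong (_* + Kₙ h rs) (sym (s≡sₙ (suc r)))))
        (trans (pos-* _ _) (cong₂ _*_ (sym (Πs≡Πₙ rs)) (pos-* 2 _))))
      opaque
        unfolding _+_ 0≟
        lem′ : ∀ n p h k s₀ t → (+ 1 + s₀ + h * t) * (+ 2 * n * p - h * k) + p * (+ 2 * (+ 1 * s₀ + + 1)) ≡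
          + 2 * (+ 1 + n) * ((+ 1 + s₀ + h * t) * p) - h * ((+ 1 + s₀ + h * t) * k + p * (+ 2 * t))
        lem′ = solve-∀ ring
      lem : ∀ s₁ n p h k s₀ t → s₁ ≡ + 1 + s₀ + h * t → s₁ * (+ 2 * n * p - h * k) + p * (+ 2 * (+ 1 * s₀ + + 1)) ≡
          + 2 * (+ 1 + n) * (s₁ * p) - h * (s₁ * k + p * (+ 2 * t))
      lem s₁ n p h k s₀ t refl = lem′ n p h k s₀ t

    rose-D : ∀ {k} (P : Petals G k) → let rs = map length (Petals.petals P) in D (+ 2 + + h) (+ 1) G ≡ + h * + (Πₙ h rs ℕ.+ Kₙ h rs)
    rose-D {k} P = begin
      D (+ 2 + + h) (+ 1) G ≡⟨ rose-det s≢0 P ⟩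
      (+ 2 + + h + + 1 * (+ (2 ℕ.* k) - + 2)) * Πs rs - + 1 * Ws rs
        ≡⟨ cong₂ (λ x y → (+ 2 + + h + + 1 * (x - + 2)) * Πs rs - + 1 * y) (pos-* 2 k) (trans (Ws≡Kₙ rs) (cong (λ z → + 2 * + z * Πs rs - + h * + Kₙ h rs) len)) ⟩
      (+ 2 + + h + + 1 * (+ 2 * + k - + 2)) * Πs rs - + 1 * (+ 2 * + k * Πs rs - + h * + Kₙ h rs) ≡⟨ lem (+ h) (+ k) (Πs rs) (+ Kₙ h rs) ⟩
      + h * (Πs rs + + Kₙ h rs) ≡⟨ cong (λ z → + h * (z + + Kₙ h rs)) (Πs≡Πₙ rs) ⟩
      + h * (+ Πₙ h rs + + Kₙ h rs) ≡⟨ cong (+ h *_) (sym (pos-+ _ _)) ⟩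
      + h * + (Πₙ h rs ℕ.+ Kₙ h rs) ∎
      where
      open ≡-Reasoning
      rs = map length (Petals.petals P)
      len : length rs ≡ k
      len = trans (length-map length (Petals.petals P)) (number-of-petals s≢0 P)
      opaque
        unfolding _+_ 0≟
        lem : ∀ h k p K → (+ 2 + h + + 1 * (+ 2 * k - + 2)) * p - + 1 * (+ 2 * k * p - h * K) ≡ h * (p + K)
        lem = solve-∀ ring

  s-mod : ∀ h l → + sₙ h l ≈ + sₙ 0 l mod (+ h)
  s-mod h zero = mod-refl refl
  s-mod h (suc l) = mod-trans (mod (+ tₙ h l) (trans (pos-+ 1 _) (trans (cong (_+_ (+ 1)) (trans (pos-+ (sₙ h l) _) (cong (_+_ _) (trans (pos-* h _) (*-comm _ _))))) (sym (+-assoc _ _ _)))))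
    (mod-trans (mod-+ (mod-refl {a = + 1} refl) (s-mod h l)) (mod-refl (trans (sym (pos-+ 1 _)) (cong (λ z → + suc z) (sym (ℕ.+-identityʳ _))))))

  t-mod : ∀ h l → + tₙ h l ≈ + tₙ 0 l mod (+ h)
  t-mod h zero = mod-refl refl
  t-mod h (suc l) = mod-trans (mod-refl (pos-+ (tₙ h l) _)) (mod-trans (mod-+ (t-mod h l) (s-mod h (suc l))) (mod-refl (sym (pos-+ (tₙ 0 l) _))))

  Π-mod : ∀ h rs → + Πₙ h rs ≈ + Πₙ 0 rs mod (+ h)
  Π-mod h [] = mod-refl refl
  Π-mod h (r ∷ rs) = mod-trans (mod-refl (pos-* (sₙ h (suc r)) _)) (mod-trans (mod-* (s-mod h (suc r)) (Π-mod h rs)) (mod-refl (sym (pos-* (sₙ 0 (suc r)) _))))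

  K-mod : ∀ h rs → + Kₙ h rs ≈ + Kₙ 0 rs mod (+ h)
  K-mod h [] = mod-refl refl
  K-mod h (r ∷ rs) = mod-trans (mod-refl (split h)) (mod-trans (mod-+ (mod-* (s-mod h (suc r)) (K-mod h rs)) (mod-* (Π-mod h rs) (mod-* (mod-refl {a = + 2} refl) (t-mod h r)))) (mod-refl (sym (split 0))))
    where
    split : ∀ h → + Kₙ h (r ∷ rs) ≡ + sₙ h (suc r) * + Kₙ h rs + + Πₙ h rs * (+ 2 * + tₙ h r)
    split h = trans (pos-+ (sₙ h (suc r) ℕ.* Kₙ h rs) _) (cong₂ _+_ (pos-* _ _) (trans (pos-* _ _) (cong (_*_ _) (pos-* 2 _))))

  -- The coefficient of h in det(hI + L) is n times the number of spanning trees; h exceeds it below.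
  cospectral-rose-connected : ∀ {k} G H → Petals G k → (∀ a b → D a b G ≡ D a b H) → Connected H
  cospectral-rose-connected G H P eq with connected-or-separated H
  ... | inj₁ c = c
  ... | inj₂ sep = contradiction (mod-small small (ℕ.n<1+n _) (ℕ.s≤s ℕ.z≤n)) K₀≢0
    where
    rs = map length (Petals.petals P)
    K₀ = Πₙ 0 rs ℕ.+ Kₙ 0 rs
    h = suc K₀
    Π₀-pos : ∀ rs → Πₙ 0 rs ≢ 0
    Π₀-pos [] ()
    Π₀-pos (r ∷ rs) e with ℕ.m*n≡0⇒m≡0∨n≡0 (sₙ 0 (suc r)) e
    ... | inj₂ q = Π₀-pos rs q
    K₀≢0 : K₀ ≢ 0
    K₀≢0 e = Π₀-pos rs (ℕ.m+n≡0⇒m≡0 _ e)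
    small : + K₀ ≈ + 0 mod (+ h)
    small = mod-trans (mod-trans (mod-refl (pos-+ (Πₙ 0 rs) _)) (mod-trans (mod-sym (mod-+ (Π-mod h rs) (K-mod h rs))) (mod-refl (sym (pos-+ _ _)))))
      (mod-cancelˡ (+ h) (λ ()) (mod-trans (mod-refl (trans (sym (rose-D G h P)) (eq _ _))) (mod-trans (separated-D H (+ h) sep) (mod-refl (sym (zeroʳ (+ h)))))))

-- Jacobi's formula in terms of traces of powers.

module PowerTraces where
  open Integers
  open Determinants
  open Pencils

  N : (G : Graph) → Mat (size G)
  N G i j = δ i j * excess G i - A G i j

  power : (G : Graph) → ℕ → Fin (size G) → Fin (size G) → ℤ
  power G zero v i = δ i v
  power G (suc j) v = N G · power G j v

  -- The trace of the j-th power of L − 2I.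
  trace : Graph → ℕ → ℤ
  trace G j = sum λ v → power G j v v

  ·-+ : ∀ {n} (M : Mat n) F F′ i → (M · λ k → F k + F′ k) i ≡ (M · F) i + (M · F′) i
  ·-+ M F F′ i = trans (sum-cong λ k → distribˡ (M i k) (F k) (F′ k)) (sum-+ _ _)

  ·-* : ∀ {n} (M : Mat n) c F i → (M · λ k → c * F k) i ≡ c * (M · F) i
  ·-* M c F i = trans (sum-cong λ k → lem (M i k) c (F k)) (sum-*ˡ c _)
    where
    opaque
      unfolding _+_ 0≟
      lem : ∀ m c f → m * (c * f) ≡ c * (m * f)
      lem = solve-∀ ring

  module _ (G : Graph) where
    private
      V = Fin (size G)
      y = power G

    pencil-N : ∀ a b F i → (pencil a b G · F) i ≡ a * F i + b * (N G · F) i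
    pencil-N a b F i = trans (sum-cong λ k → lem (δ i k) a b (excess G i) (A G i k) (F k))
      (trans (sum-linear a b _ _) (cong (λ z → a * z + b * (N G · F) i) (sum-δ i F)))
      where
      opaque
        unfolding _+_ 0≟
        lem : ∀ d a b x e f → (d * (a + b * x) - b * e) * f ≡ a * (d * f) + b * ((d * x - e) * f)
        lem = solve-∀ ring

    combination : (c₀ c₁ c₂ c₃ c₄ c₅ : ℤ) → V → V → ℤ
    combination c₀ c₁ c₂ c₃ c₄ c₅ v i = c₀ * y 0 v i + (c₁ * y 1 v i + (c₂ * y 2 v i + (c₃ * y 3 v i + (c₄ * y 4 v i + c₅ * y 5 v i))))

    N-combination : ∀ c₀ c₁ c₂ c₃ c₄ c₅ v i → (N G · combination c₀ c₁ c₂ c₃ c₄ c₅ v) i ≡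
      c₀ * y 1 v i + (c₁ * y 2 v i + (c₂ * y 3 v i + (c₃ * y 4 v i + (c₄ * y 5 v i + c₅ * y 6 v i))))
    N-combination c₀ c₁ c₂ c₃ c₄ c₅ v i =
      trans (·-+ (N G) (λ k → c₀ * y 0 v k) _ i) (cong₂ _+_ (·-* (N G) c₀ (y 0 v) i)
      (trans (·-+ (N G) (λ k → c₁ * y 1 v k) _ i) (cong₂ _+_ (·-* (N G) c₁ (y 1 v) i)
      (trans (·-+ (N G) (λ k → c₂ * y 2 v k) _ i) (cong₂ _+_ (·-* (N G) c₂ (y 2 v) i)
      (trans (·-+ (N G) (λ k → c₃ * y 3 v k) _ i) (cong₂ _+_ (·-* (N G) c₃ (y 3 v) i)
      (trans (·-+ (N G) (λ k → c₄ * y 4 v k) _ i) (cong₂ _+_ (·-* (N G) c₄ (y 4 v) i) (·-* (N G) c₅ (y 5 v) i))))))))))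

    module _ (q : ℤ) where
      q² q³ q⁴ q⁵ : ℤ
      q² = q * q
      q³ = q * q²
      q⁴ = q * q³
      q⁵ = q * q⁴

      M = pencil (+ 1 + q²) q G

      -- The derivative of (1 + q²)I + qN with respect to q.
      Y : Mat (size G)
      Y i v = δ i v * (+ 2 * q) + N G i v

      -- (2q + N) applied to the truncation of ((1 + q²) + qN)⁻¹ = ∑ q^j U_j(−N/2)
      approx : V → V → ℤ
      approx = combination (+ 2 * q - + 2 * q³ + + 2 * q⁵) (+ 1 - + 3 * q² + + 5 * q⁴) (- q + + 4 * q³ - + 6 * q⁵)
                           (q² - + 5 * q⁴) (- q³ + + 2 * q⁵) q⁴

      N-δ : ∀ v i → y 1 v i ≡ N G i v
      N-δ v i = trans (sum-cong λ k → lem (N G i k) k) (sum-δ v (N G i))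
        where
        lem : ∀ m k → m * δ k v ≡ δ v k * m
        lem m k with k ≟ v | v ≟ k
        ... | yes _ | yes _ = *-comm _ _
        ... | no _ | no _ = *-comm _ _
        ... | yes p | no n = contradiction (sym p) n
        ... | no n | yes p = contradiction (sym p) n

      approx-correct : ∀ v i → (M · approx v) i ≈ Y i v mod q⁵
      approx-correct v i = mod-trans (mod _ (trans (pencil-N (+ 1 + q²) q (approx v) i)
        (trans (cong (λ z → (+ 1 + q²) * approx v i + q * z) (N-combination _ _ _ _ _ _ v i))
          (lem q (y 0 v i) (y 1 v i) (y 2 v i) (y 3 v i) (y 4 v i) (y 5 v i) (y 6 v i)))))
        (mod-refl (cong (λ z → δ i v * (+ 2 * q) + z) (N-δ v i)))
        where
        opaque
          unfolding _+_ 0≟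
          lem : ∀ q y₀ y₁ y₂ y₃ y₄ y₅ y₆ →
            let c₀ = + 2 * q - + 2 * (q * (q * q)) + + 2 * (q * (q * (q * (q * q)))) ; c₁ = + 1 - + 3 * (q * q) + + 5 * (q * (q * (q * q)))
                c₂ = - q + + 4 * (q * (q * q)) - + 6 * (q * (q * (q * (q * q)))) ; c₃ = q * q - + 5 * (q * (q * (q * q)))
                c₄ = - (q * (q * q)) + + 2 * (q * (q * (q * (q * q)))) ; c₅ = q * (q * (q * q)) in
            (+ 1 + q * q) * (c₀ * y₀ + (c₁ * y₁ + (c₂ * y₂ + (c₃ * y₃ + (c₄ * y₄ + c₅ * y₅))))) +
              q * (c₀ * y₁ + (c₁ * y₂ + (c₂ * y₃ + (c₃ * y₄ + (c₄ * y₅ + c₅ * y₆))))) ≡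
            y₀ * (+ 2 * q) + y₁ + ((+ 2 * (q * q)) * y₀ + (+ 7 * q) * y₁ + (+ 3 - + 6 * (q * q)) * y₂ + (- (+ 11 * q)) * y₃ + (- (+ 4) + + 2 * (q * q)) * y₄ + (+ 3 * q) * y₅ + y₆) * (q * (q * (q * (q * q))))
          lem = solve-∀ ring

      S : ℤ
      S = (+ 2 * q - + 2 * q³ + + 2 * q⁵) * trace G 0 + ((+ 1 - + 3 * q² + + 5 * q⁴) * trace G 1 + ((- q + + 4 * q³ - + 6 * q⁵) * trace G 2 +
          ((q² - + 5 * q⁴) * trace G 3 + ((- q³ + + 2 * q⁵) * trace G 4 + q⁴ * trace G 5))))

      sum-approx : sum (λ v → approx v v) ≡ S
      sum-approx = trans (sum-+ _ _) (cong₂ _+_ (sum-*ˡ _ _) (trans (sum-+ _ _) (cong₂ _+_ (sum-*ˡ _ _) (trans (sum-+ _ _) (cong₂ _+_ (sum-*ˡ _ _)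
        (trans (sum-+ _ _) (cong₂ _+_ (sum-*ˡ _ _) (trans (sum-+ _ _) (cong₂ _+_ (sum-*ˡ _ _) (sum-*ˡ _ _))))))))))

      private
        h = q⁵
        entry : ∀ i j → pencil (+ 1 + (q + h) * (q + h)) (q + h) G i j ≈ M i j + h * Y i j mod (h * h)
        entry i j = mod (δ i j) (lem (δ i j) q h (excess G i) (A G i j))
          where
          opaque
            unfolding _+_ 0≟
            lem : ∀ d q h x a → d * (+ 1 + (q + h) * (q + h) + (q + h) * x) - (q + h) * a ≡
              (d * (+ 1 + q * q + q * x) - q * a) + h * (d * (+ 2 * q) + (d * x - a)) + d * (h * h)
            lem = solve-∀ ring

        column : ∀ v → detℤ (setCol v (λ i → Y i v) M) ≈ detℤ M * approx v v mod h
        column v = mod-trans (detℤ-mod near) (mod-refl (cramer M (approx v) v))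
          where
          near : ∀ i j → setCol v (λ i → Y i v) M i j ≈ setCol v (M · approx v) M i j mod h
          near i j with j ≟ v
          ... | yes _ = mod-sym (approx-correct v i)
          ... | no _ = mod-refl refl

      -- Jacobi's formula, det M times the trace of M⁻¹M′, for the step from q to q + q⁵. The
      -- vectors `approx` invert M only modulo q⁵; this suffices, because the first-order term
      -- carries another factor q⁵.
      jacobi : D (+ 1 + (q + q⁵) * (q + q⁵)) (q + q⁵) G ≈ D (+ 1 + q²) q G + q⁵ * (D (+ 1 + q²) q G * S) mod (q⁵ * q⁵)
      jacobi = mod-trans (detℤ-mod entry) (mod-trans (detℤ-perturb h M Y)
        (mod-+ (mod-refl {a = detℤ M} refl) (mod-scale h (mod-trans (mod-sum column) (mod-refl (trans (sum-*ˡ (detℤ M) (λ v → approx v v)) (cong (detℤ M *_) sum-approx)))))))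

-- The first five traces of a graph cospectral with a rose.

module RoseTraces where
  open Integers
  open Determinants
  open Pencils
  open PetalDecomposition
  open CycleLengths
  open PowerTraces

  -- A property of integer polynomials. It is all that is asked of the terms of high order in q,
  -- which can therefore be carried along as mere functions.
  Lipschitz : (ℤ → ℤ) → Set
  Lipschitz W = ∀ q h → W (q + h) ≈ W q mod h

  lip-const : ∀ c → Lipschitz λ _ → c
  lip-const c q h = mod-refl refl

  lip-id : Lipschitz λ q → q
  lip-id q h = mod (+ 1) (cong (_+_ q) (sym (*-identityˡ h)))

  lip-+ : ∀ {V W} → Lipschitz V → Lipschitz W → Lipschitz λ q → V q + W q
  lip-+ v w q h = mod-+ (v q h) (w q h)

  lip-- : ∀ {V W} → Lipschitz V → Lipschitz W → Lipschitz λ q → V q - W q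
  lip-- v w q h = mod-- (v q h) (w q h)

  lip-* : ∀ {V W} → Lipschitz V → Lipschitz W → Lipschitz λ q → V q * W q
  lip-* v w q h = mod-* (v q h) (w q h)

  lip-pow : ∀ n → Lipschitz λ q → pow q n
  lip-pow zero = lip-const (+ 1)
  lip-pow (suc n) = lip-* lip-id (lip-pow n)

  private
    sixth : ℤ → ℤ
    sixth q = q * (q * (q * (q * (q * q))))

    cubic : ℤ → ℤ → ℤ → ℤ → ℤ
    cubic c₃ c₄ c₅ q = q * (q * q) * (c₃ + q * (c₄ + q * c₅))

    lip-cubic : ∀ c₃ c₄ c₅ → Lipschitz (cubic c₃ c₄ c₅)
    lip-cubic c₃ c₄ c₅ = lip-* (lip-* lip-id (lip-* lip-id lip-id)) (lip-+ (lip-const c₃) (lip-* lip-id (lip-+ (lip-const c₄) (lip-* lip-id (lip-const c₅)))))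

    lip-sixth : Lipschitz sixth
    lip-sixth = lip-* lip-id (lip-* lip-id (lip-* lip-id (lip-* lip-id (lip-* lip-id lip-id))))

  open Ψ using (Πa; Σa)

  private
    square-expand : ∀ l → 3 ℕ.≤ l → Σ (ℤ → ℤ) λ w → Lipschitz w × ∀ q → + 1 - pow q l * pow q l ≡ + 1 + sixth q * w q
    square-expand (suc (suc (suc l))) _ = (λ q → + 0 - pow q l * pow q l) , lip-- (lip-const (+ 0)) (lip-* (lip-pow l) (lip-pow l)) , λ q → lem q (pow q l)
      where
      opaque
        unfolding _+_ 0≟
        lem : ∀ q p → + 1 - (q * (q * (q * p))) * (q * (q * (q * p))) ≡ + 1 + q * (q * (q * (q * (q * q)))) * (+ 0 - p * p)
        lem = solve-∀ ring
    square-expand (suc zero) (ℕ.s≤s ())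
    square-expand (suc (suc zero)) (ℕ.s≤s (ℕ.s≤s ()))

    -- The contribution is q^l - q^(2l) with 2l >= 6, so below q⁶ only the lengths 3, 4 and 5 are
    -- visible, each as a single unit.
    petal-expand : ∀ l → 3 ℕ.≤ l → Σ ℤ λ e₃ → Σ ℤ λ e₄ → Σ ℤ λ e₅ →
      (∀ ls → + cnt 3 (l ∷ ls) ≡ e₃ + + cnt 3 ls × + cnt 4 (l ∷ ls) ≡ e₄ + + cnt 4 ls × + cnt 5 (l ∷ ls) ≡ e₅ + + cnt 5 ls) ×
      Σ (ℤ → ℤ) λ w → Lipschitz w × ∀ q → pow q l * (+ 1 - pow q l) ≡ cubic e₃ e₄ e₅ q + sixth q * w q
    petal-expand 3 _ = + 1 , + 0 , + 0 , (λ ls → pos-+ 1 _ , sym (+-identityˡ _) , sym (+-identityˡ _)) , (λ q → - (+ 1)) , lip-const _ , lem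
      where
      opaque
        unfolding _+_ 0≟
        lem : ∀ q → q * (q * (q * + 1)) * (+ 1 - q * (q * (q * + 1))) ≡ q * (q * q) * (+ 1 + q * (+ 0 + q * + 0)) + q * (q * (q * (q * (q * q)))) * (- (+ 1))
        lem = solve-∀ ring
    petal-expand 4 _ = + 0 , + 1 , + 0 , (λ ls → sym (+-identityˡ _) , pos-+ 1 _ , sym (+-identityˡ _)) , (λ q → (- (+ 1)) * (q * q)) , lip-* (lip-const _) (lip-* lip-id lip-id) , lem
      where
      opaque
        unfolding _+_ 0≟
        lem : ∀ q → q * (q * (q * (q * + 1))) * (+ 1 - q * (q * (q * (q * + 1)))) ≡ q * (q * q) * (+ 0 + q * (+ 1 + q * + 0)) + q * (q * (q * (q * (q * q)))) * ((- (+ 1)) * (q * q))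
        lem = solve-∀ ring
    petal-expand 5 _ = + 0 , + 0 , + 1 , (λ ls → sym (+-identityˡ _) , sym (+-identityˡ _) , pos-+ 1 _) , (λ q → (- (+ 1)) * pow q 4) , lip-* (lip-const _) (lip-pow 4) , lem
      where
      opaque
        unfolding _+_ 0≟
        lem : ∀ q → q * (q * (q * (q * (q * + 1)))) * (+ 1 - q * (q * (q * (q * (q * + 1))))) ≡ q * (q * q) * (+ 0 + q * (+ 0 + q * + 1)) + q * (q * (q * (q * (q * q)))) * ((- (+ 1)) * (q * (q * (q * (q * + 1)))))
        lem = solve-∀ ring
    petal-expand (suc (suc (suc (suc (suc (suc l)))))) _ = + 0 , + 0 , + 0 , (λ ls → sym (+-identityˡ _) , sym (+-identityˡ _) , sym (+-identityˡ _)) ,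
        (λ q → pow q l * (+ 1 - pow q (6 ℕ.+ l))) , lip-* (lip-pow l) (lip-- (lip-const _) (lip-pow (6 ℕ.+ l))) , λ q → lem q (pow q l)
      where
      opaque
        unfolding _+_ 0≟
        lem : ∀ q p → q * (q * (q * (q * (q * (q * p))))) * (+ 1 - q * (q * (q * (q * (q * (q * p)))))) ≡ q * (q * q) * (+ 0 + q * (+ 0 + q * + 0)) + q * (q * (q * (q * (q * q)))) * (p * (+ 1 - q * (q * (q * (q * (q * (q * p)))))))
        lem = solve-∀ ring
    petal-expand 1 (ℕ.s≤s ())
    petal-expand 2 (ℕ.s≤s (ℕ.s≤s ()))

    Πa-expand : ∀ ls → All (3 ℕ.≤_) ls → Σ (ℤ → ℤ) λ W → Lipschitz W × ∀ q → Πa q ls ≡ + 1 + sixth q * W q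
    Πa-expand [] [] = (λ _ → + 0) , lip-const _ , λ q → sym (+-zero (zeroʳ _))
    Πa-expand (l ∷ ls) (p ∷ ps) with square-expand l p | Πa-expand ls ps
    ... | w , lw , ew | W , lW , eW = (λ q → w q + W q + sixth q * (w q * W q)) , lip-+ (lip-+ lw lW) (lip-* lip-sixth (lip-* lw lW)) ,
        λ q → trans (cong₂ _*_ (ew q) (eW q)) (lem (sixth q) (w q) (W q))
      where
      opaque
        unfolding _+_ 0≟
        lem : ∀ s w W → (+ 1 + s * w) * (+ 1 + s * W) ≡ + 1 + s * (w + W + s * (w * W))
        lem = solve-∀ ring

    Σa-expand : ∀ ls → All (3 ℕ.≤_) ls → Σ (ℤ → ℤ) λ W → Lipschitz W × ∀ q → Σa q ls ≡ cubic (+ cnt 3 ls) (+ cnt 4 ls) (+ cnt 5 ls) q + sixth q * W q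
    Σa-expand [] [] = (λ _ → + 0) , lip-const _ , lem
      where
      opaque
        unfolding _+_ 0≟
        lem : ∀ q → + 0 ≡ q * (q * q) * (+ 0 + q * (+ 0 + q * + 0)) + q * (q * (q * (q * (q * q)))) * + 0
        lem = solve-∀ ring
    Σa-expand (l ∷ ls) (p ∷ ps) with square-expand l p | petal-expand l p | Πa-expand ls ps | Σa-expand ls ps
    ... | v , lv , ev | e₃ , e₄ , e₅ , es , w , lw , ew | V , lV , eV | W , lW , eW =
        (λ q → W q + v q * (C q + sixth q * W q) + w q + (E q + sixth q * w q) * V q) ,
        lip-+ (lip-+ (lip-+ lW (lip-* lv (lip-+ (lip-cubic _ _ _) (lip-* lip-sixth lW)))) lw) (lip-* (lip-+ (lip-cubic _ _ _) (lip-* lip-sixth lw)) lV) ,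
        λ q → trans (cong₂ (λ x y → x + y) (cong₂ _*_ (ev q) (eW q)) (cong₂ _*_ (ew q) (eV q)))
          (trans (lem (sixth q) (v q) (C q) (W q) (E q) (w q) (V q))
            (cong (_+ₛ (sixth q * (W q + v q * (C q + sixth q * W q) + w q + (E q + sixth q * w q) * V q)))
              (trans (lem₂ q e₃ e₄ e₅ (+ cnt 3 ls) (+ cnt 4 ls) (+ cnt 5 ls))
                (cong₂ (λ x (y , z) → cubic x y z q) (sym (proj₁ (es ls))) (cong₂ _,_ (sym (proj₁ (proj₂ (es ls)))) (sym (proj₂ (proj₂ (es ls)))))))))
      where
      _+ₛ_ : ℤ → ℤ → ℤ
      a +ₛ b = a + b
      C E : ℤ → ℤ
      C = cubic (+ cnt 3 ls) (+ cnt 4 ls) (+ cnt 5 ls)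
      E = cubic e₃ e₄ e₅
      opaque
        unfolding _+_ 0≟
        lem : ∀ s v C W E w V → (+ 1 + s * v) * (C + s * W) + (E + s * w) * (+ 1 + s * V) ≡ (E + C) + s * (W + v * (C + s * W) + w + (E + s * w) * V)
        lem = solve-∀ ring
        lem₂ : ∀ q e₃ e₄ e₅ c₃ c₄ c₅ → q * (q * q) * (e₃ + q * (e₄ + q * e₅)) + q * (q * q) * (c₃ + q * (c₄ + q * c₅)) ≡ q * (q * q) * ((e₃ + c₃) + q * ((e₄ + c₄) + q * (e₅ + c₅)))
        lem₂ = solve-∀ ring

  quintic : (f₁ f₂ f₃ f₄ f₅ q : ℤ) → ℤ
  quintic f₁ f₂ f₃ f₄ f₅ q = + 1 + q * (f₁ + q * (f₂ + q * (f₃ + q * (f₄ + q * f₅))))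

  Φ : ℕ → List ℕ → ℤ → ℤ
  Φ k ls q = (+ 1 - q) * Ψ.Ψ q (+ 1 + (+ 2 * + k - + 1) * q) (+ 2 * (+ 1 + q)) ls

  module Low (k : ℕ) (ls : List ℕ) where
    b c₃ c₄ c₅ : ℤ
    b = + 2 * + k - + 2
    c₃ = + cnt 3 ls
    c₄ = + cnt 4 ls
    c₅ = + cnt 5 ls
    -- The coefficients of q, ..., q⁵ in `Φ`, read off from (1 - q)(1 + (2k - 1)q) - 2(1 - q²)(c₃q³
    -- + c₄q⁴ + c₅q⁵).
    f₁ f₂ f₃ f₄ f₅ : ℤ
    f₁ = b
    f₂ = - (b + + 1)
    f₃ = - (+ 2 * c₃)
    f₄ = - (+ 2 * c₄)
    f₅ = + 2 * c₃ - + 2 * c₅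

    Φ-expand : All (3 ℕ.≤_) ls → Σ (ℤ → ℤ) λ W → Lipschitz W × ∀ q → Φ k ls q ≡ quintic f₁ f₂ f₃ f₄ f₅ q + sixth q * W q
    Φ-expand ps with Πa-expand ls ps | Σa-expand ls ps
    ... | V , lV , eV | W , lW , eW =
        (λ q → (+ 1 - q) * ((+ 1 + (+ 2 * + k - + 1) * q) * V q - (+ 2 * (+ 1 + q)) * W q) + (+ 2 * c₄ + + 2 * c₅ * q)) ,
        lip-+ (lip-* (lip-- (lip-const _) lip-id) (lip-- (lip-* (lip-+ (lip-const _) (lip-* (lip-const _) lip-id)) lV) (lip-* (lip-* (lip-const _) (lip-+ (lip-const _) lip-id)) lW)))
          (lip-+ (lip-const _) (lip-* (lip-const _) lip-id)) ,
        λ q → trans (cong₂ (λ x y → (+ 1 - q) * ((+ 1 + (+ 2 * + k - + 1) * q) * x - (+ 2 * (+ 1 + q)) * y)) (eV q) (eW q)) (lem q (+ k) c₃ c₄ c₅ (V q) (W q))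
      where
      opaque
        unfolding _+_ 0≟
        lem : ∀ q k c₃ c₄ c₅ V W → (+ 1 - q) * ((+ 1 + (+ 2 * k - + 1) * q) * (+ 1 + q * (q * (q * (q * (q * q)))) * V) - (+ 2 * (+ 1 + q)) * (q * (q * q) * (c₃ + q * (c₄ + q * c₅)) + q * (q * (q * (q * (q * q)))) * W)) ≡
          (+ 1 + q * ((+ 2 * k - + 2) + q * (- ((+ 2 * k - + 2) + + 1) + q * (- (+ 2 * c₃) + q * (- (+ 2 * c₄) + q * (+ 2 * c₃ - + 2 * c₅))))))
          + q * (q * (q * (q * (q * q)))) * ((+ 1 - q) * ((+ 1 + (+ 2 * k - + 1) * q) * V - (+ 2 * (+ 1 + q)) * W) + (+ 2 * c₄ + + 2 * c₅ * q))
        lem = solve-∀ ring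

    slope : ℤ → ℤ
    slope q = f₁ + q * (+ 2 * f₂ + q * (+ 3 * f₃ + q * (+ 4 * f₄ + q * (+ 5 * f₅))))

    -- `slope` is the derivative of the quintic part. The remainder q⁶W(q) is stationary modulo h² =
    -- q^10: the sixth power of q + q⁵ is q⁶(1 + q⁴)⁶, and W changes by a multiple of q⁵.
    Φ-step : All (3 ℕ.≤_) ls → ∀ q → let h = q * (q * (q * (q * q))) in Φ k ls (q + h) ≈ Φ k ls q + h * slope q mod (h * h)
    Φ-step ps q with Φ-expand ps
    ... | W , lW , eW = mod-trans (mod-refl (eW (q + h))) (mod-trans (mod-+ (mod _ (lem₁ q h f₁ f₂ f₃ f₄ f₅)) tail) (mod-refl (trans (lem₃ _ _ _) (cong (λ z → z + h * slope q) (sym (eW q))))))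
      where
      h = q * (q * (q * (q * q)))
      ε = + 1 + q * (q * (q * q))
      opaque
        unfolding _+_ 0≟
        lem₁ : ∀ q h f₁ f₂ f₃ f₄ f₅ →
          + 1 + (q + h) * (f₁ + (q + h) * (f₂ + (q + h) * (f₃ + (q + h) * (f₄ + (q + h) * f₅)))) ≡
          (+ 1 + q * (f₁ + q * (f₂ + q * (f₃ + q * (f₄ + q * f₅)))) + h * (f₁ + q * (+ 2 * f₂ + q * (+ 3 * f₃ + q * (+ 4 * f₄ + q * (+ 5 * f₅))))))
          + (f₂ + f₃ * (+ 3 * q + h) + f₄ * (+ 6 * (q * q) + + 4 * (q * h) + h * h) + f₅ * (+ 10 * (q * (q * q)) + + 10 * (q * (q * h)) + + 5 * (q * (h * h)) + h * (h * h))) * (h * h)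
        lem₁ = solve-∀ ring
        lem₃ : ∀ a b c → (a + b) + c ≡ (a + c) + b
        lem₃ = solve-∀ ring
        lem₄ : ∀ q → (q + q * (q * (q * (q * q)))) ≡ q * (+ 1 + q * (q * (q * q)))
        lem₄ = solve-∀ ring
        lem₅ : ∀ q e W → let p = q * (q * (q * q)) in
          (q * e) * ((q * e) * ((q * e) * ((q * e) * ((q * e) * (q * e))))) * W ≡ q * (q * (q * (q * (q * q)))) * ((e * (e * (e * (e * (e * e))))) * W)
        lem₅ = solve-∀ ring
        lem₆ : ∀ p → (+ 1 + p) * ((+ 1 + p) * ((+ 1 + p) * ((+ 1 + p) * ((+ 1 + p) * (+ 1 + p))))) ≡ + 1 + (+ 6 + p * (+ 15 + p * (+ 20 + p * (+ 15 + p * (+ 6 + p))))) * p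
        lem₆ = solve-∀ ring
        lem₇ : ∀ q → q * (q * (q * (q * (q * q)))) * (q * (q * (q * q))) ≡ (q * (q * (q * (q * q)))) * (q * (q * (q * (q * q))))
        lem₇ = solve-∀ ring
      W-step : W (q + h) ≈ W q mod (q * (q * (q * q)))
      W-step = mod-weaken q (subst (λ z → W (q + h) ≈ W q mod z) (*-comm q _) (lW q h))
      ε-step : ε * (ε * (ε * (ε * (ε * ε)))) ≈ + 1 mod (q * (q * (q * q)))
      ε-step = mod _ (lem₆ _)
      tail : sixth (q + h) * W (q + h) ≈ sixth q * W q mod (h * h)
      tail = mod-trans (mod-refl (trans (cong (λ z → sixth z * W (q + h)) (lem₄ q)) (lem₅ q ε (W (q + h)))))
        (subst (λ z → sixth q * ((ε * (ε * (ε * (ε * (ε * ε))))) * W (q + h)) ≈ sixth q * W q mod z) (lem₇ q) (mod-scale (sixth q) (mod-trans (mod-* ε-step W-step) (mod-refl (*-identityˡ _)))))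

    -- The first-order change of θ^k for θ = 1 - q², multiplied by θ so that no power k - 1 occurs.
    θ-power : ∀ q h k → pow (+ 1 - (q + h) * (q + h)) k * (+ 1 - q * q) ≈ pow (+ 1 - q * q) k * ((+ 1 - q * q) - + 2 * + k * q * h) mod (h * h)
    θ-power q h zero = mod-refl (lem (+ 1 - q * q) q h)
      where
      opaque
        unfolding _+_ 0≟
        lem : ∀ t q h → + 1 * t ≡ + 1 * (t - + 2 * + 0 * q * h)
        lem = solve-∀ ring
    θ-power q h (suc k) = mod-trans (mod-refl (*-assoc _ _ _)) (mod-trans (mod-* (mod-refl {a = + 1 - (q + h) * (q + h)} refl) (θ-power q h k))
        (mod-trans (mod _ (lem q h (pow (+ 1 - q * q) k) (+ k))) (mod-refl (cong (λ z → (+ 1 - q * q) * pow (+ 1 - q * q) k * ((+ 1 - q * q) - + 2 * z * q * h)) (sym (pos-+ 1 k))))))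
      where
      opaque
        unfolding _+_ 0≟
        lem : ∀ q h p k → (+ 1 - (q + h) * (q + h)) * (p * ((+ 1 - q * q) - + 2 * k * q * h)) ≡
          (+ 1 - q * q) * p * ((+ 1 - q * q) - + 2 * (+ 1 + k) * q * h) + (p * (+ 4 * k * q * q - (+ 1 - q * q) + + 2 * k * q * h)) * (h * h)
        lem = solve-∀ ring

  -- The formula for the rose is known at the bases only, so the shifted argument q + q⁵ has to be
  -- one of them.
  base-shift : ∀ t → Σ ℕ λ t′ → base t + base t * (base t * (base t * (base t * base t))) ≡ base t′
  base-shift t = t ℕ.+ n ℕ.* (n ℕ.* (n ℕ.* (n ℕ.* n))) , trans (cong (_+_ (+ n)) fifth) (sym (pos-+ n _))
    where
    n = 2 ℕ.+ t
    fifth : + n * (+ n * (+ n * (+ n * + n))) ≡ + (n ℕ.* (n ℕ.* (n ℕ.* (n ℕ.* n))))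
    fifth = sym (trans (pos-* n _) (cong (_*_ (+ n)) (trans (pos-* n _) (cong (_*_ (+ n)) (trans (pos-* n _) (cong (_*_ (+ n)) (pos-* n n)))))))

  module _ {k} (G H : Graph) (P : Petals G k) (eq : ∀ a b → D a b G ≡ D a b H) where
    private
      ls = map ℕ.suc (map length (Petals.petals P))
      ls≥3 : All (3 ℕ.≤_) ls
      ls≥3 = go (Petals.petals P) (Petals.long P)
        where
        go : ∀ ps → All (λ p → 2 ℕ.≤ length p) ps → All (3 ℕ.≤_) (map ℕ.suc (map length ps))
        go [] [] = []
        go (p ∷ ps) (l ∷ ll) = ℕ.s≤s l ∷ go ps ll
    open Low k ls public

    private
      D-Φ : ∀ t → let q = base t in pow (+ 1 - q * q) k * D (+ 1 + q * q) q H ≡ Φ k ls q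
      D-Φ t = trans (cong (_*_ _) (sym (eq _ _))) (RoseΨ.rose-Ψ t G P)

      T = trace H
      -- Coefficients of q^0, ..., q⁴: the `S₀`, ..., `S₄` are those of `S`, the `B₀`, ..., `B₄`
      -- those of θS - 2kq, and the `z₀`, ..., `z₄` those of θ times `slope` minus `Φ` times θS -
      -- 2kq, where θ = 1 - q².
      S₀ S₁ S₂ S₃ S₄ : ℤ
      S₀ = T 1
      S₁ = + 2 * T 0 - T 2
      S₂ = T 3 - + 3 * T 1
      S₃ = + 4 * T 2 - T 4 - + 2 * T 0
      S₄ = T 5 - + 5 * T 3 + + 5 * T 1

      B₀ B₁ B₂ B₃ B₄ : ℤ
      B₀ = S₀
      B₁ = S₁ - + 2 * + k
      B₂ = S₂ - S₀
      B₃ = S₃ - S₁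
      B₄ = S₄ - S₂

      z₀ z₁ z₂ z₃ z₄ : ℤ
      z₀ = f₁ - B₀
      z₁ = + 2 * f₂ - B₁ - f₁ * B₀
      z₂ = + 3 * f₃ - f₁ - B₂ - f₁ * B₁ - f₂ * B₀
      z₃ = + 4 * f₄ - + 2 * f₂ - B₃ - f₁ * B₂ - f₂ * B₁ - f₃ * B₀
      z₄ = + 5 * f₅ - + 3 * f₃ - B₄ - f₁ * B₃ - f₂ * B₂ - f₃ * B₁ - f₄ * B₀

      module At (t : ℕ) where
        q = base t
        θ = + 1 - q * q
        h = q * (q * (q * (q * q)))
        Dq = D (+ 1 + q * q) q H
        s = S H q

        opaque
          unfolding _+_ 0≟
          lem₀ : ∀ θ p d → θ * (p * d) ≡ (p * θ) * d
          lem₀ = solve-∀ ring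
          lem₁ : ∀ p θ κ q h d s → p * (θ - + 2 * κ * q * h) * (d + h * (d * s)) ≡ ((p * d) * θ + h * ((p * d) * (θ * s - + 2 * κ * q))) + (- ((p * d) * (+ 2 * κ * q * s))) * (h * h)
          lem₁ = solve-∀ ring
          lem₂ : ∀ φ θ h d → h * (θ * d) ≡ θ * (φ + h * d) - φ * θ
          lem₂ = solve-∀ ring
          lem₃ : ∀ a b → (a + b) - a ≡ b
          lem₃ = solve-∀ ring

        -- The logarithmic derivative of the identity θ^k D = `Φ`, multiplied by θ: it is compared
        -- at q and at q + q⁵, and one factor q⁵ is cancelled.
        main : θ * slope q ≈ Φ k ls q * (θ * s - + 2 * + k * q) mod h
        main = mod-cancelˡ h h≢0 (mod-trans (mod-refl (lem₂ (Φ k ls q) θ h (slope q)))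
          (mod-trans (mod-- (mod-trans (mod-* (mod-refl {a = θ} refl) (mod-sym (Φ-step ls≥3 q))) total) (mod-refl refl)) (mod-refl (lem₃ _ _))))
          where
          h≢0 : h ≢ + 0
          h≢0 e = pow≢0 t 5 (trans (cong (λ z → q * (q * (q * (q * z)))) (*-identityʳ q)) e)
          t′ = proj₁ (base-shift t)
          D-Φ′ : pow (+ 1 - (q + h) * (q + h)) k * D (+ 1 + (q + h) * (q + h)) (q + h) H ≡ Φ k ls (q + h)
          D-Φ′ = subst (λ z → pow (+ 1 - z * z) k * D (+ 1 + z * z) z H ≡ Φ k ls z) (sym (proj₂ (base-shift t))) (D-Φ t′)
          total : θ * Φ k ls (q + h) ≈ Φ k ls q * θ + h * (Φ k ls q * (θ * s - + 2 * + k * q)) mod (h * h)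
          total = mod-trans (mod-refl (trans (cong (θ *_) (sym D-Φ′)) (lem₀ θ _ _)))
            (mod-trans (mod-* (θ-power q h k) (jacobi H q))
              (mod-trans (mod _ (lem₁ (pow θ k) θ (+ k) q h Dq s)) (mod-refl (cong₂ (λ x y → x * θ + h * (y * (θ * s - + 2 * + k * q))) (D-Φ t) (D-Φ t)))))

        digits : z₀ + q * (z₁ + q * (z₂ + q * (z₃ + q * z₄))) ≈ + 0 mod h
        digits = mod-trans (mod-sym (mod _ (lem q f₁ f₂ f₃ f₄ f₅ B₀ B₁ B₂ B₃ B₄))) (mod-trans (mod-- main′ (mod-refl refl)) (mod-refl (-‿inverseʳ _)))
          where
          opaque
            unfolding _+_ 0≟
            lem : ∀ q f₁ f₂ f₃ f₄ f₅ B₀ B₁ B₂ B₃ B₄ →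
              (+ 1 - q * q) * (f₁ + q * (+ 2 * f₂ + q * (+ 3 * f₃ + q * (+ 4 * f₄ + q * (+ 5 * f₅))))) - (+ 1 + q * (f₁ + q * (f₂ + q * (f₃ + q * (f₄ + q * f₅))))) * (B₀ + q * (B₁ + q * (B₂ + q * (B₃ + q * B₄)))) ≡
              ((f₁ - B₀) + q * ((+ 2 * f₂ - B₁ - f₁ * B₀) + q * ((+ 3 * f₃ - f₁ - B₂ - f₁ * B₁ - f₂ * B₀) + q * ((+ 4 * f₄ - + 2 * f₂ - B₃ - f₁ * B₂ - f₂ * B₁ - f₃ * B₀) + q * (+ 5 * f₅ - + 3 * f₃ - B₄ - f₁ * B₃ - f₂ * B₂ - f₃ * B₁ - f₄ * B₀)))))
              + ((- (+ 4 * f₄) - f₁ * B₄ - f₂ * B₃ - f₃ * B₂ - f₄ * B₁ - f₅ * B₀) + q * ((- (+ 5 * f₅) - f₂ * B₄ - f₃ * B₃ - f₄ * B₂ - f₅ * B₁) + q * ((- (f₃ * B₄) - f₄ * B₃ - f₅ * B₂) + q * ((- (f₄ * B₄) - f₅ * B₃) - q * (f₅ * B₄))))) * (q * (q * (q * (q * q))))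
            lem = solve-∀ ring
            lem₄ : ∀ q k T₀ T₁ T₂ T₃ T₄ T₅ →
              (+ 1 - q * q) * ((+ 2 * q - + 2 * (q * (q * q)) + + 2 * (q * (q * (q * (q * q))))) * T₀ + ((+ 1 - + 3 * (q * q) + + 5 * (q * (q * (q * q)))) * T₁ + ((- q + + 4 * (q * (q * q)) - + 6 * (q * (q * (q * (q * q))))) * T₂ + ((q * q - + 5 * (q * (q * (q * q)))) * T₃ + ((- (q * (q * q)) + + 2 * (q * (q * (q * (q * q))))) * T₄ + (q * (q * (q * q))) * T₅))))) - + 2 * k * q ≡
              (T₁ + q * ((+ 2 * T₀ - T₂ - + 2 * k) + q * ((T₃ - + 3 * T₁ - T₁) + q * ((+ 4 * T₂ - T₄ - + 2 * T₀ - (+ 2 * T₀ - T₂)) + q * (T₅ - + 5 * T₃ + + 5 * T₁ - (T₃ - + 3 * T₁))))))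
              + ((+ 4 * T₀ - + 10 * T₂ + + 3 * T₄) + q * ((+ 5 * T₃ - + 5 * T₁ - T₅) + q * (+ 6 * T₂ - + 2 * T₀ - + 2 * T₄))) * (q * (q * (q * (q * q))))
            lem₄ = solve-∀ ring
          Φ≈ : Φ k ls q ≈ quintic f₁ f₂ f₃ f₄ f₅ q mod h
          Φ≈ with Φ-expand ls≥3
          ... | W , _ , eW = mod (q * W q) (trans (eW q) (cong (_+_ _) (lem₅ q (W q))))
            where
            opaque
              unfolding _+_ 0≟
              lem₅ : ∀ q w → q * (q * (q * (q * (q * q)))) * w ≡ q * w * (q * (q * (q * (q * q))))
              lem₅ = solve-∀ ring
          main′ : θ * slope q ≈ quintic f₁ f₂ f₃ f₄ f₅ q * (B₀ + q * (B₁ + q * (B₂ + q * (B₃ + q * B₄)))) mod h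
          main′ = mod-trans main (mod-* Φ≈ (mod _ (lem₄ q (+ k) (T 0) (T 1) (T 2) (T 3) (T 4) (T 5))))

      divisible : ∀ z → (∀ t → z ≈ + 0 mod (base t)) → z ≡ + 0
      divisible (+ n) d = cong +_ (mod-small (d n) (ℕ.n≤1+n _) (ℕ.s≤s ℕ.z≤n))
      divisible ℤ.-[1+ n ] d = contradiction (mod-small (mod-trans (mod-trans (mod-refl (neg n)) (mod-- (mod-refl {a = + 0} refl) (d (suc n)))) (mod-refl (-‿inverseʳ (+ 0)))) (ℕ.n≤1+n _) (ℕ.s≤s ℕ.z≤n)) λ ()
        where
        opaque
          unfolding _+_
          neg : ∀ n → + suc n ≡ + 0 - ℤ.-[1+ n ]
          neg n = refl

      -- Comparison of coefficients without polynomials: z is divisible by every q >= 2 and hence 0,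
      -- after which one factor q cancels.
      next-digit : ∀ z (X Y : ℕ → ℤ) → (∀ t → z + base t * X t ≈ + 0 mod (base t * Y t)) → z ≡ + 0 × (∀ t → X t ≈ + 0 mod (Y t))
      next-digit z X Y d = z≡0 , λ t → mod-cancelˡ (base t) (λ ()) (mod-trans (mod-refl (sym (zero-+ z≡0))) (mod-trans (d t) (mod-refl (sym (zeroʳ _)))))
        where
        z≡0 : z ≡ + 0
        z≡0 = divisible z λ t → mod-trans (mod-sym (mod (X t) (cong (_+_ z) (*-comm _ _)))) (mod-weaken (Y t) (d t))

    private
      d₀ = next-digit z₀ _ _ At.digits
      d₁ = next-digit z₁ _ _ (proj₂ d₀)
      d₂ = next-digit z₂ _ _ (proj₂ d₁)
      d₃ = next-digit z₃ _ _ (proj₂ d₂)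
      z₄≡0 : z₄ ≡ + 0
      z₄≡0 = divisible z₄ (proj₂ d₃)

    -- Each equation z = 0 is linear in one new trace. So the traces of `H` are solved for in turn,
    -- in terms of its size, k, and the numbers of petals of length 3, 4 and 5.
    trace-1 : trace H 1 ≡ b
    trace-1 = trans (lem (T 1) b) (zero-- (proj₁ d₀))
      where
      opaque
        unfolding _+_ 0≟
        lem : ∀ t b → t ≡ b - (b - t)
        lem = solve-∀ ring

    trace-2 : trace H 2 ≡ + 2 * trace H 0 + b + b * b
    trace-2 = trans (lem (T 0) (T 2) (+ k)) (zero-+ (subst (λ x → + 2 * f₂ - B₁ - f₁ * x ≡ + 0) trace-1 (proj₁ d₁)))
      where
      opaque
        unfolding _+_ 0≟
        lem : ∀ T₀ T₂ k → T₂ ≡ (+ 2 * - ((+ 2 * k - + 2) + + 1) - (+ 2 * T₀ - T₂ - + 2 * k) - (+ 2 * k - + 2) * (+ 2 * k - + 2))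
          + (+ 2 * T₀ + (+ 2 * k - + 2) + (+ 2 * k - + 2) * (+ 2 * k - + 2))
        lem = solve-∀ ring

    trace-3 : trace H 3 ≡ b * b * b + + 3 * (b * b) + + 6 * b - + 6 * c₃
    trace-3 = trans (lem (T 0) (T 3) (+ k) c₃) (zero-- (subst₂ (λ x y → + 3 * f₃ - f₁ - (T 3 - + 3 * x - x) - f₁ * (+ 2 * T 0 - y - + 2 * + k) - f₂ * x ≡ + 0) trace-1 trace-2 (proj₁ d₂)))
      where
      opaque
        unfolding _+_ 0≟
        lem : ∀ T₀ T₃ k c → let b = + 2 * k - + 2 in T₃ ≡ (b * b * b + + 3 * (b * b) + + 6 * b - + 6 * c)
          - (+ 3 * - (+ 2 * c) - b - (T₃ - + 3 * b - b) - b * (+ 2 * T₀ - (+ 2 * T₀ + b + b * b) - + 2 * k) - (- (b + + 1)) * b)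
        lem = solve-∀ ring

    trace-4 : trace H 4 ≡ + 5 * trace H 2 - + 4 * trace H 0 - + 4 * f₄ + + 2 * f₂ + b * (trace H 3 - + 4 * trace H 1)
      + f₂ * (+ 2 * trace H 0 - trace H 2 - + 2 * + k) + f₃ * trace H 1
    trace-4 = trans (lem (T 0) (T 1) (T 2) (T 3) (T 4) (+ k) f₂ f₃ f₄) (zero-+ (proj₁ d₃))
      where
      opaque
        unfolding _+_ 0≟
        lem : ∀ T₀ T₁ T₂ T₃ T₄ k f₂ f₃ f₄ → let b = + 2 * k - + 2 in T₄ ≡
          (+ 4 * f₄ - + 2 * f₂ - (+ 4 * T₂ - T₄ - + 2 * T₀ - (+ 2 * T₀ - T₂)) - b * (T₃ - + 3 * T₁ - T₁) - f₂ * (+ 2 * T₀ - T₂ - + 2 * k) - f₃ * T₁)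
          + (+ 5 * T₂ - + 4 * T₀ - + 4 * f₄ + + 2 * f₂ + b * (T₃ - + 4 * T₁) + f₂ * (+ 2 * T₀ - T₂ - + 2 * k) + f₃ * T₁)
        lem = solve-∀ ring

    trace-5 : trace H 5 ≡ + 6 * trace H 3 - + 8 * trace H 1 + + 5 * f₅ - + 3 * f₃ - b * (+ 5 * trace H 2 - trace H 4 - + 4 * trace H 0)
      - f₂ * (trace H 3 - + 4 * trace H 1) - f₃ * (+ 2 * trace H 0 - trace H 2 - + 2 * + k) - f₄ * trace H 1
    trace-5 = trans (lem (T 0) (T 1) (T 2) (T 3) (T 4) (T 5) (+ k) f₂ f₃ f₄ f₅) (zero-- z₄≡0)
      where
      opaque
        unfolding _+_ 0≟
        lem : ∀ T₀ T₁ T₂ T₃ T₄ T₅ k f₂ f₃ f₄ f₅ → let b = + 2 * k - + 2 in T₅ ≡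
          (+ 6 * T₃ - + 8 * T₁ + + 5 * f₅ - + 3 * f₃ - b * (+ 5 * T₂ - T₄ - + 4 * T₀) - f₂ * (T₃ - + 4 * T₁) - f₃ * (+ 2 * T₀ - T₂ - + 2 * k) - f₄ * T₁)
          - (+ 5 * f₅ - + 3 * f₃ - (T₅ - + 5 * T₃ + + 5 * T₁ - (T₃ - + 3 * T₁)) - b * (+ 4 * T₂ - T₄ - + 2 * T₀ - (+ 2 * T₀ - T₂)) - f₂ * (T₃ - + 3 * T₁ - T₁) - f₃ * (+ 2 * T₀ - T₂ - + 2 * k) - f₄ * T₁)
        lem = solve-∀ ring

-- The first three traces as moments of the degree excess.

module DegreeMoments where
  open import Data.Integer using (_≤_)
  open Integers
  open Determinants
  open Pencils
  open Neighbours
  open PowerTraces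

  δ-sym : ∀ {n} (i j : Fin n) → δ i j ≡ δ j i
  δ-sym i j with i ≟ j | j ≟ i
  ... | yes _ | yes _ = refl
  ... | no _ | no _ = refl
  ... | yes p | no n = contradiction (sym p) n
  ... | no n | yes p = contradiction (sym p) n

  sum-δʳ : ∀ {n} (j : Fin n) (f : Fin n → ℤ) → sum (λ i → δ i j * f i) ≡ f j
  sum-δʳ j f = trans (sum-cong λ i → cong (_* f i) (δ-sym i j)) (sum-δ j f)

  module _ (G : Graph) where
    private
      V = Fin (size G)
      a = A G

    x : V → ℤ
    x = excess G

    d : V → ℤ
    d i = x i + + 2

    d≡degree : ∀ i → d i ≡ + degree G i
    d≡degree i = lem (+ degree G i)
      where
      opaque
        unfolding _+_ 0≟
        lem : ∀ d → d - + 2 + + 2 ≡ d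
        lem = solve-∀ ring

    sum-A : ∀ i → sum (a i) ≡ d i
    sum-A i = trans (sym (degree-sum G i)) (sym (d≡degree i))

    codeg : V → V → ℤ
    codeg i j = sum λ k → a i k * a k j

    A-idem : ∀ i j → a i j * a i j ≡ a i j
    A-idem i j with adj G i j
    ... | true = *-identityˡ _
    ... | false = zeroˡ _

    codeg-diag : ∀ i → codeg i i ≡ d i
    codeg-diag i = trans (sum-cong λ k → trans (cong (a i k *_) (A-sym G k i)) (A-idem i k)) (sum-A i)

    codeg-sym : ∀ i j → codeg i j ≡ codeg j i
    codeg-sym i j = sum-cong λ k → trans (*-comm _ _) (cong₂ _*_ (A-sym G k j) (A-sym G i k))

    codeg-nonneg : ∀ i j → + 0 ≤ codeg i j
    codeg-nonneg i j = sum-nonneg λ k → *-nonneg (A-nonneg G i k) (A-nonneg G k j)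

    sum-codeg : ∀ i → sum (codeg i) ≡ sum λ k → a i k * d k
    sum-codeg i = trans (sum-comm (λ j k → a i k * a k j)) (sum-cong λ k → trans (sum-*ˡ (a i k) (a k)) (cong (a i k *_) (sum-A k)))

    -- The entries of (X - A)² = X² - (XA + AX) + A².
    square : ∀ i j → power G 2 j i ≡ δ i j * (x i * x i) - (x i + x j) * a i j + codeg i j
    square i j = begin
      sum (λ k → N G i k * power G 1 j k) ≡⟨ sum-cong (λ k → trans (cong (N G i k *_) (N-δ G (+ 0) j k)) (lem (δ i k) (x i) (a i k) (δ k j) (x k) (a k j))) ⟩
      sum (λ k → (δ i k * (x i * (δ k j * x k)) - δ i k * (x i * a k j)) + (a i k * a k j - δ k j * (x k * a i k)))
        ≡⟨ trans (sum-+ _ _) (cong₂ _+_ (trans (sum-- _ _) (cong₂ _-_ (sum-δ i (λ k → x i * (δ k j * x k))) (sum-δ i (λ k → x i * a k j))))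
             (trans (sum-- _ _) (cong (λ z → codeg i j - z) (sum-δʳ j (λ k → x k * a i k))))) ⟩
      (x i * (δ i j * x i) - x i * a i j) + (codeg i j - x j * a i j) ≡⟨ lem₂ (x i) (x j) (δ i j) (a i j) (codeg i j) ⟩
      δ i j * (x i * x i) - (x i + x j) * a i j + codeg i j ∎
      where
      open ≡-Reasoning
      opaque
        unfolding _+_ 0≟
        lem : ∀ d x a d′ x′ a′ → (d * x - a) * (d′ * x′ - a′) ≡ (d * (x * (d′ * x′)) - d * (x * a′)) + (a * a′ - d′ * (x′ * a))
        lem = solve-∀ ring
        lem₂ : ∀ x y d a c → (x * (d * x) - x * a) + (c - y * a) ≡ d * (x * x) - (x + y) * a + c
        lem₂ = solve-∀ ring

    -- The trace of A³, six times the number of triangles.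
    Θ : ℤ
    Θ = sum λ v → sum λ k → a v k * codeg k v

    Θ-nonneg : + 0 ≤ Θ
    Θ-nonneg = sum-nonneg λ v → sum-nonneg λ k → *-nonneg (A-nonneg G v k) (codeg-nonneg k v)

    trace-0 : trace G 0 ≡ + size G
    trace-0 = trans (sum-cong δ-refl) (sum-one (size G))

    trace-1-x : trace G 1 ≡ sum x
    trace-1-x = sum-cong λ v → trans (N-δ G (+ 0) v v) (trans (cong₂ (λ p q → p * x v - q) (δ-refl v) (A-irrefl G v)) (lem (x v)))
      where
      opaque
        unfolding _+_ 0≟
        lem : ∀ x → + 1 * x - + 0 ≡ x
        lem = solve-∀ ring

    trace-2-x : trace G 2 ≡ sum (λ v → x v * x v) + (sum x + + 2 * + size G)
    trace-2-x = trans (sum-cong term) (trans (sum-+ _ _) (cong (_+_ _) (trans (sum-+ x (λ _ → + 2)) (cong (_+_ (sum x)) (trans (sum-const (size G) (+ 2)) (*-comm _ _))))))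
      where
      opaque
        unfolding _+_ 0≟
        lem : ∀ x d → + 1 * (x * x) - (x + x) * + 0 + d ≡ x * x + d
        lem = solve-∀ ring
      term : ∀ v → power G 2 v v ≡ x v * x v + d v
      term v = trans (square v v) (trans (cong₂ (λ p q → p * (x v * x v) - (x v + x v) * q + codeg v v) (δ-refl v) (A-irrefl G v))
        (trans (lem (x v) (codeg v v)) (cong (_+_ (x v * x v)) (codeg-diag v))))

    sum-x-A : ∀ (F : V → ℤ) → sum (λ v → sum λ k → a v k * F k) ≡ sum (λ k → F k * d k)
    sum-x-A F = trans (sum-comm (λ v k → a v k * F k)) (sum-cong λ k → trans (sum-*ʳ (F k) (λ v → a v k)) (trans (*-comm _ _) (cong (F k *_) (trans (sum-cong λ v → A-sym G v k) (sum-A k)))))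

    trace-3-x : trace G 3 ≡ sum (λ v → x v * x v * x v) + + 3 * sum (λ v → x v * d v) - Θ
    trace-3-x = begin
      sum (λ v → sum λ k → N G v k * power G 2 v k) ≡⟨ sum-cong (λ v → trans (sum-cong λ k → trans (cong (N G v k *_) (square k v)) (entry v k)) (row v)) ⟩
      sum (λ v → (x v * x v * x v + x v * d v) + ((sum (λ k → a v k * x k) + x v * d v) - sum (λ k → a v k * codeg k v)))
        ≡⟨ trans (sum-+ _ _) (cong₂ _+_ (sum-+ _ _) (trans (sum-- _ _) (cong (λ z → z - Θ) (trans (sum-+ _ _) (cong (λ z → z + sum (λ v → x v * d v)) (sum-x-A x)))))) ⟩
      (sum (λ v → x v * x v * x v) + sum (λ v → x v * d v)) + ((sum (λ v → x v * d v) + sum (λ v → x v * d v)) - Θ) ≡⟨ lem₃ _ _ Θ ⟩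
      sum (λ v → x v * x v * x v) + + 3 * sum (λ v → x v * d v) - Θ ∎
      where
      open ≡-Reasoning
      opaque
        unfolding _+_ 0≟
        lem₃ : ∀ X D T → (X + D) + ((D + D) - T) ≡ X + + 3 * D - T
        lem₃ = solve-∀ ring
        lem₁ : ∀ dl xv a dl′ xk a′ c → (dl * xv - a) * (dl′ * (xk * xk) - (xk + xv) * a′ + c) ≡
          dl * (xv * (dl′ * (xk * xk) - (xk + xv) * a′ + c)) + ((a * a′ * (xk + xv) - dl′ * (a * (xk * xk))) - a * c)
        lem₁ = solve-∀ ring
        lem₂ : ∀ x c → x * (+ 1 * (x * x) - (x + x) * + 0 + c) ≡ x * x * x + x * c
        lem₂ = solve-∀ ring
        lem₄ : ∀ a x y → a * (x + y) ≡ a * x + a * y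
        lem₄ = solve-∀ ring
        lem₅ : ∀ x → + 0 * (x * x) ≡ + 0
        lem₅ = solve-∀ ring
      entry : ∀ v k → N G v k * (δ k v * (x k * x k) - (x k + x v) * a k v + codeg k v) ≡
        δ v k * (x v * (δ k v * (x k * x k) - (x k + x v) * a k v + codeg k v)) + ((a v k * (x k + x v) - δ k v * (a v k * (x k * x k))) - a v k * codeg k v)
      entry v k = trans (lem₁ (δ v k) (x v) (a v k) (δ k v) (x k) (a k v) (codeg k v))
        (cong (λ z → δ v k * (x v * (δ k v * (x k * x k) - (x k + x v) * a k v + codeg k v)) + ((z * (x k + x v) - δ k v * (a v k * (x k * x k))) - a v k * codeg k v))
          (trans (cong (a v k *_) (A-sym G k v)) (A-idem v k)))
      row : ∀ v → sum (λ k → δ v k * (x v * (δ k v * (x k * x k) - (x k + x v) * a k v + codeg k v)) + ((a v k * (x k + x v) - δ k v * (a v k * (x k * x k))) - a v k * codeg k v)) ≡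
        (x v * x v * x v + x v * d v) + ((sum (λ k → a v k * x k) + x v * d v) - sum (λ k → a v k * codeg k v))
      row v = trans (sum-+ _ _) (cong₂ _+_
        (trans (sum-δ v _) (trans (cong₂ (λ p q → x v * (p * (x v * x v) - (x v + x v) * q + codeg v v)) (δ-refl v) (A-irrefl G v)) (trans (lem₂ (x v) (codeg v v)) (cong (λ z → x v * x v * x v + x v * z) (codeg-diag v)))))
        (trans (sum-- _ _) (cong (λ z → z - sum (λ k → a v k * codeg k v)) (trans (sum-- _ _) (trans (zero-- (trans (sum-δʳ v _) (trans (cong (_* (x v * x v)) (A-irrefl G v)) (lem₅ (x v)))))
          (trans (sum-cong λ k → lem₄ (a v k) (x k) (x v)) (trans (sum-+ _ _) (cong (_+_ _) (trans (sum-*ʳ (x v) (a v)) (trans (*-comm _ _) (cong (x v *_) (sum-A v)))))))))) ))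

-- The possible degree sequences.

module DegreeSequence where
  open import Data.Integer using (_≤_)
  open Integers
  open Determinants
  open Pencils
  open Neighbours
  open DegreeMoments

  listSum-≤ : ∀ {n} (f : Fin n → ℤ) → (∀ i → + 0 ≤ f i) → ∀ {ys} → Unique ys → + 0 ≤ sum f - listSum f ys
  listSum-≤ f f≥0 {ys} u = subst (+ 0 ≤_) (trans (sum-- f (λ i → mult ys i * f i)) (cong (λ z → sum f - z) (sum-mult ys f))) (sum-nonneg term)
    where
    term : ∀ i → + 0 ≤ f i - mult ys i * f i
    term i with i ∈? ys
    ... | yes p = ℤ.≤-reflexive (sym (trans (cong (λ z → f i - z) (trans (cong (_* f i) (mult-∈ u p)) (*-identityˡ _))) (-‿inverseʳ _)))
    ... | no p = subst (+ 0 ≤_) (sym (zero-- (trans (cong (_* f i) (mult-∉ p)) (zeroˡ _)))) (f≥0 i)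

  -- Degree 3 at the three `u`s, 1 at `z` and 2 elsewhere, encoded as one formula for the excess:
  -- sums weighted by the excess then reduce to four terms.
  record Special (H : Graph) : Set where
    field
      u₁ u₂ u₃ z : Fin (size H)
      distinct : Unique (u₁ ∷ u₂ ∷ u₃ ∷ z ∷ [])
      excess≡ : ∀ i → excess H i ≡ mult (u₁ ∷ u₂ ∷ u₃ ∷ []) i - δ z i

  RoseDegrees : ℕ → Graph → Set
  RoseDegrees k H = Σ (Fin (size H)) λ c → degree H c ≡ 2 ℕ.* k × (∀ v → ¬ (v ≡ c) → degree H v ≡ 2)

  module _ (H : Graph) where
    private
      X = excess H
      V = Fin (size H)

    degree-from-excess : ∀ {i n} → X i ≡ + n - + 2 → degree H i ≡ n
    degree-from-excess {i} {n} e = ℤ.+-injective (trans (lem (+ degree H i)) (trans (cong (_+ₗ (+ 2)) e) (sym (lem (+ n)))))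
      where
      _+ₗ_ : ℤ → ℤ → ℤ
      p +ₗ q = p + q
      opaque
        unfolding _+_ 0≟
        lem : ∀ d → d ≡ d - + 2 + + 2
        lem = solve-∀ ring

    -- One vertex of excess at least b already exhausts the sum of squares b²; so its excess is
    -- exactly b and all others are 0.
    dominant : ∀ k → 2 ℕ.≤ k → let b = + 2 * + k - + 2 in sum (λ v → X v * X v) ≡ b * b → ∀ c → b ≤ X c → RoseDegrees k H
    dominant k 2≤k M₂ c b≤ = c , degree-from-excess (trans Xc≡b (cong (λ z → z - + 2) (sym (pos-* 2 k)))) ,
        λ v v≢c → degree-from-excess (trans (other v v≢c) two)
      where
      b = + 2 * + k - + 2
      y = X c - b
      y≥0 : + 0 ≤ y
      y≥0 = difference-nonneg b≤
      b≥0 : + 0 ≤ b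
      b≥0 with ℕ.m≤n⇒∃[o]m+o≡n 2≤k
      ... | m , refl = subst (+ 0 ≤_) (sym (trans (cong (λ z → + 2 * z - + 2) (pos-+ 2 m)) (lem (+ m)))) (+-nonneg (nonneg 2) (*-nonneg (nonneg 2) (nonneg m)))
        where
        opaque
          unfolding _+_ 0≟
          lem : ∀ m → + 2 * (+ 2 + m) - + 2 ≡ + 2 + + 2 * m
          lem = solve-∀ ring
      opaque
        unfolding _+_ 0≟
        two : + 0 ≡ + 2 - + 2
        two = refl
        lem₁ : ∀ b y → (b * b - (b + y) * (b + y)) + (y * y + + 2 * b * y) ≡ + 0
        lem₁ = solve-∀ ring
        lem₂ : ∀ x b → x ≡ b + (x - b)
        lem₂ = solve-∀ ring
      rest : V → ℤ
      rest v = X v * X v - mult (c ∷ []) v * (X v * X v)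
      rest≥0 : ∀ v → + 0 ≤ rest v
      rest≥0 v with v ∈? (c ∷ [])
      ... | yes p = ℤ.≤-reflexive (sym (trans (cong (λ z → X v * X v - z) (trans (cong (_* (X v * X v)) (mult-∈ ([] ∷ []) p)) (*-identityˡ _))) (-‿inverseʳ _)))
      ... | no p = subst (+ 0 ≤_) (sym (zero-- (trans (cong (_* (X v * X v)) (mult-∉ p)) (zeroˡ _)))) (square-nonneg (X v))
      sum-rest : sum rest ≡ b * b - (b + y) * (b + y)
      sum-rest = trans (sum-- _ _) (cong₂ _-_ M₂ (trans (sum-mult (c ∷ []) (λ v → X v * X v)) (trans (+-identityʳ _) (cong (λ z → z * z) (lem₂ (X c) b)))))
      slack≥0 : + 0 ≤ y * y + + 2 * b * y
      slack≥0 = +-nonneg (square-nonneg y) (*-nonneg (*-nonneg (nonneg 2) b≥0) y≥0)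
      zero-sum : ∀ {p q} → + 0 ≤ p → + 0 ≤ q → p + q ≡ + 0 → p ≡ + 0
      zero-sum {p} {q} p≥0 q≥0 e = ℤ.≤-antisym (≤-from-difference q q≥0 (sym e)) p≥0
      rest-sum≡0 : sum rest ≡ + 0
      rest-sum≡0 = zero-sum (sum-nonneg rest≥0) slack≥0 (trans (cong (λ z → z + (y * y + + 2 * b * y)) sum-rest) (lem₁ b y))
      slack≡0 : y * y ≡ + 0
      slack≡0 = zero-sum (square-nonneg y) (*-nonneg (*-nonneg (nonneg 2) b≥0) y≥0)
        (zero-sum slack≥0 (sum-nonneg rest≥0) (trans (+-comm _ _) (trans (cong (λ z → z + (y * y + + 2 * b * y)) sum-rest) (lem₁ b y))))
      square-zero : ∀ {t} → t * t ≡ + 0 → t ≡ + 0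
      square-zero {t} e with zero-product t t e
      ... | inj₁ p = p
      ... | inj₂ p = p
      Xc≡b : X c ≡ b
      Xc≡b = trans (lem₂ (X c) b) (+-zero (square-zero slack≡0))
      other : ∀ v → ¬ v ≡ c → X v ≡ + 0
      other v v≢c = square-zero (trans (sym (zero-- (trans (cong (_* (X v * X v)) (mult-∉ {xs = c ∷ []} λ { (here e) → v≢c e })) (zeroˡ _)))) (sum-nonneg-zero rest≥0 rest-sum≡0 v))

    module _ (M₁ M₂ M₃ : ℤ) (e₁ : sum X ≡ M₁) (e₂ : sum (λ v → X v * X v) ≡ M₂) (e₃ : sum (λ v → X v * X v * X v) ≡ M₃) where

      -- The terms x²(c - x) are nonnegative.
      cubic-bound : ∀ c → (∀ v → + 0 ≤ c - X v) → + 0 ≤ c * M₂ - M₃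
      cubic-bound c h = subst (+ 0 ≤_) total (sum-nonneg λ v → *-nonneg (square-nonneg (X v)) (h v))
        where
        opaque
          unfolding _+_ 0≟
          lem : ∀ c x → x * x * (c - x) ≡ c * (x * x) - x * x * x
          lem = solve-∀ ring
        total : sum (λ v → X v * X v * (c - X v)) ≡ c * M₂ - M₃
        total = trans (sum-cong λ v → lem c (X v)) (trans (sum-- _ _) (cong₂ _-_ (trans (sum-*ˡ c _) (cong (c *_) e₂)) e₃))

    -- This is k = 3, b = 4, where the plain cubic bound is too weak; 46 = 4³ - 6·3 is the least
    -- third moment, attained with three triangles in the rose and none in `H`. As the squares sum
    -- to 16, at most one excess is 3. The third moment is then at most 27 + 2·7 = 41, and at most
    -- 32 if no excess is 3.
    no-special-4 : sum (λ v → X v * X v) ≡ + 16 → ∀ M₃ → sum (λ v → X v * X v * X v) ≡ M₃ → + 0 ≤ M₃ - + 46 → (∀ v → + 0 ≤ + 3 - X v) → ⊥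
    no-special-4 e₂ M₃ e₃ big small with any? (λ v → + 3 ℤ.≤? X v)
    ... | no none = negative-absurd (+-nonneg (cubic-bound (sum X) (+ 16) M₃ refl e₂ e₃ (+ 2) λ v → subst (λ w → + 0 ≤ w - X v) lit (≰⇒difference λ p → none (v , p))) big) (lem M₃)
      where
      opaque
        unfolding _+_ 0≟
        lit : + 3 - + 1 ≡ + 2
        lit = refl
        lem′ : ∀ m → + 2 * + 16 - m + (m - + 46) ≡ - (+ 14)
        lem′ = solve-∀ ring
        lem : ∀ m → + 2 * + 16 - m + (m - + 46) ≡ ℤ.-[1+ 13 ]
        lem = lem′
    ... | yes (i , 3≤) = negative-absurd (+-nonneg (subst (+ 0 ≤_) total (sum-nonneg term)) big) (lem M₃)
      where
      Xi : X i ≡ + 3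
      Xi = ℤ.≤-antisym (≤-from-difference (+ 3 - X i) (small i) (lem₁ (X i))) 3≤
        where
        opaque
          unfolding _+_ 0≟
          lem₁ : ∀ x → + 3 ≡ x + (+ 3 - x)
          lem₁ = solve-∀ ring
      opaque
        unfolding _+_ 0≟
        lit : + 3 - + 1 ≡ + 2
        lit = refl
        lem′ : ∀ m → + 2 * + 16 - m + + 9 + (m - + 46) ≡ - (+ 5)
        lem′ = solve-∀ ring
        lem : ∀ m → + 2 * + 16 - m + + 9 + (m - + 46) ≡ ℤ.-[1+ 4 ]
        lem = lem′
        lem₂ : ∀ c x → x * x * (c - x) ≡ c * (x * x) - x * x * x
        lem₂ = solve-∀ ring
        at-i : + 3 * + 3 * (+ 2 - + 3) + + 1 * + 9 ≡ + 0
        at-i = refl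
        at-two : ∀ y → + 16 - (+ 3 * + 3 + ((+ 3 + y) * (+ 3 + y) + + 0)) + (+ 6 * y + y * y) ≡ ℤ.-[1+ 1 ]
        at-two = at-two′
          where
          at-two′ : ∀ y → + 16 - (+ 3 * + 3 + ((+ 3 + y) * (+ 3 + y) + + 0)) + (+ 6 * y + y * y) ≡ - (+ 2)
          at-two′ = solve-∀ ring
        split : ∀ x → x ≡ + 3 + (x - + 3)
        split = solve-∀ ring
      other : ∀ v → v ≢ i → + 0 ≤ + 2 - X v
      other v v≢i with + 3 ℤ.≤? X v
      ... | no n = subst (λ w → + 0 ≤ w - X v) lit (≰⇒difference n)
      ... | yes p = negative-absurd (+-nonneg (subst (+ 0 ≤_) (cong₂ _-_ e₂ (cong₂ (λ s t → s * s + (t * t + + 0)) Xi (split (X v))))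
            (listSum-≤ (λ v → X v * X v) (λ v → square-nonneg (X v)) (((λ e → v≢i (sym e)) ∷ []) ∷ [] ∷ [])))
            (+-nonneg (*-nonneg (nonneg 6) (difference-nonneg p)) (square-nonneg (X v - + 3)))) (at-two (X v - + 3))
      -- The 9 at the vertex `i` makes up for x²(2 - x) = -9 at x = 3.
      term : ∀ v → + 0 ≤ X v * X v * (+ 2 - X v) + δ i v * + 9
      term v = by (v ≟ i)
        where
        by : Dec (v ≡ i) → + 0 ≤ X v * X v * (+ 2 - X v) + δ i v * + 9
        by (yes refl) = ℤ.≤-reflexive (sym (trans (cong₂ (λ s t → s * s * (+ 2 - s) + t * + 9) Xi (δ-refl v)) at-i))
        by (no n) = subst (+ 0 ≤_) (sym (+-zero (trans (cong (_* + 9) (δ-≢ λ e → n (sym e))) (zeroˡ _)))) (*-nonneg (square-nonneg (X v)) (other v n))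
      total : sum (λ v → X v * X v * (+ 2 - X v) + δ i v * + 9) ≡ + 2 * + 16 - M₃ + + 9
      total = trans (sum-+ _ _) (cong₂ _+_ (trans (sum-cong λ v → lem₂ (+ 2) (X v)) (trans (sum-- _ _) (cong₂ _-_ (trans (sum-*ˡ (+ 2) _) (cong (+ 2 *_) e₂)) e₃))) (sum-δ i (λ _ → + 9)))

    -- The quantity x(x - 1) sums to 2, vanishes at 0 and 1, and is n(n + 1) at x = -n. So exactly
    -- one excess is -1, all others are 0 or 1, and the first moment leaves three 1s.
    small-special : sum X ≡ + 2 → sum (λ v → X v * X v) ≡ + 4 → (∀ v → + 0 ≤ + 1 - X v) → Special H
    small-special e₁ e₂ small = special (any? λ v → X v ℤ.<? + 0)
      where
      f : V → ℤ
      f v = X v * (X v - + 1)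
      opaque
        unfolding _+_ 0≟
        lem : ∀ x → x * (x - + 1) ≡ x * x - x
        lem = solve-∀ ring
        lit₁ : + 4 - + 2 ≡ + 2
        lit₁ = refl
        too-big : ∀ n → + 0 ≤ + 1 - + suc (suc n) → ⊥
        too-big n ()
        neg-value : ∀ n → ℤ.-[1+ n ] * (ℤ.-[1+ n ] - + 1) ≡ + (suc n ℕ.* suc (suc n))
        neg-value n = cong (λ m → + (suc n ℕ.* suc (suc m))) (ℕ.+-identityʳ n)
        small-value : ∀ n → + 0 ≤ + 2 - (+ (suc n ℕ.* suc (suc n)) + + 0) → n ≡ 0
        small-value zero _ = refl
        small-value (suc n) ()
        one : + 1 - + 1 ≡ + 0
        one = refl
        minus-one : ℤ.-[1+ 0 ] ≡ + 0 - + 1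
        minus-one = refl
        three : + 2 + + 1 ≡ + 3
        three = refl
        lem₂ : ∀ i d → i ≡ (i - d) + d
        lem₂ = solve-∀ ring
      data View (x : ℤ) : Set where
        is-one : x ≡ + 1 → View x
        is-zero : x ≡ + 0 → View x
        is-neg : ∀ n → x ≡ ℤ.-[1+ n ] → View x
      view : ∀ v → View (X v)
      view v = go (X v) (small v)
        where
        go : ∀ x → + 0 ≤ + 1 - x → View x
        go (+ 0) _ = is-zero refl
        go (+ 1) _ = is-one refl
        go (+ suc (suc n)) p = ⊥-elim (too-big n p)
        go ℤ.-[1+ n ] _ = is-neg n refl
      f-value : ∀ {x} → View x → + 0 ≤ x * (x - + 1)
      f-value (is-one refl) = ℤ.≤-reflexive (sym (trans (cong (_*_ _) one) (zeroʳ _)))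
      f-value (is-zero refl) = ℤ.≤-reflexive (sym (zeroˡ _))
      f-value (is-neg n refl) = subst (+ 0 ≤_) (sym (neg-value n)) (nonneg _)
      f≥0 : ∀ v → + 0 ≤ f v
      f≥0 v = f-value (view v)
      sum-f : sum f ≡ + 2
      sum-f = trans (sum-cong λ v → lem (X v)) (trans (sum-- _ _) (trans (cong₂ _-_ e₂ e₁) lit₁))
      special : Dec (Σ V λ v → X v ℤ.< + 0) → Special H
      special (no none) = contradiction (trans (sym (sum-zero all-zero)) sum-f) λ ()
        where
        all-zero : ∀ v → f v ≡ + 0
        all-zero v with view v
        ... | is-one e = trans (cong₂ (λ p q → p * (q - + 1)) e e) (trans (cong (_*_ _) one) (zeroʳ _))
        ... | is-zero e = trans (cong (_* (X v - + 1)) e) (zeroˡ _)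
        ... | is-neg n e = contradiction (v , subst (ℤ._< + 0) (sym e) ℤ.-<+) none
      special (yes (z , z<0)) = build
        where
        Xz : X z ≡ ℤ.-[1+ 0 ]
        Xz with view z
        ... | is-one e = contradiction (subst (ℤ._< + 0) e z<0) λ { (ℤ.+<+ ()) }
        ... | is-zero e = contradiction (subst (ℤ._< + 0) e z<0) λ { (ℤ.+<+ ()) }
        ... | is-neg n e = trans e (cong ℤ.-[1+_] (small-value n (subst (+ 0 ≤_) (cong₂ (λ s t → s - (t + + 0)) sum-f (trans (cong (λ x → x * (x - + 1)) e) (neg-value n)))
                (listSum-≤ f f≥0 {z ∷ []} ([] ∷ [])))))
        fz : f z ≡ + 2
        fz = trans (cong (λ x → x * (x - + 1)) Xz) (neg-value 0)
        g : V → ℤ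
        g v = f v - mult (z ∷ []) v * f v
        g≥0 : ∀ v → + 0 ≤ g v
        g≥0 v with v ∈? (z ∷ [])
        ... | yes p = ℤ.≤-reflexive (sym (trans (cong (λ w → f v - w) (trans (cong (_* f v) (mult-∈ ([] ∷ []) p)) (*-identityˡ _))) (-‿inverseʳ _)))
        ... | no p = subst (+ 0 ≤_) (sym (zero-- (trans (cong (_* f v) (mult-∉ p)) (zeroˡ _)))) (f≥0 v)
        sum-g : sum g ≡ + 0
        sum-g = trans (sum-- _ _) (trans (cong₂ _-_ sum-f (trans (sum-mult (z ∷ []) f) (trans (+-identityʳ _) fz))) (-‿inverseʳ _))
        isOne : V → Bool
        isOne v = ⌊ X v ℤ.≟ + 1 ⌋
        isOne-value : ∀ v → isOne v ≡ true → X v ≡ + 1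
        isOne-value v e with X v ℤ.≟ + 1
        ... | yes p = p
        value : ∀ v → X v ≡ ι (isOne v) - δ z v
        value v = by (v ≟ z)
          where
          by : Dec (v ≡ z) → X v ≡ ι (isOne v) - δ z v
          by (yes refl) with X v ℤ.≟ + 1
          ... | yes p = contradiction (trans (sym Xz) p) λ ()
          ... | no _ = trans Xz (trans minus-one (cong (λ w → + 0 - w) (sym (δ-refl v))))
          by (no n) = trans (inner (view v)) (sym (zero-- (δ-≢ λ e → n (sym e))))
            where
            inner : View (X v) → X v ≡ ι (isOne v)
            inner w with X v ℤ.≟ + 1
            inner w | yes p = p
            inner (is-one p) | no q = contradiction p q
            inner (is-zero p) | no q = p
            inner (is-neg m p) | no q = contradiction (trans (sym (neg-value m)) (trans (cong (λ x → x * (x - + 1)) (sym p))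
              (trans (sym (zero-- (trans (cong (_* f v) (mult-∉ {xs = z ∷ []} λ { (here e) → n e })) (zeroˡ _)))) (sum-nonneg-zero g≥0 sum-g v)))) λ ()
        count : sum (ι ∘ isOne) ≡ + 3
        count = trans (sum-cong λ v → trans (lem₂ (ι (isOne v)) (δ z v)) (cong₂ _+_ (sym (value v)) (sym (*-identityʳ (δ z v)))))
          (trans (sum-+ _ _) (trans (cong₂ _+_ e₁ (sum-δ z (λ _ → + 1))) three))
        p₁ = count-extra isOne [] [] [] λ e → contradiction (trans (sym count) e) λ ()
        w₁ = proj₁ p₁
        p₂ = count-extra isOne (w₁ ∷ []) ([] ∷ []) (proj₂ (proj₂ p₁) ∷ []) λ e → contradiction (trans (sym count) e) λ ()
        w₂ = proj₁ p₂
        u₂ : Unique (w₂ ∷ w₁ ∷ [])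
        u₂ = ((λ e → proj₁ (proj₂ p₂) (here e)) ∷ []) ∷ [] ∷ []
        p₃ = count-extra isOne (w₂ ∷ w₁ ∷ []) u₂ (proj₂ (proj₂ p₂) ∷ proj₂ (proj₂ p₁) ∷ []) λ e → contradiction (trans (sym count) e) λ ()
        w₃ = proj₁ p₃
        u₃ : Unique (w₃ ∷ w₂ ∷ w₁ ∷ [])
        u₃ = ((λ e → proj₁ (proj₂ p₃) (here e)) ∷ (λ e → proj₁ (proj₂ p₃) (there (here e))) ∷ []) ∷ u₂
        ne : ∀ {w} → isOne w ≡ true → w ≢ z
        ne e refl = contradiction (trans (sym Xz) (isOne-value z e)) λ ()
        build : Special H
        build = record { u₁ = w₃ ; u₂ = w₂ ; u₃ = w₁ ; z = z
          ; distinct = ((λ e → proj₁ (proj₂ p₃) (here e)) ∷ (λ e → proj₁ (proj₂ p₃) (there (here e))) ∷ ne (proj₂ (proj₂ p₃)) ∷ []) ∷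
                       ((λ e → proj₁ (proj₂ p₂) (here e)) ∷ ne (proj₂ (proj₂ p₂)) ∷ []) ∷ (ne (proj₂ (proj₂ p₁)) ∷ []) ∷ [] ∷ []
          ; excess≡ = λ i → trans (value i) (cong (λ w → w - δ z i) (count-exact isOne (w₃ ∷ w₂ ∷ w₁ ∷ []) u₃ (proj₂ (proj₂ p₃) ∷ proj₂ (proj₂ p₂) ∷ proj₂ (proj₂ p₁) ∷ []) count i)) }

    -- If every excess is at most b - 1, the cubic bound gives b² <= 6c - Θ <= 6k, that is (2k - 2)²
    -- <= 6k. This survives only for k = 2 and k = 3, and k = 3 needs the closer count of
    -- `no-special-4`.
    dichotomy : ∀ k c → 2 ℕ.≤ k → c ℕ.≤ k → let b = + 2 * + k - + 2 in sum X ≡ b → sum (λ v → X v * X v) ≡ b * b →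
      sum (λ v → X v * X v * X v) ≡ b * b * b - + 6 * + c + Θ H → RoseDegrees k H ⊎ (k ≡ 2 × Special H)
    dichotomy k c 2≤k c≤k e₁ e₂ e₃ with any? (λ v → (+ 2 * + k - + 2) ℤ.≤? X v)
    ... | yes (v , p) = inj₁ (dominant k 2≤k e₂ v p)
    ... | no none = inj₂ (go k 2≤k c≤k e₁ e₂ e₃ λ v → ≰⇒difference λ p → none (v , p))
      where
      go : ∀ k → 2 ℕ.≤ k → c ℕ.≤ k → let b = + 2 * + k - + 2 in sum X ≡ b → sum (λ v → X v * X v) ≡ b * b →
        sum (λ v → X v * X v * X v) ≡ b * b * b - + 6 * + c + Θ H → (∀ v → + 0 ≤ b - + 1 - X v) → k ≡ 2 × Special H
      go 1 (ℕ.s≤s ())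
      go 2 _ _ e₁ e₂ e₃ small = refl , small-special (trans e₁ l₁) (trans e₂ l₂) (λ v → subst (λ w → + 0 ≤ w - X v) l₃ (small v))
        where
        opaque
          unfolding _+_
          l₁ : + 2 * + 2 - + 2 ≡ + 2
          l₁ = refl
          l₂ : (+ 2 * + 2 - + 2) * (+ 2 * + 2 - + 2) ≡ + 4
          l₂ = refl
          l₃ : + 2 * + 2 - + 2 - + 1 ≡ + 1
          l₃ = refl
      go 3 _ c≤3 e₁ e₂ e₃ small = ⊥-elim (no-special-4 (trans e₂ l₂) _ (trans e₃ (cong (λ w → w - + 6 * + c + Θ H) l₁))
          (subst (+ 0 ≤_) (lem (+ c) (Θ H)) (+-nonneg (*-nonneg (nonneg 6) (difference-nonneg (ℤ.+≤+ c≤3))) (Θ-nonneg H)))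
          (λ v → subst (λ w → + 0 ≤ w - X v) l₃ (small v)))
        where
        opaque
          unfolding _+_ 0≟
          l₁ : (+ 2 * + 3 - + 2) * (+ 2 * + 3 - + 2) * (+ 2 * + 3 - + 2) ≡ + 64
          l₁ = refl
          l₂ : (+ 2 * + 3 - + 2) * (+ 2 * + 3 - + 2) ≡ + 16
          l₂ = refl
          l₃ : + 2 * + 3 - + 2 - + 1 ≡ + 3
          l₃ = refl
          lem : ∀ c t → + 6 * (+ 3 - c) + t ≡ + 64 - + 6 * c + t - + 46
          lem = solve-∀ ring
      -- With k = 4 + j one has 6k - b² = -12 - 18j - 4j².
      go (suc (suc (suc (suc j)))) _ c≤k e₁ e₂ e₃ small = ⊥-elim (negative-absurd
          (+-nonneg (+-nonneg (+-nonneg (cubic-bound (sum X) _ _ refl e₂ e₃ (b - + 1) small) (Θ-nonneg H)) (*-nonneg (nonneg 6) (difference-nonneg (ℤ.+≤+ c≤k))))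
            (+-nonneg (*-nonneg (nonneg 18) (nonneg j)) (*-nonneg (nonneg 4) (square-nonneg (+ j)))))
          (lem (+ j) (+ c) (Θ H) (+ (4 ℕ.+ j)) (pos-+ 4 j)))
        where
        b = + 2 * + (4 ℕ.+ j) - + 2
        opaque
          unfolding _+_ 0≟
          lem′ : ∀ j c t → let k = + 4 + j ; b = + 2 * k - + 2 in
            (b - + 1) * (b * b) - (b * b * b - + 6 * c + t) + t + + 6 * (k - c) + (+ 18 * j + + 4 * (j * j)) ≡ - (+ 12)
          lem′ = solve-∀ ring
          lem : ∀ j c t k → k ≡ + 4 + j → let b = + 2 * k - + 2 in
            (b - + 1) * (b * b) - (b * b * b - + 6 * c + t) + t + + 6 * (k - c) + (+ 18 * j + + 4 * (j * j)) ≡ ℤ.-[1+ 11 ]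
          lem j c t k refl = lem′ j c t

-- The fourth and fifth traces of a triangle-free graph.

module HigherTraces where
  open import Data.Integer using (_≤_)
  open Integers
  open Determinants
  open Pencils
  open Neighbours
  open PowerTraces
  open DegreeMoments

  sum₂ : ∀ {m n} → (Fin m → Fin n → ℤ) → ℤ
  sum₂ f = sum λ i → sum (f i)

  sum₂-cong : ∀ {m n} {f g : Fin m → Fin n → ℤ} → (∀ i j → f i j ≡ g i j) → sum₂ f ≡ sum₂ g
  sum₂-cong h = sum-cong λ i → sum-cong (h i)

  sum₂-+ : ∀ {m n} (f g : Fin m → Fin n → ℤ) → sum₂ (λ i j → f i j + g i j) ≡ sum₂ f + sum₂ g
  sum₂-+ f g = trans (sum-cong λ i → sum-+ (f i) (g i)) (sum-+ _ _)

  sum₂-- : ∀ {m n} (f g : Fin m → Fin n → ℤ) → sum₂ (λ i j → f i j - g i j) ≡ sum₂ f - sum₂ g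
  sum₂-- f g = trans (sum-cong λ i → sum-- (f i) (g i)) (sum-- _ _)

  sum₂-*ˡ : ∀ {m n} c (f : Fin m → Fin n → ℤ) → sum₂ (λ i j → c * f i j) ≡ c * sum₂ f
  sum₂-*ˡ c f = trans (sum-cong λ i → sum-*ˡ c (f i)) (sum-*ˡ c _)

  module _ (G : Graph) where
    private
      V = Fin (size G)
      a = A G
      X = x G
      Δ = d G
      C = codeg G

    -- The diagonal of A⁴, the closed walks of length 4.
    a₄ : V → ℤ
    a₄ v = sum λ l → C v l * C v l

    X₁₁ X₂₁ : ℤ
    X₁₁ = sum₂ λ v l → X v * X l * a v l
    X₂₁ = sum₂ λ v l → X v * X v * X l * a v l

    p : V → V → ℤ
    p i j = power G 2 j i

    N² : ∀ F v → (N G · (N G · F)) v ≡ sum λ l → p v l * F l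
    N² F v = begin
      sum (λ k → N G v k * sum (λ l → N G k l * F l)) ≡⟨ sum-cong (λ k → trans (sym (sum-*ˡ (N G v k) _)) (sum-cong λ l → sym (*-assoc _ _ _))) ⟩
      sum (λ k → sum (λ l → N G v k * N G k l * F l)) ≡⟨ sum-comm _ ⟩
      sum (λ l → sum (λ k → N G v k * N G k l * F l)) ≡⟨ sum-cong (λ l → trans (sum-*ʳ (F l) _) (cong (_* F l) (sum-cong λ k → cong (N G v k *_) (sym (N-δ G (+ 0) l k))))) ⟩
      sum (λ l → p v l * F l) ∎
      where open ≡-Reasoning

    module TriangleFree (free : Θ G ≡ + 0) where

      -- Up to the symmetry of `codeg`, these products are the nonnegative summands of `Θ`.
      a*C : ∀ i j → a i j * C i j ≡ + 0
      a*C i j = trans (cong (a i j *_) (codeg-sym G i j)) (sum-nonneg-zero (λ k → *-nonneg (A-nonneg G i k) (codeg-nonneg G k i))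
        (sum-nonneg-zero (λ v → sum-nonneg λ k → *-nonneg (A-nonneg G v k) (codeg-nonneg G k v)) free i) j)

      triangle : ∀ v l m → a v l * a l m * a m v ≡ + 0
      triangle v l m = trans (lem (a v l) (a l m) (a m v)) (sum-nonneg-zero (λ k → *-nonneg (A-nonneg G m v) (*-nonneg (A-nonneg G v k) (A-nonneg G k m)))
          (trans (sum-*ˡ (a m v) _) (trans (cong (a m v *_) (codeg-sym G v m)) (a*C m v))) l)
        where
        opaque
          unfolding _+_ 0≟
          lem : ∀ a b c → a * b * c ≡ c * (a * b)
          lem = solve-∀ ring

      y : V → V → ℤ
      y i j = (X i + X j) * a i j

      y-sym : ∀ i j → y i j ≡ y j i
      y-sym i j = cong₂ _*_ (+-comm _ _) (A-sym G i j)

      private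
        diag : V → V → ℤ
        diag i j = δ i j * (X i * X i)

        diag-sym : ∀ i j → diag i j ≡ diag j i
        diag-sym i j with i ≟ j | j ≟ i
        ... | yes refl | yes _ = refl
        ... | no _ | no _ = trans (zeroˡ _) (sym (zeroˡ _))
        ... | yes q | no n = contradiction (sym q) n
        ... | no n | yes q = contradiction (sym q) n

        δa : ∀ i j → δ i j * a i j ≡ + 0
        δa i j with i ≟ j
        ... | yes refl = trans (*-identityˡ _) (A-irrefl G i)
        ... | no _ = zeroˡ _

        δδ : ∀ (i j : V) → δ i j * δ i j ≡ δ i j
        δδ i j with i ≟ j
        ... | yes _ = *-identityˡ _
        ... | no _ = zeroˡ _

      -- Two cross terms drop out: the identity against A because there are no loops, and A against
      -- A² because there are no triangles.
      entry² : ∀ v l → p v l * p l v ≡ δ v l * (X v * X v * X v * X v + + 2 * (X v * X v) * C v l) + ((X v + X l) * (X v + X l) * a v l + C v l * C v l)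
      entry² v l = begin
        p v l * p l v ≡⟨ cong₂ _*_ (square G v l) (trans (square G l v) (cong₂ _+_ (cong₂ _-_ (diag-sym l v) (y-sym l v)) (codeg-sym G l v))) ⟩
        (diag v l - y v l + C v l) * (diag v l - y v l + C v l) ≡⟨ lem (δ v l) (X v) (X v + X l) (a v l) (C v l) ⟩
        (δ v l * δ v l * (X v * X v * X v * X v) + δ v l * (+ 2 * (X v * X v) * C v l)) + ((X v + X l) * (X v + X l) * (a v l * a v l) + C v l * C v l)
          - (+ 2 * (X v * X v) * (X v + X l) * (δ v l * a v l) + + 2 * (X v + X l) * (a v l * C v l))
          ≡⟨ cong₂ _-_ (cong₂ (λ s t → (s * (X v * X v * X v * X v) + δ v l * (+ 2 * (X v * X v) * C v l)) + ((X v + X l) * (X v + X l) * t + C v l * C v l)) (δδ v l) (A-idem G v l))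
               (cong₂ (λ s t → + 2 * (X v * X v) * (X v + X l) * s + + 2 * (X v + X l) * t) (δa v l) (a*C v l)) ⟩
        (δ v l * (X v * X v * X v * X v) + δ v l * (+ 2 * (X v * X v) * C v l)) + ((X v + X l) * (X v + X l) * a v l + C v l * C v l)
          - (+ 2 * (X v * X v) * (X v + X l) * + 0 + + 2 * (X v + X l) * + 0) ≡⟨ lem₂ (δ v l) (X v * X v * X v * X v) (+ 2 * (X v * X v) * C v l) _ (+ 2 * (X v * X v) * (X v + X l)) (+ 2 * (X v + X l)) ⟩
        _ ∎
        where
        open ≡-Reasoning
        opaque
          unfolding _+_ 0≟
          lem : ∀ d x s a c → (d * (x * x) - s * a + c) * (d * (x * x) - s * a + c) ≡
            (d * d * (x * x * x * x) + d * (+ 2 * (x * x) * c)) + (s * s * (a * a) + c * c) - (+ 2 * (x * x) * s * (d * a) + + 2 * s * (a * c))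
          lem = solve-∀ ring
          lem₂ : ∀ d p q r s t → (d * p + d * q) + r - (s * + 0 + t * + 0) ≡ d * (p + q) + r
          lem₂ = solve-∀ ring

      sum-ya : sum₂ (λ v l → (X v + X l) * (X v + X l) * a v l) ≡ + 2 * sum (λ v → X v * X v * Δ v) + + 2 * X₁₁
      sum-ya = trans (sum₂-cong λ v l → lem (X v) (X l) (a v l)) (trans (sum₂-+ _ _) (cong₂ _+_ (trans (sum₂-+ _ _) (trans (cong₂ _+_ left (sum-x-A G (λ v → X v * X v))) (lem₂ _))) (sum₂-*ˡ (+ 2) _)))
        where
        left : sum₂ (λ v l → X v * X v * a v l) ≡ sum (λ v → X v * X v * Δ v)
        left = sum-cong λ v → trans (sum-*ˡ (X v * X v) (a v)) (cong (X v * X v *_) (sum-A G v))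
        opaque
          unfolding _+_ 0≟
          lem : ∀ x z a → (x + z) * (x + z) * a ≡ (x * x * a + a * (z * z)) + + 2 * (x * z * a)
          lem = solve-∀ ring
          lem₂ : ∀ s → s + s ≡ + 2 * s
          lem₂ = solve-∀ ring

      trace-4-x : trace G 4 ≡ sum (λ v → X v * X v * X v * X v) + + 4 * sum (λ v → X v * X v * Δ v) + + 2 * X₁₁ + sum a₄
      trace-4-x = begin
        trace G 4 ≡⟨ sum-cong (λ v → N² (power G 2 v) v) ⟩
        sum₂ (λ v l → p v l * p l v) ≡⟨ sum₂-cong entry² ⟩
        sum₂ (λ v l → δ v l * (X v * X v * X v * X v + + 2 * (X v * X v) * C v l) + ((X v + X l) * (X v + X l) * a v l + C v l * C v l))
          ≡⟨ trans (sum₂-+ _ _) (cong₂ _+_ diagonal (trans (sum₂-+ _ _) (cong (λ z → z + sum a₄) sum-ya))) ⟩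
        (sum (λ v → X v * X v * X v * X v) + + 2 * sum (λ v → X v * X v * Δ v)) + ((+ 2 * sum (λ v → X v * X v * Δ v) + + 2 * X₁₁) + sum a₄) ≡⟨ lem _ _ _ _ ⟩
        _ ∎
        where
        open ≡-Reasoning
        opaque
          unfolding _+_ 0≟
          lem : ∀ s t e c → (s + + 2 * t) + ((+ 2 * t + + 2 * e) + c) ≡ s + + 4 * t + + 2 * e + c
          lem = solve-∀ ring
        diagonal : sum₂ (λ v l → δ v l * (X v * X v * X v * X v + + 2 * (X v * X v) * C v l)) ≡ sum (λ v → X v * X v * X v * X v) + + 2 * sum (λ v → X v * X v * Δ v)
        diagonal = trans (sum-cong λ v → trans (sum-δ v _) (cong (λ z → X v * X v * X v * X v + z) (trans (cong (+ 2 * (X v * X v) *_) (codeg-diag G v)) (*-assoc _ _ _))))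
          (trans (sum-+ _ _) (cong (_+_ _) (sum-*ˡ (+ 2) _)))

      -- The trace of A⁵. It enters the final inequality through its sign.
      a₅ : ℤ
      a₅ = sum₂ λ v l → sum λ m → C v l * a l m * C m v

      a₅-nonneg : + 0 ≤ a₅
      a₅-nonneg = sum-nonneg λ v → sum-nonneg λ l → sum-nonneg λ m → *-nonneg (*-nonneg (codeg-nonneg G v l) (A-nonneg G l m)) (codeg-nonneg G m v)

      private
        X₃d = sum λ v → X v * X v * X v * Δ v
        Xa₄ = sum λ v → X v * a₄ v

        aC : ∀ m l → sum (λ v → C m v * a v l) ≡ sum (λ k → a m k * C k l)
        aC m l = trans (sum-cong λ v → trans (sym (sum-*ʳ (a v l) _)) (sum-cong λ k → *-assoc _ _ _))
          (trans (sum-comm _) (sum-cong λ k → sum-*ˡ (a m k) _))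

        CaaC : ∀ v → sum₂ (λ l m → a v l * a l m * C m v) ≡ a₄ v
        CaaC v = trans (sum-comm _) (sum-cong λ m → trans (sum-*ʳ (C m v) _) (cong (C v m *_) (codeg-sym G m v)))

        S₃ : sum₂ (λ v l → sum λ m → y v l * a l m * C m v) ≡ + 2 * Xa₄
        S₃ = begin
          sum₂ (λ v l → sum λ m → y v l * a l m * C m v) ≡⟨ sum₂-cong (λ v l → trans (sum-cong λ m → lem (X v) (X l) (a v l) (a l m) (C m v)) (sum-+ _ _)) ⟩
          sum₂ (λ v l → sum (λ m → X v * (a v l * a l m * C m v)) + sum (λ m → X l * (a v l * (a l m * C m v)))) ≡⟨ sum₂-+ _ _ ⟩
          sum₂ (λ v l → sum λ m → X v * (a v l * a l m * C m v)) + sum₂ (λ v l → sum λ m → X l * (a v l * (a l m * C m v))) ≡⟨ cong₂ _+_ first second ⟩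
          Xa₄ + Xa₄ ≡⟨ lem₂ Xa₄ ⟩
          + 2 * Xa₄ ∎
          where
          open ≡-Reasoning
          opaque
            unfolding _+_ 0≟
            lem : ∀ x z a b c → (x + z) * a * b * c ≡ x * (a * b * c) + z * (a * (b * c))
            lem = solve-∀ ring
            lem₂ : ∀ s → s + s ≡ + 2 * s
            lem₂ = solve-∀ ring
            lem₃ : ∀ a b c → a * (b * c) ≡ b * (c * a)
            lem₃ = solve-∀ ring
          first : sum₂ (λ v l → sum λ m → X v * (a v l * a l m * C m v)) ≡ Xa₄
          first = sum-cong λ v → trans (sum-cong λ l → sum-*ˡ (X v) _) (trans (sum-*ˡ (X v) _) (cong (X v *_) (CaaC v)))
          second : sum₂ (λ v l → sum λ m → X l * (a v l * (a l m * C m v))) ≡ Xa₄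
          second = trans (sum-comm _) (sum-cong λ l → trans (sum-cong λ v → sum-*ˡ (X l) _) (trans (sum-*ˡ (X l) _) (cong (X l *_)
            (trans (sum-comm _) (trans (sum-cong λ m → trans (sum-cong λ v → lem₃ (a v l) (a l m) (C m v)) (trans (sum-*ˡ (a l m) _) (cong (a l m *_) (aC m l)))) (back l))))))
            where
            back : ∀ l → sum (λ m → a l m * sum (λ k → a m k * C k l)) ≡ a₄ l
            back l = trans (sum-cong λ m → trans (sym (sum-*ˡ (a l m) _)) (sum-cong λ k → sym (*-assoc _ _ _))) (CaaC l)

        S₄ : sum₂ (λ v l → sum λ m → C v l * a l m * y m v) ≡ + 2 * Xa₄
        S₄ = trans (sum-cong λ v → trans (sum-comm _) (sum₂-cong λ m l → trans (lem (C v l) (a l m) (y m v)) (cong₂ _*_ (cong₂ _*_ (y-sym m v) (A-sym G l m)) (codeg-sym G v l)))) S₃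
          where
          opaque
            unfolding _+_ 0≟
            lem : ∀ c a y → c * a * y ≡ y * a * c
            lem = solve-∀ ring

        S₁′ : sum (λ v → sum λ m → X v * X v * (a v m * (X m + X v))) ≡ X₂₁ + X₃d
        S₁′ = trans (sum₂-cong λ v m → lem (X v) (X m) (a v m)) (trans (sum₂-+ _ _) (cong (_+_ X₂₁) (sum-cong λ v → trans (sum-*ˡ (X v * X v * X v) (a v)) (cong (_*_ _) (sum-A G v)))))
          where
          opaque
            unfolding _+_ 0≟
            lem : ∀ x z a → x * x * (a * (z + x)) ≡ x * x * z * a + x * x * x * a
            lem = solve-∀ ring

        S₁ : sum₂ (λ v l → sum λ m → diag v l * a l m * y m v) ≡ X₂₁ + X₃d
        S₁ = trans (sum-cong λ v → trans (sum-cong λ l → trans (sum-cong λ m → trans (*-assoc _ _ _) (*-assoc _ _ _)) (sum-*ˡ (δ v l) _)) (trans (sum-δ v _)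
            (sum-cong λ m → cong (X v * X v *_) (trans (lem (a v m) (X m + X v) (a m v)) (trans (cong (_* (X m + X v)) (trans (cong (a v m *_) (A-sym G m v)) (A-idem G v m))) refl))))) S₁′
          where
          opaque
            unfolding _+_ 0≟
            lem : ∀ a s b → a * (s * b) ≡ a * b * s
            lem = solve-∀ ring

        S₂ : sum₂ (λ v l → sum λ m → y v l * a l m * diag m v) ≡ X₂₁ + X₃d
        S₂ = trans (sum-cong λ v → trans (sum-comm _) (sum₂-cong λ m l → trans (lem (y v l) (a l m) (diag m v)) (cong₂ _*_ (cong₂ _*_ (diag-sym m v) (A-sym G l m)) (y-sym v l)))) S₁
          where
          opaque
            unfolding _+_ 0≟
            lem : ∀ y a d → y * a * d ≡ d * a * y
            lem = solve-∀ ring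

        -- Each factor p is X² - (XA + AX) + A². Of the nine products four vanish: X² with X² for
        -- want of loops, the two of X² with A² and that of the two mixed terms for want of
        -- triangles.
        middle : ∀ v l m → p v l * a l m * p m v ≡
          C v l * a l m * C m v - (diag v l * a l m * y m v + y v l * a l m * diag m v + (y v l * a l m * C m v + C v l * a l m * y m v))
        middle v l m = trans (cong₂ (λ s t → s * a l m * t) (square G v l) (square G m v))
          (trans (lem (diag v l) (y v l) (C v l) (a l m) (diag m v) (y m v) (C m v)) (+-zero zeros))
          where
          opaque
            unfolding _+_ 0≟
            lem : ∀ d y c a d′ y′ c′ → (d - y + c) * a * (d′ - y′ + c′) ≡
              (c * a * c′ - (d * a * y′ + y * a * d′ + (y * a * c′ + c * a * y′))) + (d * a * d′ + y * a * y′ + (d * a * c′ + c * a * d′))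
            lem = solve-∀ ring
            l₂ : ∀ s a b t c → s * a * b * (t * c) ≡ a * b * c * (s * t)
            l₂ = solve-∀ ring
            l₃ : + 0 + + 0 + (+ 0 + + 0) ≡ + 0
            l₃ = refl
          diag-≢ : ∀ {i j} → i ≢ j → diag i j ≡ + 0
          diag-≢ ne = trans (cong (_* _) (δ-≢ ne)) (zeroˡ _)
          dd : diag v l * a l m * diag m v ≡ + 0
          dd = by (v ≟ l) (m ≟ v)
            where
            by : Dec (v ≡ l) → Dec (m ≡ v) → diag v l * a l m * diag m v ≡ + 0
            by (yes refl) (yes refl) = trans (cong (λ z → diag v v * z * diag v v) (A-irrefl G v)) (trans (cong (_* diag v v) (zeroʳ _)) (zeroˡ _))
            by (no n) _ = trans (cong (λ z → z * a l m * diag m v) (diag-≢ n)) (trans (cong (_* diag m v) (zeroˡ _)) (zeroˡ _))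
            by (yes _) (no n) = trans (cong (diag v l * a l m *_) (diag-≢ n)) (zeroʳ _)
          yy : y v l * a l m * y m v ≡ + 0
          yy = trans (l₂ (X v + X l) (a v l) (a l m) (X m + X v) (a m v)) (trans (cong (_* ((X v + X l) * (X m + X v))) (triangle v l m)) (zeroˡ _))
          dc : ∀ v l m → diag v l * a l m * C m v ≡ + 0
          dc v l m with v ≟ l
          ... | yes refl = trans (*-assoc _ _ _) (trans (cong (_*_ _) (trans (cong (a v m *_) (codeg-sym G m v)) (a*C v m))) (zeroʳ _))
          ... | no _ = trans (cong (λ z → z * a l m * C m v) (zeroˡ _)) (trans (cong (_* C m v) (zeroˡ _)) (zeroˡ _))
          cd : C v l * a l m * diag m v ≡ + 0
          cd = trans (l₄ (C v l) (a l m) (diag m v)) (trans (cong₂ _*_ (cong₂ _*_ (diag-sym m v) (A-sym G l m)) (codeg-sym G v l)) (dc v m l))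
            where
            opaque
              unfolding _+_ 0≟
              l₄ : ∀ c a d → c * a * d ≡ d * a * c
              l₄ = solve-∀ ring
          zeros : diag v l * a l m * diag m v + y v l * a l m * y m v + (diag v l * a l m * C m v + C v l * a l m * diag m v) ≡ + 0
          zeros = trans (cong₂ _+_ (cong₂ _+_ dd yy) (cong₂ _+_ (dc v l m) cd)) l₃

      trace-5-x : trace G 5 ≡ sum (λ v → X v * X v * X v * X v * X v) + + 5 * sum (λ v → X v * X v * X v * Δ v) + + 5 * X₂₁ + + 5 * sum (λ v → X v * a₄ v) - a₅
      trace-5-x = begin
        trace G 5 ≡⟨ sum-cong (λ v → N² (power G 3 v) v) ⟩
        sum₂ (λ v l → p v l * sum (λ m → N G l m * p m v)) ≡⟨ sum₂-cong (λ v l → split v l) ⟩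
        sum₂ (λ v l → X l * (p v l * p l v) - sum (λ m → p v l * a l m * p m v)) ≡⟨ sum₂-- _ _ ⟩
        sum₂ (λ v l → X l * (p v l * p l v)) - sum₂ (λ v l → sum (λ m → p v l * a l m * p m v)) ≡⟨ cong₂ _-_ part₁ part₂ ⟩
        _ ≡⟨ lem (sum (λ v → X v * X v * X v * X v * X v)) X₃d X₂₁ Xa₄ a₅ ⟩
        _ ∎
        where
        open ≡-Reasoning
        opaque
          unfolding _+_ 0≟
          lem : ∀ s t f e c → (s + + 2 * t + (+ 3 * f + t + e)) - (c - ((f + t) + (f + t) + (+ 2 * e + + 2 * e))) ≡ s + + 5 * t + + 5 * f + + 5 * e - c
          lem = solve-∀ ring
          lem₁ : ∀ p d x a q → p * ((d * x - a) * q) ≡ d * (x * (p * q)) - p * a * q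
          lem₁ = solve-∀ ring
          lem₂ : ∀ x d z t → z * (d * (x * x * x * x + + 2 * (x * x) * t)) ≡ d * (z * (x * x * x * x) + + 2 * (z * (x * x) * t))
          lem₂ = solve-∀ ring
          lem₃ : ∀ x z a c → z * ((x + z) * (x + z) * a + c) ≡ (x * x * z * a + + 2 * (z * z * x * a) + z * z * z * a) + z * c
          lem₃ = solve-∀ ring
          lem₄ : ∀ x → x * (x * x * x * x) ≡ x * x * x * x * x
          lem₄ = solve-∀ ring
          lem₅ : ∀ x t → + 2 * (x * (x * x) * t) ≡ + 2 * (x * x * x * t)
          lem₅ = solve-∀ ring
          lem₆ : ∀ f t → f + + 2 * f + t ≡ + 3 * f + t
          lem₆ = solve-∀ ring
        split : ∀ v l → p v l * sum (λ m → N G l m * p m v) ≡ X l * (p v l * p l v) - sum (λ m → p v l * a l m * p m v)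
        split v l = trans (sym (sum-*ˡ (p v l) _)) (trans (sum-cong λ m → lem₁ (p v l) (δ l m) (X l) (a l m) (p m v)) (trans (sum-- _ _) (cong (λ z → z - sum (λ m → p v l * a l m * p m v)) (sum-δ l (λ m → X l * (p v l * p m v))))))
        part₁ : sum₂ (λ v l → X l * (p v l * p l v)) ≡ sum (λ v → X v * X v * X v * X v * X v) + + 2 * X₃d + (+ 3 * X₂₁ + X₃d + Xa₄)
        part₁ = trans (sum₂-cong λ v l → trans (cong (X l *_) (entry² v l)) (trans (distribˡ (X l) _ _) (cong₂ _+_ (lem₂ (X v) (δ v l) (X l) (C v l)) (lem₃ (X v) (X l) (a v l) (C v l * C v l)))))
          (trans (sum₂-+ _ _) (cong₂ _+_ dia (trans (sum₂-+ _ _) (cong₂ _+_ off sq))))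
          where
          dia : sum₂ (λ v l → δ v l * (X l * (X v * X v * X v * X v) + + 2 * (X l * (X v * X v) * C v l))) ≡ sum (λ v → X v * X v * X v * X v * X v) + + 2 * X₃d
          dia = trans (sum-cong λ v → trans (sum-δ v _) (cong₂ _+_ (lem₄ (X v)) (trans (lem₅ (X v) (C v v)) (cong (λ z → + 2 * (X v * X v * X v * z)) (codeg-diag G v))))) (trans (sum-+ _ _) (cong (_+_ _) (sum-*ˡ (+ 2) _)))
          flip₂₁ : sum₂ (λ v l → X l * X l * X v * a v l) ≡ X₂₁
          flip₂₁ = trans (sum-comm _) (sum₂-cong λ l v → cong (X l * X l * X v *_) (A-sym G v l))
          cube : sum₂ (λ v l → X l * X l * X l * a v l) ≡ X₃d
          cube = trans (sum₂-cong λ v l → *-comm _ _) (sum-x-A G (λ l → X l * X l * X l))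
          off : sum₂ (λ v l → X v * X v * X l * a v l + + 2 * (X l * X l * X v * a v l) + X l * X l * X l * a v l) ≡ + 3 * X₂₁ + X₃d
          off = trans (sum₂-+ _ _) (trans (cong₂ _+_ (trans (sum₂-+ _ _) (cong (_+_ X₂₁) (trans (sum₂-*ˡ (+ 2) _) (cong (+ 2 *_) flip₂₁)))) cube) (lem₆ X₂₁ X₃d))
          sq : sum₂ (λ v l → X l * (C v l * C v l)) ≡ Xa₄
          sq = trans (sum-comm _) (sum-cong λ l → trans (sum-*ˡ (X l) _) (cong (X l *_) (sum-cong λ v → cong₂ _*_ (codeg-sym G v l) (codeg-sym G v l))))
        part₂ : sum₂ (λ v l → sum (λ m → p v l * a l m * p m v)) ≡ a₅ - ((X₂₁ + X₃d) + (X₂₁ + X₃d) + (+ 2 * Xa₄ + + 2 * Xa₄))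
        part₂ = trans (sum₂-cong λ v l → trans (sum-cong (middle v l)) (trans (sum-- _ _) (cong (λ z → sum (λ m → C v l * a l m * C m v) - z) (trans (sum-+ _ _) (cong₂ _+_ (sum-+ _ _) (sum-+ _ _))))))
          (trans (sum₂-- _ _) (cong (λ z → a₅ - z) (trans (sum₂-+ _ _) (cong₂ _+_ (trans (sum₂-+ _ _) (cong₂ _+_ S₁ S₂)) (trans (sum₂-+ _ _) (cong₂ _+_ S₃ S₄))))))

-- Counting 4-cycles for the degrees 3, 3, 3, 1, 2, ..., 2.

module SpecialSums where
  open import Data.Integer using (_≤_)
  open Integers
  open Determinants
  open Pencils
  open Neighbours
  open PowerTraces
  open DegreeMoments
  open DegreeSequence
  open HigherTraces

  module SpecialGraph (H : Graph) (S : Special H) where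
    open Special S public
    V = Fin (size H)
    a = A H
    X = excess H
    C = codeg H
    n = + size H
    us : List V
    us = u₁ ∷ u₂ ∷ u₃ ∷ []

    us-unique : Unique us
    us-unique = (All.head p₁ ∷ All.head (All.tail p₁) ∷ []) ∷ (All.head p₂ ∷ []) ∷ [] ∷ []
      where
      p₁ = AllPairs.head distinct
      p₂ = AllPairs.head (AllPairs.tail distinct)

    z∉us : z ∉ us
    z∉us (here e) = All.head (All.tail (All.tail (AllPairs.head distinct))) (sym e)
    z∉us (there (here e)) = All.head (All.tail (AllPairs.head (AllPairs.tail distinct))) (sym e)
    z∉us (there (there (here e))) = All.head (AllPairs.head (AllPairs.tail (AllPairs.tail distinct))) (sym e)

    opaque
      unfolding _+_ 0≟
      lit₁ : + 1 - + 0 ≡ + 1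
      lit₁ = refl
      lit₂ : + 0 - + 1 ≡ ℤ.-[1+ 0 ]
      lit₂ = refl
      lit₃ : + 0 - + 0 ≡ + 0
      lit₃ = refl

    X-us : ∀ {i} → i ∈ us → X i ≡ + 1
    X-us {i} p = trans (excess≡ i) (trans (cong₂ _-_ (mult-∈ us-unique p) (δ-≢ λ { refl → z∉us p })) lit₁)

    X-z : X z ≡ ℤ.-[1+ 0 ]
    X-z = trans (excess≡ z) (trans (cong₂ _-_ (mult-∉ z∉us) (δ-refl z)) lit₂)

    X-other : ∀ {i} → i ∉ us → i ≢ z → X i ≡ + 0
    X-other {i} p q = trans (excess≡ i) (trans (cong₂ _-_ (mult-∉ p) (δ-≢ (q ∘ sym))) lit₃)

    -- The excess is -1, 0 or 1, so all higher moments reduce to the first two.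
    cube : ∀ i → X i * X i * X i ≡ X i
    cube i = by (i ∈? us) (i ≟ z)
      where
      opaque
        unfolding _+_
        c₁ : + 1 * + 1 * + 1 ≡ + 1
        c₁ = refl
        c₂ : ℤ.-[1+ 0 ] * ℤ.-[1+ 0 ] * ℤ.-[1+ 0 ] ≡ ℤ.-[1+ 0 ]
        c₂ = refl
        c₃ : + 0 * + 0 * + 0 ≡ + 0
        c₃ = refl
      at : ∀ {c} → c * c * c ≡ c → X i ≡ c → X i * X i * X i ≡ X i
      at p e = subst (λ t → t * t * t ≡ t) (sym e) p
      by : Dec (i ∈ us) → Dec (i ≡ z) → X i * X i * X i ≡ X i
      by (yes p) _ = at c₁ (X-us p)
      by (no _) (yes refl) = at c₂ X-z
      by (no p) (no q) = at c₃ (X-other p q)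

    sum-x : ∀ (g : V → ℤ) → sum (λ i → X i * g i) ≡ listSum g us - g z
    sum-x g = trans (sum-cong λ i → trans (cong (_* g i) (excess≡ i)) (lem (mult us i) (δ z i) (g i)))
      (trans (sum-- _ _) (cong₂ _-_ (sum-mult us g) (sum-δ z g)))
      where
      opaque
        unfolding _+_ 0≟
        lem : ∀ m d g → (m - d) * g ≡ m * g - d * g
        lem = solve-∀ ring

    x₁ : sum X ≡ + 2
    x₁ = trans (sum-cong λ i → sym (*-identityʳ (X i))) (trans (sum-x λ _ → + 1) lit)
      where
      opaque
        unfolding _+_
        lit : (+ 1 + (+ 1 + (+ 1 + + 0))) - + 1 ≡ + 2
        lit = refl

    x₂ : sum (λ i → X i * X i) ≡ + 4
    x₂ = trans (sum-x X) (trans (cong₂ _-_ (cong₂ _+_ (X-us (here refl)) (cong₂ _+_ (X-us (there (here refl))) (cong (λ t → t + + 0) (X-us (there (there (here refl))))))) X-z) lit)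
      where
      opaque
        unfolding _+_
        lit : (+ 1 + (+ 1 + (+ 1 + + 0))) - ℤ.-[1+ 0 ] ≡ + 4
        lit = refl

    x₃ : sum (λ i → X i * X i * X i) ≡ + 2
    x₃ = trans (sum-cong cube) x₁

    x₄ : sum (λ i → X i * X i * X i * X i) ≡ + 4
    x₄ = trans (sum-cong λ i → cong (_* X i) (cube i)) x₂

    x₅ : sum (λ i → X i * X i * X i * X i * X i) ≡ + 2
    x₅ = trans (sum-cong λ i → trans (cong (λ t → t * X i * X i) (cube i)) (cube i)) x₁

    x₁d : sum (λ i → X i * d H i) ≡ + 8
    x₁d = trans (sum-cong λ i → lem (X i)) (trans (sum-linear (+ 1) (+ 2) _ _) (trans (cong₂ (λ s t → + 1 * s + + 2 * t) x₂ x₁) lit))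
      where
      opaque
        unfolding _+_ 0≟
        lem : ∀ x → x * (x + + 2) ≡ + 1 * (x * x) + + 2 * x
        lem = solve-∀ ring
        lit : + 1 * + 4 + + 2 * + 2 ≡ + 8
        lit = refl

    x₂d : sum (λ i → X i * X i * d H i) ≡ + 10
    x₂d = trans (sum-cong λ i → lem (X i)) (trans (sum-linear (+ 1) (+ 2) _ _) (trans (cong₂ (λ s t → + 1 * s + + 2 * t) x₃ x₂) lit))
      where
      opaque
        unfolding _+_ 0≟
        lem : ∀ x → x * x * (x + + 2) ≡ + 1 * (x * x * x) + + 2 * (x * x)
        lem = solve-∀ ring
        lit : + 1 * + 2 + + 2 * + 4 ≡ + 10
        lit = refl

    x₃d : sum (λ i → X i * X i * X i * d H i) ≡ + 8
    x₃d = trans (sum-cong λ i → cong (_* d H i) (cube i)) x₁d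

    -- The number of edges among the vertices of degree 3, and of those from them to the vertex of
    -- degree 1.
    e₃₃ e₃₁ : ℤ
    e₃₃ = a u₁ u₂ + a u₁ u₃ + a u₂ u₃
    e₃₁ = a u₁ z + a u₂ z + a u₃ z

    private
      g : V → ℤ
      g v = sum λ l → X l * a v l
      g≡ : ∀ v → g v ≡ (a v u₁ + (a v u₂ + (a v u₃ + + 0))) - a v z
      g≡ v = sum-x (a v)
      g₁ : g u₁ ≡ (+ 0 + (a u₁ u₂ + (a u₁ u₃ + + 0))) - a u₁ z
      g₁ = trans (g≡ u₁) (cong (λ t → (t + (a u₁ u₂ + (a u₁ u₃ + + 0))) - a u₁ z) (A-irrefl H u₁))
      g₂ : g u₂ ≡ (a u₁ u₂ + (+ 0 + (a u₂ u₃ + + 0))) - a u₂ z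
      g₂ = trans (g≡ u₂) (cong₂ (λ s t → (s + (t + (a u₂ u₃ + + 0))) - a u₂ z) (A-sym H u₂ u₁) (A-irrefl H u₂))
      g₃ : g u₃ ≡ (a u₁ u₃ + (a u₂ u₃ + (+ 0 + + 0))) - a u₃ z
      g₃ = trans (g≡ u₃) (cong₂ (λ s t → s - t) (cong₂ _+_ (A-sym H u₃ u₁) (cong₂ _+_ (A-sym H u₃ u₂) (cong (λ t → t + + 0) (A-irrefl H u₃)))) refl)
      gz : g z ≡ (a u₁ z + (a u₂ z + (a u₃ z + + 0))) - + 0
      gz = trans (g≡ z) (cong₂ _-_ (cong₂ _+_ (A-sym H z u₁) (cong₂ _+_ (A-sym H z u₂) (cong (λ t → t + + 0) (A-sym H z u₃)))) (A-irrefl H z))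

    X₁₁≡ : X₁₁ H ≡ + 2 * e₃₃ - + 2 * e₃₁
    X₁₁≡ = trans (sum-cong λ v → trans (sum-cong λ l → *-assoc _ _ _) (sum-*ˡ (X v) _)) (trans (sum-x g)
      (trans (cong₂ _-_ (cong₂ _+_ g₁ (cong₂ _+_ g₂ (cong (λ t → t + + 0) g₃))) gz) (lem (a u₁ u₂) (a u₁ u₃) (a u₂ u₃) (a u₁ z) (a u₂ z) (a u₃ z))))
      where
      opaque
        unfolding _+_ 0≟
        lem : ∀ p q r s t w → (((+ 0 + (p + (q + + 0))) - s) + (((p + (+ 0 + (r + + 0))) - t) + (((q + (r + (+ 0 + + 0))) - w) + + 0))) - ((s + (t + (w + + 0))) - + 0) ≡ + 2 * (p + q + r) - + 2 * (s + t + w)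
        lem = solve-∀ ring

    X₂₁≡ : X₂₁ H ≡ + 2 * e₃₃
    X₂₁≡ = trans (sum-cong λ v → trans (sum-cong λ l → lem₀ (X v) (X l) (a v l)) (trans (sum-*ˡ (X v) _) (cong (X v *_) (sum-*ˡ (X v) _)))) (trans (sum-x λ v → X v * g v)
      (trans (cong₂ _-_ (cong₂ _+_ (cong₂ _*_ (X-us (here refl)) g₁) (cong₂ _+_ (cong₂ _*_ (X-us (there (here refl))) g₂) (cong (λ t → t + + 0) (cong₂ _*_ (X-us (there (there (here refl)))) g₃)))) (cong₂ _*_ X-z gz))
        (lem (a u₁ u₂) (a u₁ u₃) (a u₂ u₃) (a u₁ z) (a u₂ z) (a u₃ z))))
      where
      opaque
        unfolding _+_ 0≟
        lem₀ : ∀ x y a → x * x * y * a ≡ x * (x * (y * a))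
        lem₀ = solve-∀ ring
        lem : ∀ p q r s t w → (+ 1 * ((+ 0 + (p + (q + + 0))) - s) + (+ 1 * ((p + (+ 0 + (r + + 0))) - t) + (+ 1 * ((q + (r + (+ 0 + + 0))) - w) + + 0))) - ℤ.-[1+ 0 ] * ((s + (t + (w + + 0))) - + 0) ≡ + 2 * (p + q + r)
        lem = solve-∀ ring

    -- R v l = codeg (codeg − 1) off the diagonal, so q v is twice the number of 4-cycles through v.
    R : V → V → ℤ
    R v l = C v l * (C v l - + 1) - δ v l * (d H v * (d H v - + 1))

    q : V → ℤ
    q v = sum (R v)

    -- Eight times the number of 4-cycles, each counted twice at each of its four vertices.
    Q : ℤ
    Q = sum q

    R-off : ∀ {v l} → v ≢ l → R v l ≡ C v l * (C v l - + 1)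
    R-off ne = zero-- (trans (cong (_* _) (δ-≢ ne)) (zeroˡ _))

    R-diag : ∀ v → R v v ≡ + 0
    R-diag v = trans (cong₂ (λ s t → s * (s - + 1) - t * (d H v * (d H v - + 1))) (codeg-diag H v) (δ-refl v)) (lem (d H v * (d H v - + 1)))
      where
      opaque
        unfolding _+_ 0≟
        lem : ∀ m → m - + 1 * m ≡ + 0
        lem = solve-∀ ring

    R-nonneg : ∀ v l → + 0 ≤ R v l
    R-nonneg v l = by (v ≟ l)
      where
      product : ∀ c → + 0 ≤ c → + 0 ≤ c * (c - + 1)
      product (+ 0) _ = ℤ.≤-reflexive (sym (zeroˡ _))
      product (+ suc m) _ = *-nonneg (nonneg (suc m)) (subst (+ 0 ≤_) (sym (trans (cong (λ t → t - + 1) (pos-+ 1 m)) (lem (+ m)))) (nonneg m))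
        where
        opaque
          unfolding _+_ 0≟
          lem : ∀ m → + 1 + m - + 1 ≡ m
          lem = solve-∀ ring
      by : Dec (v ≡ l) → + 0 ≤ R v l
      by (yes refl) = ℤ.≤-reflexive (sym (R-diag v))
      by (no ne) = subst (+ 0 ≤_) (sym (R-off ne)) (product (C v l) (codeg-nonneg H v l))

    q-nonneg : ∀ v → + 0 ≤ q v
    q-nonneg v = sum-nonneg (R-nonneg v)

    a₄≡ : ∀ v → a₄ H v ≡ q v + (sum (λ k → a v k * d H k) + d H v * (d H v - + 1))
    a₄≡ v = trans (sum-cong λ l → lem (C v l) (δ v l * (d H v * (d H v - + 1)))) (trans (sum-+ _ _) (cong (_+_ (q v))
      (trans (sum-+ _ _) (cong₂ _+_ (sum-codeg H v) (sum-δ v (λ _ → d H v * (d H v - + 1)))))))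
      where
      opaque
        unfolding _+_ 0≟
        lem : ∀ c e → c * c ≡ (c * (c - + 1) - e) + (c + e)
        lem = solve-∀ ring

    sum-a₄ : sum (a₄ H) ≡ Q + + 22 + + 6 * n
    sum-a₄ = trans (sum-cong a₄≡) (trans (sum-+ _ _) (trans (cong (_+_ Q) (trans (sum-+ _ _) (cong₂ _+_ (trans (sum-x-A H (d H)) dd) dd₁))) (lem₂ Q n)))
      where
      opaque
        unfolding _+_ 0≟
        lem : ∀ x → (x + + 2) * (x + + 2) ≡ (+ 1 * (x * x) + + 4 * x) + + 4
        lem = solve-∀ ring
        lem₁ : ∀ x → (x + + 2) * (x + + 2 - + 1) ≡ (+ 1 * (x * x) + + 3 * x) + + 2
        lem₁ = solve-∀ ring
        lem₂ : ∀ Q n → Q + (((+ 1 * + 4 + + 4 * + 2) + n * + 4) + ((+ 1 * + 4 + + 3 * + 2) + n * + 2)) ≡ Q + + 22 + + 6 * n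
        lem₂ = solve-∀ ring
      dd : sum (λ k → d H k * d H k) ≡ (+ 1 * + 4 + + 4 * + 2) + n * + 4
      dd = trans (sum-cong λ k → lem (X k)) (trans (sum-+ _ _) (cong₂ _+_ (trans (sum-linear (+ 1) (+ 4) _ _) (cong₂ (λ s t → + 1 * s + + 4 * t) x₂ x₁)) (sum-const (size H) (+ 4))))
      dd₁ : sum (λ k → d H k * (d H k - + 1)) ≡ (+ 1 * + 4 + + 3 * + 2) + n * + 2
      dd₁ = trans (sum-cong λ k → lem₁ (X k)) (trans (sum-+ _ _) (cong₂ _+_ (trans (sum-linear (+ 1) (+ 3) _ _) (cong₂ (λ s t → + 1 * s + + 3 * t) x₂ x₁)) (sum-const (size H) (+ 2))))

    sum-Xa₄ : sum (λ v → X v * a₄ H v) ≡ (listSum q us - q z) + (+ 2 * e₃₃ - + 2 * e₃₁ + + 34)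
    sum-Xa₄ = trans (sum-cong λ v → trans (cong (X v *_) (a₄≡ v)) (lem₀ (X v) (q v) _)) (trans (sum-+ _ _) (trans (cong₂ _+_ (sum-x q) (trans (sum-+ _ _) (cong₂ _+_ mixed cubic))) (lem₂ _ e₃₃ e₃₁)))
      where
      opaque
        unfolding _+_ 0≟
        lem₀ : ∀ x q s → x * (q + (s + (x + + 2) * (x + + 2 - + 1))) ≡ x * q + (x * s + (+ 1 * (x * x * x + + 3 * (x * x)) + + 2 * x))
        lem₀ = solve-∀ ring
        lem₂ : ∀ s e f → s + (((+ 2 * e - + 2 * f) + + 2 * + 8) + (+ 1 * (+ 2 + + 3 * + 4) + + 2 * + 2)) ≡ s + (+ 2 * e - + 2 * f + + 34)
        lem₂ = solve-∀ ring
        lem₃ : ∀ x a y → x * (a * (y + + 2)) ≡ x * y * a + + 2 * (x * a)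
        lem₃ = solve-∀ ring
      mixed : sum (λ v → X v * sum (λ k → a v k * d H k)) ≡ (+ 2 * e₃₃ - + 2 * e₃₁) + + 2 * + 8
      mixed = trans (sum-cong λ v → trans (sym (sum-*ˡ (X v) _)) (sum-cong λ k → lem₃ (X v) (a v k) (X k))) (trans (sum₂-+ _ _) (cong₂ _+_ X₁₁≡
        (trans (sum₂-*ˡ (+ 2) _) (cong (+ 2 *_) (trans (sum-cong λ v → trans (sum-*ˡ (X v) (a v)) (cong (X v *_) (sum-A H v))) x₁d)))))
      cubic : sum (λ v → + 1 * (X v * X v * X v + + 3 * (X v * X v)) + + 2 * X v) ≡ + 1 * (+ 2 + + 3 * + 4) + + 2 * + 2
      cubic = trans (sum-linear (+ 1) (+ 2) _ _) (cong₂ (λ s t → + 1 * s + + 2 * t) (trans (sum-+ _ _) (cong₂ _+_ x₃ (trans (sum-*ˡ (+ 3) _) (cong (+ 3 *_) x₂)))) x₁)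

    module Free (free : Θ H ≡ + 0) where
      open TriangleFree H free public

      -- The fourth trace of `H`, computed from degrees and 4-cycles, is set against the value that
      -- the rose dictates; c stands for the number of 4-cycles of the rose.
      Q-equation : ∀ c → trace H 4 ≡ + 86 + + 6 * n + + 8 * c → Q ≡ + 20 + + 8 * c - + 4 * e₃₃ + + 4 * e₃₁
      Q-equation c t₄ = trans (lem Q n e₃₃ e₃₁) (trans (cong (λ t → t - + 66 - + 6 * n - + 4 * e₃₃ + + 4 * e₃₁)
        (trans (sym (trans trace-4-x (cong₂ _+_ (cong₂ _+_ (cong₂ _+_ x₄ (cong (+ 4 *_) x₂d)) (cong (+ 2 *_) X₁₁≡)) sum-a₄))) t₄)) (lem₂ n c e₃₃ e₃₁))
        where
        opaque
          unfolding _+_ 0≟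
          lem : ∀ Q n e f → Q ≡ (+ 4 + + 4 * + 10 + + 2 * (+ 2 * e - + 2 * f) + (Q + + 22 + + 6 * n)) - + 66 - + 6 * n - + 4 * e + + 4 * f
          lem = solve-∀ ring
          lem₂ : ∀ n c e f → (+ 86 + + 6 * n + + 8 * c) - + 66 - + 6 * n - + 4 * e + + 4 * f ≡ + 20 + + 8 * c - + 4 * e + + 4 * f
          lem₂ = solve-∀ ring

      -- The fifth trace contains the trace of XA⁴, in which each 4-cycle is weighted by the excess
      -- of its vertices. So it tells where the 4-cycles lie relative to the vertices of degree 3
      -- and 1.
      q-equation : trace H 5 ≡ + 302 → + 5 * (listSum q us - q z) ≡ + 90 - + 20 * e₃₃ + + 10 * e₃₁ + a₅
      q-equation t₅ = trans (lem (listSum q us - q z) e₃₃ e₃₁ a₅) (trans (cong (λ t → t - + 212 - + 20 * e₃₃ + + 10 * e₃₁ + a₅)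
        (trans (sym (trans trace-5-x (cong (λ t → t - a₅) (cong₂ _+_ (cong₂ _+_ (cong₂ _+_ x₅ (cong (+ 5 *_) x₃d)) (cong (+ 5 *_) X₂₁≡)) (cong (+ 5 *_) sum-Xa₄))))) t₅)) (lem₂ e₃₃ e₃₁ a₅))
        where
        opaque
          unfolding _+_ 0≟
          lem : ∀ s e f c → + 5 * s ≡ (+ 2 + + 5 * + 8 + + 5 * (+ 2 * e) + + 5 * (s + (+ 2 * e - + 2 * f + + 34)) - c) - + 212 - + 20 * e + + 10 * f + c
          lem = solve-∀ ring
          lem₂ : ∀ e f c → + 302 - + 212 - + 20 * e + + 10 * f + c ≡ + 90 - + 20 * e + + 10 * f + c
          lem₂ = solve-∀ ring

-- The two mates.

module Mates where
  fromEdges : ∀ n (e : ℕ → ℕ → Bool) → (∀ a → e a a ≡ false) → Graph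
  fromEdges n e irr = record { size = n ; adj = λ i j → e (toℕ i) (toℕ j) ∨ e (toℕ j) (toℕ i)
    ; adj-sym = λ i j → ∨-comm (e (toℕ i) (toℕ j)) _ ; adj-irrefl = λ i → cong₂ _∨_ (irr (toℕ i)) (irr (toℕ i)) }

  -- K₂,₃ with a pendant vertex at one of the three vertices of degree 2.
  edge₄ : ℕ → ℕ → Bool
  edge₄ 0 2 = true
  edge₄ 0 3 = true
  edge₄ 0 4 = true
  edge₄ 1 2 = true
  edge₄ 1 3 = true
  edge₄ 1 4 = true
  edge₄ 2 5 = true
  edge₄ _ _ = false

  edge₄-irrefl : ∀ a → edge₄ a a ≡ false
  edge₄-irrefl 0 = refl
  edge₄-irrefl 1 = refl
  edge₄-irrefl 2 = refl
  edge₄-irrefl (ℕ.suc (ℕ.suc (ℕ.suc a))) = refl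

  mate4 : Graph
  mate4 = fromEdges 6 edge₄ edge₄-irrefl

  mate4-edges : ∀ {P : Fin 6 → Fin 6 → Set} → (∀ {v w} → P v w → P w v) → P 0F 2F → P 0F 3F → P 0F 4F → P 1F 2F → P 1F 3F → P 1F 4F → P 2F 5F →
    ∀ v w → adj mate4 v w ≡ true → P v w
  mate4-edges s a b c d e f g 0F 2F refl = a
  mate4-edges s a b c d e f g 0F 3F refl = b
  mate4-edges s a b c d e f g 0F 4F refl = c
  mate4-edges s a b c d e f g 1F 2F refl = d
  mate4-edges s a b c d e f g 1F 3F refl = e
  mate4-edges s a b c d e f g 1F 4F refl = f
  mate4-edges s a b c d e f g 2F 5F refl = g
  mate4-edges s a b c d e f g 2F 0F refl = s a
  mate4-edges s a b c d e f g 3F 0F refl = s b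
  mate4-edges s a b c d e f g 4F 0F refl = s c
  mate4-edges s a b c d e f g 2F 1F refl = s d
  mate4-edges s a b c d e f g 3F 1F refl = s e
  mate4-edges s a b c d e f g 4F 1F refl = s f
  mate4-edges s a b c d e f g 5F 2F refl = s g
  mate4-edges _ _ _ _ _ _ _ _ 3F 2F ()
  mate4-edges _ _ _ _ _ _ _ _ 3F 3F ()
  mate4-edges _ _ _ _ _ _ _ _ 3F 4F ()
  mate4-edges _ _ _ _ _ _ _ _ 3F 5F ()
  mate4-edges _ _ _ _ _ _ _ _ 4F 2F ()
  mate4-edges _ _ _ _ _ _ _ _ 4F 3F ()
  mate4-edges _ _ _ _ _ _ _ _ 4F 4F ()
  mate4-edges _ _ _ _ _ _ _ _ 4F 5F ()

  -- Two 4-cycles sharing the edge 01, with a pendant vertex at 2.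
  edge₅ : ℕ → ℕ → Bool
  edge₅ 0 1 = true
  edge₅ 0 2 = true
  edge₅ 2 3 = true
  edge₅ 1 3 = true
  edge₅ 0 4 = true
  edge₅ 4 5 = true
  edge₅ 1 5 = true
  edge₅ 2 6 = true
  edge₅ _ _ = false

  edge₅-irrefl : ∀ a → edge₅ a a ≡ false
  edge₅-irrefl 0 = refl
  edge₅-irrefl 1 = refl
  edge₅-irrefl 2 = refl
  edge₅-irrefl 3 = refl
  edge₅-irrefl 4 = refl
  edge₅-irrefl (ℕ.suc (ℕ.suc (ℕ.suc (ℕ.suc (ℕ.suc a))))) = refl

  mate5 : Graph
  mate5 = fromEdges 7 edge₅ edge₅-irrefl

  mate5-edges : ∀ {P : Fin 7 → Fin 7 → Set} → (∀ {v w} → P v w → P w v) → P 0F 1F → P 0F 2F → P 2F 3F → P 1F 3F → P 0F 4F → P 4F 5F → P 1F 5F → P 2F 6F →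
    ∀ v w → adj mate5 v w ≡ true → P v w
  mate5-edges s a b c d e f g h 0F 1F refl = a
  mate5-edges s a b c d e f g h 0F 2F refl = b
  mate5-edges s a b c d e f g h 2F 3F refl = c
  mate5-edges s a b c d e f g h 1F 3F refl = d
  mate5-edges s a b c d e f g h 0F 4F refl = e
  mate5-edges s a b c d e f g h 4F 5F refl = f
  mate5-edges s a b c d e f g h 1F 5F refl = g
  mate5-edges s a b c d e f g h 2F 6F refl = h
  mate5-edges s a b c d e f g h 1F 0F refl = s a
  mate5-edges s a b c d e f g h 2F 0F refl = s b
  mate5-edges s a b c d e f g h 3F 2F refl = s c
  mate5-edges s a b c d e f g h 3F 1F refl = s d
  mate5-edges s a b c d e f g h 4F 0F refl = s e
  mate5-edges s a b c d e f g h 5F 4F refl = s f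
  mate5-edges s a b c d e f g h 5F 1F refl = s g
  mate5-edges s a b c d e f g h 6F 2F refl = s h
  mate5-edges _ _ _ _ _ _ _ _ _ 3F 3F ()
  mate5-edges _ _ _ _ _ _ _ _ _ 3F 4F ()
  mate5-edges _ _ _ _ _ _ _ _ _ 3F 5F ()
  mate5-edges _ _ _ _ _ _ _ _ _ 3F 6F ()
  mate5-edges _ _ _ _ _ _ _ _ _ 6F 3F ()
  mate5-edges _ _ _ _ _ _ _ _ _ 6F 4F ()
  mate5-edges _ _ _ _ _ _ _ _ _ 6F 5F ()
  mate5-edges _ _ _ _ _ _ _ _ _ 6F 6F ()

  -- Both polynomials are evaluated, and they agree even as lists of coefficients.
  mate4-cospectral : lapCharPoly (R3 4) ≡ lapCharPoly mate4
  mate4-cospectral = refl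

  mate5-cospectral : lapCharPoly (R3 5) ≡ lapCharPoly mate5
  mate5-cospectral = refl

-- The special degree sequence forces one of the two mates.

module MateClassification where
  open import Data.Integer using (_≤_)
  open Integers
  open Determinants
  open Pencils
  open Neighbours
  open Embeddings
  open Connectivity using (unique-length)
  open PowerTraces using (trace)
  open DegreeMoments using (codeg; codeg-nonneg; Θ)
  open DegreeSequence
  open HigherTraces using (module TriangleFree)
  open SpecialSums
  open Mates

  lookup-injective : ∀ {n} {xs : List (Fin n)} → Unique xs → ∀ {i j} → lookup xs i ≡ lookup xs j → i ≡ j
  lookup-injective {xs = x ∷ xs} (p ∷ u) {zero} {zero} e = refl
  lookup-injective {xs = x ∷ xs} (p ∷ u) {zero} {suc j} e = contradiction e (All.lookup p (∈-lookup j))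
  lookup-injective {xs = x ∷ xs} (p ∷ u) {suc i} {zero} e = contradiction (sym e) (All.lookup p (∈-lookup i))
  lookup-injective {xs = x ∷ xs} (p ∷ u) {suc i} {suc j} e = cong suc (lookup-injective u e)

  nbrs-bound : ∀ H v ys → Unique ys → All (λ y → adj H v y ≡ true) ys → length ys ℕ.≤ degree H v
  nbrs-bound H v ys u as = ℤ.drop‿+≤+ (≤-from-difference _ (listSum-≤ (A H v) (A-nonneg H v) u) (trans (degree-sum H v) (trans (lem (sum (A H v)) (listSum (A H v) ys)) (cong (λ t → t + (sum (A H v) - listSum (A H v) ys)) (ones ys as)))))
    where
    opaque
      unfolding _+_ 0≟
      lem : ∀ s t → s ≡ t + (s - t)
      lem = solve-∀ ring
    ones : ∀ ys → All (λ y → adj H v y ≡ true) ys → listSum (A H v) ys ≡ + length ys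
    ones [] [] = refl
    ones (y ∷ ys) (p ∷ ps) = trans (cong₂ _+_ (A-true H p) (ones ys ps)) (sym (pos-+ 1 (length ys)))

  closed-covers : ∀ {H} → Connected H → ∀ (L : List (Fin (size H))) {v} → v ∈ L → (∀ {u w} → u ∈ L → adj H u w ≡ true → w ∈ L) → ∀ w → w ∈ L
  closed-covers {H} conn L {v} v∈ cl w = go v∈ (conn v w)
    where
    go : ∀ {u} → u ∈ L → Reach H u w → w ∈ L
    go u∈ Reach.here = u∈
    go u∈ (Reach.step e r) = go (cl u∈ e) r

  common : (H : Graph) → Fin (size H) → Fin (size H) → Fin (size H) → Bool
  common H i j k = adj H i k ∧ adj H k j

  codeg-count : ∀ H i j → codeg H i j ≡ sum (ι ∘ common H i j)
  codeg-count H i j = sum-cong λ k → lem (adj H i k) (adj H k j)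
    where
    lem : ∀ b b′ → ι b * ι b′ ≡ ι (b ∧ b′)
    lem true b′ = *-identityˡ _
    lem false b′ = zeroˡ _

  common-split : ∀ H {i j k} → common H i j k ≡ true → adj H i k ≡ true × adj H k j ≡ true
  common-split H {i} {j} {k} e with adj H i k | adj H k j
  ... | true | true = refl , refl

  codeg-lower : ∀ H i j ks → Unique ks → All (λ k → adj H i k ≡ true × adj H k j ≡ true) ks → + 0 ≤ codeg H i j - + length ks
  codeg-lower H i j ks u as = subst (λ t → + 0 ≤ codeg H i j - t) (ones ks as) (listSum-≤ _ (λ k → *-nonneg (A-nonneg H i k) (A-nonneg H k j)) u)
    where
    ones : ∀ ks → All (λ k → adj H i k ≡ true × adj H k j ≡ true) ks → listSum (λ k → A H i k * A H k j) ks ≡ + length ks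
    ones [] [] = refl
    ones (k ∷ ks) ((p , q) ∷ ps) = trans (cong₂ _+_ (trans (cong₂ _*_ (A-true H p) (A-true H q)) (*-identityˡ _)) (ones ks ps)) (sym (pos-+ 1 (length ks)))

  module Specials (H : Graph) (S : Special H) where
    open SpecialGraph H S

    private
      opaque
        unfolding _+_
        three : + 1 ≡ + 3 - + 2
        three = refl
        one : ℤ.-[1+ 0 ] ≡ + 1 - + 2
        one = refl
        two : + 0 ≡ + 2 - + 2
        two = refl

    degree-us : ∀ {i} → i ∈ us → degree H i ≡ 3
    degree-us p = degree-from-excess H (trans (X-us p) three)

    degree-z : degree H z ≡ 1
    degree-z = degree-from-excess H (trans X-z one)

    degree-other : ∀ {i} → i ∉ us → i ≢ z → degree H i ≡ 2
    degree-other p q = degree-from-excess H (trans (X-other p q) two)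

    degree≤3 : ∀ i → degree H i ℕ.≤ 3
    degree≤3 i with i ∈? us | i ≟ z
    ... | yes p | _ = ℕ.≤-reflexive (degree-us p)
    ... | no p | yes refl = ℕ.≤-trans (ℕ.≤-reflexive degree-z) (ℕ.s≤s ℕ.z≤n)
    ... | no p | no q = ℕ.≤-trans (ℕ.≤-reflexive (degree-other p q)) (ℕ.s≤s (ℕ.s≤s ℕ.z≤n))

    three-nbrs : ∀ {i ys} → length ys ≡ 3 → Unique ys → All (λ y → adj H i y ≡ true) ys → i ∈ us × Nbrs H i ys
    three-nbrs {i} {ys} l u as = by (i ∈? us) (i ≟ z) , nbrs-intro H i ys u as deg
      where
      deg : degree H i ≡ length ys
      deg = ℕ.≤-antisym (ℕ.≤-trans (degree≤3 i) (ℕ.≤-reflexive (sym l))) (nbrs-bound H i ys u as)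
      deg3 : degree H i ≡ 3
      deg3 = trans deg l
      by : Dec (i ∈ us) → Dec (i ≡ z) → i ∈ us
      by (yes p) _ = p
      by (no p) (yes refl) = contradiction (trans (sym degree-z) deg3) λ ()
      by (no p) (no q) = contradiction (trans (sym (degree-other p q)) deg3) λ ()

    two-nbrs : ∀ {i y y′} → y ≢ y′ → adj H i y ≡ true → adj H i y′ ≡ true → i ≢ z × (i ∈ us ⊎ Nbrs H i (y ∷ y′ ∷ []))
    two-nbrs {i} {y} {y′} ne e e′ = i≢z , by (i ∈? us)
      where
      u : Unique (y ∷ y′ ∷ [])
      u = (ne ∷ []) ∷ [] ∷ []
      i≢z : i ≢ z
      i≢z refl = contradiction (subst (2 ℕ.≤_) degree-z (nbrs-bound H i (y ∷ y′ ∷ []) u (e ∷ e′ ∷ []))) λ { (ℕ.s≤s ()) }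
      by : Dec (i ∈ us) → i ∈ us ⊎ Nbrs H i (y ∷ y′ ∷ [])
      by (yes p) = inj₁ p
      by (no p) = inj₂ (nbrs-intro H i (y ∷ y′ ∷ []) u (e ∷ e′ ∷ []) (degree-other p i≢z))

    -- The three vertices of degree 3 have no preferred order; here a configuration gets to name
    -- them as it needs.
    relabel : ∀ p q r → Unique (p ∷ q ∷ r ∷ []) → p ∈ us → q ∈ us → r ∈ us → Special H
    relabel p q r u p∈ q∈ r∈ = record { u₁ = p ; u₂ = q ; u₃ = r ; z = z ; distinct = dist ; excess≡ = λ i → trans (excess≡ i) (cong (λ t → t - δ z i) (same i)) }
      where
      pqr : List V
      pqr = p ∷ q ∷ r ∷ []
      sub : ∀ {i} → i ∈ pqr → i ∈ us
      sub (here refl) = p∈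
      sub (there (here refl)) = q∈
      sub (there (there (here refl))) = r∈
      ne : ∀ {i} → i ∈ us → i ≢ z
      ne i∈ refl = z∉us i∈
      dist : Unique (p ∷ q ∷ r ∷ z ∷ [])
      dist = (All.head (AllPairs.head u) ∷ All.head (All.tail (AllPairs.head u)) ∷ ne p∈ ∷ []) ∷ (All.head (AllPairs.head (AllPairs.tail u)) ∷ ne q∈ ∷ []) ∷ (ne r∈ ∷ []) ∷ [] ∷ []
      opaque
        unfolding _+_ 0≟
        lem : ∀ a b → a ≡ (a - b) + b
        lem = solve-∀ ring
      g≥0 : ∀ i → + 0 ≤ mult us i - mult pqr i
      g≥0 i with i ∈? pqr
      ... | yes w = ℤ.≤-reflexive (sym (trans (cong₂ _-_ (mult-∈ us-unique (sub w)) (mult-∈ u w)) (-‿inverseʳ _)))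
      ... | no w = subst (+ 0 ≤_) (sym (zero-- (mult-∉ w))) (mult-nonneg us i)
      same : ∀ i → mult us i ≡ mult pqr i
      same i = trans (lem (mult us i) (mult pqr i)) (zero-+ (sum-nonneg-zero g≥0 (trans (sum-- _ _) (trans (cong₂ _-_ (sum-mult-one us) (sum-mult-one pqr)) (-‿inverseʳ _))) i))

    R≥2 : ∀ {v l} → v ≢ l → + 0 ≤ C v l - + 2 → + 0 ≤ R v l - + 2
    R≥2 {v} {l} ne h = subst (+ 0 ≤_) (sym (trans (cong (λ t → t - + 2) (R-off ne)) (lem (C v l)))) (*-nonneg h (+-nonneg (codeg-nonneg H v l) (nonneg 1)))
      where
      opaque
        unfolding _+_ 0≟
        lem : ∀ c → c * (c - + 1) - + 2 ≡ (c - + 2) * (c + + 1)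
        lem = solve-∀ ring

    R≥6 : ∀ {v l} → v ≢ l → + 0 ≤ C v l - + 3 → + 0 ≤ R v l - + 6
    R≥6 {v} {l} ne h = subst (+ 0 ≤_) (sym (trans (cong (λ t → t - + 6) (R-off ne)) (lem (C v l)))) (*-nonneg h (+-nonneg (codeg-nonneg H v l) (nonneg 2)))
      where
      opaque
        unfolding _+_ 0≟
        lem : ∀ c → c * (c - + 1) - + 6 ≡ (c - + 3) * (c + + 2)
        lem = solve-∀ ring

    q≥R : ∀ v l {m} → + 0 ≤ R v l - m → + 0 ≤ q v - m
    q≥R v l {m} h = subst (+ 0 ≤_) (lem (q v) (R v l) m) (+-nonneg (listSum-≤ (R v) (R-nonneg v) {l ∷ []} ([] ∷ [])) h)
      where
      opaque
        unfolding _+_ 0≟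
        lem : ∀ q r m → q - (r + + 0) + (r - m) ≡ q - m
        lem = solve-∀ ring

    q≥R² : ∀ v l l′ → l ≢ l′ → + 0 ≤ R v l - + 2 → + 0 ≤ R v l′ - + 2 → + 0 ≤ q v - + 4
    q≥R² v l l′ ne h h′ = subst (+ 0 ≤_) (lem (q v) (R v l) (R v l′)) (+-nonneg (listSum-≤ (R v) (R-nonneg v) {l ∷ l′ ∷ []} ((ne ∷ []) ∷ [] ∷ [])) (+-nonneg h h′))
      where
      opaque
        unfolding _+_ 0≟
        lem : ∀ q r s → q - (r + (s + + 0)) + ((r - + 2) + (s - + 2)) ≡ q - + 4
        lem = solve-∀ ring

  -- What a rose made of one triangle and one longer cycle imposes on `H`; `c₄` is 1 when the longer
  -- cycle has length 4. The fifth trace is recorded from eight vertices on: there the rose has no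
  -- cycle of length 4 or 5, and two disjoint 4-cycles would have room.
  record Spectrum (H : Graph) : Set where
    field
      connected : Connected H
      free  : Θ H ≡ + 0
      c₄    : ℕ
      t₄    : trace H 4 ≡ + 86 + + 6 * + size H + + 8 * + c₄
      c₄≤1  : c₄ ℕ.≤ 1
      small : c₄ ≡ 1 → size H ℕ.≤ 6
      large : 8 ℕ.≤ size H → trace H 5 ≡ + 302

  module Classification (H : Graph) (spectrum : Spectrum H) where
    open Spectrum spectrum

    V = Fin (size H)

    _~_ : V → V → Set
    i ~ j = adj H i j ≡ true

    flip : ∀ {i j} → i ~ j → j ~ i
    flip = adj-flip H

    no-triangle : ∀ {i j k} → i ~ j → j ~ k → k ~ i → ⊥
    no-triangle {i} {j} {k} p q r = contradiction (trans (sym (trans (cong₂ _*_ (cong₂ _*_ (A-true H p) (A-true H q)) (A-true H r)) lit)) (TriangleFree.triangle H free i j k)) λ ()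
      where
      opaque
        unfolding _+_
        lit : + 1 * + 1 * + 1 ≡ + 1
        lit = refl

    non-adjacent : ∀ {i j} → ¬ i ~ j → A H i j ≡ + 0
    non-adjacent n = A-false H n

    -- The two hubs and three further vertices of K₂,₃; the third vertex of degree 3 is k.
    module K₂₃ (S : Special H) (i j k l m : V) (i≢j : i ≢ j) (distinct : Unique (k ∷ l ∷ m ∷ []))
               (ik : i ~ k) (il : i ~ l) (im : i ~ m) (jk : j ~ k) (jl : j ~ l) (jm : j ~ m)
               (k∈ : k ∈ SpecialGraph.us H S) where
      private
        k≢l = All.head (AllPairs.head distinct)
        k≢m = All.head (All.tail (AllPairs.head distinct))
        l≢m = All.head (AllPairs.head (AllPairs.tail distinct))
        i-nbrs = Specials.three-nbrs H S {i} refl distinct (ik ∷ il ∷ im ∷ [])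
        j-nbrs = Specials.three-nbrs H S {j} refl distinct (jk ∷ jl ∷ jm ∷ [])
        S′ : Special H
        S′ = Specials.relabel H S i j k ((i≢j ∷ adj-≢ H ik ∷ []) ∷ (adj-≢ H jk ∷ []) ∷ [] ∷ []) (proj₁ i-nbrs) (proj₁ j-nbrs) k∈
        open SpecialGraph H S′ hiding (distinct; V)
        open Specials H S′
        l∉us : l ∉ us
        l∉us (here refl) = contradiction refl (adj-≢ H il)
        l∉us (there (here refl)) = contradiction refl (adj-≢ H jl)
        l∉us (there (there (here e))) = k≢l (sym e)
        m∉us : m ∉ us
        m∉us (here refl) = contradiction refl (adj-≢ H im)
        m∉us (there (here refl)) = contradiction refl (adj-≢ H jm)
        m∉us (there (there (here e))) = k≢m (sym e)
        l≢z : l ≢ z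
        l≢z = proj₁ (two-nbrs i≢j (flip il) (flip jl))
        m≢z : m ≢ z
        m≢z = proj₁ (two-nbrs i≢j (flip im) (flip jm))
        k≢z : k ≢ z
        k≢z = proj₁ (two-nbrs i≢j (flip ik) (flip jk))
        hub-z : ∀ {h} → Nbrs H h (k ∷ l ∷ m ∷ []) → ¬ h ~ z
        hub-z nb e with nbrs-elim {H} {ys = k ∷ l ∷ m ∷ []} nb e
        ... | here p = k≢z (sym p)
        ... | there (here p) = l≢z (sym p)
        ... | there (there (here p)) = m≢z (sym p)
        e₃₃≡ : e₃₃ ≡ + 0 + + 1 + + 1
        e₃₃≡ = cong₂ _+_ (cong₂ _+_ (non-adjacent λ e → no-triangle e jk (flip ik)) (A-true H ik)) (A-true H jk)
        e₃₁≡ : e₃₁ ≡ + 0 + + 0 + A H k z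
        e₃₁≡ = cong₂ (λ s t → s + t + A H k z) (non-adjacent (hub-z (proj₂ i-nbrs))) (non-adjacent (hub-z (proj₂ j-nbrs)))
        hubs : ∀ {v v′} → v ≢ v′ → v ~ k → v ~ l → v ~ m → v′ ~ k → v′ ~ l → v′ ~ m → + 0 ≤ q v - + 6
        hubs {v} {v′} ne vk vl vm wk wl wm = q≥R v v′ (R≥6 ne (codeg-lower H v v′ (k ∷ l ∷ m ∷ []) distinct ((vk , flip wk) ∷ (vl , flip wl) ∷ (vm , flip wm) ∷ [])))
        pair : ∀ {v w} → v ≢ w → i ~ v → i ~ w → j ~ v → j ~ w → + 0 ≤ R v w - + 2
        pair {v} {w} ne iv iw jv jw = R≥2 ne (codeg-lower H v w (i ∷ j ∷ []) ((i≢j ∷ []) ∷ [] ∷ []) ((flip iv , iw) ∷ (flip jv , jw) ∷ []))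
        five : Unique (i ∷ j ∷ k ∷ l ∷ m ∷ [])
        five = (i≢j ∷ adj-≢ H ik ∷ adj-≢ H il ∷ adj-≢ H im ∷ []) ∷ (adj-≢ H jk ∷ adj-≢ H jl ∷ adj-≢ H jm ∷ []) ∷ distinct
        -- The hubs have codegree at least 3 with each other, giving 3·2 = 6 each; `k`, `l`, `m`
        -- have codegree at least 2 with one another, giving 2 + 2 each.
        Q≥24 : + 0 ≤ Q - + 24
        Q≥24 = subst (+ 0 ≤_) (lem Q (q i) (q j) (q k) (q l) (q m))
          (+-nonneg (listSum-≤ q q-nonneg five) (+-nonneg (hubs i≢j ik il im jk jl jm) (+-nonneg (hubs (i≢j ∘ sym) jk jl jm ik il im)
            (+-nonneg (q≥R² k l m l≢m (pair k≢l ik il jk jl) (pair k≢m ik im jk jm)) (+-nonneg (q≥R² l k m k≢m (pair (k≢l ∘ sym) il ik jl jk) (pair l≢m il im jl jm)) (q≥R² m k l k≢l (pair (k≢m ∘ sym) im ik jm jk) (pair (l≢m ∘ sym) im il jm jl)))))))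
          where
          opaque
            unfolding _+_ 0≟
            lem : ∀ Q a b c d e → Q - (a + (b + (c + (d + (e + + 0))))) + ((a - + 6) + ((b - + 6) + ((c - + 4) + ((d - + 4) + (e - + 4))))) ≡ Q - + 24
            lem = solve-∀ ring
        -- Here two of the pairs of degree-3 vertices are adjacent, so Q = 12 + 8c₄, plus 4 if `k`
        -- and `z` are adjacent. With c₄ <= 1, without that edge Q would be at most 20.
        kz : k ~ z
        kz = decidable-stable (adj H k z Bool.≟ true) λ n → negative-absurd (+-nonneg Q≥24 (*-nonneg (nonneg 8) (difference-nonneg (ℤ.+≤+ c₄≤1))))
          (trans (cong (λ t → t - + 24 + + 8 * (+ 1 - + c₄)) (trans (Free.Q-equation free (+ c₄) t₄) (cong₂ (λ s t → + 20 + + 8 * + c₄ - + 4 * s + + 4 * t) e₃₃≡ (trans e₃₁≡ (cong (λ t → + 0 + + 0 + t) (non-adjacent n)))))) (lem (+ c₄)))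
          where
          opaque
            unfolding _+_ 0≟
            lem′ : ∀ c → (+ 20 + + 8 * c - + 4 * (+ 0 + + 1 + + 1) + + 4 * (+ 0 + + 0 + + 0)) - + 24 + + 8 * (+ 1 - c) ≡ - (+ 4)
            lem′ = solve-∀ ring
            lem : ∀ c → (+ 20 + + 8 * c - + 4 * (+ 0 + + 1 + + 1) + + 4 * (+ 0 + + 0 + + 0)) - + 24 + + 8 * (+ 1 - c) ≡ ℤ.-[1+ 3 ]
            lem = lem′
        vertices : List V
        vertices = i ∷ j ∷ k ∷ l ∷ m ∷ z ∷ []
        us≢z : ∀ {v} → v ∈ us → v ≢ z
        us≢z v∈ refl = z∉us v∈
        six : Unique vertices
        six = (i≢j ∷ adj-≢ H ik ∷ adj-≢ H il ∷ adj-≢ H im ∷ us≢z (here refl) ∷ []) ∷ (adj-≢ H jk ∷ adj-≢ H jl ∷ adj-≢ H jm ∷ us≢z (there (here refl)) ∷ []) ∷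
              (k≢l ∷ k≢m ∷ k≢z ∷ []) ∷ (l≢m ∷ l≢z ∷ []) ∷ (m≢z ∷ []) ∷ [] ∷ []
        f : Fin 6 → V
        f = lookup vertices
        edge : ∀ v w → adj mate4 v w ≡ true → f v ~ f w
        edge = mate4-edges flip ik il im jk jl jm kz
        deg : ∀ v → degree mate4 v ≡ degree H (f v)
        deg 0F = sym (degree-us (here refl))
        deg 1F = sym (degree-us (there (here refl)))
        deg 2F = sym (degree-us (there (there (here refl))))
        deg 3F = sym (degree-other l∉us l≢z)
        deg 4F = sym (degree-other m∉us m≢z)
        deg 5F = sym degree-z

      iso : Iso mate4 H
      iso = embedding-iso mate4 H f (lookup-injective six) (λ {v} {w} → edge v w) deg connected 0F

    -- Two 4-cycles sharing the edge v w; the third vertex of degree 3 is y.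
    module Domino (S : Special H) (v w x y x′ y′ : V) (v≢x : v ≢ x) (v≢x′ : v ≢ x′) (w≢y : w ≢ y) (w≢y′ : w ≢ y′) (x≢x′ : x ≢ x′) (y≢y′ : y ≢ y′)
                  (vw : v ~ w) (wx : w ~ x) (xy : x ~ y) (yv : y ~ v) (wx′ : w ~ x′) (xy′ : x′ ~ y′) (yv′ : y′ ~ v)
                  (y∈ : y ∈ SpecialGraph.us H S) where
      private
        x≢y′ : x ≢ y′
        x≢y′ refl = no-triangle vw wx yv′
        y≢x′ : y ≢ x′
        y≢x′ refl = no-triangle vw wx′ yv
        distinct : Unique (v ∷ w ∷ x ∷ y ∷ x′ ∷ y′ ∷ [])
        distinct = (adj-≢ H vw ∷ v≢x ∷ adj-≢ H (flip yv) ∷ v≢x′ ∷ adj-≢ H (flip yv′) ∷ []) ∷ (adj-≢ H wx ∷ w≢y ∷ adj-≢ H wx′ ∷ w≢y′ ∷ []) ∷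
                   (adj-≢ H xy ∷ x≢x′ ∷ x≢y′ ∷ []) ∷ (y≢x′ ∷ y≢y′ ∷ []) ∷ (adj-≢ H xy′ ∷ []) ∷ [] ∷ []
        v-nbrs = Specials.three-nbrs H S {v} {w ∷ y ∷ y′ ∷ []} refl ((w≢y ∷ w≢y′ ∷ []) ∷ (y≢y′ ∷ []) ∷ [] ∷ []) (vw ∷ flip yv ∷ flip yv′ ∷ [])
        w-nbrs = Specials.three-nbrs H S {w} {v ∷ x ∷ x′ ∷ []} refl ((v≢x ∷ v≢x′ ∷ []) ∷ (x≢x′ ∷ []) ∷ [] ∷ []) (flip vw ∷ wx ∷ wx′ ∷ [])
        S′ : Special H
        S′ = Specials.relabel H S v w y ((adj-≢ H vw ∷ adj-≢ H (flip yv) ∷ []) ∷ (w≢y ∷ []) ∷ [] ∷ []) (proj₁ v-nbrs) (proj₁ w-nbrs) y∈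
        open SpecialGraph H S′ hiding (distinct; V)
        open Specials H S′
        us≢z : ∀ {v} → v ∈ us → v ≢ z
        us≢z v∈ refl = z∉us v∈
        x≢z : x ≢ z
        x≢z = proj₁ (two-nbrs w≢y (flip wx) xy)
        x′≢z : x′ ≢ z
        x′≢z = proj₁ (two-nbrs w≢y′ (flip wx′) xy′)
        y′≢z : y′ ≢ z
        y′≢z = proj₁ (two-nbrs v≢x′ yv′ (flip xy′))
        v≁z : ¬ v ~ z
        v≁z e with nbrs-elim {H} {ys = w ∷ y ∷ y′ ∷ []} (proj₂ v-nbrs) e
        ... | here p = us≢z (there (here refl)) (sym p)
        ... | there (here p) = us≢z (there (there (here refl))) (sym p)
        ... | there (there (here p)) = y′≢z (sym p)
        w≁z : ¬ w ~ z
        w≁z e with nbrs-elim {H} {ys = v ∷ x ∷ x′ ∷ []} (proj₂ w-nbrs) e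
        ... | here p = us≢z (here refl) (sym p)
        ... | there (here p) = x≢z (sym p)
        ... | there (there (here p)) = x′≢z (sym p)
        e₃₃≡ : e₃₃ ≡ + 1 + + 1 + + 0
        e₃₃≡ = cong₂ _+_ (cong₂ _+_ (A-true H vw) (A-true H (flip yv))) (non-adjacent λ e → no-triangle e yv vw)
        e₃₁≡ : e₃₁ ≡ + 0 + + 0 + A H y z
        e₃₁≡ = cong₂ (λ s t → s + t + A H y z) (non-adjacent v≁z) (non-adjacent w≁z)
        opposite : ∀ {p r s t} → p ≢ s → r ≢ t → p ~ r → r ~ s → s ~ t → t ~ p → + 0 ≤ R p s - + 2
        opposite {p} {r} {s} {t} ne ne′ pr rs st tp = R≥2 ne (codeg-lower H p s (r ∷ t ∷ []) ((ne′ ∷ []) ∷ [] ∷ []) ((pr , rs) ∷ (flip tp , flip st) ∷ []))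
        -- The ends of the shared edge lie on both 4-cycles and contribute at least 4 each, the
        -- other four corners at least 2 each.
        Q≥16 : + 0 ≤ Q - + 16
        Q≥16 = subst (+ 0 ≤_) (lem Q (q v) (q w) (q x) (q y) (q x′) (q y′)) (+-nonneg (listSum-≤ q q-nonneg distinct)
          (+-nonneg (q≥R² v x x′ x≢x′ (opposite v≢x w≢y vw wx xy yv) (opposite v≢x′ w≢y′ vw wx′ xy′ yv′))
          (+-nonneg (q≥R² w y y′ y≢y′ (opposite w≢y (v≢x ∘ sym) wx xy yv vw) (opposite w≢y′ (v≢x′ ∘ sym) wx′ xy′ yv′ vw))
          (+-nonneg (q≥R x v (opposite (v≢x ∘ sym) (w≢y ∘ sym) xy yv vw wx)) (+-nonneg (q≥R y w (opposite (w≢y ∘ sym) v≢x yv vw wx xy))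
          (+-nonneg (q≥R x′ v (opposite (v≢x′ ∘ sym) (w≢y′ ∘ sym) xy′ yv′ vw wx′)) (q≥R y′ w (opposite (w≢y′ ∘ sym) v≢x′ yv′ vw wx′ xy′))))))))
          where
          opaque
            unfolding _+_ 0≟
            lem : ∀ Q a b c d e f → Q - (a + (b + (c + (d + (e + (f + + 0)))))) + ((a - + 4) + ((b - + 4) + ((c - + 2) + ((d - + 2) + ((e - + 2) + (f - + 2)))))) ≡ Q - + 16
            lem = solve-∀ ring
        vertices : List V
        vertices = v ∷ w ∷ y ∷ x ∷ y′ ∷ x′ ∷ z ∷ []
        seven : Unique vertices
        seven = (adj-≢ H vw ∷ adj-≢ H (flip yv) ∷ v≢x ∷ adj-≢ H (flip yv′) ∷ v≢x′ ∷ us≢z (here refl) ∷ []) ∷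
                (w≢y ∷ adj-≢ H wx ∷ w≢y′ ∷ adj-≢ H wx′ ∷ us≢z (there (here refl)) ∷ []) ∷
                (adj-≢ H (flip xy) ∷ y≢y′ ∷ y≢x′ ∷ us≢z (there (there (here refl))) ∷ []) ∷
                (x≢y′ ∷ x≢x′ ∷ x≢z ∷ []) ∷ (adj-≢ H (flip xy′) ∷ y′≢z ∷ []) ∷ (x′≢z ∷ []) ∷ [] ∷ []
        c₄≡0 : c₄ ≡ 0
        c₄≡0 = by c₄ c₄≤1 small
          where
          by : ∀ c → c ℕ.≤ 1 → (c ≡ 1 → size H ℕ.≤ 6) → c ≡ 0
          by 0 _ _ = refl
          by 1 _ s = contradiction (ℕ.≤-trans (unique-length seven) (s refl)) ℕ.1+n≰n
          by (suc (suc _)) (ℕ.s≤s ()) _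
        -- Seven vertices exclude c₄ = 1, and two of the pairs of degree-3 vertices are adjacent. So
        -- Q = 12, plus 4 if `y` and `z` are adjacent.
        yz : y ~ z
        yz = decidable-stable (adj H y z Bool.≟ true) λ n → negative-absurd Q≥16
          (trans (cong (λ t → t - + 16) (trans (Free.Q-equation free (+ c₄) t₄) (trans (cong (λ c → + 20 + + 8 * + c - + 4 * e₃₃ + + 4 * e₃₁) c₄≡0)
            (cong₂ (λ s t → + 20 + + 8 * + 0 - + 4 * s + + 4 * t) e₃₃≡ (trans e₃₁≡ (cong (λ t → + 0 + + 0 + t) (non-adjacent n))))))) lit)
          where
          opaque
            unfolding _+_
            lit : (+ 20 + + 8 * + 0 - + 4 * (+ 1 + + 1 + + 0) + + 4 * (+ 0 + + 0 + + 0)) - + 16 ≡ ℤ.-[1+ 3 ]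
            lit = refl
        x∉us : x ∉ us
        x∉us (here e) = v≢x (sym e)
        x∉us (there (here refl)) = contradiction refl (adj-≢ H wx)
        x∉us (there (there (here refl))) = contradiction refl (adj-≢ H xy)
        x′∉us : x′ ∉ us
        x′∉us (here e) = v≢x′ (sym e)
        x′∉us (there (here refl)) = contradiction refl (adj-≢ H wx′)
        x′∉us (there (there (here e))) = y≢x′ (sym e)
        y′∉us : y′ ∉ us
        y′∉us (here refl) = contradiction refl (adj-≢ H yv′)
        y′∉us (there (here e)) = w≢y′ (sym e)
        y′∉us (there (there (here e))) = y≢y′ (sym e)
        f : Fin 7 → V
        f = lookup vertices
        edge : ∀ v w → adj mate5 v w ≡ true → f v ~ f w
        edge = mate5-edges flip vw (flip yv) (flip xy) wx (flip yv′) (flip xy′) wx′ yz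
        deg : ∀ v → degree mate5 v ≡ degree H (f v)
        deg 0F = sym (degree-us (here refl))
        deg 1F = sym (degree-us (there (here refl)))
        deg 2F = sym (degree-us (there (there (here refl))))
        deg 3F = sym (degree-other x∉us x≢z)
        deg 4F = sym (degree-other y′∉us y′≢z)
        deg 5F = sym (degree-other x′∉us x′≢z)
        deg 6F = sym degree-z

      iso : Iso mate5 H
      iso = embedding-iso mate5 H f (lookup-injective seven) (λ {v} {w} → edge v w) deg connected 0F

    record C₄ (i a j b : V) : Set where
      constructor cycle
      field
        ia : i ~ a
        aj : a ~ j
        jb : j ~ b
        bi : b ~ i
        i≢j : i ≢ j
        a≢b : a ≢ b

    -- The ordered pairs of opposite corners: the positions at which a 4-cycle contributes to `R`.
    Diagonal : (i a j b p r : V) → Set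
    Diagonal i a j b p r = ((p ≡ i × r ≡ j) ⊎ (p ≡ j × r ≡ i)) ⊎ ((p ≡ a × r ≡ b) ⊎ (p ≡ b × r ≡ a))

    diagonal? : ∀ i a j b p r → Dec (Diagonal i a j b p r)
    diagonal? i a j b p r = (((p ≟ i) ×-dec (r ≟ j)) ⊎-dec ((p ≟ j) ×-dec (r ≟ i))) ⊎-dec (((p ≟ a) ×-dec (r ≟ b)) ⊎-dec ((p ≟ b) ×-dec (r ≟ a)))

    rotate : ∀ {i a j b} → C₄ i a j b → C₄ a j b i
    rotate (cycle ia aj jb bi i≢j a≢b) = cycle aj jb bi ia a≢b (i≢j ∘ sym)

    reflect : ∀ {i a j b} → C₄ i a j b → C₄ i b j a
    reflect (cycle ia aj jb bi i≢j a≢b) = cycle (flip bi) (flip jb) (flip aj) (flip ia) i≢j (a≢b ∘ sym)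

    rotate-diagonal : ∀ {i a j b p r} → Diagonal i a j b p r → Diagonal a j b i p r
    rotate-diagonal (inj₁ (inj₁ e)) = inj₂ (inj₂ e)
    rotate-diagonal (inj₁ (inj₂ e)) = inj₂ (inj₁ e)
    rotate-diagonal (inj₂ e) = inj₁ e

    reflect-diagonal : ∀ {i a j b p r} → Diagonal i a j b p r → Diagonal i b j a p r
    reflect-diagonal (inj₁ e) = inj₁ e
    reflect-diagonal (inj₂ (inj₁ e)) = inj₂ (inj₂ e)
    reflect-diagonal (inj₂ (inj₂ e)) = inj₂ (inj₁ e)

    corners : (i a j b : V) → List V
    corners i a j b = i ∷ a ∷ j ∷ b ∷ []

    -- The same cycle read from a chosen corner, with the same opposite pairs. Two cycles that meet
    -- can thus both be started at the common vertex.
    record From (v i a j b : V) : Set where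
      field
        w x y : V
        from : C₄ v w x y
        to-diagonal : ∀ {p r} → Diagonal i a j b p r → Diagonal v w x y p r
        of-diagonal : ∀ {p r} → Diagonal v w x y p r → Diagonal i a j b p r

    start-at : ∀ {v i a j b} → C₄ i a j b → v ∈ corners i a j b → From v i a j b
    start-at c (here refl) = record { from = c ; to-diagonal = λ e → e ; of-diagonal = λ e → e }
    start-at c (there (here refl)) = record { from = rotate c ; to-diagonal = rotate-diagonal ; of-diagonal = rotate-diagonal ∘ rotate-diagonal ∘ rotate-diagonal }
    start-at c (there (there (here refl))) = record { from = rotate (rotate c) ; to-diagonal = rotate-diagonal ∘ rotate-diagonal ; of-diagonal = rotate-diagonal ∘ rotate-diagonal }
    start-at c (there (there (there (here refl)))) = record { from = rotate (rotate (rotate c)) ; to-diagonal = rotate-diagonal ∘ rotate-diagonal ∘ rotate-diagonal ; of-diagonal = rotate-diagonal }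

    corners-unique : ∀ {i a j b} → C₄ i a j b → Unique (corners i a j b)
    corners-unique (cycle ia aj jb bi i≢j a≢b) = (adj-≢ H ia ∷ i≢j ∷ adj-≢ H (flip bi) ∷ []) ∷ (adj-≢ H aj ∷ a≢b ∷ []) ∷ (adj-≢ H jb ∷ []) ∷ [] ∷ []

    module _ (S : Special H) where
      open SpecialGraph H S hiding (V)
      open Specials H S
      open Free free using (Q-equation; q-equation; a₅; a₅-nonneg)

      private
        e₃₃≤2 : + 0 ≤ + 2 - e₃₃
        e₃₃≤2 = bound (adj H u₁ u₂) (adj H u₁ u₃) (adj H u₂ u₃) λ p q r → no-triangle p r (flip q)
          where
          opaque
            unfolding _+_
            bound : ∀ b₁ b₂ b₃ → (b₁ ≡ true → b₂ ≡ true → b₃ ≡ true → ⊥) → + 0 ≤ + 2 - (ι b₁ + ι b₂ + ι b₃)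
            bound true true true n = ⊥-elim (n refl refl refl)
            bound true true false _ = nonneg 0
            bound true false true _ = nonneg 0
            bound true false false _ = nonneg 1
            bound false true true _ = nonneg 0
            bound false true false _ = nonneg 1
            bound false false true _ = nonneg 1
            bound false false false _ = nonneg 2

        e₃₁≤1 : + 0 ≤ + 1 - e₃₁
        e₃₁≤1 = subst (+ 0 ≤_) (cong₂ _-_ (trans (sym (degree-sum H z)) (cong +_ degree-z)) (trans (cong₂ _+_ (A-sym H z u₁) (cong₂ _+_ (A-sym H z u₂) (cong (λ t → t + + 0) (A-sym H z u₃)))) (lem (A H u₁ z) (A H u₂ z) (A H u₃ z))))
            (listSum-≤ (A H z) (A-nonneg H z) us-unique)
          where
          opaque
            unfolding _+_ 0≟
            lem : ∀ a b c → a + (b + (c + + 0)) ≡ a + b + c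
            lem = solve-∀ ring

        e₃₁≥0 : + 0 ≤ e₃₁
        e₃₁≥0 = +-nonneg (+-nonneg (A-nonneg H u₁ z) (A-nonneg H u₂ z)) (A-nonneg H u₃ z)

        -- Three edges among the vertices of degree 3 would form a triangle, so at most 8 is taken
        -- from 20. As a single 4-cycle accounts for 8, there must be a second one.
        Q≥12 : + 0 ≤ Q - + 12
        Q≥12 = subst (+ 0 ≤_) (trans (lem (+ c₄) e₃₃ e₃₁) (cong (λ t → t - + 12) (sym (Q-equation (+ c₄) t₄))))
            (+-nonneg (*-nonneg (nonneg 8) (nonneg c₄)) (+-nonneg (*-nonneg (nonneg 4) e₃₃≤2) (*-nonneg (nonneg 4) e₃₁≥0)))
          where
          opaque
            unfolding _+_ 0≟
            lem : ∀ c e f → + 8 * c + (+ 4 * (+ 2 - e) + + 4 * f) ≡ (+ 20 + + 8 * c - + 4 * e + + 4 * f) - + 12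
            lem = solve-∀ ring

        ≥2 : V → V → Set
        ≥2 i j = + 2 ≤ C i j

        R-zero : ∀ v l → (v ≢ l → ¬ ≥2 v l) → R v l ≡ + 0
        R-zero v l h = by (v ≟ l)
          where
          opaque
            unfolding _+_
            value : ∀ c → + 0 ≤ c → ¬ + 2 ≤ c → c * (c - + 1) ≡ + 0
            value (+ 0) _ _ = refl
            value (+ 1) _ _ = refl
            value (+ suc (suc c)) _ n = contradiction (ℤ.+≤+ (ℕ.s≤s (ℕ.s≤s ℕ.z≤n))) n
          by : Dec (v ≡ l) → R v l ≡ + 0
          by (yes refl) = R-diag v
          by (no ne) = trans (R-off ne) (value (C v l) (codeg-nonneg H v l) (h ne))

        pick : ∀ {i j} ks → Unique ks → All (λ k → common H i j k ≡ true) ks → ¬ C i j ≡ + length ks → Σ V λ k → k ∉ ks × common H i j k ≡ true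
        pick {i} {j} ks u as ne = count-extra (common H i j) ks u as λ e → ne (trans (codeg-count H i j) e)

        not-below : ∀ {c m k} → + m ≤ c → k ℕ.< m → c ≢ + k
        not-below le lt refl = ℕ.<⇒≱ lt (ℤ.drop‿+≤+ le)

        four-cycle : ∀ {i j} → i ≢ j → ≥2 i j → Σ V λ a → Σ V λ b → C₄ i a j b
        four-cycle {i} {j} i≢j le = k , l , cycle (proj₁ ck) (proj₂ ck) (flip (proj₂ cl)) (flip (proj₁ cl)) i≢j λ e → proj₁ (proj₂ p₂) (here (sym e))
          where
          p₁ = pick {i} {j} [] [] [] (not-below le (ℕ.s≤s ℕ.z≤n))
          k = proj₁ p₁
          p₂ = pick {i} {j} (k ∷ []) ([] ∷ []) (proj₂ (proj₂ p₁) ∷ []) (not-below le (ℕ.s≤s (ℕ.s≤s ℕ.z≤n)))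
          l = proj₁ p₂
          ck = common-split H {i} {j} (proj₂ (proj₂ p₁))
          cl = common-split H {i} {j} (proj₂ (proj₂ p₂))

        degree≥2-not-z : ∀ {L : List V} → (∀ {v} → v ∈ L → v ≢ z) → ∀ {v} → v ∈ L → (∀ {u w} → u ∈ L → u ~ w → w ∈ L) → ⊥
        degree≥2-not-z {L} ne v∈ cl = ne (closed-covers connected L v∈ cl z) refl

      -- Codegree 3 produces K₂,₃. If its three common neighbours all had degree 2, these five
      -- vertices would be a component that misses `z`; so one of them has degree 3.
      thick : ∀ i j → i ≢ j → + 3 ≤ C i j → Iso mate4 H
      thick i j i≢j le = by (k ∈? us) (l ∈? us) (m ∈? us)
        where
        p₁ = pick {i} {j} [] [] [] (not-below le (ℕ.s≤s ℕ.z≤n))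
        k = proj₁ p₁
        p₂ = pick {i} {j} (k ∷ []) ([] ∷ []) (proj₂ (proj₂ p₁) ∷ []) (not-below le (ℕ.s≤s (ℕ.s≤s ℕ.z≤n)))
        l = proj₁ p₂
        l≢k : l ≢ k
        l≢k e = proj₁ (proj₂ p₂) (here e)
        p₃ = pick {i} {j} (l ∷ k ∷ []) ((l≢k ∷ []) ∷ [] ∷ []) (proj₂ (proj₂ p₂) ∷ proj₂ (proj₂ p₁) ∷ []) (not-below le (ℕ.s≤s (ℕ.s≤s (ℕ.s≤s ℕ.z≤n))))
        m = proj₁ p₃
        m≢l : m ≢ l
        m≢l e = proj₁ (proj₂ p₃) (here e)
        m≢k : m ≢ k
        m≢k e = proj₁ (proj₂ p₃) (there (here e))
        ck = common-split H {i} {j} (proj₂ (proj₂ p₁))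
        cl = common-split H {i} {j} (proj₂ (proj₂ p₂))
        cm = common-split H {i} {j} (proj₂ (proj₂ p₃))
        ik = proj₁ ck
        il = proj₁ cl
        im = proj₁ cm
        kj = proj₂ ck
        lj = proj₂ cl
        mj = proj₂ cm
        klm : Unique (k ∷ l ∷ m ∷ [])
        klm = ((l≢k ∘ sym) ∷ (m≢k ∘ sym) ∷ []) ∷ ((m≢l ∘ sym) ∷ []) ∷ [] ∷ []
        rim : ∀ {v} → i ~ v → v ~ j → v ∉ us → Nbrs H v (i ∷ j ∷ [])
        rim iv vj v∉ with proj₂ (two-nbrs i≢j (flip iv) vj)
        ... | inj₁ v∈ = contradiction v∈ v∉
        ... | inj₂ nb = nb
        by : Dec (k ∈ us) → Dec (l ∈ us) → Dec (m ∈ us) → Iso mate4 H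
        by (yes p) _ _ = K₂₃.iso S i j k l m i≢j klm ik il im (flip kj) (flip lj) (flip mj) p
        by (no _) (yes p) _ = K₂₃.iso S i j l k m i≢j ((l≢k ∷ (m≢l ∘ sym) ∷ []) ∷ ((m≢k ∘ sym) ∷ []) ∷ [] ∷ []) il ik im (flip lj) (flip kj) (flip mj) p
        by (no _) (no _) (yes p) = K₂₃.iso S i j m k l i≢j ((m≢k ∷ m≢l ∷ []) ∷ ((l≢k ∘ sym) ∷ []) ∷ [] ∷ []) im ik il (flip mj) (flip kj) (flip lj) p
        by (no k∉) (no l∉) (no m∉) = ⊥-elim (degree≥2-not-z ne (here refl) closed)
          where
          L : List V
          L = i ∷ j ∷ k ∷ l ∷ m ∷ []
          i-nbrs = three-nbrs {i} refl klm (ik ∷ il ∷ im ∷ [])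
          j-nbrs = three-nbrs {j} refl klm (flip kj ∷ flip lj ∷ flip mj ∷ [])
          ne : ∀ {v} → v ∈ L → v ≢ z
          ne (here refl) refl = z∉us (proj₁ i-nbrs)
          ne (there (here refl)) refl = z∉us (proj₁ j-nbrs)
          ne (there (there (here refl))) = proj₁ (two-nbrs i≢j (flip ik) kj)
          ne (there (there (there (here refl)))) = proj₁ (two-nbrs i≢j (flip il) lj)
          ne (there (there (there (there (here refl))))) = proj₁ (two-nbrs i≢j (flip im) mj)
          inner : ∀ {w} → w ∈ i ∷ j ∷ [] → w ∈ L
          inner (here e) = here e
          inner (there (here e)) = there (here e)
          closed : ∀ {u w} → u ∈ L → u ~ w → w ∈ L
          closed (here refl) e = there (there (nbrs-elim {H} {ys = k ∷ l ∷ m ∷ []} (proj₂ i-nbrs) e))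
          closed (there (here refl)) e = there (there (nbrs-elim {H} {ys = k ∷ l ∷ m ∷ []} (proj₂ j-nbrs) e))
          closed (there (there (here refl))) e = inner (nbrs-elim {H} {ys = i ∷ j ∷ []} (rim ik kj k∉) e)
          closed (there (there (there (here refl)))) e = inner (nbrs-elim {H} {ys = i ∷ j ∷ []} (rim il lj l∉) e)
          closed (there (there (there (there (here refl))))) e = inner (nbrs-elim {H} {ys = i ∷ j ∷ []} (rim im mj m∉) e)

      module Thin (thin : ∀ {i j} → i ≢ j → ¬ + 3 ≤ C i j) where

        private
          no-three : ∀ {i j k l m} → i ≢ j → k ≢ l → k ≢ m → l ≢ m → i ~ k → k ~ j → i ~ l → l ~ j → i ~ m → m ~ j → ⊥
          no-three {i} {j} {k} {l} {m} ne p q r ik kj il lj im mj = thin ne (≤-from-difference _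
            (codeg-lower H i j (k ∷ l ∷ m ∷ []) ((p ∷ q ∷ []) ∷ (r ∷ []) ∷ [] ∷ []) ((ik , kj) ∷ (il , lj) ∷ (im , mj) ∷ [])) (lem (C i j)))
            where
            opaque
              unfolding _+_ 0≟
              lem : ∀ c → c ≡ + 3 + (c - + 3)
              lem = solve-∀ ring

          R≤2 : ∀ {v l} → v ≢ l → + 0 ≤ + 2 - R v l
          R≤2 {v} {l} ne = subst (λ t → + 0 ≤ + 2 - t) (sym (R-off ne)) (value (C v l) (codeg-nonneg H v l) (thin ne))
            where
            opaque
              unfolding _+_
              value : ∀ c → + 0 ≤ c → ¬ + 3 ≤ c → + 0 ≤ + 2 - c * (c - + 1)
              value (+ 0) _ _ = nonneg 2
              value (+ 1) _ _ = nonneg 2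
              value (+ 2) _ _ = nonneg 0
              value (+ suc (suc (suc c))) _ n = contradiction (ℤ.+≤+ (ℕ.s≤s (ℕ.s≤s (ℕ.s≤s ℕ.z≤n)))) n

        -- If the four corners off the shared edge all had degree 2, the six vertices would be a
        -- component without `z`. By the symmetries of the figure the corner of degree 3 can be
        -- brought into the role of `y`.
        domino : ∀ {v w x y x′ y′} → C₄ v w x y → C₄ v w x′ y′ → x ≢ x′ → y ≢ y′ → Iso mate5 H
        domino {v} {w} {x} {y} {x′} {y′} (cycle vw wx xy yv v≢x w≢y) (cycle _ wx′ xy′ yv′ v≢x′ w≢y′) x≢x′ y≢y′ = by (y ∈? us) (y′ ∈? us) (x ∈? us) (x′ ∈? us)
          where
          by : Dec (y ∈ us) → Dec (y′ ∈ us) → Dec (x ∈ us) → Dec (x′ ∈ us) → Iso mate5 H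
          by (yes p) _ _ _ = Domino.iso S v w x y x′ y′ v≢x v≢x′ w≢y w≢y′ x≢x′ y≢y′ vw wx xy yv wx′ xy′ yv′ p
          by (no _) (yes p) _ _ = Domino.iso S v w x′ y′ x y v≢x′ v≢x w≢y′ w≢y (x≢x′ ∘ sym) (y≢y′ ∘ sym) vw wx′ xy′ yv′ wx xy yv p
          by (no _) (no _) (yes p) _ = Domino.iso S w v y x y′ x′ w≢y w≢y′ v≢x v≢x′ y≢y′ x≢x′ (flip vw) (flip yv) (flip xy) (flip wx) (flip yv′) (flip xy′) (flip wx′) p
          by (no _) (no _) (no _) (yes p) = Domino.iso S w v y′ x′ y x w≢y′ w≢y v≢x′ v≢x (y≢y′ ∘ sym) (x≢x′ ∘ sym) (flip vw) (flip yv′) (flip xy′) (flip wx′) (flip yv) (flip xy) (flip wx) p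
          by (no y∉) (no y′∉) (no x∉) (no x′∉) = ⊥-elim (degree≥2-not-z ne (here refl) closed)
            where
            L : List V
            L = v ∷ w ∷ x ∷ y ∷ x′ ∷ y′ ∷ []
            v-nbrs = three-nbrs {v} {w ∷ y ∷ y′ ∷ []} refl ((w≢y ∷ w≢y′ ∷ []) ∷ (y≢y′ ∷ []) ∷ [] ∷ []) (vw ∷ flip yv ∷ flip yv′ ∷ [])
            w-nbrs = three-nbrs {w} {v ∷ x ∷ x′ ∷ []} refl ((v≢x ∷ v≢x′ ∷ []) ∷ (x≢x′ ∷ []) ∷ [] ∷ []) (flip vw ∷ wx ∷ wx′ ∷ [])
            outer : ∀ {u p r} → p ≢ r → u ~ p → u ~ r → u ∉ us → Nbrs H u (p ∷ r ∷ [])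
            outer ne up ur u∉ with proj₂ (two-nbrs ne up ur)
            ... | inj₁ u∈ = contradiction u∈ u∉
            ... | inj₂ nb = nb
            ne : ∀ {u} → u ∈ L → u ≢ z
            ne (here refl) refl = z∉us (proj₁ v-nbrs)
            ne (there (here refl)) refl = z∉us (proj₁ w-nbrs)
            ne (there (there (here refl))) = proj₁ (two-nbrs w≢y (flip wx) xy)
            ne (there (there (there (here refl)))) = proj₁ (two-nbrs v≢x yv (flip xy))
            ne (there (there (there (there (here refl))))) = proj₁ (two-nbrs w≢y′ (flip wx′) xy′)
            ne (there (there (there (there (there (here refl)))))) = proj₁ (two-nbrs v≢x′ yv′ (flip xy′))
            closed : ∀ {u t} → u ∈ L → u ~ t → t ∈ L
            closed (here refl) e with nbrs-elim {H} {ys = w ∷ y ∷ y′ ∷ []} (proj₂ v-nbrs) e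
            ... | here p = there (here p)
            ... | there (here p) = there (there (there (here p)))
            ... | there (there (here p)) = there (there (there (there (there (here p)))))
            closed (there (here refl)) e with nbrs-elim {H} {ys = v ∷ x ∷ x′ ∷ []} (proj₂ w-nbrs) e
            ... | here p = here p
            ... | there (here p) = there (there (here p))
            ... | there (there (here p)) = there (there (there (there (here p))))
            closed (there (there (here refl))) e with nbrs-elim {H} {ys = w ∷ y ∷ []} (outer w≢y (flip wx) xy x∉) e
            ... | here p = there (here p)
            ... | there (here p) = there (there (there (here p)))
            closed (there (there (there (here refl)))) e with nbrs-elim {H} {ys = v ∷ x ∷ []} (outer v≢x yv (flip xy) y∉) e
            ... | here p = here p
            ... | there (here p) = there (there (here p))
            closed (there (there (there (there (here refl))))) e with nbrs-elim {H} {ys = w ∷ y′ ∷ []} (outer w≢y′ (flip wx′) xy′ x′∉) e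
            ... | here p = there (here p)
            ... | there (here p) = there (there (there (there (there (here p)))))
            closed (there (there (there (there (there (here refl)))))) e with nbrs-elim {H} {ys = v ∷ x′ ∷ []} (outer v≢x′ yv′ (flip xy′) y′∉) e
            ... | here p = here p
            ... | there (here p) = there (there (there (there (here p))))

        -- A further common corner would either make the cycles equal or give an opposite pair three
        -- common neighbours; so both remaining corners differ.
        share-edge : ∀ {v w x y x′ y′ p r} → C₄ v w x y → C₄ v w x′ y′ → ¬ Diagonal v w x y p r → Diagonal v w x′ y′ p r → Iso mate5 H
        share-edge {v} {w} {x} {y} {x′} {y′} c@(cycle vw wx xy yv v≢x w≢y) c′@(cycle _ wx′ xy′ yv′ v≢x′ w≢y′) n dg with y ≟ y′ | x ≟ x′
        ... | yes refl | yes refl = contradiction dg n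
        ... | yes refl | no x≢x′ = ⊥-elim (no-three w≢y v≢x v≢x′ x≢x′ (flip vw) (flip yv) wx xy wx′ xy′)
        ... | no y≢y′ | yes refl = ⊥-elim (no-three v≢x w≢y w≢y′ y≢y′ vw wx (flip yv) (flip xy) (flip yv′) (flip xy′))
        ... | no y≢y′ | no x≢x′ = domino c c′ x≢x′ y≢y′

        -- At a common vertex the two cycles use four neighbours in all, but its degree is at most
        -- 3, so they share an edge there.
        share-vertex : ∀ {v w x y w′ x′ y′ p r} → C₄ v w x y → C₄ v w′ x′ y′ → ¬ Diagonal v w x y p r → Diagonal v w′ x′ y′ p r → Iso mate5 H
        share-vertex {v} {w} {x} {y} {w′} {x′} {y′} c c′ n dg with w′ ≟ w | w′ ≟ y | y′ ≟ w | y′ ≟ y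
        ... | yes refl | _ | _ | _ = share-edge c c′ n dg
        ... | no _ | yes refl | _ | _ = share-edge (reflect c) c′ (n ∘ reflect-diagonal) dg
        ... | no _ | no _ | yes refl | _ = share-edge c (reflect c′) n (reflect-diagonal dg)
        ... | no _ | no _ | no _ | yes refl = share-edge (reflect c) (reflect c′) (n ∘ reflect-diagonal) (reflect-diagonal dg)
        ... | no p₁ | no p₂ | no p₃ | no p₄ = contradiction (ℕ.≤-trans (nbrs-bound H v (w ∷ y ∷ w′ ∷ y′ ∷ [])
                ((C₄.a≢b c ∷ (p₁ ∘ sym) ∷ (p₃ ∘ sym) ∷ []) ∷ ((p₂ ∘ sym) ∷ (p₄ ∘ sym) ∷ []) ∷ (C₄.a≢b c′ ∷ []) ∷ [] ∷ [])
                (C₄.ia c ∷ flip (C₄.bi c) ∷ C₄.ia c′ ∷ flip (C₄.bi c′) ∷ [])) (degree≤3 v)) λ { (ℕ.s≤s (ℕ.s≤s (ℕ.s≤s ()))) }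

        -- All eight corners have q >= 2 while only three vertices have degree 3, so too much of Q
        -- lies off those three. The multipliers 5 and 10 are chosen so that `Q-equation` and
        -- `q-equation` together eliminate `e₃₃`, `e₃₁` and `a₅`: the nonnegative terms add up to
        -- -30.
        disjoint : ∀ {i a j b i′ a′ j′ b′} → C₄ i a j b → C₄ i′ a′ j′ b′ → (∀ {v} → v ∈ corners i a j b → v ∈ corners i′ a′ j′ b′ → ⊥) → ⊥
        disjoint {i} {a} {j} {b} {i′} {a′} {j′} {b′} c c′ disj = negative-absurd
            (+-nonneg (+-nonneg (*-nonneg (nonneg 5) (listSum-≤ g g≥0 us-unique)) (+-nonneg (*-nonneg (nonneg 5) (q-nonneg z)) a₅-nonneg))
              (+-nonneg (*-nonneg (nonneg 10) e₃₁≤1) (*-nonneg (nonneg 10) (+-nonneg (χ≤1 u₁) (+-nonneg (χ≤1 u₂) (χ≤1 u₃))))))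
            (trans (cong₂ (λ s t → + 5 * (s - t) + (+ 5 * q z + a₅) + (+ 10 * (+ 1 - e₃₁) + + 10 * ((+ 1 - χ u₁) + ((+ 1 - χ u₂) + (+ 1 - χ u₃))))) sum-g (refl {x = listSum g us}))
              (trans (lem₁ Q (q u₁) (q u₂) (q u₃) (q z) (χ u₁) (χ u₂) (χ u₃) a₅ e₃₁)
                (trans (cong₂ (λ s t → + 5 * s - t + a₅ - + 40 - + 10 * e₃₁) (trans (Q-equation (+ c₄) t₄) (cong (λ k → + 20 + + 8 * + k - + 4 * e₃₃ + + 4 * e₃₁) c₄≡0)) (q-equation (large eight≤)))
                  (lem₂ e₃₃ e₃₁ a₅))))
          where
          L : List V
          L = i ∷ a ∷ j ∷ b ∷ i′ ∷ a′ ∷ j′ ∷ b′ ∷ []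
          L-unique : Unique L
          L-unique = ++⁺ (corners-unique c) (corners-unique c′) (λ (p , q) → disj p q)
          eight≤ : 8 ℕ.≤ size H
          eight≤ = unique-length L-unique
          c₄≡0 : c₄ ≡ 0
          c₄≡0 = by c₄ c₄≤1 small
            where
            by : ∀ k → k ℕ.≤ 1 → (k ≡ 1 → size H ℕ.≤ 6) → k ≡ 0
            by 0 _ _ = refl
            by 1 _ s = contradiction (ℕ.≤-trans eight≤ (s refl)) λ { (ℕ.s≤s (ℕ.s≤s (ℕ.s≤s (ℕ.s≤s (ℕ.s≤s (ℕ.s≤s ())))))) }
            by (suc (suc _)) (ℕ.s≤s ()) _
          χ : V → ℤ
          χ = mult L
          χ≤1 : ∀ v → + 0 ≤ + 1 - χ v
          χ≤1 v with v ∈? L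
          ... | yes p = subst (λ t → + 0 ≤ + 1 - t) (sym (mult-∈ L-unique p)) (ℤ.≤-reflexive (sym (-‿inverseʳ (+ 1))))
          ... | no p = subst (+ 0 ≤_) (sym (zero-- (mult-∉ p))) (nonneg 1)
          opp : ∀ {p r s t} → C₄ p r s t → + 0 ≤ q p - + 2
          opp {p} {r} {s} {t} (cycle pr rs st tp p≢s r≢t) = q≥R p s (R≥2 p≢s (codeg-lower H p s (r ∷ t ∷ []) ((r≢t ∷ []) ∷ [] ∷ []) ((pr , rs) ∷ (flip tp , flip st) ∷ [])))
          on-cycle : ∀ {p r s t v} → C₄ p r s t → v ∈ corners p r s t → + 0 ≤ q v - + 2
          on-cycle c v∈ = opp (From.from (start-at c v∈))
          at : ∀ {v} → v ∈ L → + 0 ≤ q v - + 2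
          at (here e) = on-cycle c (here e)
          at (there (here e)) = on-cycle c (there (here e))
          at (there (there (here e))) = on-cycle c (there (there (here e)))
          at (there (there (there (here e)))) = on-cycle c (there (there (there (here e))))
          at (there (there (there (there p)))) = on-cycle c′ p
          g : V → ℤ
          g v = q v - χ v * + 2
          g≥0 : ∀ v → + 0 ≤ g v
          g≥0 v with v ∈? L
          ... | yes p = subst (λ t → + 0 ≤ q v - t) (sym (trans (cong (_* + 2) (mult-∈ L-unique p)) (*-identityˡ _))) (at p)
          ... | no p = subst (+ 0 ≤_) (sym (zero-- (trans (cong (_* + 2) (mult-∉ p)) (zeroˡ _)))) (q-nonneg v)
          sum-g : sum g ≡ Q - + 8 * + 2
          sum-g = trans (sum-- _ _) (cong (λ t → Q - t) (trans (sum-*ʳ (+ 2) χ) (cong (_* + 2) (sum-mult-one L))))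
          opaque
            unfolding _+_ 0≟
            lem₁ : ∀ Q p r s z χ₁ χ₂ χ₃ a e → + 5 * ((Q - + 8 * + 2) - ((p - χ₁ * + 2) + ((r - χ₂ * + 2) + ((s - χ₃ * + 2) + + 0)))) + (+ 5 * z + a) + (+ 10 * (+ 1 - e) + + 10 * ((+ 1 - χ₁) + ((+ 1 - χ₂) + (+ 1 - χ₃)))) ≡
              + 5 * Q - + 5 * ((p + (r + (s + + 0))) - z) + a - + 40 - + 10 * e
            lem₁ = solve-∀ ring
            lem₂′ : ∀ e f a → + 5 * (+ 20 + + 8 * + 0 - + 4 * e + + 4 * f) - (+ 90 - + 20 * e + + 10 * f + a) + a - + 40 - + 10 * f ≡ - (+ 30)
            lem₂′ = solve-∀ ring
            lem₂ : ∀ e f a → + 5 * (+ 20 + + 8 * + 0 - + 4 * e + + 4 * f) - (+ 90 - + 20 * e + + 10 * f + a) + a - + 40 - + 10 * f ≡ ℤ.-[1+ 29 ]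
            lem₂ = lem₂′

        -- If all pairs of codegree 2 were diagonals of the given cycle, only its four corners would
        -- contribute to Q, each at most 2; but 8 < 12.
        second : ∀ {i a j b} → C₄ i a j b → Σ V λ p → Σ V λ r → p ≢ r × ≥2 p r × ¬ Diagonal i a j b p r
        second {i} {a} {j} {b} c with any? (λ p → any? (λ r → ¬? (p ≟ r) ×-dec ((+ 2 ℤ.≤? C p r) ×-dec ¬? (diagonal? i a j b p r))))
        ... | yes found = found
        ... | no none = ⊥-elim (negative-absurd (+-nonneg (subst (+ 0 ≤_) total (sum-nonneg bound)) Q≥12) (lem Q))
          where
          opaque
            unfolding _+_ 0≟
            lem′ : ∀ Q → (+ 4 * + 2 - Q) + (Q - + 12) ≡ - (+ 4)
            lem′ = solve-∀ ring
            lem : ∀ Q → (+ 4 * + 2 - Q) + (Q - + 12) ≡ ℤ.-[1+ 3 ]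
            lem = lem′
          only : ∀ {p r} → p ≢ r → ≥2 p r → Diagonal i a j b p r
          only {p} {r} ne le = decidable-stable (diagonal? i a j b p r) λ n → none (p , r , ne , le , n)
          L = corners i a j b
          u = corners-unique c
          on : ∀ {v w x y} → C₄ v w x y → (∀ {p r} → Diagonal i a j b p r → Diagonal v w x y p r) → + 0 ≤ + 1 * + 2 - q v
          on {v} {w} {x} {y} (cycle vw wx xy yv v≢x w≢y) to = subst (λ t → + 0 ≤ t) (sym (cong₂ _-_ (*-identityˡ (+ 2)) (sum-single (R v) x λ l l≢x → R-zero v l λ v≢l le → l≢x (target (to (only v≢l le)))))) (R≤2 v≢x)
            where
            target : ∀ {l} → Diagonal v w x y v l → l ≡ x
            target (inj₁ (inj₁ (_ , e))) = e
            target (inj₁ (inj₂ (e , _))) = contradiction e v≢x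
            target (inj₂ (inj₁ (e , _))) = contradiction e (adj-≢ H vw)
            target (inj₂ (inj₂ (e , _))) = contradiction (sym e) (adj-≢ H yv)
          bound : ∀ v → + 0 ≤ mult L v * + 2 - q v
          bound v with v ∈? L
          ... | yes p = subst (λ t → + 0 ≤ t * + 2 - q v) (sym (mult-∈ u p)) (on (From.from (start-at c p)) (From.to-diagonal (start-at c p)))
          ... | no p = ℤ.≤-reflexive (sym (trans (cong₂ (λ s t → s * + 2 - t) (mult-∉ p) (sum-zero λ l → R-zero v l λ v≢l le → p (source (only v≢l le)))) lit))
            where
            opaque
              unfolding _+_
              lit : + 0 * + 2 - + 0 ≡ + 0
              lit = refl
            source : ∀ {l} → Diagonal i a j b v l → v ∈ L
            source (inj₁ (inj₁ (e , _))) = here e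
            source (inj₁ (inj₂ (e , _))) = there (there (here e))
            source (inj₂ (inj₁ (e , _))) = there (here e)
            source (inj₂ (inj₂ (e , _))) = there (there (there (here e)))
          total : sum (λ v → mult L v * + 2 - q v) ≡ + 4 * + 2 - Q
          total = trans (sum-- _ _) (cong (λ t → t - Q) (trans (sum-*ʳ (+ 2) (mult L)) (cong (_* + 2) (sum-mult-one L))))

        thin-case : ∀ {i a j b} → C₄ i a j b → Iso mate5 H
        thin-case {i} {a} {j} {b} c with second c
        ... | p , r , p≢r , le , n with four-cycle p≢r le
        ...   | s , t , c′ with Any.any? (λ v → v ∈? corners p s r t) (corners i a j b)
        ...     | no none = ⊥-elim (disjoint c c′ λ v∈ v∈′ → none (lose v∈ v∈′))
        ...     | yes some with find some
        ...       | v , v∈ , v∈′ = share-vertex F.from F′.from (n ∘ F.of-diagonal) (F′.to-diagonal (inj₁ (inj₁ (refl , refl))))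
          where
          module F = From (start-at c v∈)
          module F′ = From (start-at c′ v∈′)

      classify : Iso mate4 H ⊎ Iso mate5 H
      classify with any? (λ i → any? (λ j → ¬? (i ≟ j) ×-dec (+ 3 ℤ.≤? C i j)))
      ... | yes (i , j , i≢j , le) = inj₁ (thick i j i≢j le)
      ... | no none with any? (λ i → any? (λ j → ¬? (i ≟ j) ×-dec (+ 2 ℤ.≤? C i j)))
      ...   | yes (i , j , i≢j , le) = inj₂ (Thin.thin-case (λ {i} {j} ne le → none (i , j , ne , le)) (proj₂ (proj₂ (four-cycle i≢j le))))
      ...   | no none₂ = ⊥-elim (negative-absurd Q≥12 (trans (cong (λ t → t - + 12) (sum-zero λ v → sum-zero λ l → R-zero v l λ ne le → none₂ (v , l , ne , le))) lit))
        where
        opaque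
          unfolding _+_
          lit : + 0 - + 12 ≡ ℤ.-[1+ 11 ]
          lit = refl

-- Assembling the two statements.

module Conclusion where
  open import Data.Integer using (_≤_)
  open Integers
  open Determinants
  open Pencils
  open Neighbours
  open PetalDecomposition
  open RoseDeterminant
  open CycleLengths
  open Embeddings
  open Connectivity
  open PowerTraces using (trace)
  module T = RoseTraces
  open DegreeMoments using (codeg; codeg-nonneg; Θ; Θ-nonneg; trace-0; trace-1-x; trace-2-x; trace-3-x; d)
  open DegreeSequence
  open SpecialSums
  open MateClassification
  open Mates

  -- As `z` has a single neighbour, at least two vertices of degree 3 miss it, and on five vertices
  -- each of them is adjacent to everything else. They are adjacent and have two common neighbours,
  -- which makes two triangles, whereas Θ = 6 allows one.
  no-five : ∀ H → Special H → size H ≡ 5 → Θ H ≡ + 6 → ⊥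
  no-five H S n≡5 θ≡6 = by (u₁ ≟ y) (u₂ ≟ y)
    where
    open SpecialGraph H S hiding (Q; q; R)
    open Specials H S
    _~_ : V → V → Set
    i ~ j = adj H i j ≡ true
    z-nbr = extra-nbr H z [] [] [] (subst (0 ℕ.<_) (sym degree-z) (ℕ.s≤s ℕ.z≤n))
    y = proj₁ z-nbr
    z-nbrs : Nbrs H z (y ∷ [])
    z-nbrs = nbrs-intro H z (y ∷ []) ([] ∷ []) (proj₂ (proj₂ z-nbr) ∷ []) degree-z
    far : ∀ {p} → p ≢ y → ¬ p ~ z
    far {p} ne e with nbrs-elim {H} {ys = y ∷ []} z-nbrs (adj-flip H e)
    ... | here q = ne q

    everything : ∀ {p} → p ∈ us → ¬ p ~ z → ∀ {w} → w ≢ p → w ≢ z → p ~ w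
    everything {p} p∈ p≁z {w} w≢p w≢z = nbr-of (decidable-stable (w ∈? L) λ w∉ → contradiction (subst (6 ℕ.≤_) n≡5 (unique-length ((All.tabulate λ { v∈ refl → w∉ v∈ }) ∷ L-unique))) ℕ.1+n≰n)
      where
      lt : ∀ {m} → m ℕ.< 3 → m ℕ.< degree H p
      lt {m} = subst (m ℕ.<_) (sym (degree-us p∈))
      p₁ = extra-nbr H p [] [] [] (lt (ℕ.s≤s ℕ.z≤n))
      y₁ = proj₁ p₁
      p₂ = extra-nbr H p (y₁ ∷ []) ([] ∷ []) (proj₂ (proj₂ p₁) ∷ []) (lt (ℕ.s≤s (ℕ.s≤s ℕ.z≤n)))
      y₂ = proj₁ p₂
      u₂′ : Unique (y₂ ∷ y₁ ∷ [])
      u₂′ = ((λ e → proj₁ (proj₂ p₂) (here e)) ∷ []) ∷ [] ∷ []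
      p₃ = extra-nbr H p (y₂ ∷ y₁ ∷ []) u₂′ (proj₂ (proj₂ p₂) ∷ proj₂ (proj₂ p₁) ∷ []) (lt (ℕ.s≤s (ℕ.s≤s (ℕ.s≤s ℕ.z≤n))))
      y₃ = proj₁ p₃
      L : List V
      L = p ∷ z ∷ y₃ ∷ y₂ ∷ y₁ ∷ []
      z≢ : ∀ {v} → p ~ v → z ≢ v
      z≢ e refl = p≁z e
      L-unique : Unique L
      L-unique = ((λ { refl → z∉us p∈ }) ∷ adj-≢ H (proj₂ (proj₂ p₃)) ∷ adj-≢ H (proj₂ (proj₂ p₂)) ∷ adj-≢ H (proj₂ (proj₂ p₁)) ∷ []) ∷
                 (z≢ (proj₂ (proj₂ p₃)) ∷ z≢ (proj₂ (proj₂ p₂)) ∷ z≢ (proj₂ (proj₂ p₁)) ∷ []) ∷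
                 ((λ e → proj₁ (proj₂ p₃) (here e)) ∷ (λ e → proj₁ (proj₂ p₃) (there (here e))) ∷ []) ∷ u₂′
      nbr-of : w ∈ L → p ~ w
      nbr-of (here e) = contradiction e w≢p
      nbr-of (there (here e)) = contradiction e w≢z
      nbr-of (there (there (here e))) = subst (p ~_) (sym e) (proj₂ (proj₂ p₃))
      nbr-of (there (there (there (here e)))) = subst (p ~_) (sym e) (proj₂ (proj₂ p₂))
      nbr-of (there (there (there (there (here e))))) = subst (p ~_) (sym e) (proj₂ (proj₂ p₁))

    clash : ∀ {p r} → p ≢ r → p ∈ us → r ∈ us → ¬ p ~ z → ¬ r ~ z → ⊥
    clash {p} {r} p≢r p∈ r∈ p≁z r≁z = negative-absurd (+-nonneg (listSum-≤ θ θ-nonneg {p ∷ r ∷ []} ((p≢r ∷ []) ∷ [] ∷ [])) (+-nonneg (heavy pr ps pt rs rt) (heavy (adj-flip H pr) rs rt ps pt)))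
        (trans (cong (λ w → w - (θ p + (θ r + + 0)) + ((θ p - + 4) + (θ r - + 4))) θ≡6) (lem (θ p) (θ r)))
      where
      θ : V → ℤ
      θ v = sum λ k → A H v k * codeg H k v
      θ-nonneg : ∀ v → + 0 ≤ θ v
      θ-nonneg v = sum-nonneg λ k → *-nonneg (A-nonneg H v k) (codeg-nonneg H k v)
      opaque
        unfolding _+_ 0≟
        lem′ : ∀ s t → + 6 - (s + (t + + 0)) + ((s - + 4) + (t - + 4)) ≡ - (+ 2)
        lem′ = solve-∀ ring
        lem : ∀ s t → + 6 - (s + (t + + 0)) + ((s - + 4) + (t - + 4)) ≡ ℤ.-[1+ 1 ]
        lem = lem′
        lem₁ : ∀ w a b c → w - (+ 1 * a + (+ 1 * b + (+ 1 * c + + 0))) + ((a - + 2) + ((b - + 1) + (c - + 1))) ≡ w - + 4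
        lem₁ = solve-∀ ring
      pr : p ~ r
      pr = everything p∈ p≁z (p≢r ∘ sym) λ { refl → z∉us r∈ }
      q₁ = extra-nbr H p (r ∷ []) ([] ∷ []) (pr ∷ []) (subst (1 ℕ.<_) (sym (degree-us p∈)) (ℕ.s≤s (ℕ.s≤s ℕ.z≤n)))
      s = proj₁ q₁
      ps = proj₂ (proj₂ q₁)
      s≢r : s ≢ r
      s≢r e = proj₁ (proj₂ q₁) (here e)
      q₂ = extra-nbr H p (s ∷ r ∷ []) ((s≢r ∷ []) ∷ [] ∷ []) (ps ∷ pr ∷ []) (subst (2 ℕ.<_) (sym (degree-us p∈)) (ℕ.s≤s (ℕ.s≤s (ℕ.s≤s ℕ.z≤n))))
      t = proj₁ q₂
      pt = proj₂ (proj₂ q₂)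
      t≢s : t ≢ s
      t≢s e = proj₁ (proj₂ q₂) (here e)
      t≢r : t ≢ r
      t≢r e = proj₁ (proj₂ q₂) (there (here e))
      rs : r ~ s
      rs = everything r∈ r≁z s≢r λ e → p≁z (subst (p ~_) e ps)
      rt : r ~ t
      rt = everything r∈ r≁z t≢r λ e → p≁z (subst (p ~_) e pt)
      heavy : ∀ {p r} → p ~ r → p ~ s → p ~ t → r ~ s → r ~ t → + 0 ≤ θ p - + 4
      heavy {p} {r} pr ps pt rs rt = subst (+ 0 ≤_) (trans (cong (λ w → θ p - w + ((codeg H r p - + 2) + ((codeg H s p - + 1) + (codeg H t p - + 1))))
          (cong₂ _+_ (cong (_* codeg H r p) (A-true H pr)) (cong₂ _+_ (cong (_* codeg H s p) (A-true H ps)) (cong (λ w → w * codeg H t p + + 0) (A-true H pt)))))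
          (lem₁ (θ p) (codeg H r p) (codeg H s p) (codeg H t p)))
        (+-nonneg (listSum-≤ (λ k → A H p k * codeg H k p) (λ k → *-nonneg (A-nonneg H p k) (codeg-nonneg H k p)) {r ∷ s ∷ t ∷ []} ((adj-≢ H rs ∷ adj-≢ H rt ∷ []) ∷ ((t≢s ∘ sym) ∷ []) ∷ [] ∷ []))
          (+-nonneg (codeg-lower H r p (s ∷ t ∷ []) (((t≢s ∘ sym) ∷ []) ∷ [] ∷ []) ((rs , adj-flip H ps) ∷ (rt , adj-flip H pt) ∷ []))
            (+-nonneg (codeg-lower H s p (r ∷ []) ([] ∷ []) ((adj-flip H rs , adj-flip H pr) ∷ [])) (codeg-lower H t p (r ∷ []) ([] ∷ []) ((adj-flip H rt , adj-flip H pr) ∷ [])))))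

    u₁≢u₂ = All.head (AllPairs.head us-unique)
    u₁≢u₃ = All.head (All.tail (AllPairs.head us-unique))
    u₂≢u₃ = All.head (AllPairs.head (AllPairs.tail us-unique))
    by : Dec (u₁ ≡ y) → Dec (u₂ ≡ y) → ⊥
    by (yes e) _ = clash u₂≢u₃ (there (here refl)) (there (there (here refl))) (far λ e′ → u₁≢u₂ (trans e (sym e′))) (far λ e′ → u₁≢u₃ (trans e (sym e′)))
    by (no n) (yes e) = clash u₁≢u₃ (here refl) (there (there (here refl))) (far n) (far λ e′ → u₂≢u₃ (trans e (sym e′)))
    by (no n) (no n′) = clash u₁≢u₂ (here refl) (there (here refl)) (far n) (far n′)

  cnt≤length : ∀ m ls → cnt m ls ℕ.≤ length ls
  cnt≤length m [] = ℕ.z≤n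
  cnt≤length m (l ∷ ls) with l ℕ.≟ m
  ... | yes _ = ℕ.s≤s (cnt≤length m ls)
  ... | no _ = ℕ.m≤n⇒m≤1+n (cnt≤length m ls)

  cnt-skip : ∀ {l m ls} → l ≢ m → cnt m (l ∷ ls) ≡ cnt m ls
  cnt-skip {l} {m} ne with l ℕ.≟ m
  ... | yes e = contradiction e ne
  ... | no _ = refl

  petals-number : ∀ {k G} (P : Petals G k) → length (Petals.petals P) ≡ k
  petals-number {G = G} P = Pencil.number-of-petals G _ _ (RoseΨ.s≢0 0 G) P

  length-concat-sum : ∀ {X : Set} (xss : List (List X)) → length (concat xss) ≡ ℕ-sum (map length xss)
  length-concat-sum [] = refl
  length-concat-sum (xs ∷ xss) = trans (length-++ xs) (cong (length xs ℕ.+_) (length-concat-sum xss))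

  petals-size : ∀ {k G} (P : Petals G k) → size G ≡ suc (ℕ-sum (map length (Petals.petals P)))
  petals-size {G = G} P = trans (sym (length-tabulate {n = size G} id)) (trans (sym (↭-length (Petals.cover P))) (cong suc (length-concat-sum (Petals.petals P))))

  module _ {k} (G H : Graph) (P : Petals G k) (2≤k : 2 ℕ.≤ k) (eq : ∀ a b → D a b G ≡ D a b H) where
    private
      ls : List ℕ
      ls = map ℕ.suc (map length (Petals.petals P))
      b = + 2 * + k - + 2
      c₃ = cnt 3 ls
      X = excess H
      e₁ : sum X ≡ b
      e₁ = trans (sym (trace-1-x H)) (T.trace-1 G H P eq)
      e₂ : sum (λ v → X v * X v) ≡ b * b
      e₂ = trans (lem (sum (λ v → X v * X v)) (sum X + + 2 * + size H)) (trans (cong₂ _-_ (trans (sym (trace-2-x H)) (trans (T.trace-2 G H P eq) (cong (λ t → + 2 * t + b + b * b) (trace-0 H)))) (cong (λ t → t + + 2 * + size H) e₁)) (lem₂ b (+ size H)))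
        where
        opaque
          unfolding _+_ 0≟
          lem : ∀ s t → s ≡ (s + t) - t
          lem = solve-∀ ring
          lem₂ : ∀ b n → (+ 2 * n + b + b * b) - (b + + 2 * n) ≡ b * b
          lem₂ = solve-∀ ring
      e₃ : sum (λ v → X v * X v * X v) ≡ b * b * b - + 6 * + c₃ + Θ H
      e₃ = trans (lem (sum (λ v → X v * X v * X v)) (sum (λ v → X v * d H v)) (Θ H)) (trans (cong₂ (λ s t → s - + 3 * t + Θ H) (trans (sym (trace-3-x H)) (T.trace-3 G H P eq)) xd) (lem₂ b (+ c₃) (Θ H)))
        where
        opaque
          unfolding _+_ 0≟
          lem : ∀ s t r → s ≡ (s + + 3 * t - r) - + 3 * t + r
          lem = solve-∀ ring
          lem₁ : ∀ x → x * (x + + 2) ≡ + 1 * (x * x) + + 2 * x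
          lem₁ = solve-∀ ring
          lem₂ : ∀ b c r → (b * b * b + + 3 * (b * b) + + 6 * b - + 6 * c) - + 3 * (+ 1 * (b * b) + + 2 * b) + r ≡ b * b * b - + 6 * c + r
          lem₂ = solve-∀ ring
        xd : sum (λ v → X v * d H v) ≡ + 1 * (b * b) + + 2 * b
        xd = trans (sum-cong λ v → lem₁ (X v)) (trans (sum-linear (+ 1) (+ 2) _ _) (cong₂ (λ s t → + 1 * s + + 2 * t) e₂ e₁))
      c₃≤k : c₃ ℕ.≤ k
      c₃≤k = ℕ.≤-trans (cnt≤length 3 ls) (ℕ.≤-reflexive (trans (length-map ℕ.suc (map length (Petals.petals P))) (trans (length-map length (Petals.petals P)) (petals-number P))))

    degrees : RoseDegrees k H ⊎ (k ≡ 2 × Special H)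
    degrees = dichotomy H k c₃ 2≤k c₃≤k e₁ e₂ e₃

    -- For two petals the third moment is 8 - 6c₃ + Θ, and for the special degrees it is 2.
    triangles : k ≡ 2 → Special H → Θ H ≡ + 6 * + c₃ - + 6
    triangles k≡2 S = trans (lem (Θ H) (+ c₃)) (trans (cong (λ t → t - + 8 + + 6 * + c₃) (trans (sym (cong (λ k → let b = + 2 * + k - + 2 in b * b * b - + 6 * + c₃ + Θ H) k≡2)) (trans (sym e₃) (SpecialGraph.x₃ H S)))) (lem₂ (+ c₃)))
      where
      opaque
        unfolding _+_ 0≟
        lem : ∀ t c → t ≡ (let b = + 2 * + 2 - + 2 in b * b * b - + 6 * c + t) - + 8 + + 6 * c
        lem = solve-∀ ring
        lem₂ : ∀ c → + 2 - + 8 + + 6 * c ≡ + 6 * c - + 6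
        lem₂ = solve-∀ ring

  module _ (G H : Graph) (P : Petals G 2) (eq : ∀ a b → D a b G ≡ D a b H) (one : cnt 3 (map ℕ.suc (map length (Petals.petals P))) ≡ 1) where
    private
      ls : List ℕ
      ls = map ℕ.suc (map length (Petals.petals P))
      n = + size H
      T₀ = trace-0 H
      T₁ = T.trace-1 G H P eq
      T₂ : trace H 2 ≡ + 2 * n + (+ 2 * + 2 - + 2) + (+ 2 * + 2 - + 2) * (+ 2 * + 2 - + 2)
      T₂ = trans (T.trace-2 G H P eq) (cong (λ t → + 2 * t + (+ 2 * + 2 - + 2) + (+ 2 * + 2 - + 2) * (+ 2 * + 2 - + 2)) T₀)
      T₃ : trace H 3 ≡ + 26
      T₃ = trans (T.trace-3 G H P eq) (trans (cong (λ c → let b = + 2 * + 2 - + 2 in b * b * b + + 3 * (b * b) + + 6 * b - + 6 * + c) one) lit)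
        where
        opaque
          unfolding _+_
          lit : (let b = + 2 * + 2 - + 2 in b * b * b + + 3 * (b * b) + + 6 * b - + 6 * + 1) ≡ + 26
          lit = refl

    trace-4-one : trace H 4 ≡ + 86 + + 6 * n + + 8 * + cnt 4 ls
    trace-4-one = trans (T.trace-4 G H P eq) (trans (cong₂ (λ s t → expr s t (trace H 2) (trace H 3) (cnt 3 ls)) T₀ T₁) (trans (cong₂ (λ s t → expr n (+ 2 * + 2 - + 2) s t (cnt 3 ls)) T₂ T₃)
        (trans (cong (expr n (+ 2 * + 2 - + 2) (+ 2 * n + (+ 2 * + 2 - + 2) + (+ 2 * + 2 - + 2) * (+ 2 * + 2 - + 2)) (+ 26)) one) (lem n (+ cnt 4 ls)))))
      where
      expr : ℤ → ℤ → ℤ → ℤ → ℕ → ℤ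
      expr t₀ t₁ t₂ t₃ c = + 5 * t₂ - + 4 * t₀ - + 4 * (- (+ 2 * + cnt 4 ls)) + + 2 * (- ((+ 2 * + 2 - + 2) + + 1)) + (+ 2 * + 2 - + 2) * (t₃ - + 4 * t₁)
        + (- ((+ 2 * + 2 - + 2) + + 1)) * (+ 2 * t₀ - t₂ - + 2 * + 2) + (- (+ 2 * + c)) * t₁
      opaque
        unfolding _+_ 0≟
        lem : ∀ n c → let b = + 2 * + 2 - + 2 ; t₂ = + 2 * n + b + b * b in
          + 5 * t₂ - + 4 * n - + 4 * (- (+ 2 * c)) + + 2 * (- (b + + 1)) + b * (+ 26 - + 4 * b) + (- (b + + 1)) * (+ 2 * n - t₂ - + 2 * + 2) + (- (+ 2 * + 1)) * b ≡ + 86 + + 6 * n + + 8 * c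
        lem = solve-∀ ring

    trace-5-one : cnt 4 ls ≡ 0 → cnt 5 ls ≡ 0 → trace H 5 ≡ + 302
    trace-5-one no4 no5 = trans (T.trace-5 G H P eq) (trans (cong₂ (λ s t → expr s t (trace H 2) (trace H 3) (trace H 4) (cnt 3 ls) (cnt 4 ls) (cnt 5 ls)) T₀ T₁)
        (trans (cong₂ (λ s t → expr n (+ 2 * + 2 - + 2) s t (trace H 4) (cnt 3 ls) (cnt 4 ls) (cnt 5 ls)) T₂ T₃)
        (trans (cong₂ (λ s t → expr n (+ 2 * + 2 - + 2) t₂ (+ 26) s t (cnt 4 ls) (cnt 5 ls)) (trans trace-4-one (cong (λ c → + 86 + + 6 * n + + 8 * + c) no4)) one)
        (trans (cong₂ (expr n (+ 2 * + 2 - + 2) t₂ (+ 26) (+ 86 + + 6 * n + + 8 * + 0) 1) no4 no5) (lem n)))))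
      where
      t₂ = + 2 * n + (+ 2 * + 2 - + 2) + (+ 2 * + 2 - + 2) * (+ 2 * + 2 - + 2)
      expr : ℤ → ℤ → ℤ → ℤ → ℤ → ℕ → ℕ → ℕ → ℤ
      expr t₀ t₁ t₂ t₃ t₄ c₃ c₄ c₅ = + 6 * t₃ - + 8 * t₁ + + 5 * (+ 2 * + c₃ - + 2 * + c₅) - + 3 * (- (+ 2 * + c₃)) - (+ 2 * + 2 - + 2) * (+ 5 * t₂ - t₄ - + 4 * t₀)
        - (- ((+ 2 * + 2 - + 2) + + 1)) * (t₃ - + 4 * t₁) - (- (+ 2 * + c₃)) * (+ 2 * t₀ - t₂ - + 2 * + 2) - (- (+ 2 * + c₄)) * t₁
      opaque
        unfolding _+_ 0≟
        lem : ∀ n → let b = + 2 * + 2 - + 2 ; t₂ = + 2 * n + b + b * b in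
          + 6 * + 26 - + 8 * b + + 5 * (+ 2 * + 1 - + 2 * + 0) - + 3 * (- (+ 2 * + 1)) - b * (+ 5 * t₂ - (+ 86 + + 6 * n + + 8 * + 0) - + 4 * n)
          - (- (b + + 1)) * (+ 26 - + 4 * b) - (- (+ 2 * + 1)) * (+ 2 * n - t₂ - + 2 * + 2) - (- (+ 2 * + 0)) * b ≡ + 302
        lem = solve-∀ ring

  -- The lists count petal vertices without the centre, one less than the cycle lengths: 2, 3
  -- belongs to R(3,4) and 2, 4 to R(3,5).
  data Outcome (G H : Graph) (rs : List ℕ) : Set where
    isomorphic : Iso G H → Outcome G H rs
    mated₄ : rs ↭ 2 ∷ 3 ∷ [] → Iso mate4 H → Outcome G H rs
    mated₅ : rs ↭ 2 ∷ 4 ∷ [] → Iso mate5 H → Outcome G H rs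

  module _ (G H : Graph) (cos : LapCospectral G H) where
    private
      eq : ∀ a b → D a b G ≡ D a b H
      eq = cospectral-D {G} {H} cos
      same-size : size G ≡ size H
      same-size = cospectral-size {G} {H} cos

    triangle-and-cycle : ∀ (P : Petals G 2) r → map length (Petals.petals P) ≡ 2 ∷ r ∷ [] → 3 ℕ.≤ r → Special H → Outcome G H (2 ∷ r ∷ [])
    triangle-and-cycle P r shape 3≤r S = case (Classification.classify H spectrum S)
      where
      ls≡ : map ℕ.suc (map length (Petals.petals P)) ≡ 3 ∷ suc r ∷ []
      ls≡ = cong (map ℕ.suc) shape
      size≡ : size H ≡ 3 ℕ.+ r
      size≡ = trans (sym same-size) (trans (petals-size P) (cong suc (trans (cong ℕ-sum shape) (cong (2 ℕ.+_) (ℕ.+-identityʳ r)))))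
      one : cnt 3 (map ℕ.suc (map length (Petals.petals P))) ≡ 1
      one = trans (cong (cnt 3) ls≡) (cong suc (no-more r 3≤r))
        where
        no-more : ∀ r → 3 ℕ.≤ r → cnt 3 (suc r ∷ []) ≡ 0
        no-more (suc (suc (suc r))) _ = refl
        no-more 1 (ℕ.s≤s ())
        no-more 2 (ℕ.s≤s (ℕ.s≤s ()))
      c₄ : ℕ
      c₄ = cnt 4 (3 ∷ suc r ∷ [])
      c₄-spec : c₄ ≡ 1 → r ≡ 3
      c₄-spec = go r 3≤r
        where
        go : ∀ r → 3 ℕ.≤ r → cnt 4 (3 ∷ suc r ∷ []) ≡ 1 → r ≡ 3
        go 3 _ _ = refl
        go (suc (suc (suc (suc r)))) _ ()
        go 1 (ℕ.s≤s ())
        go 2 (ℕ.s≤s (ℕ.s≤s ()))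
      c₄≤1 : c₄ ℕ.≤ 1
      c₄≤1 = cnt≤length 4 (suc r ∷ [])
      spectrum : Spectrum H
      spectrum = record
        { connected = cospectral-rose-connected G H P eq
        ; free = trans (triangles G H P ℕ.≤-refl eq refl S) (trans (cong (λ c → + 6 * + c - + 6) one) lit)
        ; c₄ = c₄
        ; t₄ = trans (trace-4-one G H P eq one) (cong (λ l → + 86 + + 6 * + size H + + 8 * + cnt 4 l) ls≡)
        ; c₄≤1 = c₄≤1
        ; small = λ e → ℕ.≤-reflexive (trans size≡ (cong (3 ℕ.+_) (c₄-spec e)))
        ; large = λ le → trace-5-one G H P eq one (trans (cong (cnt 4) ls≡) (proj₁ (none r (big le)))) (trans (cong (cnt 5) ls≡) (proj₂ (none r (big le)))) }
        where
        opaque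
          unfolding _+_
          lit : + 6 * + 1 - + 6 ≡ + 0
          lit = refl
        big : 8 ℕ.≤ size H → 5 ℕ.≤ r
        big le = ℕ.+-cancelˡ-≤ 3 5 r (subst (8 ℕ.≤_) size≡ le)
        none : ∀ r → 5 ℕ.≤ r → cnt 4 (3 ∷ suc r ∷ []) ≡ 0 × cnt 5 (3 ∷ suc r ∷ []) ≡ 0
        none (suc (suc (suc (suc (suc r))))) _ = refl , refl
        none 1 (ℕ.s≤s ())
        none 2 (ℕ.s≤s (ℕ.s≤s ()))
        none 3 (ℕ.s≤s (ℕ.s≤s (ℕ.s≤s ())))
        none 4 (ℕ.s≤s (ℕ.s≤s (ℕ.s≤s (ℕ.s≤s ()))))
      case : Iso mate4 H ⊎ Iso mate5 H → Outcome G H (2 ∷ r ∷ [])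
      case (inj₁ i) = mated₄ (Perm.↭-reflexive (cong (λ r → 2 ∷ r ∷ []) (ℕ.+-cancelˡ-≡ 3 r 3 (sym (trans (↔⇒≡ (proj₁ i)) size≡))))) i
      case (inj₂ i) = mated₅ (Perm.↭-reflexive (cong (λ r → 2 ∷ r ∷ []) (ℕ.+-cancelˡ-≡ 3 r 4 (sym (trans (↔⇒≡ (proj₁ i)) size≡))))) i

    -- By `triangles`, a rose without a triangle would make Θ negative, and one with two triangles
    -- has five vertices, which `no-five` excludes. So exactly one petal is a triangle, and it is
    -- moved to the front.
    special-outcome : ∀ (P : Petals G 2) → Special H → Outcome G H (map length (Petals.petals P))
    special-outcome P S = go (map length (Petals.petals P)) refl (lens (Petals.petals P) (petals-number P)) (longs (Petals.petals P) (Petals.long P))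
      where
      lens : ∀ (ps : List (List (Fin (size G)))) → length ps ≡ 2 → Σ ℕ λ r → Σ ℕ λ r′ → map length ps ≡ r ∷ r′ ∷ []
      lens (p ∷ p′ ∷ []) _ = length p , length p′ , refl
      longs : ∀ (ps : List (List (Fin (size G)))) → All (λ p → 2 ℕ.≤ length p) ps → All (2 ℕ.≤_) (map length ps)
      longs [] [] = []
      longs (p ∷ ps) (l ∷ ll) = l ∷ longs ps ll
      relax : ∀ {rs rs′} → rs ↭ rs′ → Outcome G H rs′ → Outcome G H rs
      relax p (isomorphic i) = isomorphic i
      relax p (mated₄ q i) = mated₄ (↭-trans p q) i
      relax p (mated₅ q i) = mated₅ (↭-trans p q) i
      normalised : ∀ r → map length (Petals.petals P) ↭ 2 ∷ r ∷ [] → 3 ℕ.≤ r → Outcome G H (2 ∷ r ∷ [])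
      normalised r p 3≤r = let P′ , shape = permute-petals P p in triangle-and-cycle P′ r shape 3≤r S
      opaque
        unfolding _+_
        lit₂ : + 6 * + 2 - + 6 ≡ + 6
        lit₂ = refl
        lit₀ : + 6 * + 0 - + 6 ≡ ℤ.-[1+ 5 ]
        lit₀ = refl
      θ : ∀ {rs} → map length (Petals.petals P) ≡ rs → Θ H ≡ + 6 * + cnt 3 (map ℕ.suc rs) - + 6
      θ shape = trans (triangles G H P ℕ.≤-refl eq refl S) (cong (λ rs → + 6 * + cnt 3 (map ℕ.suc rs) - + 6) shape)
      big : ∀ {r} → 2 ℕ.≤ r → r ≢ 2 → 3 ℕ.≤ r
      big le ne = ℕ.≤∧≢⇒< le (ne ∘ sym)
      go : ∀ rs → map length (Petals.petals P) ≡ rs → (Σ ℕ λ r → Σ ℕ λ r′ → rs ≡ r ∷ r′ ∷ []) → All (2 ℕ.≤_) rs → Outcome G H rs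
      go _ shape (r , r′ , refl) (l ∷ l′ ∷ []) with r ℕ.≟ 2 | r′ ℕ.≟ 2
      ... | yes refl | yes refl = ⊥-elim (no-five H S (trans (sym same-size) (trans (petals-size P) (cong (λ rs → suc (ℕ-sum rs)) shape))) (trans (θ shape) lit₂))
      ... | yes refl | no n′ = normalised r′ (Perm.↭-reflexive shape) (big l′ n′)
      ... | no n | yes refl = relax (Perm.swap r 2 ↭-refl) (normalised r (↭-trans (Perm.↭-reflexive shape) (Perm.swap r 2 ↭-refl)) (big l n))
      ... | no n | no n′ = ⊥-elim (negative-absurd (Θ-nonneg H) (trans (θ shape) (trans (cong (λ c → + 6 * + c - + 6) none) lit₀)))
        where
        none : cnt 3 (suc r ∷ suc r′ ∷ []) ≡ 0
        none = trans (cnt-skip (n ∘ ℕ.suc-injective)) (cnt-skip (n′ ∘ ℕ.suc-injective))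

    rose-outcome : ∀ k → (P : Petals G k) → RoseDegrees k H → Iso G H
    rose-outcome k P (c , deg-c , deg-v) = petals-iso (proj₁ rearranged) P′ conn (proj₂ rearranged)
      where
      conn : Connected H
      conn = cospectral-rose-connected G H P eq
      P′ : Petals H k
      P′ = rose-petals k H (conn , c , deg-c , deg-v)
      rearranged : Σ (Petals G k) λ P₁ → map length (Petals.petals P₁) ≡ map length (Petals.petals P′)
      rearranged = permute-petals P (roses-same-lengths G H P P′ eq)

    outcome : ∀ k → 2 ℕ.≤ k → (P : Petals G k) → Outcome G H (map length (Petals.petals P))
    outcome k 2≤k P = by P (degrees G H P 2≤k eq)
      where
      by : ∀ {k} (P : Petals G k) → RoseDegrees k H ⊎ (k ≡ 2 × Special H) → Outcome G H (map length (Petals.petals P))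
      by P (inj₁ rose) = isomorphic (rose-outcome _ P rose)
      by P (inj₂ (refl , S)) = special-outcome P S

  R3-petals : ∀ ℓ → ℓ ≡ 4 ⊎ ℓ ≡ 5 → Σ (Petals (R3 ℓ) 2) λ P → map length (Petals.petals P) ≡ 2 ∷ (ℓ ℕ.∸ 1) ∷ []
  R3-petals .4 (inj₁ refl) = record
    { centre = 0F ; petals = (1F ∷ 2F ∷ []) ∷ (3F ∷ 4F ∷ 5F ∷ []) ∷ []
    ; paths = (nb 1F 0F 2F refl refl refl (λ ()) , nb 2F 1F 0F refl refl refl (λ ()) , tt) ∷ (nb 3F 0F 4F refl refl refl (λ ()) , nb 4F 3F 5F refl refl refl (λ ()) , nb 5F 4F 0F refl refl refl (λ ()) , tt) ∷ []
    ; long = ℕ.s≤s (ℕ.s≤s ℕ.z≤n) ∷ ℕ.s≤s (ℕ.s≤s ℕ.z≤n) ∷ [] ; cover = ↭-refl ; degree-centre = refl } , refl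
    where
    nb : ∀ x y z → adj (R3 4) x y ≡ true → adj (R3 4) x z ≡ true → degree (R3 4) x ≡ 2 → y ≢ z → Nbrs (R3 4) x (y ∷ z ∷ [])
    nb x y z p q r ne = nbrs-intro (R3 4) x (y ∷ z ∷ []) ((ne ∷ []) ∷ [] ∷ []) (p ∷ q ∷ []) r
  R3-petals .5 (inj₂ refl) = record
    { centre = 0F ; petals = (1F ∷ 2F ∷ []) ∷ (3F ∷ 4F ∷ 5F ∷ 6F ∷ []) ∷ []
    ; paths = (nb 1F 0F 2F refl refl refl (λ ()) , nb 2F 1F 0F refl refl refl (λ ()) , tt) ∷
              (nb 3F 0F 4F refl refl refl (λ ()) , nb 4F 3F 5F refl refl refl (λ ()) , nb 5F 4F 6F refl refl refl (λ ()) , nb 6F 5F 0F refl refl refl (λ ()) , tt) ∷ []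
    ; long = ℕ.s≤s (ℕ.s≤s ℕ.z≤n) ∷ ℕ.s≤s (ℕ.s≤s ℕ.z≤n) ∷ [] ; cover = ↭-refl ; degree-centre = refl } , refl
    where
    nb : ∀ x y z → adj (R3 5) x y ≡ true → adj (R3 5) x z ≡ true → degree (R3 5) x ≡ 2 → y ≢ z → Nbrs (R3 5) x (y ∷ z ∷ [])
    nb x y z p q r ne = nbrs-intro (R3 5) x (y ∷ z ∷ []) ((ne ∷ []) ∷ [] ∷ []) (p ∷ q ∷ []) r

  -- The graph is cospectral with itself, so the connectivity theorem applies to it.
  R3-connected : ∀ ℓ → (P : Petals (R3 ℓ) 2) → Connected (R3 ℓ)
  R3-connected ℓ P = cospectral-rose-connected (R3 ℓ) (R3 ℓ) P λ a b → refl

  iso-R3 : ∀ {G} (P : Petals G 2) ℓ → (e : ℓ ≡ 4 ⊎ ℓ ≡ 5) → map length (Petals.petals P) ↭ 2 ∷ (ℓ ℕ.∸ 1) ∷ [] → Iso G (R3 ℓ)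
  iso-R3 P ℓ e p = let P₁ , shape = permute-petals P p ; P′ , shape′ = R3-petals ℓ e in petals-iso P₁ P′ (R3-connected ℓ P′) (trans shape (sym shape′))

  -- The invariant that tells R(3,4) and R(3,5) from their mates, which have no triangle.
  TriangleIn : Graph → Set
  TriangleIn G = Σ (Fin (size G)) λ i → Σ (Fin (size G)) λ j → Σ (Fin (size G)) λ k → (adj G i j ∧ adj G j k ∧ adj G k i) ≡ true

  iso-triangle : ∀ {G H} → Iso G H → TriangleIn G → TriangleIn H
  iso-triangle (f , pres) (i , j , k , e) = Inverse.to f i , Inverse.to f j , Inverse.to f k , trans (cong₂ _∧_ (pres i j) (cong₂ _∧_ (pres j k) (pres k i))) e

  triangle? : ∀ G → Dec (TriangleIn G)
  triangle? G = any? λ i → any? λ j → any? λ k → (adj G i j ∧ adj G j k ∧ adj G k i) Bool.≟ true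

  roses-determined : ∀ k → 2 ℕ.≤ k → ∀ G → IsRose k G → ¬ Iso G (R3 4) → ¬ Iso G (R3 5) → DeterminedByLapSpectrum G
  roses-determined k 2≤k G rose n₄ n₅ H cos = conclude (outcome G H cos k 2≤k P)
    where
    P = rose-petals k G rose
    two : ∀ {r} → map length (Petals.petals P) ↭ 2 ∷ r ∷ [] → k ≡ 2
    two p = trans (sym (petals-number P)) (trans (sym (length-map length (Petals.petals P))) (↭-length p))
    conclude : Outcome G H (map length (Petals.petals P)) → Iso G H
    conclude (isomorphic i) = i
    conclude (mated₄ p _) = contradiction (excluded (two p) P 4 (inj₁ refl) p) n₄
      where
      excluded : ∀ {k} → k ≡ 2 → (P : Petals G k) → ∀ ℓ → ℓ ≡ 4 ⊎ ℓ ≡ 5 → map length (Petals.petals P) ↭ 2 ∷ (ℓ ℕ.∸ 1) ∷ [] → Iso G (R3 ℓ)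
      excluded refl P = iso-R3 P
    conclude (mated₅ p _) = contradiction (excluded (two p) P 5 (inj₂ refl) p) n₅
      where
      excluded : ∀ {k} → k ≡ 2 → (P : Petals G k) → ∀ ℓ → ℓ ≡ 4 ⊎ ℓ ≡ 5 → map length (Petals.petals P) ↭ 2 ∷ (ℓ ℕ.∸ 1) ∷ [] → Iso G (R3 ℓ)
      excluded refl P = iso-R3 P

  not-both : ¬ ((List ℕ ∋ 2 ∷ 3 ∷ []) ↭ 2 ∷ 4 ∷ [])
  not-both p with ∈-resp-↭ p (there (here refl))
  ... | there (there ())

  only-mate₄ : ∀ {G H rs} → rs ≡ 2 ∷ 3 ∷ [] → ¬ Iso G H → Outcome G H rs → Iso mate4 H
  only-mate₄ shape n (isomorphic i) = contradiction i n
  only-mate₄ shape n (mated₄ _ i) = i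
  only-mate₄ refl n (mated₅ p _) = contradiction p not-both

  only-mate₅ : ∀ {G H rs} → rs ≡ 2 ∷ 4 ∷ [] → ¬ Iso G H → Outcome G H rs → Iso mate5 H
  only-mate₅ shape n (isomorphic i) = contradiction i n
  only-mate₅ refl n (mated₄ p _) = contradiction (↭-sym p) not-both
  only-mate₅ shape n (mated₅ _ i) = i

  no-triangle₄ : ¬ TriangleIn mate4
  no-triangle₄ = from-no (triangle? mate4)

  no-triangle₅ : ¬ TriangleIn mate5
  no-triangle₅ = from-no (triangle? mate5)

  HasUniqueMate : Graph → Set
  HasUniqueMate G = Σ Graph λ H → LapCospectral G H × ¬ Iso G H × (∀ H′ → LapCospectral G H′ → ¬ Iso G H′ → Iso H H′)

  same-charpoly : ∀ G H → lapCharPoly G ≡ lapCharPoly H → LapCospectral G H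
  same-charpoly G H e i = cong (λ p → coeff p i) e

  unique-mate : ∀ ℓ → (ℓ ≡ 4 ⊎ ℓ ≡ 5) → HasUniqueMate (R3 ℓ)
  unique-mate .4 (inj₁ refl) = mate4 , same-charpoly (R3 4) mate4 mate4-cospectral ,
      (λ i → no-triangle₄ (iso-triangle {R3 4} {mate4} i (0F , 1F , 2F , refl))) ,
      λ H′ cos n → only-mate₄ {R3 4} {H′} (proj₂ (R3-petals 4 (inj₁ refl))) n (outcome (R3 4) H′ cos 2 ℕ.≤-refl (proj₁ (R3-petals 4 (inj₁ refl))))
  unique-mate .5 (inj₂ refl) = mate5 , same-charpoly (R3 5) mate5 mate5-cospectral ,
      (λ i → no-triangle₅ (iso-triangle {R3 5} {mate5} i (0F , 1F , 2F , refl))) ,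
      λ H′ cos n → only-mate₅ {R3 5} {H′} (proj₂ (R3-petals 5 (inj₂ refl))) n (outcome (R3 5) H′ cos 2 ℕ.≤-refl (proj₁ (R3-petals 5 (inj₂ refl))))

open Conclusion using (roses-determined; unique-mate)
open import Data.Nat using (_≤_)

theorem1p1 : (∀ (k : ℕ) → 2 ≤ k → ∀ (G : Graph) → IsRose k G →
    ¬ Iso G (R3 4) → ¬ Iso G (R3 5) → DeterminedByLapSpectrum G)
    × (∀ (ℓ : ℕ) → (ℓ ≡ 4 ⊎ ℓ ≡ 5) →
    Σ Graph λ H → LapCospectral (R3 ℓ) H × ¬ Iso (R3 ℓ) H
    × (∀ H′ → LapCospectral (R3 ℓ) H′ → ¬ Iso (R3 ℓ) H′ → Iso H H′))
theorem1p1 = roses-determined , unique-mate
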